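{- Let $r$ be a positive integer. (a) For every graph $G$ of genus $g$, we have \[ \mathrm{col}_r(G)\le (4g+5)r+2g+1\quad\text{and}\quad \mathrm{wcol}_r(G)\le \Bigl(2g+\binom{r+2}{2}\Bigr)\cdot(2r+1). \] (b) In particular, for every planar graph $G$, we have \[ \mathrm{col}_r(G)\le 5r+1\quad\text{and}\quad \mathrm{wcol}_r(G)\le \binom{r+2}{2}\cdot(2r+1). \]
   Context: All graphs are finite, undirected and simple; the genus of a graph is the minimum genus of an orientable surface in which it embeds. For a linear order $L$ of $V(G)$ and vertices $u,v$: $u$ is weakly $r$-reachable from $v$ if there is a path of length $\ell$, $0\le\ell\le r$, between $u$ and $v$ such that $u$ is the $L$-minimum among the vertices of the path; $u$ is strongly $r$-reachable from $v$ if there is such a path with $u\le_L v$ and every inner vertex $w$ satisfying $v<_L w$. Let $\mathrm{WReach}_r[G,L,v]$ and $\mathrm{SReach}_r[G,L,v]$ be the sets of weakly resp. strongly $r$-reachable vertices from $v$ (both contain $v$). Then $\mathrm{wcol}_r(G)=\min_L\max_{v}|\mathrm{WReach}_r[G,L,v]|$ and $\mathrm{col}_r(G)=\min_L\max_v|\mathrm{SReach}_r[G,L,v]|$, minima over all linear orders $L$ of $V(G)$. -}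

module Defs where

open import Data.Nat using (ℕ; zero; suc; _+_; _*_; _≤_; _<_; _≡ᵇ_)
open import Data.Bool using (Bool; true; false; T; if_then_else_)
open import Data.Fin using (Fin)
open import Data.List using (List; []; _∷_; length; map; allFin)
open import Data.Nat.ListAction using (sum)
open import Data.List.Relation.Unary.All using (All)
open import Data.List.Relation.Unary.Unique.Propositional using (Unique)
open import Data.Product using (Σ; ∃; _×_; _,_; proj₁)
open import Relation.Nullary using (¬_)
open import Relation.Binary.PropositionalEquality using (_≡_; subst)
open import Function.Definitions using (Injective)

record Graph : Set where
  field
    n      : ℕ
    adj    : Fin n → Fin n → Bool
    sym    : ∀ u v → adj u v ≡ adj v u
    irrefl : ∀ v → adj v v ≡ false

module _ (G : Graph) where
  open Graph G

  data Walk : Fin n → Fin n → List (Fin n) → Set where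
    here : ∀ {a} → Walk a a (a ∷ [])
    step : ∀ {a b c xs} → T (adj a b) → Walk b c xs → Walk a c (a ∷ xs)

  -- a path: a walk with pairwise distinct vertices; its length is
  -- (number of vertices) - 1
  Path : Fin n → Fin n → List (Fin n) → Set
  Path a b xs = Walk a b xs × Unique xs

  Connected : Fin n → Fin n → Set
  Connected a b = ∃ λ xs → Walk a b xs

dropLast : {A : Set} → List A → List A
dropLast []           = []
dropLast (x ∷ [])     = []
dropLast (x ∷ y ∷ zs) = x ∷ dropLast (y ∷ zs)

inner : {A : Set} → List A → List A
inner []       = []
inner (x ∷ xs) = dropLast xs

-- Linear orders of V(G): given by an injective rank function
-- pos : Fin n → ℕ, with u ≤_L v iff pos u ≤ pos v.

module _ (G : Graph) where
  open Graph G

  LinearOrder : Set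
  LinearOrder = Σ (Fin n → ℕ) λ pos → Injective _≡_ _≡_ pos

  WReach : ℕ → LinearOrder → Fin n → Fin n → Set
  WReach r (pos , _) v u =
    ∃ λ xs → Path G v u xs × length xs ≤ suc r × All (λ w → pos u ≤ pos w) xs

  SReach : ℕ → LinearOrder → Fin n → Fin n → Set
  SReach r (pos , _) v u =
    ∃ λ xs → Path G v u xs × length xs ≤ suc r × pos u ≤ pos v
           × All (λ w → pos v < pos w) (inner xs)

  CardAtMost : ℕ → (Fin n → Set) → Set
  CardAtMost k P = ∀ (xs : List (Fin n)) → Unique xs → All P xs → length xs ≤ k

  WcolAtMost : ℕ → ℕ → Set
  WcolAtMost r k = ∃ λ (L : LinearOrder) → ∀ v → CardAtMost k (WReach r L v)

  ColAtMost : ℕ → ℕ → Set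
  ColAtMost r k = ∃ λ (L : LinearOrder) → ∀ v → CardAtMost k (SReach r L v)

iter : {A : Set} → ℕ → (A → A) → A → A
iter zero    f x = x
iter (suc k) f x = f (iter k f x)

sumFin : {n : ℕ} → (Fin n → ℕ) → ℕ
sumFin {n} f = sum (map f (allFin n))

b2n : Bool → ℕ
b2n true  = 1
b2n false = 0

module _ (G : Graph) where
  open Graph G

  Dart : Set
  Dart = Σ (Fin n) λ u → Σ (Fin n) λ v → T (adj u v)

  tail : Dart → Fin n
  tail = proj₁

  rev : Dart → Dart
  rev (u , v , p) = (v , u , subst T (sym u v) p)

  numDarts : ℕ
  numDarts = sumFin λ u → sumFin λ v → b2n (adj u v)

  degree : Fin n → ℕ
  degree v = sumFin λ u → b2n (adj v u)

  numIsolated : ℕ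
  numIsolated = sumFin λ v → if degree v ≡ᵇ 0 then 1 else 0

  record RotationSystem : Set where
    field
      ρ      : Dart → Dart
      ρ⁻¹    : Dart → Dart
      inv₁   : ∀ d → ρ (ρ⁻¹ d) ≡ d
      inv₂   : ∀ d → ρ⁻¹ (ρ d) ≡ d
      ρ-tail : ∀ d → tail (ρ d) ≡ tail d
      cyclic : ∀ d d' → tail d ≡ tail d' → ∃ λ k → iter k ρ d ≡ d'

    -- face-tracing permutation: (u , v) ↦ (v , ρ_v(u))
    φ : Dart → Dart
    φ d = ρ (rev d)

  -- G has a (cellular-per-component) embedding in the orientable surface
  -- of genus h: some rotation system whose faces (φ-orbits, plus one face
  -- per isolated vertex) satisfy Euler's formula summed over the c
  -- components:  n - |E| + faces ≥ 2c - 2h,  written here multiplied by 2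
  -- and without subtraction.
  EmbedsInGenus : ℕ → Set
  EmbedsInGenus h =
    Σ RotationSystem λ R → let open RotationSystem R in
    Σ ℕ λ f → Σ (Dart → Fin f) λ face →
      (∀ i → ∃ λ d → face d ≡ i) ×
      (∀ d d' → (face d ≡ face d' → ∃ λ k → iter k φ d ≡ d')
              × ((∃ λ k → iter k φ d ≡ d') → face d ≡ face d')) ×
    Σ ℕ λ c → Σ (Fin n → Fin c) λ comp →
      (∀ i → ∃ λ v → comp v ≡ i) ×
      (∀ u v → (comp u ≡ comp v → Connected G u v)
             × (Connected G u v → comp u ≡ comp v)) ×
      (4 * c + numDarts ≤ 4 * h + 2 * n + 2 * (f + numIsolated))

  HasGenus : ℕ → Set
  HasGenus g = EmbedsInGenus g × (∀ h → h < g → ¬ EmbedsInGenus h)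

  Planar : Set
  Planar = EmbedsInGenus 0

{-# OPTIONS --safe #-}
module Submission where

-- Homology over the two-element field on the map given by the rotation system: as long as some closed walk
-- avoiding the vertices removed so far is not a sum of faces and of cycles already chosen, choose such a walk
-- that is a simple cycle made of an edge and two geodesics, and remove it as a new tier. The chosen cycles are
-- disjoint and independent modulo the faces; orthogonality to the cochains of their left push-offs bounds
-- their number by g. Being made of geodesics, a tier contains at most 2(2r + 1) vertices reachable from a given one.
--
-- In what remains every closed walk bounds. Splitting the removed vertices into leaves and subdividing the
-- faces yields a triangulated map in which Stokes' theorem gives the separation properties of the sphere.
-- The remaining vertices are ordered path by path: a component K of the unplaced vertices has neighbours on at
-- most two earlier paths A and B, on which a level function is injective and 1-Lipschitz also through K, so
-- that at most 2r + 1 vertices of a path are reachable. For weak reachability the next path is a geodesic of K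
-- separating A from B. For strong reachability A is first made free of detours through K, by repeatedly
-- placing a detour that maximises the part of K seen from B.

open import Algebra.Bundles using (CommutativeMonoid; CommutativeRing)
import Algebra.Properties.CommutativeMonoid.Sum as MonoidSum
open import Data.Bool using (Bool; true; false; _∧_; _∨_; not; _xor_; T; if_then_else_)
import Data.Bool.Properties as Bool
open import Data.Empty using (⊥; ⊥-elim)
import Data.Fin
open import Data.Fin using (Fin; zero; suc; toℕ; fromℕ<; punchIn; _↑ˡ_; _↑ʳ_; splitAt)
open import Data.Fin.Patterns using (0F; 1F; 2F)
open import Data.Fin.Permutation using (Permutation; permutation)
import Data.Fin.Properties as Fin
import Data.List as List
open import Data.List using (List; []; _∷_; _++_; length; map; tabulate)
open import Data.List.Membership.Propositional using (find) renaming (_∈_ to _∈ˡ_)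
open import Data.List.Membership.Propositional.Properties using (∈-lookup; ∈-++⁺ˡ; ∈-++⁺ʳ; ∈-map⁺; ∈-map⁻; ∈-tabulate⁺; ∈-++⁻)
open import Data.List.Properties using (length-++; length-map; length-tabulate; map-tabulate)
import Data.List.Relation.Unary.All as All
open import Data.List.Relation.Unary.All using (All; []; _∷_)
open import Data.List.Relation.Unary.All.Properties using (¬Any⇒All¬) renaming (++⁺ to All-++⁺; map⁺ to All-map⁺)
open import Data.List.Relation.Unary.AllPairs using (AllPairs; []; _∷_)
import Data.List.Relation.Unary.AllPairs.Properties as AllPairs
import Data.List.Relation.Unary.Any as Any
open import Data.List.Relation.Unary.Any using (Any; here; there)
open import Data.List.Relation.Unary.Unique.Propositional using (Unique)
import Data.List.Relation.Unary.Unique.Propositional.Properties as Unique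
open import Data.Nat using (ℕ; zero; suc; _+_; _*_; _∸_; _≤_; _<_; z≤n; s≤s; _≤?_; _<?_; _⊔_; _⊓_)
open import Data.Nat.Induction using (<-wellFounded)
open import Data.Nat.ListAction using (sum)
open import Data.Nat.Properties
open import Data.Nat.Solver using (module +-*-Solver)
open import Data.Product using (Σ; ∃; _×_; _,_; proj₁; proj₂)
import Data.Sum as Sum
open import Data.Sum using (_⊎_; inj₁; inj₂; [_,_]′)
open import Data.Unit using (⊤; tt)
import Data.Vec.Functional as Vector
import Data.Vec.Functional.Properties as Vector
import Defs
open import Defs using (iter)
open import Function using (_∘_; id; case_of_)
open import Function.Bundles using (module Equivalence)
open import Induction.WellFounded using (Acc; acc)
open import Relation.Binary.PropositionalEquality using (_≡_; _≢_; refl; sym; trans; cong; cong₂; subst)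
open import Relation.Nullary using (¬_; Dec; yes; no; does; _×-dec_; _⊎-dec_; ¬?)
open import Relation.Nullary.Decidable using (map′; dec-true; dec-false)

-- Vertex sets, cardinalities and walks

-- Disjointness is why at most `g` tiers occur rather than `2g`: disjoint cycles span an isotropic
-- subspace for the intersection form, hence at most half of the homology. Each tier costs
-- `2 * (2 * r + 1)`, so the spherical remainder must meet the planar constants exactly.
--
-- For strong reachability two parent paths at `2r + 1` each and the current path at `r + 1` give
-- `5r + 3`, two too many. A parent reaches `2r + 1` only if both extreme levels are seen, and then
-- the two witnesses form an increasing walk through `K`, a detour; a parent free of detours costs
-- `2r`. The obstacle is that a geodesic just placed may have detours. The invariant therefore keeps
-- one parent free of them and ties the ends of the other to it. Placing a detour is affordable
-- because it saves one vertex either on itself or on the parent, and its extremal choice leaves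
-- that parent clean for the components hidden behind it.
--
-- For weak reachability paths are counted, `2r + 1` vertices on each. A walk that leaves a
-- component spends a step, and the resulting recursion in the numbers of remaining steps solves to
-- `r + r(r+1)/2` earlier paths.

VSet : ℕ → Set
VSet n = Fin n → Bool

infix 4 _∈_ _∉_ _⊆_
-- A record instead of the bare equation, because unification cannot recover `v` and `X` from
-- `X v ≡ true`, and nearly all lemmas leave them implicit.
record _∈_ {n : ℕ} (v : Fin n) (X : VSet n) : Set where
  constructor ⟨_⟩
  field un : X v ≡ true

record _∉_ {n : ℕ} (v : Fin n) (X : VSet n) : Set where
  constructor ⟨_⟩
  field un : X v ≡ false

open _∈_ public
open _∉_ public renaming (un to un∉)

_⊆_ : {n : ℕ} → VSet n → VSet n → Set
X ⊆ Y = ∀ {v} → v ∈ X → v ∈ Y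

t≢f : {b : Bool} → b ≡ true → b ≡ false → ⊥
t≢f refl ()

¬t→f : {b : Bool} → ¬ (b ≡ true) → b ≡ false
¬t→f {true}  h = ⊥-elim (h refl)
¬t→f {false} h = refl

¬f→t : {b : Bool} → ¬ (b ≡ false) → b ≡ true
¬f→t {true}  h = refl
¬f→t {false} h = ⊥-elim (h refl)

module _ {n : ℕ} {v : Fin n} where
  ∈∉ : ∀ {X : VSet n} → v ∈ X → v ∉ X → ⊥
  ∈∉ ⟨ p ⟩ ⟨ q ⟩ = t≢f p q

  ¬∈→∉ : ∀ {X : VSet n} → ¬ (v ∈ X) → v ∉ X
  ¬∈→∉ h = ⟨ ¬t→f (λ p → h ⟨ p ⟩) ⟩

  ¬∉→∈ : ∀ {X : VSet n} → ¬ (v ∉ X) → v ∈ X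
  ¬∉→∈ h = ⟨ ¬f→t (λ p → h ⟨ p ⟩) ⟩

does-e : {P : Set} (d : Dec P) → does d ≡ true → P
does-e (yes p) _ = p

∨-e : {a b : Bool} → a ∨ b ≡ true → a ≡ true ⊎ b ≡ true
∨-e {true}  p = inj₁ p
∨-e {false} p = inj₂ p

∧-l : {a b : Bool} → a ∧ b ≡ true → a ≡ true
∧-l {true} p = refl

∧-r : {a b : Bool} → a ∧ b ≡ true → b ≡ true
∧-r {true} p = p

not-t : {a : Bool} → not a ≡ true → a ≡ false
not-t {false} _ = refl

infixr 6 _∪_
infixl 7 _∖_ _∩_
opaque
  _∪_ _∖_ _∩_ : {n : ℕ} → VSet n → VSet n → VSet n
  (X ∪ Y) v = X v ∨ Y v
  (X ∖ Y) v = X v ∧ not (Y v)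
  (X ∩ Y) v = X v ∧ Y v

  ∩-l : {n : ℕ} {v : Fin n} {X Y : VSet n} → v ∈ X ∩ Y → v ∈ X
  ∩-l ⟨ p ⟩ = ⟨ ∧-l p ⟩

  ∩-r : {n : ℕ} {v : Fin n} {X Y : VSet n} → v ∈ X ∩ Y → v ∈ Y
  ∩-r {v = v} {X} ⟨ p ⟩ = ⟨ ∧-r {X v} p ⟩

  ∩-i : {n : ℕ} {v : Fin n} {X Y : VSet n} → v ∈ X → v ∈ Y → v ∈ X ∩ Y
  ∩-i ⟨ p ⟩ ⟨ q ⟩ = ⟨ cong₂ _∧_ p q ⟩

  ⟪_⟫ : {n : ℕ} → Fin n → VSet n
  ⟪ q ⟫ v = does (v Fin.≟ q)

  ∅ : {n : ℕ} → VSet n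
  ∅ _ = false

  ∅-no : {n : ℕ} {v : Fin n} → v ∉ ∅ {n}
  ∅-no = ⟨ refl ⟩

  ⟪⟫-i : {n : ℕ} (q : Fin n) → q ∈ ⟪ q ⟫
  ⟪⟫-i q = ⟨ dec-true (q Fin.≟ q) refl ⟩

  ⟪⟫-e : {n : ℕ} {q v : Fin n} → v ∈ ⟪ q ⟫ → v ≡ q
  ⟪⟫-e {q = q} {v} ⟨ e ⟩ = does-e (v Fin.≟ q) e

  ∪-e : {n : ℕ} {v : Fin n} {X Y : VSet n} → v ∈ X ∪ Y → v ∈ X ⊎ v ∈ Y
  ∪-e ⟨ p ⟩ = Sum.map ⟨_⟩ ⟨_⟩ (∨-e p)

  ∪-l : {n : ℕ} {v : Fin n} {X Y : VSet n} → v ∈ X → v ∈ X ∪ Y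
  ∪-l {v = v} {X} {Y} ⟨ p ⟩ = ⟨ cong (_∨ Y v) p ⟩

  ∪-r : {n : ℕ} {v : Fin n} {X Y : VSet n} → v ∈ Y → v ∈ X ∪ Y
  ∪-r {v = v} {X} ⟨ p ⟩ = ⟨ trans (cong (X v ∨_) p) (Bool.∨-zeroʳ (X v)) ⟩

  ∖-l : {n : ℕ} {v : Fin n} {X Y : VSet n} → v ∈ X ∖ Y → v ∈ X
  ∖-l ⟨ p ⟩ = ⟨ ∧-l p ⟩

  ∖-r : {n : ℕ} {v : Fin n} {X Y : VSet n} → v ∈ X ∖ Y → v ∉ Y
  ∖-r {v = v} {X} ⟨ p ⟩ = ⟨ not-t (∧-r {X v} p) ⟩

  ∖-i : {n : ℕ} {v : Fin n} {X Y : VSet n} → v ∈ X → v ∉ Y → v ∈ X ∖ Y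
  ∖-i ⟨ p ⟩ ⟨ q ⟩ = ⟨ cong₂ (λ a b → a ∧ not b) p q ⟩

module _ {n : ℕ} {v : Fin n} where
  ∪-∉ : ∀ {X Y : VSet n} → v ∉ X → v ∉ Y → v ∉ X ∪ Y
  ∪-∉ p q = ¬∈→∉ λ r → [ (λ x → ∈∉ x p) , (λ y → ∈∉ y q) ]′ (∪-e r)

  ∪-∉l : ∀ {X Y : VSet n} → v ∉ X ∪ Y → v ∉ X
  ∪-∉l p = ¬∈→∉ λ x → ∈∉ (∪-l x) p

  ∪-∉r : ∀ {X Y : VSet n} → v ∉ X ∪ Y → v ∉ Y
  ∪-∉r p = ¬∈→∉ λ x → ∈∉ (∪-r x) p

  ∖-∉ : ∀ {X Y : VSet n} → v ∈ X → v ∉ X ∖ Y → v ∈ Y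
  ∖-∉ x p = ¬∉→∈ λ y → ∈∉ (∖-i x y) p

in? : {n : ℕ} (v : Fin n) (X : VSet n) → v ∈ X ⊎ v ∉ X
in? v X with X v in eq
... | true  = inj₁ ⟨ eq ⟩
... | false = inj₂ ⟨ eq ⟩

mem? : {n : ℕ} (v : Fin n) (X : VSet n) → Dec (v ∈ X)
mem? v X = map′ ⟨_⟩ un (X v Bool.≟ true)

card : {n : ℕ} → VSet n → ℕ
card {zero}  X = 0
card {suc n} X = (if X zero then 1 else 0) + card (X ∘ suc)

card-mono : {n : ℕ} {X Y : VSet n} → X ⊆ Y → card X ≤ card Y
card-mono {zero}          h = z≤n
card-mono {suc n} {X} {Y} h with X zero in ex | Y zero in ey | card-mono {n} {X ∘ suc} {Y ∘ suc} (λ { ⟨ p ⟩ → ⟨ un (h ⟨ p ⟩) ⟩ })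
... | true  | true  | r = s≤s r
... | true  | false | r = ⊥-elim (t≢f (un (h ⟨ ex ⟩)) ey)
... | false | true  | r = m≤n⇒m≤1+n r
... | false | false | r = r

card-strict : {n : ℕ} {X Y : VSet n} → X ⊆ Y → ∀ v → v ∈ Y → v ∉ X → card X < card Y
card-strict {suc n} {X} {Y} h zero ⟨ vy ⟩ ⟨ vx ⟩ rewrite vx | vy = s≤s (card-mono {n} {X ∘ suc} {Y ∘ suc} (λ { ⟨ p ⟩ → ⟨ un (h ⟨ p ⟩) ⟩ }))
card-strict {suc n} {X} {Y} h (suc v) ⟨ vy ⟩ ⟨ vx ⟩ with X zero in ex | Y zero in ey
  | card-strict {n} {X ∘ suc} {Y ∘ suc} (λ { ⟨ p ⟩ → ⟨ un (h ⟨ p ⟩) ⟩ }) v ⟨ vy ⟩ ⟨ vx ⟩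
... | true  | true  | r = s≤s r
... | true  | false | r = ⊥-elim (t≢f (un (h ⟨ ex ⟩)) ey)
... | false | true  | r = m≤n⇒m≤1+n r
... | false | false | r = r

card≤n : {n : ℕ} (X : VSet n) → card X ≤ n
card≤n {zero}  X = z≤n
card≤n {suc n} X with X zero
... | true  = s≤s (card≤n (X ∘ suc))
... | false = m≤n⇒m≤1+n (card≤n (X ∘ suc))

inhabited? : {n : ℕ} (X : VSet n) → (∃ λ v → v ∈ X) ⊎ (∀ v → v ∉ X)
inhabited? X with Fin.any? (λ v → mem? v X)
... | yes p = inj₁ p
... | no ¬p = inj₂ (λ v → ¬∈→∉ (λ e → ¬p (v , e)))

maxval : {n : ℕ} (f : Fin n → ℕ) → ∃ λ M → ∀ v → f v < M
maxval {zero}  f = 0 , λ ()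
maxval {suc n} f with maxval (f ∘ suc)
... | M , h = suc (f zero) ⊔ M , λ { zero → m≤m⊔n _ M ; (suc v) → <-≤-trans (h v) (m≤n⊔m _ M) }

least : {P : ℕ → Set} → (∀ m → Dec (P m)) → ∃ P → ∃ λ m → P m × (∀ k → k < m → ¬ P k)
least {P} P? (m , p) = go m 0 (subst P (sym (+-identityʳ m)) p) (λ k ())
  where
  go : ∀ k j → P (k + j) → (∀ i → i < j → ¬ P i) → ∃ λ m → P m × (∀ k → k < m → ¬ P k)
  go zero    j p h = j , p , h
  go (suc k) j p h with P? j
  ... | yes q = j , q , h
  ... | no ¬q = go k (suc j) (subst P (sym (+-suc k j)) p) h'
    where
    h' : ∀ i → i < suc j → ¬ P i
    h' i i<sj q with m≤n⇒m<n∨m≡n (≤-pred i<sj)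
    ... | inj₁ i<j = h i i<j q
    ... | inj₂ refl = ¬q q

-- `CardAtMost` over an arbitrary type. Bounds originate in injections into an interval of levels
-- (`card-inj`) and are added by `card-⊎`.
CardAt : {A : Set} → ℕ → (A → Set) → Set
CardAt {A} k P = ∀ (xs : List A) → Unique xs → All P xs → length xs ≤ k

card-⊆ : {A : Set} {k l : ℕ} {P Q : A → Set} → k ≤ l → (∀ {u} → Q u → P u) → CardAt k P → CardAt l Q
card-⊆ k≤l f c xs ux q = ≤-trans (c xs ux (All.map f q)) k≤l

private
  split-⊎ : {A : Set} {P Q : A → Set} (xs : List A) → Unique xs → All (λ u → P u ⊎ Q u) xs →
          ∃ λ ys → ∃ λ zs → Unique ys × Unique zs × All P ys × All Q zs × length xs ≡ length ys + length zs
          × (∀ x → All (x ≢_) xs → All (x ≢_) ys × All (x ≢_) zs)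
  split-⊎ [] [] [] = [] , [] , [] , [] , [] , [] , refl , λ x _ → [] , []
  split-⊎ (x ∷ xs) (x# ∷ ux) (p ∷ ps) with split-⊎ xs ux ps
  ... | ys , zs , uy , uz , py , qz , eq , h with p
  ...   | inj₁ px = x ∷ ys , zs , (proj₁ (h x x#) ∷ uy) , uz , (px ∷ py) , qz , cong suc eq
                  , λ { y (a ∷ as) → (a ∷ proj₁ (h y as)) , proj₂ (h y as) }
  ...   | inj₂ qx = ys , x ∷ zs , uy , (proj₂ (h x x#) ∷ uz) , py , (qx ∷ qz)
                  , trans (cong suc eq) (sym (+-suc (length ys) (length zs)))
                  , λ { y (a ∷ as) → proj₁ (h y as) , (a ∷ proj₂ (h y as)) }

card-⊎ : {A : Set} {k l : ℕ} {P Q : A → Set} → CardAt k P → CardAt l Q → CardAt (k + l) (λ u → P u ⊎ Q u)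
card-⊎ c d xs ux pq with split-⊎ xs ux pq
... | ys , zs , uy , uz , py , qz , eq , _ = ≤-trans (≤-reflexive eq) (+-mono-≤ (c ys uy py) (d zs uz qz))

private
  lookup-inj : {A : Set} (xs : List A) → Unique xs → (i j : Fin (length xs)) →
               List.lookup xs i ≡ List.lookup xs j → i ≡ j
  lookup-inj (x ∷ xs) (x# ∷ ux) zero    zero    e = refl
  lookup-inj (x ∷ xs) (x# ∷ ux) zero    (suc j) e = ⊥-elim (All.lookup x# (∈-lookup j) e)
  lookup-inj (x ∷ xs) (x# ∷ ux) (suc i) zero    e = ⊥-elim (All.lookup x# (∈-lookup i) (sym e))
  lookup-inj (x ∷ xs) (x# ∷ ux) (suc i) (suc j) e = cong suc (lookup-inj xs ux i j e)

card-inj : {A : Set} {k : ℕ} {P : A → Set} (f : A → ℕ) →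
           (∀ {u w} → P u → P w → f u ≡ f w → u ≡ w) → (∀ {u} → P u → f u < k) → CardAt k P
card-inj f inj bd xs ux ps = Fin.injective⇒≤ {f = g} g-inj
  where
  at : ∀ i → _
  at i = All.lookup ps (∈-lookup {xs = xs} i)
  g : Fin (length xs) → Fin _
  g i = fromℕ< (bd (at i))
  g-inj : ∀ {i j} → g i ≡ g j → i ≡ j
  g-inj {i} {j} e = lookup-inj xs ux i j
    (inj (at i) (at j) (trans (sym (Fin.toℕ-fromℕ< (bd (at i)))) (trans (cong toℕ e) (Fin.toℕ-fromℕ< (bd (at j))))))

card-0 : {A : Set} {P : A → Set} → (∀ {u} → ¬ P u) → CardAt 0 P
card-0 h []       _ _        = z≤n
card-0 h (x ∷ xs) _ (p ∷ ps) = ⊥-elim (h p)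

-- Walks, components and distance levels of a finite graph

module Walks {n : ℕ} (_~_ : Fin n → Fin n → Set) where

  data W (X : VSet n) : Fin n → Fin n → ℕ → Set where
    nil  : ∀ {u} → u ∈ X → W X u u 0
    cons : ∀ {u w v m} → u ∈ X → u ~ w → W X w v m → W X u v (suc m)

  wfst : ∀ {X u v m} → W X u v m → u ∈ X
  wfst (nil p)      = p
  wfst (cons p _ _) = p

  wlst : ∀ {X u v m} → W X u v m → v ∈ X
  wlst (nil p)      = p
  wlst (cons _ _ w) = wlst w

  wmono : ∀ {X Y u v m} → X ⊆ Y → W X u v m → W Y u v m
  wmono h (nil p)      = nil (h p)
  wmono h (cons p e w) = cons (h p) e (wmono h w)

  wapp : ∀ {X u v x k m} → W X u v k → W X v x m → W X u x (k + m)
  wapp (nil p)      w' = w'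
  wapp (cons p e w) w' = cons p e (wapp w w')

  wsnoc : ∀ {X u v x m} → W X u v m → v ~ x → x ∈ X → W X u x (suc m)
  wsnoc (nil p)       e q = cons p e (nil q)
  wsnoc (cons p e' w) e q = cons p e' (wsnoc w e q)

  Conn : VSet n → Set
  Conn X = ∀ u v → u ∈ X → v ∈ X → ∃ λ m → W X u v m

  Adj : VSet n → VSet n → Set
  Adj X Y = ∃ λ u → ∃ λ v → u ∈ X × v ∈ Y × u ~ v

  Disj : VSet n → VSet n → Set
  Disj X Y = ∀ {v} → v ∈ X → v ∉ Y

  exit : ∀ {X u v m} (Y : VSet n) → W X u v m → u ∈ Y → v ∉ Y →
         ∃ λ a → ∃ λ b → ∃ λ k → ∃ λ l → a ∈ Y × b ∉ Y × a ~ b × W X u a k × W X b v l × k + suc l ≡ m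
  exit Y (nil p) y ny = ⊥-elim (∈∉ y ny)
  exit {m = suc m} Y (cons {w = w} p e r) y ny with in? w Y
  ... | inj₂ w∉ = _ , w , 0 , m , y , w∉ , e , nil p , r , refl
  ... | inj₁ w∈ with exit Y r w∈ ny
  ...   | a , b , k , l , a∈ , b∉ , ab , r₁ , r₂ , eq =
          a , b , suc k , l , a∈ , b∉ , ab , cons p e r₁ , r₂ , cong suc eq

  stay : ∀ {X u v m} (Y : VSet n) → (∀ {a b} → a ∈ Y → b ∈ X → a ~ b → b ∈ Y) →
         W X u v m → u ∈ Y → W Y u v m
  stay Y h (nil p)      y = nil y
  stay Y h (cons p e w) y = cons y e (stay Y h w (h y (wfst w) e))

  stay∩ : ∀ {X u v m} (Y : VSet n) → (∀ {a b} → a ∈ Y → b ∈ X → a ~ b → b ∈ Y) →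
          W X u v m → u ∈ Y → W (X ∩ Y) u v m
  stay∩ Y h (nil p)      y = nil (∩-i p y)
  stay∩ Y h (cons p e w) y = cons (∩-i p y) e (stay∩ Y h w (h y (wfst w) e))

module Graphs {n : ℕ} (_~_ : Fin n → Fin n → Set)
              (~sym : ∀ {u v} → u ~ v → v ~ u) (_~?_ : ∀ u v → Dec (u ~ v)) where

  open Walks _~_ public

  wrev : ∀ {X u v m} → W X u v m → W X v u m
  wrev (nil p)      = nil p
  wrev (cons p e w) = wsnoc (wrev w) (~sym e) p

  opaque
    W? : ∀ X u v m → Dec (W X u v m)
    W? X u v zero with mem? u X | u Fin.≟ v
    ... | yes p | yes refl = yes (nil p)
    ... | no ¬p | _        = no λ { (nil p) → ¬p p }
    ... | _     | no ¬e    = no λ { (nil p) → ¬e refl }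
    W? X u v (suc m) = map′ (λ { (p , w , e , r) → cons p e r }) (λ { (cons p e r) → p , _ , e , r })
                            (mem? u X ×-dec Fin.any? (λ w → (u ~? w) ×-dec W? X w v m))

  adj? : ∀ X Y → Dec (Adj X Y)
  adj? X Y = Fin.any? λ u → Fin.any? λ v → mem? u X ×-dec mem? v Y ×-dec (u ~? v)

  adj-sym : ∀ {X Y} → Adj X Y → Adj Y X
  adj-sym (u , v , p , q , e) = v , u , q , p , ~sym e

  disj-sym : ∀ {X Y} → Disj X Y → Disj Y X
  disj-sym h y = ¬∈→∉ λ x → ∈∉ y (h x)

  conn-∪ : ∀ {X Y} → Conn X → Conn Y → Adj X Y → Conn (X ∪ Y)
  conn-∪ {X} {Y} cx cy (a , b , a∈ , b∈ , e) u v u∈ v∈ with ∪-e u∈ | ∪-e v∈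
  ... | inj₁ p | inj₁ q = _ , wmono ∪-l (proj₂ (cx u v p q))
  ... | inj₂ p | inj₂ q = _ , wmono ∪-r (proj₂ (cy u v p q))
  ... | inj₁ p | inj₂ q = _ , wapp (wmono ∪-l (proj₂ (cx u a p a∈)))
                                   (cons (∪-l a∈) e (wmono ∪-r (proj₂ (cy b v b∈ q))))
  ... | inj₂ p | inj₁ q = _ , wapp (wmono ∪-r (proj₂ (cy u b p b∈)))
                                   (cons (∪-r b∈) (~sym e) (wmono ∪-l (proj₂ (cx a v a∈ q))))

  conn-⟪⟫ : ∀ q → Conn ⟪ q ⟫
  conn-⟪⟫ q u v p r with refl ← ⟪⟫-e p | refl ← ⟪⟫-e r = 0 , nil p

  record Closure (S seeds : VSet n) : Set where
    field
      C      : VSet n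
      C⊆S    : C ⊆ S
      seeds⊆ : seeds ⊆ C
      closed : ∀ {u v} → u ∈ C → v ∈ S → u ~ v → v ∈ C
      toseed : ∀ {u} → u ∈ C → ∃ λ s → ∃ λ m → s ∈ seeds × W C u s m

  opaque
    closure : ∀ S seeds → seeds ⊆ S → Closure S seeds
    -- The fuel `k` is kept at least as large as the number of vertices of `S` outside `C`, so when
    -- it is exhausted a further vertex would make `C` larger than `S`.
    closure S seeds s⊆S = go (card S) seeds (m≤m+n _ _) s⊆S (λ p → p) (λ p → _ , 0 , p , nil p)
      where
      go : ∀ k C → card S ≤ k + card C → C ⊆ S → seeds ⊆ C →
           (∀ {u} → u ∈ C → ∃ λ s → ∃ λ m → s ∈ seeds × W C u s m) → Closure S seeds
      go k C le C⊆S s⊆ ts with Fin.any? (λ u → Fin.any? λ v → mem? u C ×-dec mem? v (S ∖ C) ×-dec (u ~? v))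
      ... | no ¬p = record { C = C ; C⊆S = C⊆S ; seeds⊆ = s⊆ ; toseed = ts
              ; closed = λ {u} {v} u∈ v∈ e → ¬∉→∈ λ v∉ → ¬p (u , v , u∈ , ∖-i v∈ v∉ , e) }
      go zero C le C⊆S s⊆ ts | yes (u , v , u∈ , v∈ , e) =
        ⊥-elim (<-irrefl refl (<-≤-trans (card-strict C⊆S v (∖-l v∈) (∖-r v∈)) le))
      go (suc k) C le C⊆S s⊆ ts | yes (u , v , u∈ , v∈ , e) = go k (C ∪ ⟪ v ⟫) le' C'⊆S (λ p → ∪-l (s⊆ p)) ts'
        where
        C⊆C' : C ⊆ (C ∪ ⟪ v ⟫)
        C⊆C' p = ∪-l p
        v∈C' : v ∈ (C ∪ ⟪ v ⟫)
        v∈C' = ∪-r (⟪⟫-i v)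
        le' : card S ≤ k + card (C ∪ ⟪ v ⟫)
        le' = ≤-trans le (≤-trans (≤-reflexive (sym (+-suc k (card C))))
                (+-monoʳ-≤ k (card-strict C⊆C' v v∈C' (∖-r v∈))))
        C'⊆S : (C ∪ ⟪ v ⟫) ⊆ S
        C'⊆S p with ∪-e p
        ... | inj₁ q = C⊆S q
        ... | inj₂ q with refl ← ⟪⟫-e q = ∖-l v∈
        ts' : ∀ {w} → w ∈ (C ∪ ⟪ v ⟫) → ∃ λ s → ∃ λ m → s ∈ seeds × W (C ∪ ⟪ v ⟫) w s m
        ts' {w} p with ∪-e p
        ... | inj₁ q with ts q
        ...   | s , m , s∈ , r = s , m , s∈ , wmono C⊆C' r
        ts' {w} p | inj₂ q with refl ← ⟪⟫-e q with ts u∈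
        ...   | s , m , s∈ , r = s , suc m , s∈ , cons p (~sym e) (wmono C⊆C' r)

  record IsComp (S K : VSet n) : Set where
    field
      sub    : K ⊆ S
      conn   : Conn K
      closed : ∀ {u v} → u ∈ K → v ∈ S → u ~ v → v ∈ K
      pt     : Fin n
      pt∈    : pt ∈ K

  opaque
    compOf : ∀ S v → v ∈ S → ∃ λ K → IsComp S K × v ∈ K
    compOf S v v∈ = C , record { sub = C⊆S ; conn = cn ; closed = closed ; pt = v ; pt∈ = v∈C } , v∈C
      where
      open Closure (closure S ⟪ v ⟫ (λ p → subst (_∈ S) (sym (⟪⟫-e p)) v∈))
      v∈C : v ∈ C
      v∈C = seeds⊆ (⟪⟫-i v)
      toV : ∀ {u} → u ∈ C → ∃ λ m → W C u v m
      toV p with toseed p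
      ... | s , m , s∈ , r with refl ← ⟪⟫-e s∈ = m , r
      cn : Conn C
      cn u w p q = _ , wapp (proj₂ (toV p)) (wrev (proj₂ (toV q)))

  comp-walk : ∀ {S K u v m} → IsComp S K → u ∈ K → W S u v m → W K u v m
  comp-walk {K = K} ic u∈ w = stay K (IsComp.closed ic) w u∈

  opaque
    -- A connected set that avoids `H` lies inside `K` or misses it, as one of its points decides.
    -- Hence the invariants can be kept component by component: only the pieces of `K` need new
    -- ones.
    comp-cases : ∀ {S K} (H : VSet n) → IsComp S K → H ⊆ K → ∀ {L} → IsComp (S ∖ H) L →
                 IsComp S L ⊎ IsComp (K ∖ H) L
    comp-cases {S} {K} H ic H⊆K {L} il with in? (IsComp.pt il) K
    ... | inj₁ p∈K = inj₂ (record { sub = λ v∈ → ∖-i (L⊆K v∈) (∖-r (IsComp.sub il v∈))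
            ; conn = IsComp.conn il ; pt = IsComp.pt il ; pt∈ = IsComp.pt∈ il
            ; closed = λ {u} {v} u∈ v∈ e → IsComp.closed il u∈ (∖-i (IsComp.sub ic (∖-l v∈)) (∖-r v∈)) e })
      where
      L⊆K : L ⊆ K
      L⊆K {v} v∈ = wlst (comp-walk ic p∈K (wmono (λ p → ∖-l (IsComp.sub il p)) (proj₂ (IsComp.conn il _ v (IsComp.pt∈ il) v∈))))
    ... | inj₂ p∉K = inj₁ (record { sub = λ v∈ → ∖-l (IsComp.sub il v∈)
            ; conn = IsComp.conn il ; pt = IsComp.pt il ; pt∈ = IsComp.pt∈ il
            ; closed = cl })
      where
      L⊆S : L ⊆ S
      L⊆S p = ∖-l (IsComp.sub il p)
      L#K : ∀ {v} → v ∈ L → v ∉ K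
      L#K {v} v∈ = ¬∈→∉ λ v∈K → ∈∉ (wlst (comp-walk ic v∈K (wmono L⊆S (proj₂ (IsComp.conn il v _ v∈ (IsComp.pt∈ il)))))) p∉K
      cl : ∀ {u v} → u ∈ L → v ∈ S → u ~ v → v ∈ L
      cl {u} {v} u∈ v∈ e with in? v H
      ... | inj₂ v∉H = IsComp.closed il u∈ (∖-i v∈ v∉H) e
      ... | inj₁ v∈H = ⊥-elim (∈∉ (IsComp.closed ic (H⊆K v∈H) (L⊆S u∈) (~sym e)) (L#K u∈))

  -- Distances inside a set X to a root, constant on components, that every vertex of X reaches.
  record Levels (X : VSet n) (x : Fin n → Fin n) : Set where
    field
      ℓ     : Fin n → ℕ
      ℓ-lip : ∀ {u v} → u ∈ X → v ∈ X → u ~ v → ℓ u ≤ suc (ℓ v)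
      same  : ∀ {u v} → u ∈ X → v ∈ X → u ~ v → x u ≡ x v
      ℓ-wlk : ∀ {u} → u ∈ X → W X u (x u) (ℓ u)
      ℓ-min : ∀ {u m} → W X u (x u) m → ℓ u ≤ m

  opaque
    levels : ∀ X x → (∀ {u v} → u ∈ X → v ∈ X → u ~ v → x u ≡ x v) → (∀ {u} → u ∈ X → ∃ λ m → W X u (x u) m) → Levels X x
    levels X x same reach = record { ℓ = ℓ ; same = same ; ℓ-lip = λ {u} {v} p q e → ℓ-min (cons p e (subst (λ z → W X v z (ℓ v)) (sym (same p q e)) (ℓ-wlk q))) ; ℓ-wlk = ℓ-wlk ; ℓ-min = ℓ-min }
      where
      lst : ∀ {u} → u ∈ X → ∃ λ m → W X u (x u) m × (∀ k → k < m → ¬ W X u (x u) k)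
      lst {u} p = least (W? X u (x u)) (reach p)
      ℓ : Fin n → ℕ
      ℓ u with mem? u X
      ... | yes p = proj₁ (lst p)
      ... | no  _ = 0
      ℓ-wlk : ∀ {u} → u ∈ X → W X u (x u) (ℓ u)
      ℓ-wlk {u} p with mem? u X
      ... | yes q = proj₁ (proj₂ (lst q))
      ... | no ¬q = ⊥-elim (¬q p)
      ℓ-min : ∀ {u m} → W X u (x u) m → ℓ u ≤ m
      ℓ-min {u} {m} w with mem? u X
      ... | yes q = ≮⇒≥ λ lt → proj₂ (proj₂ (lst q)) m lt w
      ... | no ¬q = z≤n

  Lip : VSet n → (Fin n → ℕ) → Set
  Lip X ℓ = ∀ {u v} → u ∈ X → v ∈ X → u ~ v → ℓ u ≤ suc (ℓ v)

  lip-walk : ∀ {X ℓ u v m} → Lip X ℓ → W X u v m → ℓ u ≤ ℓ v + m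
  lip-walk {ℓ = ℓ} h (nil p) = ≤-reflexive (sym (+-identityʳ _))
  lip-walk {ℓ = ℓ} {u} {v} {suc m} h (cons p e w) =
    ≤-trans (h p (wfst w) e) (≤-trans (s≤s (lip-walk h w)) (≤-reflexive (sym (+-suc (ℓ v) m))))

  -- Every step raises the level by one, so each level is met at most once and the vertex set `vs`
  -- together with `ℓ` can stand for the path.
  data Up (X : VSet n) (ℓ : Fin n → ℕ) : Fin n → Fin n → ℕ → Set where
    nil  : ∀ {u} → u ∈ X → Up X ℓ u u 0
    cons : ∀ {u w v m} → u ∈ X → u ~ w → ℓ w ≡ suc (ℓ u) → Up X ℓ w v m → Up X ℓ u v (suc m)

  module _ {ℓ : Fin n → ℕ} where
    opaque
      Up? : ∀ X u v m → Dec (Up X ℓ u v m)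
      Up? X u v zero with mem? u X | u Fin.≟ v
      ... | yes p | yes refl = yes (nil p)
      ... | no ¬p | _        = no λ { (nil p) → ¬p p }
      ... | _     | no ¬e    = no λ { (nil p) → ¬e refl }
      Up? X u v (suc m) = map′ (λ { (p , w , e , l , r) → cons p e l r }) (λ { (cons p e l r) → p , _ , e , l , r })
                            (mem? u X ×-dec Fin.any? (λ w → (u ~? w) ×-dec (ℓ w ≟ suc (ℓ u)) ×-dec Up? X w v m))

    ufst : ∀ {X u v m} → Up X ℓ u v m → u ∈ X
    ufst (nil p)        = p
    ufst (cons p _ _ _) = p

    umono : ∀ {X Y u v m} → X ⊆ Y → Up X ℓ u v m → Up Y ℓ u v m
    umono h (nil p)        = nil (h p)
    umono h (cons p e l w) = cons (h p) e l (umono h w)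

    uapp : ∀ {X u v x k m} → Up X ℓ u v k → Up X ℓ v x m → Up X ℓ u x (k + m)
    uapp (nil p)        w' = w'
    uapp (cons p e l w) w' = cons p e l (uapp w w')

    usnoc : ∀ {X u v x m} → Up X ℓ u v m → v ~ x → ℓ x ≡ suc (ℓ v) → x ∈ X → Up X ℓ u x (suc m)
    usnoc (nil p)          e l q = cons p e l (nil q)
    usnoc (cons p e' l' w) e l q = cons p e' l' (usnoc w e l q)

    uwalk : ∀ {X u v m} → Up X ℓ u v m → W X u v m
    uwalk (nil p)        = nil p
    uwalk (cons p e _ w) = cons p e (uwalk w)

    ulen : ∀ {X u v m} → Up X ℓ u v m → ℓ v ≡ ℓ u + m
    ulen (nil p) = sym (+-identityʳ _)
    ulen {u = u} {m = suc m} (cons p e l w) = trans (ulen w) (trans (cong (_+ m) l) (sym (+-suc (ℓ u) m)))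

    vs : ∀ {X u v m} → Up X ℓ u v m → VSet n
    vs (nil {u} p)        = ⟪ u ⟫
    vs (cons {u} p e l w) = ⟪ u ⟫ ∪ vs w

    vs-fst : ∀ {X u v m} (r : Up X ℓ u v m) → u ∈ vs r
    vs-fst (nil {u} p)        = ⟪⟫-i u
    vs-fst (cons {u} p e l w) = ∪-l (⟪⟫-i u)

    vs-lst : ∀ {X u v m} (r : Up X ℓ u v m) → v ∈ vs r
    vs-lst (nil {u} p)        = ⟪⟫-i u
    vs-lst {v = v} (cons {u} p e l w) = ∪-r (vs-lst w)

    vs-⊆ : ∀ {X u v m} (r : Up X ℓ u v m) → vs r ⊆ X
    vs-⊆ (nil p) x∈ with refl ← ⟪⟫-e x∈ = p
    vs-⊆ (cons {u} p e l w) x∈ with ∪-e x∈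
    ... | inj₁ q with refl ← ⟪⟫-e q = p
    ... | inj₂ q = vs-⊆ w q

    vs-≥ : ∀ {X u v m} (r : Up X ℓ u v m) {x} → x ∈ vs r → ℓ u ≤ ℓ x
    vs-≥ (nil p) x∈ with refl ← ⟪⟫-e x∈ = ≤-refl
    vs-≥ (cons {u} p e l w) {x} x∈ with ∪-e x∈
    ... | inj₁ q with refl ← ⟪⟫-e q = ≤-refl
    ... | inj₂ q = ≤-trans (n≤1+n _) (≤-trans (≤-reflexive (sym l)) (vs-≥ w q))

    opaque
      vs-split : ∀ {X u v m} (r : Up X ℓ u v m) {x} → x ∈ vs r →
                 ∃ λ k → ∃ λ l → Up (vs r) ℓ u x k × Up (vs r) ℓ x v l
      vs-split (nil p) x∈ with refl ← ⟪⟫-e x∈ = 0 , 0 , nil x∈ , nil x∈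
      vs-split r@(cons {u} p e l w) {x} x∈ with ∪-e x∈
      ... | inj₁ q with refl ← ⟪⟫-e q = 0 , _ , nil x∈ , self r
        where
        self : ∀ {X u v m} (r : Up X ℓ u v m) → Up (vs r) ℓ u v m
        self (nil p) = nil (⟪⟫-i _)
        self (cons {u} p e l w) = cons (∪-l (⟪⟫-i u)) e l (umono ∪-r (self w))
      ... | inj₂ q with vs-split w q
      ...   | k , l' , r₁ , r₂ = suc k , l' , cons (∪-l (⟪⟫-i u)) e l (umono ∪-r r₁)
                               , umono ∪-r r₂

    vs-≤ : ∀ {X u v m} (r : Up X ℓ u v m) {x} → x ∈ vs r → ℓ x ≤ ℓ v
    vs-≤ r x∈ with vs-split r x∈
    ... | k , l , _ , r₂ = ≤-trans (m≤m+n _ l) (≤-reflexive (sym (ulen r₂)))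

    vs-inj : ∀ {X u v m} (r : Up X ℓ u v m) {x y} → x ∈ vs r → y ∈ vs r → ℓ x ≡ ℓ y → x ≡ y
    vs-inj (nil p) x∈ y∈ _ = trans (⟪⟫-e x∈) (sym (⟪⟫-e y∈))
    vs-inj (cons {u} p e l w) {x} {y} x∈ y∈ eq with ∪-e x∈ | ∪-e y∈
    ... | inj₁ q | inj₁ q' = trans (⟪⟫-e q) (sym (⟪⟫-e q'))
    ... | inj₂ q | inj₂ q' = vs-inj w q q' eq
    ... | inj₁ q | inj₂ q' with refl ← ⟪⟫-e q =
          ⊥-elim (<-irrefl eq (<-≤-trans (≤-reflexive (sym l)) (vs-≥ w q')))
    ... | inj₂ q | inj₁ q' with refl ← ⟪⟫-e q' =
          ⊥-elim (<-irrefl (sym eq) (<-≤-trans (≤-reflexive (sym l)) (vs-≥ w q)))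

    -- A shortest walk to the root, reversed, is increasing.
    opaque
      geodesic : ∀ {X x u} (L : Levels X x) → ℓ ≡ Levels.ℓ L → u ∈ X → Up X ℓ (x u) u (ℓ u)
      geodesic {X} {x} L refl u∈ = go _ refl (Levels.ℓ-wlk L u∈) ≤-refl
        where
        open Levels L using (ℓ-min; ℓ-wlk; ℓ-lip; same)
        go : ∀ m {u y} → y ≡ x u → W X u y m → m ≤ ℓ u → Up X ℓ y u m
        go zero _ (nil p) _ = nil p
        go (suc m) {u} {y} yx (cons {w = w} p e r) le = usnoc (go m yw r (≤-pred (≤-trans le (ℓ-lip p (wfst r) e)))) (~sym e) eq p
          where
          yw : y ≡ x w
          yw = trans yx (same p (wfst r) e)
          eq : ℓ u ≡ suc (ℓ w)
          eq = ≤-antisym (ℓ-lip p (wfst r) e) (≤-trans (s≤s (ℓ-min (subst (λ z → W X w z m) yw r))) le)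

-- Levelled paths and detours

module Paths {n : ℕ} (_~_ : Fin n → Fin n → Set)
             (~sym : ∀ {u v} → u ~ v → v ~ u) (_~?_ : ∀ u v → Dec (u ~ v)) where

  open Graphs _~_ ~sym _~?_ public

  Inj : VSet n → (Fin n → ℕ) → Set
  Inj A ℓ = ∀ {a b} → a ∈ A → b ∈ A → ℓ a ≡ ℓ b → a ≡ b

  -- With `Inj` this says that the levels occupied by `A` form an interval and consecutive ones are
  -- adjacent: `A` is a path, read upwards along `ℓ`.
  Climb : VSet n → (Fin n → ℕ) → Set
  Climb A ℓ = ∀ {a b} → a ∈ A → b ∈ A → ℓ a < ℓ b → ∃ λ c → c ∈ A × ℓ c ≡ suc (ℓ a) × a ~ c

  lip-mono : ∀ {X Y ℓ} → X ⊆ Y → Lip Y ℓ → Lip X ℓ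
  lip-mono h l p q e = l (h p) (h q) e

  -- A 1-Lipschitz function rises by at most one per step, so a walk no longer than its total rise
  -- has to rise at every step. This settles the equality cases of the reachability bounds.
  tight : ∀ {X ℓ u v m} → Lip X ℓ → W X u v m → ℓ u + m ≤ ℓ v → Up X ℓ u v m
  tight lip (nil p) le = nil p
  tight {ℓ = ℓ} {u} {v} {suc m} lip (cons {w = w} p e r) le = cons p e eq (tight lip r (≤-trans (≤-reflexive (cong (_+ m) eq)) (≤-trans (≤-reflexive (sym (+-suc (ℓ u) m))) le)))
    where
    up : ℓ w ≤ suc (ℓ u)
    up = lip (wfst r) p (~sym e)
    down : suc (ℓ u) ≤ ℓ w
    down = +-cancelʳ-≤ m _ _ (≤-trans (≤-reflexive (sym (+-suc (ℓ u) m))) (≤-trans le (≤-trans (≤-reflexive refl) vle)))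
      where
      vle : ℓ v ≤ ℓ w + m
      vle = lip-walk lip (wrev r)
    eq = ≤-antisym up down

  module _ {ℓ : Fin n → ℕ} where
    vs-self : ∀ {X u v m} (r : Up X ℓ u v m) → ∃ λ k → Up (vs r) ℓ u v k
    vs-self r with vs-split r (vs-fst r)
    ... | _ , l , _ , r₂ = l , r₂

    vs-climb : ∀ {X u v m} (r : Up X ℓ u v m) → Climb (vs r) ℓ
    vs-climb r {a} {b} a∈ b∈ lt with vs-split r a∈
    ... | _ , _ , _ , nil p = ⊥-elim (<-irrefl refl (<-≤-trans lt (vs-≤ r b∈)))
    ... | _ , _ , _ , cons {w = c} p e l r' = c , ufst r' , l , e

    opaque
      climb : ∀ {A} → Inj A ℓ → Climb A ℓ → ∀ {a b} → a ∈ A → b ∈ A → ℓ a ≤ ℓ b → ∃ λ m → Up A ℓ a b m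
      climb {A} inj cl {a} {b} a∈ b∈ le = go (ℓ b ∸ ℓ a) a∈ (m+[n∸m]≡n le)
        where
        go : ∀ d {a} → a ∈ A → ℓ a + d ≡ ℓ b → ∃ λ m → Up A ℓ a b m
        go zero {a} a∈ eq with refl ← inj a∈ b∈ (trans (sym (+-identityʳ _)) eq) = 0 , nil a∈
        go (suc d) {a} a∈ eq with cl a∈ b∈ (≤-trans (≤-reflexive (sym (+-comm (ℓ a) 1))) (≤-trans (+-monoʳ-≤ (ℓ a) (s≤s z≤n)) (≤-reflexive eq)))
        ... | c , c∈ , lc , e with go d c∈ (trans (cong (_+ d) lc) (trans (sym (+-suc (ℓ a) d)) eq))
        ...   | m , r = suc m , cons a∈ e lc r

    opaque
      below : ∀ {A} → Inj A ℓ → Climb A ℓ → ∀ {a b} → a ∈ A → b ∈ A → ℓ a < ℓ b →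
              ∃ λ c → c ∈ A × ℓ b ≡ suc (ℓ c) × c ~ b
      below {A} inj cl {a} {b} a∈ b∈ lt with climb inj cl a∈ b∈ (<⇒≤ lt)
      ... | _ , r = go r lt
        where
        go : ∀ {a m} → Up A ℓ a b m → ℓ a < ℓ b → ∃ λ c → c ∈ A × ℓ b ≡ suc (ℓ c) × c ~ b
        go (nil p) lt = ⊥-elim (<-irrefl refl lt)
        go (cons {a} p e l (nil q)) lt = a , p , l , e
        go (cons p e l r@(cons {w = w} q e' l' r')) lt = go r (≤-trans (≤-reflexive (sym l')) (≤-trans (m≤m+n _ _) (≤-reflexive (sym (ulen r')))))

    slice? : ∀ A lo hi v → Dec (v ∈ A × lo ≤ ℓ v × ℓ v ≤ hi)
    slice? A lo hi v = mem? v A ×-dec (lo ≤? ℓ v) ×-dec (ℓ v ≤? hi)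

    opaque
      slice : VSet n → ℕ → ℕ → VSet n
      slice A lo hi v = does (slice? A lo hi v)

      slice-i : ∀ {A lo hi v} → v ∈ A → lo ≤ ℓ v → ℓ v ≤ hi → v ∈ slice A lo hi
      slice-i {A} {lo} {hi} {v} p q r = ⟨ dec-true (slice? A lo hi v) (p , q , r) ⟩

      slice-e : ∀ {A lo hi v} → v ∈ slice A lo hi → v ∈ A × lo ≤ ℓ v × ℓ v ≤ hi
      slice-e {A} {lo} {hi} {v} ⟨ p ⟩ = does-e (slice? A lo hi v) p

    slice-conn : ∀ {A} lo hi → Inj A ℓ → Climb A ℓ → Conn (slice A lo hi)
    slice-conn {A} lo hi inj cl u v u∈ v∈ = case ≤-total (ℓ u) (ℓ v) of λ where
        (inj₁ le) → go u v u∈ v∈ le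
        (inj₂ le) → _ , wrev (proj₂ (go v u v∈ u∈ le))
      where
      go : ∀ u v → u ∈ slice A lo hi → v ∈ slice A lo hi → ℓ u ≤ ℓ v → ∃ λ m → W (slice A lo hi) u v m
      go u v u∈ v∈ le with slice-e u∈ | slice-e v∈
      ... | u∈A , lu , _ | v∈A , _ , vh with climb inj cl u∈A v∈A le
      ...   | m , r = _ , wmono (λ x → slice-i (vs-⊆ r x) (≤-trans lu (vs-≥ r x)) (≤-trans (vs-≤ r x) vh)) (uwalk (proj₂ (vs-self r)))

    climb-conn : ∀ {A} → Inj A ℓ → Climb A ℓ → Conn A
    climb-conn {A} inj cl u v u∈ v∈ with slice-conn 0 (ℓ u ⊔ ℓ v) inj cl u v (slice-i u∈ z≤n (m≤m⊔n _ _)) (slice-i v∈ z≤n (m≤n⊔m _ _))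
    ... | m , r = m , wmono (λ x → proj₁ (slice-e x)) r

  -- Both extremities of `A` hang on `B`, so that cutting `A` in the middle leaves the two parts
  -- joined through `B`. The parity and minor arguments about detours rest on this.
  record Ends (A : VSet n) (ℓ : Fin n → ℕ) (B : VSet n) : Set where
    field
      {lo hi b b'} : Fin n
      lo∈ : lo ∈ A
      hi∈ : hi ∈ A
      b∈  : b ∈ B
      b'∈ : b' ∈ B
      lo~ : lo ~ b
      hi~ : hi ~ b'
      lo≤ : ∀ {a} → a ∈ A → ℓ lo ≤ ℓ a
      ≤hi : ∀ {a} → a ∈ A → ℓ a ≤ ℓ hi

  -- A path recorded by its vertex set A and a level function which is 1-Lipschitz on K ∪ A;
  -- S is the set of vertices that have not been placed in the order yet.
  record LPath (S K A : VSet n) (ℓ : Fin n → ℕ) : Set where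
    field
      out : ∀ {a} → a ∈ A → a ∉ S
      lip : Lip (K ∪ A) ℓ
      inj : Inj A ℓ
      clm : Climb A ℓ

  lpath-mono : ∀ {S S' K K' A ℓ} → S' ⊆ S → K' ⊆ K → LPath S K A ℓ → LPath S' K' A ℓ
  lpath-mono s k l = record { out = λ a → ¬∈→∉ λ a' → ∈∉ (s a') (LPath.out l a)
    ; lip = lip-mono (λ p → [ (λ x → ∪-l (k x)) , ∪-r ]′ (∪-e p)) (LPath.lip l)
    ; inj = LPath.inj l ; clm = LPath.clm l }

  window : ∀ {A ℓ} (r c : ℕ) → Inj A ℓ → CardAt (2 * r + 1) (λ u → u ∈ A × ℓ u ≤ c + r × c ≤ ℓ u + r)
  window {A} {ℓ} r c inj = card-inj (λ u → (ℓ u + r) ∸ c)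
     (λ { {u} {w} (p , _ , q) (p' , _ , q') e → inj p p' (+-cancelʳ-≡ r _ _ (∸-cancelʳ-≡ q q' e)) })
     λ { {u} (p , l , q) → ≤-trans (s≤s (≤-trans (∸-monoˡ-≤ c (+-monoˡ-≤ r l)) (≤-reflexive (trans (cong (_∸ c) (+-assoc c r r)) (m+n∸m≡n c (r + r))))))
                                   (≤-reflexive (trans (cong suc (cong (r +_) (sym (+-identityʳ r)))) (+-comm 1 (2 * r)))) }

  -- All that the two orders use of the sphere. In `twoApex` the vertices `x` and `y` are third
  -- vertices of triangles over edges between `A` and `B`, one for each orientation. `noK33`
  -- excludes a minor with parts `q`, `Y`, `B` and `X₁`, `X₂`, `W'`. In `evenCut` the closed walk
  -- through `p`, `k₁`, `k₂`, `v` has exactly one edge between `X` and `K`, while a triangle with a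
  -- vertex in each of them and a third elsewhere must have `y`, off the walk, as that third vertex.
  record Separators : Set where
    field
      twoApex : ∀ K A B → Conn K → Conn A → Conn B → Disj K A → Disj K B → Disj A B →
        (∀ {u v} → u ∈ K → u ~ v → v ∈ K ⊎ v ∈ A ⊎ v ∈ B) → Adj K A → Adj K B → Adj A B →
        ∃ λ x → ∃ λ y → x ∈ K × y ∈ K
        × (∃ λ a → a ∈ A × x ~ a) × (∃ λ b → b ∈ B × x ~ b)
        × (∃ λ a → a ∈ A × y ~ a) × (∃ λ b → b ∈ B × y ~ b)
        × (∀ P L → P ⊆ K → x ∈ P → y ∈ P → Conn P → IsComp (K ∖ P) L → Adj L A → Adj L B → ⊥)
      noK33 : ∀ q X₁ X₂ W' Y B → Conn X₁ → Conn X₂ → Conn W' → Conn Y → Conn B →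
        q ∉ X₁ → q ∉ X₂ → q ∉ W' → q ∉ Y → q ∉ B →
        Disj X₁ X₂ → Disj X₁ W' → Disj X₁ Y → Disj X₁ B → Disj X₂ W' → Disj X₂ Y → Disj X₂ B →
        Disj W' Y → Disj W' B → Disj Y B →
        Adj ⟪ q ⟫ X₁ → Adj ⟪ q ⟫ X₂ → Adj ⟪ q ⟫ W' → Adj Y X₁ → Adj Y X₂ → Adj Y W' →
        Adj B X₁ → Adj B X₂ → Adj B W' → ⊥
      evenCut : ∀ K X Z y p v k₁ k₂ → Disj K X → Disj K Z → y ∉ Z → y ∉ K → p ∈ X → v ∉ X →
        p ~ k₁ → (∃ λ m → W K k₁ k₂ m) → k₂ ~ v → (∃ λ m → W Z v p m) →
        (∀ {z k x} → k ∈ K → x ∈ X → z ~ k → z ~ x → z ∈ K ⊎ z ∈ X ⊎ z ≡ y) → ⊥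

  record Choice (K A B : VSet n) : Set where
    field
      P    : VSet n
      ℓ    : Fin n → ℕ
      P⊆K  : P ⊆ K
      {p}  : Fin n
      p∈   : p ∈ P
      lip  : Lip K ℓ
      inj  : Inj P ℓ
      clm  : Climb P ℓ
      sepa : ∀ {L} → IsComp (K ∖ P) L → Adj L A → Adj L B → ⊥
      endA : Adj K A → Ends P ℓ A
      endB : Adj K B → Ends P ℓ B
      one  : ¬ Adj K A → ¬ Adj K B → ∀ {p q} → p ∈ P → q ∈ P → p ≡ q

  adj-⊆ : ∀ {X X' Y} → X' ⊆ X → Adj X' Y → Adj X Y
  adj-⊆ h (u , v , p , q , e) = u , v , h p , q , e

  opaque
    -- If `K` sees both sets, a shortest path of `K` between the two apexes separates them, and its
    -- ends see both. If `K` sees just one of them, a single vertex next to it serves, and otherwise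
    -- any single vertex. The level is always the distance inside `K` from one end, hence
    -- 1-Lipschitz on all of `K`.
    choose : Separators → ∀ {S K A B} → IsComp S K → Conn A → Conn B → Disj A B →
             (∀ {a} → a ∈ A → a ∉ S) → (∀ {b} → b ∈ B → b ∉ S) →
             (∀ {u v} → u ∈ K → u ~ v → v ∉ S → v ∈ A ⊎ v ∈ B) →
             (Adj K A → Adj K B → Adj A B) → Choice K A B
    choose seps {S} {K} {A} {B} ic cA cB dAB oA oB nbr ab = body (adj? K A) (adj? K B)
      where
      open IsComp ic
      open Separators seps
      dK : ∀ {X} → (∀ {a} → a ∈ X → a ∉ S) → Disj K X
      dK o k∈ = ¬∈→∉ λ x∈ → ∈∉ (sub k∈) (o x∈)
      nbr' : ∀ {u v} → u ∈ K → u ~ v → v ∈ K ⊎ v ∈ A ⊎ v ∈ B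
      nbr' {u} {v} u∈ e with in? v S
      ... | inj₁ v∈ = inj₁ (closed u∈ v∈ e)
      ... | inj₂ v∉ = inj₂ (nbr u∈ e v∉)
      module Mk (x y : Fin n) (x∈ : x ∈ K) (y∈ : y ∈ K) where
        L = levels K (λ _ → x) (λ _ _ _ → refl) (λ u∈ → conn _ x u∈ x∈)
        r : Up K (Levels.ℓ L) x y (Levels.ℓ L y)
        r = geodesic L refl y∈
        ends : ∀ {G} → (∃ λ a → a ∈ G × x ~ a) → (∃ λ a → a ∈ G × y ~ a) → Ends (vs r) (Levels.ℓ L) G
        ends (a , a∈ , e) (a' , a'∈ , e') = record { lo∈ = vs-fst r ; hi∈ = vs-lst r ; b∈ = a∈ ; b'∈ = a'∈
          ; lo~ = e ; hi~ = e' ; lo≤ = vs-≥ r ; ≤hi = vs-≤ r }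
        mk : (∀ {M} → IsComp (K ∖ vs r) M → Adj M A → Adj M B → ⊥) →
             (Adj K A → Ends (vs r) (Levels.ℓ L) A) → (Adj K B → Ends (vs r) (Levels.ℓ L) B) →
             (¬ Adj K A → ¬ Adj K B → x ≡ y) → Choice K A B
        mk s ea eb o = record { P = vs r ; ℓ = Levels.ℓ L ; P⊆K = vs-⊆ r ; p∈ = vs-fst r ; lip = Levels.ℓ-lip L
          ; inj = vs-inj r ; clm = vs-climb r ; sepa = s ; endA = ea ; endB = eb ; one = on }
          where
          on : ¬ Adj K A → ¬ Adj K B → ∀ {p q} → p ∈ vs r → q ∈ vs r → p ≡ q
          on na nb p∈ q∈ with refl ← o na nb = vs-inj r p∈ q∈ (trans (lv p∈) (sym (lv q∈)))
            where
            lv : ∀ {p} → p ∈ vs r → Levels.ℓ L p ≡ Levels.ℓ L x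
            lv p∈ = ≤-antisym (vs-≤ r p∈) (vs-≥ r p∈)
      sub' : ∀ {M P} → IsComp (K ∖ P) M → M ⊆ K
      sub' im m = ∖-l (IsComp.sub im m)
      body : Dec (Adj K A) → Dec (Adj K B) → Choice K A B
      body (yes ka) (yes kb) with twoApex K A B conn cA cB (dK oA) (dK oB) dAB nbr' ka kb (ab ka kb)
      ... | x , y , x∈ , y∈ , xa , xb , ya , yb , h = mk (λ im → h _ _ (vs-⊆ r) (vs-fst r) (vs-lst r) (climb-conn (vs-inj r) (vs-climb r)) im)
                  (λ _ → ends xa ya) (λ _ → ends xb yb) (λ na _ → ⊥-elim (na ka))
        where open Mk x y x∈ y∈
      body (yes ka@(k , a , k∈ , a∈ , e)) (no nb) = mk (λ im _ mb → nb (adj-⊆ (sub' im) mb)) (λ _ → ends (a , a∈ , e) (a , a∈ , e))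
                  (λ kb → ⊥-elim (nb kb)) (λ _ _ → refl)
        where open Mk k k k∈ k∈
      body (no na) (yes kb@(k , b , k∈ , b∈ , e)) = mk (λ im ma _ → na (adj-⊆ (sub' im) ma)) (λ ka → ⊥-elim (na ka))
                  (λ _ → ends (b , b∈ , e) (b , b∈ , e)) (λ _ _ → refl)
        where open Mk k k k∈ k∈
      body (no na) (no nb) = mk (λ im ma _ → na (adj-⊆ (sub' im) ma)) (λ ka → ⊥-elim (na ka)) (λ kb → ⊥-elim (nb kb)) (λ _ _ → refl)
        where open Mk pt pt pt∈ pt∈

-- Strong reachability of earlier paths from a component

module Strong {n : ℕ} (_~_ : Fin n → Fin n → Set)
             (~sym : ∀ {u v} → u ~ v → v ~ u) (_~?_ : ∀ u v → Dec (u ~ v)) (r : ℕ) where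

  open Paths _~_ ~sym _~?_ public

  -- The first and the last edge are split off because only the inner vertices are required to lie
  -- in `X`, the set of vertices placed after `v`.
  data Reach (X : VSet n) (v : Fin n) : Fin n → Set where
    self : Reach X v v
    edge : ∀ {u} → v ~ u → 1 ≤ r → Reach X v u
    thru : ∀ {u w w' k} → v ~ w → W X w w' k → w' ~ u → 2 + k ≤ r → Reach X v u

  reach-mono : ∀ {X Y v u} → X ⊆ Y → Reach X v u → Reach Y v u
  reach-mono h self            = self
  reach-mono h (edge e l)      = edge e l
  reach-mono h (thru e w f l)  = thru e (wmono h w) f l

  reach-walk : ∀ {X v u} → Reach X v u → u ≢ v → ∃ λ w → ∃ λ k → u ~ w × W (X ∪ ⟪ v ⟫) w v k × suc k ≤ r
  reach-walk self u≢v = ⊥-elim (u≢v refl)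
  reach-walk {v = v} (edge e l) _ = v , 0 , ~sym e , nil (∪-r (⟪⟫-i v)) , l
  reach-walk {v = v} (thru {w' = w'} e w f l) _ =
    w' , _ , ~sym f , wsnoc (wrev (wmono ∪-l w)) (~sym e) (∪-r (⟪⟫-i v)) , l

  module _ {S K : VSet n} (ic : IsComp S K) where
    open IsComp ic

    -- Read from `v`, the walk moves among unplaced vertices and therefore stays in the component of
    -- `v`; only its last edge may lead out.
    reach-K : ∀ {X v u} → X ⊆ S → v ∈ K → Reach X v u → u ≢ v →
              ∃ λ w → ∃ λ k → u ~ w × W ((X ∪ ⟪ v ⟫) ∩ K) w v k × suc k ≤ r
    reach-K {X} {v} X⊆S v∈ p u≢v with reach-walk p u≢v
    ... | w , k , e , ww , le = w , k , e , wrev (stay∩ K (λ a b e → closed a (Xv⊆S b) e) (wrev ww) v∈) , le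
      where
      Xv⊆S : X ∪ ⟪ v ⟫ ⊆ S
      Xv⊆S q = [ X⊆S , (λ z → subst (_∈ S) (sym (⟪⟫-e z)) (sub v∈)) ]′ (∪-e q)

    -- Vertices of an earlier path seen from K lie within r levels, and at the two extreme levels
    -- the witnessing walk is increasing.
    module _ {A : VSet n} {ℓ : Fin n → ℕ} (lp : LPath S K A ℓ) {X : VSet n} (X⊆S : X ⊆ S) where
      open LPath lp

      near : ∀ {v u} → v ∈ K → u ∈ A → Reach X v u → ℓ u ≤ ℓ v + r × ℓ v ≤ ℓ u + r
      near {v} {u} v∈ u∈ p with reach-K X⊆S v∈ p (λ { refl → ∈∉ (sub v∈) (out u∈) })
      ... | w , k , e , ww , le = a , b
        where
        liK : Lip ((X ∪ ⟪ v ⟫) ∩ K) ℓ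
        liK = lip-mono (∪-l ∘ ∩-r) lip
        w∈ = ∩-r (wfst ww)
        a : ℓ u ≤ ℓ v + r
        a = ≤-trans (lip (∪-r u∈) (∪-l w∈) e) (≤-trans (s≤s (lip-walk liK ww)) (≤-trans (≤-reflexive (sym (+-suc (ℓ v) k))) (+-monoʳ-≤ (ℓ v) le)))
        b : ℓ v ≤ ℓ u + r
        b = ≤-trans (lip-walk liK (wrev ww)) (≤-trans (+-monoˡ-≤ k (lip (∪-l w∈) (∪-r u∈) (~sym e))) (≤-trans (≤-reflexive (sym (+-suc (ℓ u) k))) (+-monoʳ-≤ (ℓ u) le)))

      lowest : ∀ {v u} → v ∈ K → u ∈ A → Reach X v u → ℓ u + r ≡ ℓ v →
               ∃ λ w → ∃ λ k → u ~ w × ℓ w ≡ suc (ℓ u) × Up ((X ∪ ⟪ v ⟫) ∩ K) ℓ w v k × suc k ≡ r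
      lowest {v} {u} v∈ u∈ p eq with reach-K X⊆S v∈ p (λ { refl → ∈∉ (sub v∈) (out u∈) })
      ... | w , k , e , ww , le = w , k , e , ℓw , tight liK ww tl , keq
        where
        liK : Lip ((X ∪ ⟪ v ⟫) ∩ K) ℓ
        liK = lip-mono (∪-l ∘ ∩-r) lip
        w∈ = ∩-r (wfst ww)
        low : suc (ℓ u) ≤ ℓ w
        low = +-cancelʳ-≤ k _ _ (≤-trans (≤-reflexive (sym (+-suc (ℓ u) k))) (≤-trans (+-monoʳ-≤ (ℓ u) le) (≤-trans (≤-reflexive eq) (lip-walk liK (wrev ww)))))
        ℓw = ≤-antisym (lip (∪-l w∈) (∪-r u∈) (~sym e)) low
        keq : suc k ≡ r
        keq = ≤-antisym le (+-cancelˡ-≤ (ℓ u) _ _ (≤-trans (≤-reflexive eq) (≤-trans (lip-walk liK (wrev ww)) (≤-reflexive (trans (cong (_+ k) ℓw) (sym (+-suc (ℓ u) k)))))))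
        tl : ℓ w + k ≤ ℓ v
        tl = ≤-reflexive (trans (cong (_+ k) ℓw) (trans (sym (+-suc (ℓ u) k)) (trans (cong (ℓ u +_) keq) eq)))

      highest : ∀ {v u} → v ∈ K → u ∈ A → Reach X v u → ℓ u ≡ ℓ v + r →
               ∃ λ w → ∃ λ k → w ~ u × ℓ u ≡ suc (ℓ w) × Up ((X ∪ ⟪ v ⟫) ∩ K) ℓ v w k
      highest {v} {u} v∈ u∈ p eq with reach-K X⊆S v∈ p (λ { refl → ∈∉ (sub v∈) (out u∈) })
      ... | w , k , e , ww , le = w , k , ~sym e , ℓu , tight liK (wrev ww) tl
        where
        liK : Lip ((X ∪ ⟪ v ⟫) ∩ K) ℓ
        liK = lip-mono (∪-l ∘ ∩-r) lip
        w∈ = ∩-r (wfst ww)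
        tl : ℓ v + k ≤ ℓ w
        tl = ≤-pred (≤-trans (≤-reflexive (sym (+-suc (ℓ v) k))) (≤-trans (+-monoʳ-≤ (ℓ v) le) (≤-trans (≤-reflexive (sym eq)) (lip (∪-r u∈) (∪-l w∈) e))))
        ℓu : ℓ u ≡ suc (ℓ w)
        ℓu = ≤-antisym (lip (∪-r u∈) (∪-l w∈) e) (≤-trans (s≤s (lip-walk liK ww)) (≤-trans (≤-reflexive (sym (+-suc (ℓ v) k))) (≤-trans (+-monoʳ-≤ (ℓ v) le) (≤-reflexive (sym eq)))))

  -- A second levelled route from `a` to `a'`, through `K` instead of along `A`. It is exactly what
  -- arises when a vertex of `K` sees `A` at both extreme levels.
  record Detour (K A : VSet n) (ℓ : Fin n → ℕ) : Set where
    field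
      {a a' x y} : Fin n
      {m} : ℕ
      a∈  : a ∈ A
      a'∈ : a' ∈ A
      a~x : a ~ x
      ℓx  : ℓ x ≡ suc (ℓ a)
      path : Up K ℓ x y m
      y~a' : y ~ a'
      ℓa' : ℓ a' ≡ suc (ℓ y)

  opaque
    detour? : ∀ K A ℓ → Dec (Detour K A ℓ)
    detour? K A ℓ = map′
      (λ { (a , a' , x , y , p , q , e , lx , w , e' , la) → record { a∈ = p ; a'∈ = q ; a~x = e ; ℓx = lx ; path = w ; y~a' = e' ; ℓa' = la } })
      (λ d → let open Detour d in a , a' , x , y , a∈ , a'∈ , a~x , ℓx
           , subst (Up K ℓ x y) (sym (trans (cong (_∸ ℓ x) (ulen path)) (m+n∸m≡n (ℓ x) m))) path , y~a' , ℓa')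
      (Fin.any? λ a → Fin.any? λ a' → Fin.any? λ x → Fin.any? λ y →
        mem? a A ×-dec mem? a' A ×-dec (a ~? x) ×-dec (ℓ x ≟ suc (ℓ a)) ×-dec Up? K x y (ℓ y ∸ ℓ x) ×-dec (y ~? a') ×-dec (ℓ a' ≟ suc (ℓ y)))

  detour-mono : ∀ {K K' A ℓ} → K ⊆ K' → Detour K A ℓ → Detour K' A ℓ
  detour-mono h d = record { a∈ = a∈ ; a'∈ = a'∈ ; a~x = a~x ; ℓx = ℓx ; path = umono h path ; y~a' = y~a' ; ℓa' = ℓa' }
    where open Detour d

  Good : VSet n → VSet n → (Fin n → ℕ) → Set
  Good K A ℓ = ¬ Detour K A ℓ

  module _ {S K : VSet n} (ic : IsComp S K) {A : VSet n} {ℓ : Fin n → ℕ} (lp : LPath S K A ℓ)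
           {X : VSet n} (X⊆S : X ⊆ S) {v : Fin n} (v∈ : v ∈ K) where
    open LPath lp

    seen : CardAt (2 * r + 1) (λ u → u ∈ A × Reach X v u)
    seen = card-⊆ ≤-refl (λ { (p , q) → p , near ic lp X⊆S v∈ p q }) (window r (ℓ v) inj)

    private
      Win : Fin n → Set
      Win u = u ∈ A × ℓ u ≤ ℓ v + r × ℓ v ≤ ℓ u + r

    seen-above : CardAt (2 * r) (λ u → Win u × ℓ u + r ≢ ℓ v)
    seen-above = card-inj (λ u → (ℓ u + r) ∸ suc (ℓ v))
      (λ { ((p , _ , q) , ne) ((p' , _ , q') , ne') e → inj p p' (+-cancelʳ-≡ r _ _ (∸-cancelʳ-≡ (≤∧≢⇒< q (ne ∘ sym)) (≤∧≢⇒< q' (ne' ∘ sym)) e)) })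
      λ { {u} ((p , l , q) , ne) → +-cancelˡ-≤ (suc (ℓ v)) _ _ (≤-trans (≤-reflexive (trans (+-suc (suc (ℓ v)) _) (cong suc (m+[n∸m]≡n (≤∧≢⇒< q (ne ∘ sym))))))
            (s≤s (≤-trans (+-monoˡ-≤ r l) (≤-reflexive (trans (+-assoc (ℓ v) r r) (cong (λ z → ℓ v + (r + z)) (sym (+-identityʳ r)))))))) }

    seen-below : CardAt (2 * r) (λ u → Win u × ℓ u ≢ ℓ v + r)
    seen-below = card-inj (λ u → (ℓ u + r) ∸ ℓ v)
      (λ { ((p , _ , q) , ne) ((p' , _ , q') , ne') e → inj p p' (+-cancelʳ-≡ r _ _ (∸-cancelʳ-≡ q q' e)) })
      λ { {u} ((p , l , q) , ne) → +-cancelˡ-< (ℓ v) _ _ (≤-trans (≤-reflexive (cong suc (m+[n∸m]≡n q)))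
            (≤-trans (+-monoˡ-≤ r (≤∧≢⇒< l ne)) (≤-reflexive (trans (+-assoc (ℓ v) r r) (cong (λ z → ℓ v + (r + z)) (sym (+-identityʳ r))))))) }

    -- If `A` were seen both at level `ℓ v - r` and at level `ℓ v + r`, the increasing walks of
    -- `lowest` and `highest` would join at `v` to a detour. So one of the `2r + 1` levels is
    -- missing.
    seen-good : Good K A ℓ → CardAt (2 * r) (λ u → u ∈ A × Reach X v u)
    seen-good good xs ux ps with Any.any? (λ u → ℓ u + r ≟ ℓ v) xs
    ... | no none = seen-above xs ux (All.zipWith (λ { ((p , q) , ne) → (p , near ic lp X⊆S v∈ p q) , ne }) (ps , ¬Any⇒All¬ xs none))
    ... | yes some with All.lookupAny ps some
    ...   | (p , q) , eq = seen-below xs ux (All.map (λ { (p' , q') → (p' , near ic lp X⊆S v∈ p' q') , no-top p' q' }) ps)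
      where
      no-top : ∀ {u} → u ∈ A → Reach X v u → ℓ u ≢ ℓ v + r
      no-top p' q' eq' with lowest ic lp X⊆S v∈ p q eq | highest ic lp X⊆S v∈ p' q' eq'
      ... | w , k , e , lw , up , _ | w' , k' , e' , lu , up' =
        good (record { a∈ = p ; a'∈ = p' ; a~x = e ; ℓx = lw ; path = uapp (umono ∩-r up) (umono ∩-r up') ; y~a' = e' ; ℓa' = lu })

-- Replacing a stretch of a path by a detour

module DetourChoice {n : ℕ} (_~_ : Fin n → Fin n → Set)
             (~sym : ∀ {u v} → u ~ v → v ~ u) (_~?_ : ∀ u v → Dec (u ~ v)) (r : ℕ) (1≤r : 1 ≤ r)
             (seps : Paths.Separators _~_ ~sym _~?_) where

  open Strong _~_ ~sym _~?_ r public
  open Separators seps public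

  module Detours {S K A B : VSet n} {ℓ ℓB : Fin n → ℕ} (ic : IsComp S K) (lpA : LPath S K A ℓ) (lpB : LPath S K B ℓB)
           (dAB : Disj A B) (nbr : ∀ {u v} → u ∈ K → u ~ v → v ∉ S → v ∈ A ⊎ v ∈ B)
           (ends : Ends A ℓ B) where
    open IsComp ic
    open LPath lpA
    open Ends ends

    private
      out∉K : ∀ {X} → (∀ {a} → a ∈ X → a ∉ S) → Disj K X
      out∉K o k∈ = ¬∈→∉ λ x∈ → ∈∉ (sub k∈) (o x∈)

    cB : Conn B
    cB = climb-conn (LPath.inj lpB) (LPath.clm lpB)

    -- If K does not see B, the ends of A are still joined through B, so a detour would bound together
    -- with that connection a cycle crossing the boundary of K an odd number of times at one edge of A.
    good-if-blind : ¬ Adj K B → Good K A ℓ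
    good-if-blind nb d with clm (Detour.a∈ d) (Detour.a'∈ d) a<a'
      where
      open Detour d
      a<a' : ℓ a < ℓ a'
      a<a' = ≤-trans (≤-reflexive (sym ℓx)) (≤-trans (m≤m+n _ m) (≤-trans (≤-reflexive (sym (ulen path))) (≤-trans (n≤1+n _) (≤-reflexive (sym ℓa')))))
    -- `c` is the vertex of `A` just above `a`, `X` the part of `A` up to `a`, and `Z` joins the
    -- part from `a'` upwards to `X` through `B`. A placed common neighbour of `K` and `X` lies on
    -- `A`, as `K` does not see `B`, and at most one level above `X`: outside `X` it can only be
    -- `c`.
    ... | c , c∈ , ℓc , a~c = evenCut K X Z c a a' x y
            (out∉K (λ p → out (proj₁ (slice-e p)))) (out∉K outZ) c∉Z c∉K a∈X a'∉X a~x (_ , uwalk path) y~a'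
            (cZ a' a (∪-l (slice-i a'∈ ≤-refl (≤hi a'∈))) (∪-r (∪-r a∈X))) tri
      where
      open Detour d
      X = slice {ℓ} A 0 (ℓ a)
      H = slice {ℓ} A (ℓ a') (ℓ hi)
      Z = H ∪ B ∪ X
      x≤y : ℓ x ≤ ℓ y
      x≤y = ≤-trans (m≤m+n _ m) (≤-reflexive (sym (ulen path)))
      c<a' : ℓ c < ℓ a'
      c<a' = ≤-trans (s≤s (≤-trans (≤-reflexive (trans ℓc (sym ℓx))) x≤y)) (≤-reflexive (sym ℓa'))
      a<c : ℓ a < ℓ c
      a<c = ≤-reflexive (sym ℓc)
      a∈X : a ∈ X
      a∈X = slice-i a∈ z≤n ≤-refl
      a'∉X : a' ∉ X
      a'∉X = ¬∈→∉ λ p → <-irrefl refl (<-≤-trans (<-trans a<c c<a') (proj₂ (proj₂ (slice-e p))))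
      outZ : ∀ {z} → z ∈ Z → z ∉ S
      outZ p with ∪-e p
      ... | inj₁ q = out (proj₁ (slice-e q))
      ... | inj₂ q with ∪-e q
      ...   | inj₁ b = LPath.out lpB b
      ...   | inj₂ w = out (proj₁ (slice-e w))
      c∉Z : c ∉ Z
      c∉Z = ∪-∉ (¬∈→∉ λ p → <-irrefl refl (<-≤-trans c<a' (proj₁ (proj₂ (slice-e p)))))
                (∪-∉ (dAB c∈) (¬∈→∉ λ p → <-irrefl refl (<-≤-trans a<c (proj₂ (proj₂ (slice-e p))))))
      c∉K : c ∉ K
      c∉K = ¬∈→∉ λ p → ∈∉ (sub p) (out c∈)
      cZ : Conn Z
      cZ = conn-∪ (slice-conn _ _ inj clm) (conn-∪ cB (slice-conn _ _ inj clm)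
                    (_ , _ , b∈ , slice-i lo∈ z≤n (lo≤ a∈) , ~sym lo~))
                  (_ , _ , slice-i hi∈ (≤hi a'∈) ≤-refl , ∪-l b'∈ , hi~)
      tri : ∀ {z k w} → k ∈ K → w ∈ X → z ~ k → z ~ w → z ∈ K ⊎ z ∈ X ⊎ z ≡ c
      tri {z} {k} {w} k∈ w∈ zk zw with in? z S
      ... | inj₁ z∈S = inj₁ (closed k∈ z∈S (~sym zk))
      ... | inj₂ z∉S with nbr k∈ (~sym zk) z∉S
      ...   | inj₂ zB = ⊥-elim (nb (_ , _ , k∈ , zB , ~sym zk))
      ...   | inj₁ zA with ℓ z ≤? ℓ a
      ...     | yes le = inj₂ (inj₁ (slice-i zA z≤n le))
      ...     | no ¬le = inj₂ (inj₂ (inj zA c∈ (≤-antisym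
                  (≤-trans (lip (∪-r zA) (∪-r (proj₁ (slice-e w∈))) zw) (≤-trans (s≤s (proj₂ (proj₂ (slice-e w∈)))) (≤-reflexive (sym ℓc))))
                  (≤-trans (≤-reflexive ℓc) (≰⇒> ¬le)))))

    module _ (d : Detour K A ℓ) where
      open Detour d
      Q : VSet n
      Q = vs path

      Q⊆K : Q ⊆ K
      Q⊆K = vs-⊆ path

      outer? : ∀ v → Dec (v ∈ A × (ℓ v ≤ ℓ a ⊎ ℓ a' ≤ ℓ v))
      outer? v = mem? v A ×-dec ((ℓ v ≤? ℓ a) ⊎-dec (ℓ a' ≤? ℓ v))

      opaque
        outer : VSet n
        outer v = does (outer? v)

        outer-i : ∀ {v} → v ∈ A → ℓ v ≤ ℓ a ⊎ ℓ a' ≤ ℓ v → v ∈ outer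
        outer-i {v} p q = ⟨ dec-true (outer? v) (p , q) ⟩

        outer-e : ∀ {v} → v ∈ outer → v ∈ A × (ℓ v ≤ ℓ a ⊎ ℓ a' ≤ ℓ v)
        outer-e {v} ⟨ p ⟩ = does-e (outer? v) p

      -- The stretch of `A` strictly between `a` and `a'` is exchanged for the detour. Since the
      -- detour carries the levels of that stretch, the same `ℓ` makes this a levelled path again.
      A* : VSet n
      A* = outer ∪ Q

      a<Q : ∀ {q} → q ∈ Q → ℓ a < ℓ q
      a<Q q∈ = ≤-trans (≤-reflexive (sym ℓx)) (vs-≥ path q∈)

      Q<a' : ∀ {q} → q ∈ Q → ℓ q < ℓ a'
      Q<a' q∈ = ≤-trans (s≤s (vs-≤ path q∈)) (≤-reflexive (sym ℓa'))

      a<a' : ℓ a < ℓ a'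
      a<a' = <-trans (a<Q (vs-fst path)) (Q<a' (vs-fst path))

      a∈A* : a ∈ A*
      a∈A* = ∪-l (outer-i a∈ (inj₁ ≤-refl))

      a'∈A* : a' ∈ A*
      a'∈A* = ∪-l (outer-i a'∈ (inj₂ ≤-refl))

      A*-inj : Inj A* ℓ
      A*-inj {u} {v} p q e with ∪-e p | ∪-e q
      ... | inj₂ u∈ | inj₂ v∈ = vs-inj path u∈ v∈ e
      ... | inj₁ u∈ | inj₁ v∈ = inj (proj₁ (outer-e u∈)) (proj₁ (outer-e v∈)) e
      ... | inj₁ u∈ | inj₂ v∈ with proj₂ (outer-e u∈)
      ...   | inj₁ l = ⊥-elim (<-irrefl e (≤-<-trans l (a<Q v∈)))
      ...   | inj₂ l = ⊥-elim (<-irrefl (sym e) (<-≤-trans (Q<a' v∈) l))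
      A*-inj {u} {v} p q e | inj₂ u∈ | inj₁ v∈ with proj₂ (outer-e v∈)
      ...   | inj₁ l = ⊥-elim (<-irrefl (sym e) (≤-<-trans l (a<Q u∈)))
      ...   | inj₂ l = ⊥-elim (<-irrefl e (<-≤-trans (Q<a' u∈) l))

      A*-clm : Climb A* ℓ
      A*-clm {u} {v} p q lt with ∪-e p
      ... | inj₂ u∈ with ℓ u <? ℓ y
      ...   | yes lt' with vs-climb path u∈ (vs-lst path) lt'
      ...     | c , c∈ , l , e = c , ∪-r c∈ , l , e
      A*-clm {u} {v} p q lt | inj₂ u∈ | no ¬lt with refl ← vs-inj path u∈ (vs-lst path) (≤-antisym (vs-≤ path u∈) (≮⇒≥ ¬lt)) =
        a' , a'∈A* , ℓa' , y~a'
      A*-clm {u} {v} p q lt | inj₁ u∈ with outer-e u∈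
      ... | uA , inj₂ l with ∪-e q
      ...   | inj₂ v∈ = ⊥-elim (<-irrefl refl (<-trans lt (<-≤-trans (Q<a' v∈) l)))
      ...   | inj₁ v∈ with clm uA (proj₁ (outer-e v∈)) lt
      ...     | c , c∈ , lc , e = c , ∪-l (outer-i c∈ (inj₂ (≤-trans l (≤-trans (n≤1+n _) (≤-reflexive (sym lc)))))) , lc , e
      A*-clm {u} {v} p q lt | inj₁ u∈ | uA , inj₁ l with ℓ u <? ℓ a
      ...   | yes lt' with clm uA a∈ lt'
      ...     | c , c∈ , lc , e = c , ∪-l (outer-i c∈ (inj₁ (≤-trans (≤-reflexive lc) lt'))) , lc , e
      A*-clm {u} {v} p q lt | inj₁ u∈ | uA , inj₁ l | no ¬lt with refl ← inj uA a∈ (≤-antisym l (≮⇒≥ ¬lt)) =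
        x , ∪-r (vs-fst path) , ℓx , a~x

      Ycond : Fin n → Set
      Ycond u = u ∈ A × ℓ a < ℓ u × ℓ u < ℓ a'

      -- A component of K ∖ Q seeing B cannot see the part of A bypassed by Q: this would be a K₃,₃.
      bypassed : ∀ {L} → IsComp (K ∖ Q) L → Adj L B → ∀ {u v} → u ∈ L → Ycond v → u ~ v → ⊥
      bypassed {L} il lb {u} {v} u∈ (v∈ , a<v , v<a') uv with conn (IsComp.pt il) x (∖-l (IsComp.sub il (IsComp.pt∈ il))) (Q⊆K (vs-fst path))
      ... | _ , w with exit L w (IsComp.pt∈ il) (¬∈→∉ λ xL → ∈∉ (vs-fst path) (∖-r (IsComp.sub il xL)))
      -- `q` is where a walk from `L` to the detour first leaves `L`. `X₁` and `X₂` are the parts of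
      -- `A*` below and above `q`, and `Y` is the bypassed stretch of `A`. The edge `uv` joins `Y`
      -- to `L`, the ends of `A` join `B` to `X₁` and `X₂`, and `lb` joins it to `L`.
      ...   | w₁ , q , _ , _ , w₁∈ , q∉ , w₁q , _ , r₂ , _ = noK33 q X₁ X₂ L Y B
              (slice-conn _ _ A*-inj A*-clm) (slice-conn _ _ A*-inj A*-clm) (IsComp.conn il) (slice-conn _ _ inj clm) cB
              (¬∈→∉ λ p → <-irrefl refl (≤-trans (s≤s (proj₂ (proj₂ (slice-e p)))) (≤-reflexive suc-pred-ℓq)))
              (¬∈→∉ λ p → <-irrefl refl (proj₁ (proj₂ (slice-e p))))
              q∉
              (¬∈→∉ λ p → ∈∉ qS (out (proj₁ (slice-e p))))
              (¬∈→∉ λ p → ∈∉ qS (LPath.out lpB p))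
              (λ p → ¬∈→∉ λ p' → <-irrefl refl (<-≤-trans (≤-trans (s≤s (proj₂ (proj₂ (slice-e p)))) (≤-reflexive suc-pred-ℓq)) (≤-trans (n≤1+n _) (proj₁ (proj₂ (slice-e p'))))))
              (λ p → ¬∈→∉ (A*L (proj₁ (slice-e p))))
              (λ p → ¬∈→∉ (A*Y (proj₁ (slice-e p))))
              (λ p → ¬∈→∉ (A*B (proj₁ (slice-e p))))
              (λ p → ¬∈→∉ (A*L (proj₁ (slice-e p))))
              (λ p → ¬∈→∉ (A*Y (proj₁ (slice-e p))))
              (λ p → ¬∈→∉ (A*B (proj₁ (slice-e p))))
              (λ p → ¬∈→∉ λ p' → ∈∉ (LS p) (out (proj₁ (slice-e p'))))
              (λ p → ¬∈→∉ λ p' → ∈∉ (LS p) (LPath.out lpB p'))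
              (λ p → dAB (proj₁ (slice-e p)))
              qX₁ qX₂ (_ , _ , ⟪⟫-i q , w₁∈ , ~sym w₁q) yX₁ yX₂ (v , u , slice-i v∈ a<v (≤-pred (≤-trans v<a' (≤-reflexive (sym spa')))) , u∈ , ~sym uv)
              (_ , _ , b∈ , slice-i (∪-l (outer-i lo∈ (inj₁ (lo≤ a∈)))) z≤n (≤-pred (≤-trans (≤-<-trans (lo≤ a∈) (a<Q q∈)) (≤-reflexive (sym suc-pred-ℓq)))) , ~sym lo~)
              (_ , _ , b'∈ , slice-i (∪-l (outer-i hi∈ (inj₂ (≤hi a'∈)))) (<-≤-trans (Q<a' q∈) (≤hi a'∈)) ≤-refl , ~sym hi~)
              (adj-sym lb)
        where
        q∈K : q ∈ K
        q∈K = wfst r₂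
        q∈ : q ∈ Q
        q∈ = ∖-∉ q∈K (¬∈→∉ λ p → ∈∉ (IsComp.closed il w₁∈ p w₁q) q∉)
        qS : q ∈ S
        qS = sub q∈K
        LS : ∀ {z} → z ∈ L → z ∈ S
        LS p = sub (∖-l (IsComp.sub il p))
        suc-pred-ℓq : suc (Data.Nat.pred (ℓ q)) ≡ ℓ q
        suc-pred-ℓq = suc-pred (ℓ q) {{Data.Nat.>-nonZero (≤-<-trans z≤n (a<Q q∈))}}
        spa' : suc (Data.Nat.pred (ℓ a')) ≡ ℓ a'
        spa' = suc-pred (ℓ a') {{Data.Nat.>-nonZero (≤-<-trans z≤n a<a')}}
        X₁ = slice {ℓ} A* 0 (Data.Nat.pred (ℓ q))
        X₂ = slice {ℓ} A* (suc (ℓ q)) (ℓ hi)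
        Y = slice {ℓ} A (suc (ℓ a)) (Data.Nat.pred (ℓ a'))
        A*L : ∀ {z} → z ∈ A* → z ∈ L → ⊥
        A*L p l with ∪-e p
        ... | inj₁ o = ∈∉ (LS l) (out (proj₁ (outer-e o)))
        ... | inj₂ o = ∈∉ o (∖-r (IsComp.sub il l))
        A*Y : ∀ {z} → z ∈ A* → z ∈ Y → ⊥
        A*Y p l with ∪-e p
        ... | inj₂ o = ∈∉ (sub (Q⊆K o)) (out (proj₁ (slice-e l)))
        ... | inj₁ o with proj₂ (outer-e o)
        ...   | inj₁ le = <-irrefl refl (<-≤-trans (proj₁ (proj₂ (slice-e l))) le)
        ...   | inj₂ le = <-irrefl refl (<-≤-trans (≤-trans (s≤s (proj₂ (proj₂ (slice-e l)))) (≤-reflexive spa')) le)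
        A*B : ∀ {z} → z ∈ A* → z ∈ B → ⊥
        A*B p l with ∪-e p
        ... | inj₁ o = ∈∉ l (dAB (proj₁ (outer-e o)))
        ... | inj₂ o = ∈∉ (sub (Q⊆K o)) (LPath.out lpB l)
        qA* : q ∈ A*
        qA* = ∪-r q∈
        qX₁ : Adj ⟪ q ⟫ X₁
        qX₁ with below A*-inj A*-clm a∈A* qA* (a<Q q∈)
        ... | c , c∈ , lc , e = q , c , ⟪⟫-i q , slice-i c∈ z≤n (≤-pred (≤-trans (≤-reflexive (sym lc)) (≤-reflexive (sym suc-pred-ℓq)))) , ~sym e
        qX₂ : Adj ⟪ q ⟫ X₂
        qX₂ with A*-clm qA* a'∈A* (Q<a' q∈)
        ... | c , c∈ , lc , e = q , c , ⟪⟫-i q , slice-i c∈ (≤-reflexive (sym lc)) (≤-trans (≤-trans (≤-reflexive lc) (Q<a' q∈)) (≤hi a'∈)) , e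
        yX₁ : Adj Y X₁
        yX₁ with clm a∈ v∈ a<v
        ... | c , c∈ , lc , e = c , a , slice-i c∈ (≤-reflexive (sym lc)) (≤-pred (≤-trans (s≤s (≤-trans (≤-reflexive lc) a<v)) (≤-trans v<a' (≤-reflexive (sym spa')))))
                              , slice-i a∈A* z≤n (≤-pred (≤-trans (a<Q q∈) (≤-reflexive (sym suc-pred-ℓq)))) , ~sym e
        yX₂ : Adj Y X₂
        yX₂ with below inj clm v∈ a'∈ v<a'
        ... | c , c∈ , lc , e = c , a' , slice-i c∈ (≤-trans a<v (≤-pred (≤-trans v<a' (≤-reflexive lc)))) (≤-pred (≤-trans (≤-reflexive (sym lc)) (≤-reflexive (sym spa'))))
                              , slice-i a'∈A* (Q<a' q∈) (≤hi a'∈) , e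

    seed? : ∀ Q v → Dec (v ∈ K ∖ Q × ∃ λ b → b ∈ B × v ~ b)
    seed? Q v = mem? v (K ∖ Q) ×-dec Fin.any? (λ b → mem? b B ×-dec (v ~? b))

    opaque
      seeds : VSet n → VSet n
      seeds Q v = does (seed? Q v)

      seeds-i : ∀ {Q v b} → v ∈ K ∖ Q → b ∈ B → v ~ b → v ∈ seeds Q
      seeds-i {Q} {v} p q e = ⟨ dec-true (seed? Q v) (p , _ , q , e) ⟩

      seeds-e : ∀ {Q v} → v ∈ seeds Q → v ∈ K ∖ Q × ∃ λ b → b ∈ B × v ~ b
      seeds-e {Q} {v} ⟨ p ⟩ = does-e (seed? Q v) p

    -- The vertices of K ∖ Q from which B can be reached inside K ∖ Q.
    opaque
      lit : (Q : VSet n) → Closure (K ∖ Q) (seeds Q)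
      lit Q = closure (K ∖ Q) (seeds Q) (λ p → proj₁ (seeds-e p))

    O : VSet n → VSet n
    O Q = Closure.C (lit Q)

    -- The walk that connects a visible vertex to its seed runs inside `O Q`, so it survives the
    -- removal of any set disjoint from `O Q`.
    O-mono : ∀ {Q R} → (∀ {w} → w ∈ O Q → w ∉ R) → O Q ⊆ O R
    O-mono {Q} {R} dis {w} w∈ with Closure.toseed (lit Q) w∈
    ... | s , m , s∈ , ww with seeds-e s∈
    ...   | s∈KQ , b , b∈ , e = wlst (stay (O R) cl (wrev ww) (Closure.seeds⊆ (lit R) (seeds-i (∖-i (∖-l s∈KQ) (dis (Closure.seeds⊆ (lit Q) s∈))) b∈ e)))
      where
      cl : ∀ {a b} → a ∈ O R → b ∈ O Q → a ~ b → b ∈ O R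
      cl a∈ b∈ e = Closure.closed (lit R) a∈ (∖-i (∖-l (Closure.C⊆S (lit Q) b∈)) (dis b∈)) e

    dark : ∀ {Q L} → IsComp (K ∖ Q) L → ¬ Adj L B → ∀ {w} → w ∈ L → w ∈ (K ∖ Q) ∖ O Q
    dark {Q} {L} il nb {w} w∈ = ∖-i (IsComp.sub il w∈) (¬∈→∉ bad)
      where
      bad : w ∈ O Q → ⊥
      bad p with Closure.toseed (lit Q) p
      ... | s , m , s∈ , ww with seeds-e s∈
      ...   | _ , b , b∈ , e = nb (s , b , wlst (comp-walk il w∈ (wmono (Closure.C⊆S (lit Q)) ww)) , b∈ , e)

    lit-adj : ∀ {Q L} → IsComp (K ∖ Q) L → ∀ {w} → w ∈ L → w ∈ O Q → Adj L B
    lit-adj {Q} {L} il {w} w∈ p with adj? L B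
    ... | yes lb = lb
    ... | no nb = ⊥-elim (∈∉ p (∖-r (dark il nb w∈)))

    -- A rising route of `r` edges from `A`, above `a`, that meets the detour only at its end `q`.
    -- Excluding it prevents `q` from seeing `A` at the lowest level `ℓ q - r`. The length is
    -- `pred r` because the edge from `u` to `u'` is counted separately.
    Short : Detour K A ℓ → Set
    Short d = ∃ λ q → ∃ λ u → ∃ λ u' → q ∈ Q d × u ∈ A × ℓ (Detour.a d) < ℓ u × u ~ u' × ℓ u' ≡ suc (ℓ u)
              × Up ((K ∖ Q d) ∪ ⟪ q ⟫) ℓ u' q (Data.Nat.pred r)

    opaque
      short? : ∀ d → Dec (Short d)
      short? d = Fin.any? λ q → Fin.any? λ u → Fin.any? λ u' → mem? q (Q d) ×-dec mem? u A ×-dec (ℓ (Detour.a d) <? ℓ u)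
                 ×-dec (u ~? u') ×-dec (ℓ u' ≟ suc (ℓ u)) ×-dec Up? _ u' q _

    record Best : Set where
      field
        d       : Detour K A ℓ
        noDark  : ¬ Detour ((K ∖ Q d) ∖ O (Q d)) A ℓ
        noShort : ¬ Short d

    span : Detour K A ℓ → ℕ
    span d = ℓ (Detour.a' d) ∸ ℓ (Detour.a d)

    -- A detour in the part hidden from `B` is disjoint from `Q d` and from `O (Q d)`. Taking it
    -- instead keeps everything visible and uncovers a vertex of `Q d`.
    reroute : Adj K B → (d : Detour K A ℓ) → (e : Detour ((K ∖ Q d) ∖ O (Q d)) A ℓ) →
              ∃ λ (d' : Detour K A ℓ) → card (O (Q d)) < card (O (Q d'))
    reroute (k₀ , b₀ , k₀∈ , b₀∈ , kb) d e = d' , card-strict O⊆ (proj₁ found) (proj₁ (proj₂ found)) (proj₂ (proj₂ found))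
      where
      d' = detour-mono (λ p → ∖-l (∖-l p)) e
      R⊆ : ∀ {w} → w ∈ Q d' → w ∈ (K ∖ Q d) ∖ O (Q d)
      R⊆ {w} w∈ = vs-⊆ (Detour.path e) (subst (w ∈_) (eq (Detour.path e)) w∈)
        where
        eq : ∀ {X Y x y m} {h : X ⊆ Y} (p : Up X ℓ x y m) → vs (umono h p) ≡ vs p
        eq (nil p) = refl
        eq (cons {u} p e l w) = cong (⟪ u ⟫ ∪_) (eq w)
      O⊆ : O (Q d) ⊆ O (Q d')
      O⊆ = O-mono (λ o → ¬∈→∉ λ p → ∈∉ o (∖-r (R⊆ p)))
      Q∩ : ∀ {w} → w ∈ Q d → w ∉ Q d'
      Q∩ q = ¬∈→∉ λ p → ∈∉ q (∖-r (∖-l (R⊆ p)))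
      QO : ∀ {w} → w ∈ Q d → w ∉ O (Q d)
      QO q = ¬∈→∉ λ o → ∈∉ q (∖-r (Closure.C⊆S (lit (Q d)) o))
      -- Some vertex of Q d becomes visible from B: K sees B, and every way from B to the detour ends in Q d.
      found : ∃ λ q → q ∈ O (Q d') × q ∉ O (Q d)
      found with in? k₀ (Q d)
      ... | inj₁ k₀Q = k₀ , Closure.seeds⊆ (lit _) (seeds-i (∖-i k₀∈ (Q∩ k₀Q)) b₀∈ kb) , QO k₀Q
      ... | inj₂ k₀Q with conn k₀ (Detour.x d) k₀∈ (Q⊆K d (vs-fst (Detour.path d)))
      ...   | _ , w with exit (O (Q d)) w (Closure.seeds⊆ (lit _) (seeds-i (∖-i k₀∈ k₀Q) b₀∈ kb)) (QO (vs-fst (Detour.path d)))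
      ...     | s , q , _ , _ , s∈ , q∉ , sq , _ , r₂ , _ = q , Closure.closed (lit _) (O⊆ s∈) (∖-i (wfst r₂) (Q∩ q∈)) sq , q∉
        where
        q∈ : q ∈ Q d
        q∈ = ∖-∉ (wfst r₂) (¬∈→∉ λ p → ∈∉ (Closure.closed (lit _) s∈ p sq) q∉)

    -- The short route followed by the rest of `Q d` starts higher on `A`, which lowers the span.
    -- The route meets no visible vertex: otherwise `u'` would be visible too, and its component
    -- would see `B` and touch `A` at `u`, strictly between `a` and `a'`, against `bypassed`.
    shorten : (d : Detour K A ℓ) → Short d →
              ∃ λ (d' : Detour K A ℓ) → card (O (Q d)) ≤ card (O (Q d')) × span d' < span d
    shorten d (q , u , u' , q∈ , u∈ , a<u , e , lu , up) with vs-split (Detour.path d) q∈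
    ... | _ , l , _ , up₂ = d' , card-mono (O-mono dis) , sp
      where
      open Detour d using (a; a'; path; ℓa'; y~a'; a'∈)
      up₁ : Up K ℓ u' q (Data.Nat.pred r)
      up₁ = umono (λ p → [ ∖-l , (λ z → subst (_∈ K) (sym (⟪⟫-e z)) (Q⊆K d q∈)) ]′ (∪-e p)) up
      up₂' = umono (Q⊆K d) up₂
      d' : Detour K A ℓ
      d' = record { a∈ = u∈ ; a'∈ = a'∈ ; a~x = e ; ℓx = lu ; path = uapp up₁ up₂' ; y~a' = y~a' ; ℓa' = ℓa' }
      u<q : ℓ u < ℓ q
      u<q = ≤-trans (≤-reflexive (sym lu)) (≤-trans (m≤m+n _ _) (≤-reflexive (sym (ulen up))))
      sp : span d' < span d
      sp = ∸-monoʳ-< a<u (<⇒≤ (<-trans u<q (Q<a' d q∈)))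
      vs-app : ∀ {X u v w k m} (p : Up X ℓ u v k) (p' : Up X ℓ v w m) {z} → z ∈ vs (uapp p p') → z ∈ vs p ⊎ z ∈ vs p'
      vs-app (nil p) p' z∈ = inj₂ z∈
      vs-app (cons {u} p e l r) p' z∈ with ∪-e z∈
      ... | inj₁ h = inj₁ (∪-l h)
      ... | inj₂ h with vs-app r p' h
      ...   | inj₁ g = inj₁ (∪-r g)
      ...   | inj₂ g = inj₂ g
      vs-mono : ∀ {X Y x y m} (h : X ⊆ Y) (p : Up X ℓ x y m) {z} → z ∈ vs (umono h p) → z ∈ X
      vs-mono h (nil p) z∈ with refl ← ⟪⟫-e z∈ = p
      vs-mono h (cons p e l w) z∈ with ∪-e z∈
      ... | inj₁ g with refl ← ⟪⟫-e g = p
      ... | inj₂ g = vs-mono h w g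
      vs-umono : ∀ {X Y x y m} (h : X ⊆ Y) (p : Up X ℓ x y m) {z} → z ∈ vs (umono h p) → z ∈ vs p
      vs-umono h (nil p) z∈ = z∈
      vs-umono h (cons p e l w) z∈ with ∪-e z∈
      ... | inj₁ g = ∪-l g
      ... | inj₂ g = ∪-r (vs-umono h w g)
      dark₁ : ∀ {w} → w ∈ O (Q d) → w ∈ vs up → ⊥
      dark₁ {w} w∈ w∈up with vs-split up w∈up
      ... | _ , _ , pre , _ = bypassed d il (lit-adj il u'∈L (wfst inO)) u'∈L (u∈ , a<u , <-trans u<q (Q<a' d q∈)) (~sym e)
        where
        w∉Q : w ∉ Q d
        w∉Q = ∖-r (Closure.C⊆S (lit (Q d)) w∈)
        w<q : ℓ w < ℓ q
        w<q = ≤∧≢⇒< (vs-≤ up w∈up) (λ eq → ∈∉ (subst (_∈ Q d) (sym (vs-inj up w∈up (vs-lst up) eq)) q∈) w∉Q)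
        low : ∀ {z} → z ∈ vs pre → z ∈ K ∖ Q d
        low {z} z∈ with ∪-e (vs-⊆ up (vs-⊆ pre z∈))
        ... | inj₁ k = k
        ... | inj₂ s with refl ← ⟪⟫-e s = ⊥-elim (<-irrefl refl (≤-<-trans (vs-≤ pre z∈) w<q))
        inO : W (O (Q d)) u' w _
        inO = wrev (stay (O (Q d)) (λ a b e → Closure.closed (lit (Q d)) a b e) (wrev (wmono low (uwalk (proj₂ (vs-self pre))))) w∈)
        cmp = compOf (K ∖ Q d) u' (low (vs-fst pre))
        il = proj₁ (proj₂ cmp)
        u'∈L = proj₂ (proj₂ cmp)
      dis : ∀ {w} → w ∈ O (Q d) → w ∉ Q d'
      dis {w} w∈ = ¬∈→∉ λ p → [ (λ h → dark₁ w∈ (vs-umono _ up h)) , (λ h → ∈∉ (vs-mono _ up₂ h) (∖-r (Closure.C⊆S (lit (Q d)) w∈))) ]′ (vs-app up₁ up₂' p)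

    Better : Detour K A ℓ → Detour K A ℓ → Set
    Better d d' = card (O (Q d)) < card (O (Q d')) ⊎ (card (O (Q d)) ≡ card (O (Q d')) × span d' < span d)

    improve : Adj K B → (d : Detour K A ℓ) → Best ⊎ ∃ (Better d)
    improve kb d = body (detour? ((K ∖ Q d) ∖ O (Q d)) A ℓ) (short? d)
      where
      body : Dec (Detour ((K ∖ Q d) ∖ O (Q d)) A ℓ) → Dec (Short d) → Best ⊎ ∃ (Better d)
      body (yes e) _      = inj₂ (proj₁ (reroute kb d e) , inj₁ (proj₂ (reroute kb d e)))
      body (no ¬e) (no ¬s) = inj₁ (record { d = d ; noDark = ¬e ; noShort = ¬s })
      body (no ¬e) (yes s) = inj₂ (proj₁ (shorten d s) , aux (shorten d s))
        where
        aux : (p : ∃ λ (d' : Detour K A ℓ) → card (O (Q d)) ≤ card (O (Q d')) × span d' < span d) → Better d (proj₁ p)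
        aux (d' , le , lt) = Sum.map₂ (_, lt) (m≤n⇒m<n∨m≡n le)

    -- Lexicographic descent on (n − |O|, span).
    module Descend (kb : Adj K B) where
      go : ∀ {c s} → Acc _<_ c → Acc _<_ s → (d : Detour K A ℓ) → n ∸ card (O (Q d)) ≡ c → span d ≡ s → Best
      next : ∀ {c s} → Acc _<_ c → Acc _<_ s → (d : Detour K A ℓ) → n ∸ card (O (Q d)) ≡ c → span d ≡ s → Best ⊎ ∃ (Better d) → Best
      go ac as d e₁ e₂ = next ac as d e₁ e₂ (improve kb d)
      next ac       as        d e₁   e₂   (inj₁ b) = b
      next (acc rs) as        d refl e₂   (inj₂ (d' , inj₁ lt)) = go (rs (∸-monoʳ-< lt (card≤n (O (Q d'))))) (<-wellFounded (span d')) d' refl refl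
      next ac       (acc rs') d e₁   refl (inj₂ (d' , inj₂ (eq , lt))) = go ac (rs' lt) d' (trans (cong (n ∸_) (sym eq)) e₁) refl

    best : Adj K B → Detour K A ℓ → Best
    best kb d₀ = Descend.go kb (<-wellFounded _) (<-wellFounded _) d₀ refl refl

-- An order for strong reachability

module StrongOrder {n : ℕ} (_~_ : Fin n → Fin n → Set)
             (~sym : ∀ {u v} → u ~ v → v ~ u) (_~?_ : ∀ u v → Dec (u ~ v)) (r : ℕ) (1≤r : 1 ≤ r)
             (seps : Paths.Separators _~_ ~sym _~?_) where

  open DetourChoice _~_ ~sym _~?_ r 1≤r seps

  private
    sum₁ : ∀ r → 2 * r + (2 * r + (r + 1)) ≡ 5 * r + 1
    sum₁ = solve 1 (λ r → con 2 :* r :+ (con 2 :* r :+ (r :+ con 1)) := con 5 :* r :+ con 1) refl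
      where open +-*-Solver
    sum₂ : ∀ r → 2 * r + ((2 * r + 1) + r) ≡ 5 * r + 1
    sum₂ = solve 1 (λ r → con 2 :* r :+ ((con 2 :* r :+ con 1) :+ r) := con 5 :* r :+ con 1) refl
      where open +-*-Solver

  later? : ∀ (S H : VSet n) (ℓ : Fin n → ℕ) v w → Dec (w ∈ S × (w ∉ H ⊎ ℓ v < ℓ w))
  later? S H ℓ v w = mem? w S ×-dec (map′ ⟨_⟩ un∉ (H w Data.Bool.≟ false) ⊎-dec (ℓ v <? ℓ w))

  opaque
    -- What may be an inner vertex when `v` lies on the path `H` being placed: vertices that come
    -- after all of `H`, and those higher on `H`, since `H` will be ordered by level.
    later : VSet n → VSet n → (Fin n → ℕ) → Fin n → VSet n
    later S H ℓ v w = does (later? S H ℓ v w)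

    later-i : ∀ {S H ℓ v w} → w ∈ S → w ∉ H ⊎ ℓ v < ℓ w → w ∈ later S H ℓ v
    later-i {S} {H} {ℓ} {v} {w} p q = ⟨ dec-true (later? S H ℓ v w) (p , q) ⟩

    later-e : ∀ {S H ℓ v w} → w ∈ later S H ℓ v → w ∈ S × (w ∉ H ⊎ ℓ v < ℓ w)
    later-e {S} {H} {ℓ} {v} {w} ⟨ p ⟩ = does-e (later? S H ℓ v w) p

  -- The invariant of a component: `B` never has detours, and `A` either has none while `B` is out
  -- of sight, or is attached to `B` at both ends, which is what allows its detours to be removed.
  record State (S K : VSet n) : Set where
    field
      A B   : VSet n
      ℓA ℓB : Fin n → ℕ
      lpA   : LPath S K A ℓA
      lpB   : LPath S K B ℓB
      dAB   : Disj A B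
      nbr   : ∀ {u v} → u ∈ K → u ~ v → v ∉ S → v ∈ A ⊎ v ∈ B
      goodB : Good K B ℓB
      link  : Ends A ℓA B ⊎ (Good K A ℓA × ¬ Adj K B)

  Bounded : VSet n → VSet n → (Fin n → ℕ) → Set
  Bounded S H ℓ = ∀ {v} → v ∈ H → CardAt (5 * r + 1) (λ u → Reach (later S H ℓ v) v u × (u ∉ S ⊎ (u ∈ H × ℓ u ≤ ℓ v)))

  record Step (S K : VSet n) : Set where
    field
      H     : VSet n
      ℓ     : Fin n → ℕ
      H⊆K   : H ⊆ K
      {h}   : Fin n
      h∈    : h ∈ H
      inj   : Inj H ℓ
      bound : Bounded S H ℓ
      next  : ∀ {L} → IsComp (K ∖ H) L → State (S ∖ H) L

  module _ {S K : VSet n} (ic : IsComp S K) where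
    open IsComp ic

    later⊆S : ∀ {H ℓ v} → later S H ℓ v ⊆ S
    later⊆S p = proj₁ (later-e p)

    own-near : ∀ {X ℓ v u} → X ⊆ S → Lip K ℓ → v ∈ K → u ∈ K → Reach X v u → ℓ v ≤ ℓ u + r
    own-near {X} {ℓ} {v} {u} X⊆S lip v∈ u∈ p with u Fin.≟ v
    ... | yes refl = m≤m+n _ _
    ... | no u≢v with reach-K ic X⊆S v∈ p u≢v
    ...   | w , k , e , ww , le = ≤-trans (lip-walk lip (wrev (cons u∈ e (wmono ∩-r ww)))) (+-monoʳ-≤ (ℓ u) le)

    -- On the path being placed only lower levels are earlier, so of the window around `ℓ v` just
    -- the levels from `ℓ v - r` to `ℓ v` count.
    own : ∀ {X ℓ v H} → X ⊆ S → Lip K ℓ → v ∈ K → H ⊆ K → Inj H ℓ →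
          CardAt (r + 1) (λ u → u ∈ H × ℓ u ≤ ℓ v × Reach X v u)
    own {ℓ = ℓ} {v} X⊆S lip v∈ H⊆K inj = card-inj (λ u → ℓ v ∸ ℓ u)
      (λ { (p , l , _) (p' , l' , _) e → inj p p' (∸-cancelˡ-≡ l l' e) })
      λ { {u} (p , l , q) → ≤-trans (s≤s (≤-trans (∸-monoˡ-≤ (ℓ u) (own-near X⊆S lip v∈ (H⊆K p) q)) (≤-reflexive (m+n∸m≡n (ℓ u) r)))) (≤-reflexive (+-comm 1 r)) }

    reach-nbr : ∀ {X v u} {A B : VSet n} → X ⊆ S → (∀ {u v} → u ∈ K → u ~ v → v ∉ S → v ∈ A ⊎ v ∈ B) →
                v ∈ K → u ∉ S → Reach X v u → u ∈ A ⊎ u ∈ B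
    reach-nbr X⊆S nbr v∈ u∉ p with reach-K ic X⊆S v∈ p (λ { refl → ∈∉ (sub v∈) u∉ })
    ... | w , k , e , ww , le = nbr (∩-r (wfst ww)) (~sym e) u∉

    sub-comp : ∀ {H L} → IsComp (K ∖ H) L → L ⊆ K
    sub-comp il p = ∖-l (IsComp.sub il p)

    placed : ∀ {H} {X : VSet n} → (∀ {x} → x ∈ X → x ∉ S) → ∀ {x} → x ∈ X → x ∉ S ∖ H
    placed o x∈ = ¬∈→∉ λ p → ∈∉ (∖-l p) (o x∈)

    removed : ∀ {H x} → x ∈ H → x ∉ S ∖ H
    removed x∈ = ¬∈→∉ λ p → ∈∉ x∈ (∖-r p)

    split-out : ∀ {H v} → v ∉ S ∖ H → v ∈ H ⊎ v ∉ S
    split-out {H} {v} p with in? v S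
    ... | inj₁ s = inj₁ (∖-∉ s p)
    ... | inj₂ s = inj₂ s

    module PathStep {A B : VSet n} {ℓA ℓB : Fin n → ℕ} (lpA : LPath S K A ℓA) (lpB : LPath S K B ℓB)
           (dAB : Disj A B) (nbr : ∀ {u v} → u ∈ K → u ~ v → v ∉ S → v ∈ A ⊎ v ∈ B)
           (goodA : Good K A ℓA) (goodB : Good K B ℓB) (ab : Adj K A → Adj K B → Adj A B) where

      ch : Choice K A B
      ch = choose seps ic (climb-conn (LPath.inj lpA) (LPath.clm lpA)) (climb-conn (LPath.inj lpB) (LPath.clm lpB))
             dAB (LPath.out lpA) (LPath.out lpB) nbr ab
      open Choice ch

      bound : Bounded S P ℓ
      -- `2r` for each of the two parents, both free of detours, and `r + 1` on the new path.
      bound {v} v∈ = card-⊆ (≤-reflexive (sum₁ r)) classify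
          (card-⊎ (seen-good ic lpA later⊆S (P⊆K v∈) goodA) (card-⊎ (seen-good ic lpB later⊆S (P⊆K v∈) goodB)
                  (own later⊆S lip (P⊆K v∈) P⊆K inj)))
        where
        X = later S P ℓ v
        classify : ∀ {u} → Reach X v u × (u ∉ S ⊎ (u ∈ P × ℓ u ≤ ℓ v)) →
                   (u ∈ A × Reach X v u) ⊎ (u ∈ B × Reach X v u) ⊎ (u ∈ P × ℓ u ≤ ℓ v × Reach X v u)
        classify (p , inj₂ (u∈ , le)) = inj₂ (inj₂ (u∈ , le , p))
        classify (p , inj₁ u∉) with reach-nbr later⊆S nbr (P⊆K v∈) u∉ p
        ... | inj₁ a = inj₁ (a , p)
        ... | inj₂ b = inj₂ (inj₁ (b , p))

      lpP : ∀ {L} → IsComp (K ∖ P) L → LPath (S ∖ P) L P ℓ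
      lpP il = record { out = removed ; inj = inj ; clm = clm
        ; lip = lip-mono (λ p → [ sub-comp il , P⊆K ]′ (∪-e p)) lip }

      toward : ∀ {L G ℓG} → IsComp (K ∖ P) L → LPath S K G ℓG → Good K G ℓG →
               (∀ {u v} → u ∈ L → u ~ v → v ∉ S → v ∈ G) → Ends P ℓ G ⊎ (Good L P ℓ × ¬ Adj L G) → State (S ∖ P) L
      toward {G = G} {ℓG} il lpG good nb lk = record { A = P ; B = G ; ℓA = ℓ ; ℓB = ℓG ; lpA = lpP il
        ; lpB = lpath-mono ∖-l (sub-comp il) lpG
        ; dAB = λ p → ¬∈→∉ λ g → ∈∉ (sub (P⊆K p)) (LPath.out lpG g)
        ; nbr = λ u∈ e v∉ → [ inj₁ , (λ v∉S → inj₂ (nb u∈ e v∉S)) ]′ (split-out v∉)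
        ; goodB = λ d → good (detour-mono (sub-comp il) d) ; link = lk }

      -- A piece never sees both `A` and `B`, so its parents are `P` and one of these, which is free
      -- of detours. A piece that sees neither is given one that `K` saw, so that the ends of `P`
      -- are attached to it; if `K` saw none, `P` is a single vertex and has no detour.
      next : ∀ {L} → IsComp (K ∖ P) L → State (S ∖ P) L
      next {L} il = body (adj? L B) (adj? L A) (adj? K A) (adj? K B)
        where
        nb : ∀ {u v} → u ∈ L → u ~ v → v ∉ S → v ∈ A ⊎ v ∈ B
        nb u∈ = nbr (sub-comp il u∈)
        onlyA : ¬ Adj L B → ∀ {u v} → u ∈ L → u ~ v → v ∉ S → v ∈ A
        onlyA ¬b u∈ e v∉ = [ id , (λ b → ⊥-elim (¬b (_ , _ , u∈ , b , e))) ]′ (nb u∈ e v∉)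
        onlyB : ¬ Adj L A → ∀ {u v} → u ∈ L → u ~ v → v ∉ S → v ∈ B
        onlyB ¬a u∈ e v∉ = [ (λ a → ⊥-elim (¬a (_ , _ , u∈ , a , e))) , id ]′ (nb u∈ e v∉)
        body : Dec (Adj L B) → Dec (Adj L A) → Dec (Adj K A) → Dec (Adj K B) → State (S ∖ P) L
        body (yes lb) (yes la) _ _ = ⊥-elim (sepa il la lb)
        body (yes lb) (no ¬la) _ _ = toward il lpB goodB (onlyB ¬la) (inj₁ (endB (adj-⊆ (sub-comp il) lb)))
        body (no ¬lb) (yes la) _ _ = toward il lpA goodA (onlyA ¬lb) (inj₁ (endA (adj-⊆ (sub-comp il) la)))
        body (no ¬lb) (no ¬la) (yes ka) _ = toward il lpA goodA (onlyA ¬lb) (inj₁ (endA ka))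
        body (no ¬lb) (no ¬la) (no _) (yes kb) = toward il lpB goodB (onlyB ¬la) (inj₁ (endB kb))
        body (no ¬lb) (no ¬la) (no ¬ka) (no ¬kb) = toward il lpB goodB (onlyB ¬la) (inj₂ (gd , ¬lb))
          where
          gd : Good L P ℓ
          gd d = <-irrefl (cong ℓ (one ¬ka ¬kb a∈ a'∈)) (≤-trans (≤-reflexive (sym ℓx)) (≤-trans (m≤m+n _ m)
                   (≤-trans (≤-reflexive (sym (ulen path))) (≤-trans (n≤1+n _) (≤-reflexive (sym ℓa'))))))
            where open Detour d

      step : Step S K
      step = record { H = P ; ℓ = ℓ ; H⊆K = P⊆K ; h∈ = p∈ ; inj = inj ; bound = bound ; next = next }

    module DetourStep {A B : VSet n} {ℓ ℓB : Fin n → ℕ} (lpA : LPath S K A ℓ) (lpB : LPath S K B ℓB)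
           (dAB : Disj A B) (nbr : ∀ {u v} → u ∈ K → u ~ v → v ∉ S → v ∈ A ⊎ v ∈ B)
           (goodB : Good K B ℓB) (ends : Ends A ℓ B) (best : Detours.Best ic lpA lpB dAB nbr ends) where
      module D = Detours ic lpA lpB dAB nbr ends
      open D.Best best
      open Detour d
      open LPath lpA

      private
        Q = D.Q d
        Q⊆K = D.Q⊆K d
        A* = D.A* d

      bound : Bounded S Q ℓ
      -- `A` may have detours, so `2r + 1` on it must be compensated. If `ℓ v` is at most `ℓ a + r`,
      -- the levels of `Q` that count lie above `ℓ a`, which leaves `r` instead of `r + 1`.
      -- Otherwise `noShort` rules out the lowest level of `A`.
      bound {v} v∈ = body (ℓ v ≤? ℓ a + r)
        where
        X = later S Q ℓ v
        v∈K = Q⊆K v∈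
        lipK : Lip K ℓ
        lipK = lip-mono ∪-l lip
        classify : ∀ {u} → Reach X v u × (u ∉ S ⊎ (u ∈ Q × ℓ u ≤ ℓ v)) →
                   (u ∈ B × Reach X v u) ⊎ (u ∈ A × Reach X v u) ⊎ (u ∈ Q × ℓ u ≤ ℓ v × Reach X v u)
        classify (p , inj₂ (u∈ , le)) = inj₂ (inj₂ (u∈ , le , p))
        classify (p , inj₁ u∉) with reach-nbr later⊆S nbr v∈K u∉ p
        ... | inj₁ a = inj₂ (inj₁ (a , p))
        ... | inj₂ b = inj₁ (b , p)
        seenB : CardAt (2 * r) (λ u → u ∈ B × Reach X v u)
        seenB = seen-good ic lpB later⊆S v∈K goodB
        fewQ : ℓ v ≤ ℓ a + r → CardAt r (λ u → u ∈ Q × ℓ u ≤ ℓ v × Reach X v u)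
        fewQ le = card-inj (λ u → ℓ v ∸ ℓ u) (λ { (p , l , _) (p' , l' , _) e → vs-inj path p p' (∸-cancelˡ-≡ l l' e) })
          λ { {u} (p , l , _) → +-cancelˡ-< (ℓ u) _ _ (≤-trans (s≤s (≤-trans (≤-reflexive (m+[n∸m]≡n l)) le)) (+-monoˡ-≤ r (D.a<Q d p))) }
        -- The witness of the lowest level rises all the way to `v`. Vertices of `Q` placed after
        -- `v` have higher levels than `v`, so it meets `Q` only at `v` and is a short route; that
        -- it starts above `a` is the assumption that `v` is far.
        noLow : ¬ (ℓ v ≤ ℓ a + r) → ∀ {u} → u ∈ A → Reach X v u → ℓ u + r ≢ ℓ v
        noLow far {u} u∈ p eq with lowest ic lpA later⊆S v∈K u∈ p eq
        ... | w , k , e , lw , up , keq = noShort (v , u , w , v∈ , u∈ , +-cancelʳ-< r _ _ (≤-trans (≰⇒> far) (≤-reflexive (sym eq))) , e , lw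
                , subst (Up ((K ∖ Q) ∪ ⟪ v ⟫) ℓ w v) (cong Data.Nat.pred keq) (umono inside (proj₂ (vs-self' up))))
          where
          vs-self' : ∀ {X u v m} (r : Up X ℓ u v m) → ⊤ × Up (vs r) ℓ u v m
          vs-self' (nil p) = tt , nil (⟪⟫-i _)
          vs-self' (cons {u} p e l w) = tt , cons (∪-l (⟪⟫-i u)) e l (umono ∪-r (proj₂ (vs-self' w)))
          inside : vs up ⊆ (K ∖ Q) ∪ ⟪ v ⟫
          inside {z} z∈ with ∪-e (∩-l (vs-⊆ up z∈))
          ... | inj₂ s = ∪-r s
          ... | inj₁ zX with proj₂ (later-e zX)
          ...   | inj₁ z∉ = ∪-l (∖-i (∩-r (vs-⊆ up z∈)) z∉)
          ...   | inj₂ lt = ⊥-elim (<-irrefl refl (<-≤-trans lt (vs-≤ up z∈)))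
        body : Dec (ℓ v ≤ ℓ a + r) → CardAt (5 * r + 1) _
        body (yes le) = card-⊆ (≤-reflexive (sum₂ r)) classify (card-⊎ seenB (card-⊎ (seen ic lpA later⊆S v∈K) (fewQ le)))
        body (no far) = card-⊆ (≤-reflexive (sum₁ r)) classify (card-⊎ seenB (card-⊎
             (card-⊆ ≤-refl (λ { (p , q) → (p , near ic lpA later⊆S v∈K p q) , noLow far p q }) (seen-above ic lpA (later⊆S {Q} {ℓ} {v}) v∈K))
             (own later⊆S lipK v∈K Q⊆K (vs-inj path))))

      -- Pieces that see `B` continue with `A*`; by `bypassed` they do not touch the omitted stretch
      -- of `A`. For the others the parents are `Q`, attached at both ends to `A`, and `A` itself,
      -- which `noDark` makes free of detours there.
      next : ∀ {L} → IsComp (K ∖ Q) L → State (S ∖ Q) L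
      next {L} il = body (adj? L B)
        where
        L⊆K : L ⊆ K
        L⊆K = sub-comp il
        A*⊆ : A* ⊆ K ∪ A
        A*⊆ p = [ (λ o → ∪-r (proj₁ (D.outer-e d o))) , (λ q → ∪-l (Q⊆K q)) ]′ (∪-e p)
        A*out : ∀ {x} → x ∈ A* → x ∉ S ∖ Q
        A*out p = [ (λ o → placed out (proj₁ (D.outer-e d o))) , removed ]′ (∪-e p)
        body : Dec (Adj L B) → State (S ∖ Q) L
        body (yes lb) = record { A = A* ; B = B ; ℓA = ℓ ; ℓB = ℓB
          ; lpA = record { out = A*out ; inj = D.A*-inj d ; clm = D.A*-clm d
                         ; lip = lip-mono (λ p → [ (λ l → ∪-l (L⊆K l)) , A*⊆ ]′ (∪-e p)) lip }
          ; lpB = lpath-mono ∖-l L⊆K lpB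
          ; dAB = λ p → [ (λ o → dAB (proj₁ (D.outer-e d o))) , (λ q → ¬∈→∉ λ b → ∈∉ (sub (Q⊆K q)) (LPath.out lpB b)) ]′ (∪-e p)
          ; nbr = nb ; goodB = λ e → goodB (detour-mono L⊆K e)
          ; link = inj₁ (record { lo∈ = ∪-l (D.outer-i d lo∈ (inj₁ (lo≤ a∈))) ; hi∈ = ∪-l (D.outer-i d hi∈ (inj₂ (≤hi a'∈)))
              ; b∈ = b∈ ; b'∈ = b'∈ ; lo~ = lo~ ; hi~ = hi~
              ; lo≤ = λ p → [ (λ o → lo≤ (proj₁ (D.outer-e d o))) , (λ q → ≤-trans (lo≤ a∈) (<⇒≤ (D.a<Q d q))) ]′ (∪-e p)
              ; ≤hi = λ p → [ (λ o → ≤hi (proj₁ (D.outer-e d o))) , (λ q → ≤-trans (<⇒≤ (D.Q<a' d q)) (≤hi a'∈)) ]′ (∪-e p) }) }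
          where
          open Ends ends
          nb : ∀ {u v} → u ∈ L → u ~ v → v ∉ S ∖ Q → v ∈ A* ⊎ v ∈ B
          nb {u} {v} u∈ e v∉ with split-out v∉
          ... | inj₁ q = inj₁ (∪-r q)
          ... | inj₂ v∉S with nbr (L⊆K u∈) e v∉S
          ...   | inj₂ b = inj₂ b
          ...   | inj₁ vA with ℓ v ≤? ℓ a | ℓ a' ≤? ℓ v
          ...     | yes le | _ = inj₁ (∪-l (D.outer-i d vA (inj₁ le)))
          ...     | no _ | yes le = inj₁ (∪-l (D.outer-i d vA (inj₂ le)))
          ...     | no ¬l | no ¬h = ⊥-elim (D.bypassed d il lb u∈ (vA , ≰⇒> ¬l , ≰⇒> ¬h) e)
        body (no ¬lb) = record { A = Q ; B = A ; ℓA = ℓ ; ℓB = ℓ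
          ; lpA = record { out = removed ; inj = vs-inj path ; clm = vs-climb path
                         ; lip = lip-mono (λ p → ∪-l ([ L⊆K , Q⊆K ]′ (∪-e p))) lip }
          ; lpB = lpath-mono ∖-l L⊆K lpA
          ; dAB = λ q → ¬∈→∉ λ p → ∈∉ (sub (Q⊆K q)) (out p)
          ; nbr = λ u∈ e v∉ → [ inj₁ , (λ v∉S → [ inj₂ , (λ b → ⊥-elim (¬lb (_ , _ , u∈ , b , e))) ]′ (nbr (L⊆K u∈) e v∉S)) ]′ (split-out v∉)
          ; goodB = λ e → noDark (detour-mono (D.dark il ¬lb) e)
          ; link = inj₁ (record { lo∈ = vs-fst path ; hi∈ = vs-lst path ; b∈ = a∈ ; b'∈ = a'∈ ; lo~ = ~sym a~x ; hi~ = y~a'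
              ; lo≤ = vs-≥ path ; ≤hi = vs-≤ path }) }

      step : Step S K
      step = record { H = Q ; ℓ = ℓ ; H⊆K = Q⊆K ; h∈ = vs-fst path ; inj = vs-inj path ; bound = bound ; next = next }

    opaque
      makeStep : State S K → Step S K
      makeStep st = go link
        where
        open State st
        go : Ends A ℓA B ⊎ (Good K A ℓA × ¬ Adj K B) → Step S K
        go (inj₂ (goodA , ¬kb)) = PathStep.step lpA lpB dAB nbr goodA goodB (λ _ kb → ⊥-elim (¬kb kb))
        go (inj₁ ends) = body (adj? K B) (detour? K A ℓA)
          where
          open Ends ends
          ab : Adj A B
          ab = _ , _ , lo∈ , b∈ , lo~
          body : Dec (Adj K B) → Dec (Detour K A ℓA) → Step S K
          body (no ¬kb) _       = PathStep.step lpA lpB dAB nbr (Detours.good-if-blind ic lpA lpB dAB nbr ends ¬kb) goodB (λ _ _ → ab)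
          body (yes kb) (no ¬d) = PathStep.step lpA lpB dAB nbr ¬d goodB (λ _ _ → ab)
          body (yes kb) (yes d) = DetourStep.step lpA lpB dAB nbr goodB ends (Detours.best ic lpA lpB dAB nbr ends kb d)

  state-mono : ∀ {S H L} → L ⊆ S ∖ H → IsComp S L → State S L → State (S ∖ H) L
  state-mono {S} {H} {L} L⊆ ic st = record { A = A ; B = B ; ℓA = ℓA ; ℓB = ℓB ; lpA = lpath-mono ∖-l id lpA ; lpB = lpath-mono ∖-l id lpB
    ; dAB = dAB ; goodB = goodB ; link = link
    ; nbr = λ u∈ e v∉ → nbr u∈ e (¬∈→∉ λ v∈ → ∈∉ (L⊆ (IsComp.closed ic u∈ v∈ e)) v∉) }
    where open State st

  -- Vertices outside `S` precede all of `S` in the order under construction.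
  Lower : VSet n → (Fin n → ℕ) → Fin n → Fin n → Set
  Lower S pos v u = u ∉ S ⊎ pos u ≤ pos v

  higher? : ∀ (S : VSet n) (pos : Fin n → ℕ) v w → Dec (w ∈ S × pos v < pos w)
  higher? S pos v w = mem? w S ×-dec (pos v <? pos w)

  opaque
    higher : VSet n → (Fin n → ℕ) → Fin n → VSet n
    higher S pos v w = does (higher? S pos v w)

    higher-i : ∀ {S pos v w} → w ∈ S → pos v < pos w → w ∈ higher S pos v
    higher-i {S} {pos} {v} {w} p q = ⟨ dec-true (higher? S pos v w) (p , q) ⟩

    higher-e : ∀ {S pos v w} → w ∈ higher S pos v → w ∈ S × pos v < pos w
    higher-e {S} {pos} {v} {w} ⟨ p ⟩ = does-e (higher? S pos v w) p

  record Ordered (S : VSet n) : Set where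
    field
      pos   : Fin n → ℕ
      pinj  : Inj S pos
      bound : ∀ {v} → v ∈ S → CardAt (5 * r + 1) (λ u → Reach (higher S pos v) v u × Lower S pos v u)

  prepend : ∀ {S H ℓ} → H ⊆ S → Inj H ℓ → Bounded S H ℓ → Ordered (S ∖ H) → Ordered S
  prepend {S} {H} {ℓ} H⊆S inj bd o = record { pos = pos ; pinj = pinj' ; bound = λ {v} → bd' v (in? v H) }
    where
    open Ordered o renaming (pos to pos'; pinj to pinj₀; bound to bound₀)
    -- `M` exceeds every level, so shifting the rest by `M` puts all of `H` first.
    M = proj₁ (maxval ℓ)
    pos : Fin n → ℕ
    pos v = if H v then ℓ v else M + pos' v
    posH : ∀ {v} → v ∈ H → pos v ≡ ℓ v
    posH ⟨ e ⟩ rewrite e = refl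
    posN : ∀ {v} → v ∉ H → pos v ≡ M + pos' v
    posN ⟨ e ⟩ rewrite e = refl
    H<N : ∀ {v w} → v ∈ H → w ∉ H → pos v < pos w
    H<N {v} {w} p q = subst (_< pos w) (sym (posH p)) (<-≤-trans (proj₂ (maxval ℓ) v) (≤-trans (m≤m+n M _) (≤-reflexive (sym (posN q)))))
    pinj' : Inj S pos
    pinj' {a} {b} p q e with in? a H | in? b H
    ... | inj₁ x | inj₁ y = inj x y (trans (sym (posH x)) (trans e (posH y)))
    ... | inj₁ x | inj₂ y = ⊥-elim (<-irrefl e (H<N x y))
    ... | inj₂ x | inj₁ y = ⊥-elim (<-irrefl (sym e) (H<N y x))
    ... | inj₂ x | inj₂ y = pinj₀ (∖-i p x) (∖-i q y) (+-cancelˡ-≡ M _ _ (trans (sym (posN x)) (trans e (posN y))))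
    bd' : ∀ v → v ∈ H ⊎ v ∉ H → v ∈ S → CardAt (5 * r + 1) (λ u → Reach (higher S pos v) v u × Lower S pos v u)
    bd' v (inj₁ v∈) _ = card-⊆ ≤-refl (λ { (p , q) → reach-mono hi p , lo q }) (bd v∈)
      where
      hi : higher S pos v ⊆ later S H ℓ v
      hi {w} h with higher-e h | in? w H
      ... | wS , lt | inj₂ w∉ = later-i wS (inj₁ w∉)
      ... | wS , lt | inj₁ w∈ = later-i wS (inj₂ (≤-trans (≤-reflexive (cong suc (sym (posH v∈)))) (≤-trans lt (≤-reflexive (posH w∈)))))
      lo : ∀ {u} → Lower S pos v u → u ∉ S ⊎ (u ∈ H × ℓ u ≤ ℓ v)
      lo (inj₁ u∉) = inj₁ u∉
      lo {u} (inj₂ le) with in? u H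
      ... | inj₁ u∈ = inj₂ (u∈ , ≤-trans (≤-reflexive (sym (posH u∈))) (≤-trans le (≤-reflexive (posH v∈))))
      ... | inj₂ u∉ = ⊥-elim (<-irrefl refl (<-≤-trans (H<N v∈ u∉) le))
    bd' v (inj₂ v∉) v∈S = card-⊆ ≤-refl (λ { (p , q) → reach-mono hi p , lo q }) (bound₀ (∖-i v∈S v∉))
      where
      hi : higher S pos v ⊆ higher (S ∖ H) pos' v
      hi {w} h with higher-e h | in? w H
      ... | wS , lt | inj₁ w∈ = ⊥-elim (<-irrefl refl (<-trans lt (H<N w∈ v∉)))
      ... | wS , lt | inj₂ w∉ = higher-i (∖-i wS w∉) (+-cancelˡ-< M _ _ (≤-trans (≤-reflexive (cong suc (sym (posN v∉)))) (≤-trans lt (≤-reflexive (posN w∉)))))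
      lo : ∀ {u} → Lower S pos v u → Lower (S ∖ H) pos' v u
      lo (inj₁ u∉) = inj₁ (¬∈→∉ λ p → ∈∉ (∖-l p) u∉)
      lo {u} (inj₂ le) with in? u H
      ... | inj₁ u∈ = inj₁ (¬∈→∉ λ p → ∈∉ u∈ (∖-r p))
      ... | inj₂ u∉ = inj₂ (+-cancelˡ-≤ M _ _ (≤-trans (≤-reflexive (sym (posN u∉))) (≤-trans le (≤-reflexive (posN v∉)))))

  order : ∀ S → (∀ {K} → IsComp S K → State S K) → Ordered S
  order S = go S (<-wellFounded _)
    where
    go : ∀ S → Acc _<_ (card S) → (∀ {K} → IsComp S K → State S K) → Ordered S
    go S (acc rs) st with inhabited? S
    ... | inj₂ none = record { pos = λ _ → 0 ; pinj = λ a _ _ → ⊥-elim (∈∉ a (none _)) ; bound = λ v → ⊥-elim (∈∉ v (none _)) }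
    ... | inj₁ (v , v∈) with compOf S v v∈
    ...   | K , ic , _ = prepend H⊆S inj bound (go (S ∖ H) (rs (card-strict ∖-l _ (H⊆S h∈) (¬∈→∉ λ p → ∈∉ h∈ (∖-r p)))) st')
      where
      open Step (makeStep ic (st ic))
      H⊆S : H ⊆ S
      H⊆S p = IsComp.sub ic (H⊆K p)
      st' : ∀ {L} → IsComp (S ∖ H) L → State (S ∖ H) L
      st' il with comp-cases H ic H⊆K il
      ... | inj₁ il' = state-mono (IsComp.sub il) il' (st il')
      ... | inj₂ il' = next il'

  everything : VSet n
  everything _ = true

  strongOrder : Ordered everything
  strongOrder = order everything λ ic → record { A = ∅ ; B = ∅ ; ℓA = λ _ → 0 ; ℓB = λ _ → 0 ; lpA = empty ; lpB = empty
    ; dAB = λ p → ⊥-elim (∈∉ p ∅-no) ; nbr = λ { _ _ ⟨ () ⟩ } ; goodB = noD ; link = inj₂ (noD , λ { (_ , _ , _ , p , _) → ∈∉ p ∅-no }) }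
    where
    empty : ∀ {S K} → LPath S K ∅ (λ _ → 0)
    empty = record { out = λ p → ⊥-elim (∈∉ p ∅-no) ; lip = λ _ _ _ → z≤n ; inj = λ p → ⊥-elim (∈∉ p ∅-no) ; clm = λ p → ⊥-elim (∈∉ p ∅-no) }
    noD : ∀ {K} → Good K ∅ (λ _ → 0)
    noD d = ∈∉ (Detour.a∈ d) ∅-no

-- An order for weak reachability

tri : ℕ → ℕ
tri zero    = 0
tri (suc m) = suc m + tri m

-- Bounds the number of earlier paths that can be reached when the two parent paths
-- are entered with fewer than p and fewer than q steps left.
budget : ℕ → ℕ → ℕ
budget p q = (p ⊓ q) + tri (p ⊔ q)

budget-comm : ∀ p q → budget p q ≡ budget q p
budget-comm p q = cong₂ (λ a b → a + tri b) (⊓-comm p q) (⊔-comm p q)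

-- One path is the first parent itself. What enters it with fewer than `suc p` steps left goes on to
-- its own parents with fewer than `p`; one of these is the second parent, for which `q` was allowed
-- anyway. For `p < q` this is an equality, and for `q ≤ p` the left side is `tri (suc p)`.
budget-step : ∀ p q → suc (budget (q ⊔ p) p) ≤ budget (suc p) q
budget-step p q with ≤-total q p
... | inj₁ q≤p rewrite m≤n⇒m⊔n≡n q≤p | ⊓-idem p | ⊔-idem p | m≥n⇒m⊔n≡m (m≤n⇒m≤1+n q≤p) = m≤n+m _ (suc p ⊓ q)
... | inj₂ p≤q with m≤n⇒m<n∨m≡n p≤q
...   | inj₂ refl rewrite ⊔-idem p | ⊓-idem p | ⊔-idem p | m≥n⇒m⊔n≡m (n≤1+n p) = m≤n+m _ (suc p ⊓ p)
...   | inj₁ p<q rewrite m≥n⇒m⊔n≡m p≤q | m≥n⇒m⊓n≡n p≤q | m≥n⇒m⊔n≡m p≤q | m≤n⇒m⊓n≡m p<q | m≤n⇒m⊔n≡n p<q = ≤-refl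

module WeakOrder {n : ℕ} (_~_ : Fin n → Fin n → Set)
             (~sym : ∀ {u v} → u ~ v → v ~ u) (_~?_ : ∀ u v → Dec (u ~ v)) (r : ℕ)
             (seps : Paths.Separators _~_ ~sym _~?_) where

  open Paths _~_ ~sym _~?_

  -- The walk is cut at a vertex of the parent path because the number `l` of steps left there is
  -- the parameter on which the count recurses. `R` will be the set of vertices unplaced when the
  -- path of `u` was chosen.
  record Hit (R A : VSet n) (p : ℕ) (v u : Fin n) : Set where
    constructor hit
    field
      {a} : Fin n
      {k l} : ℕ
      a∈  : a ∈ A
      w₁  : W R v a k
      w₂  : W R a u l
      k+l : k + l ≤ r
      l<p : l < p

  hit-mono : ∀ {R R' A p p' v u} → R ⊆ R' → p ≤ p' → Hit R A p v u → Hit R' A p' v u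
  hit-mono h le (hit a w₁ w₂ s l) = hit a (wmono h w₁) (wmono h w₂) s (≤-trans l le)

  N : ℕ
  N = 2 * r + 1

  record State (S K : VSet n) (Reg : Fin n → VSet n) : Set where
    field
      A B   : VSet n
      ℓA ℓB : Fin n → ℕ
      lpA   : LPath S K A ℓA
      lpB   : LPath S K B ℓB
      dAB   : Disj A B
      nbr   : ∀ {u v} → u ∈ K → u ~ v → v ∉ S → v ∈ A ⊎ v ∈ B
      ab    : Adj K A → Adj K B → Adj A B
      -- Paths are counted, at `N` vertices each, and for all `p` and `q` at once, since passing to
      -- the next component changes both.
      bnd   : ∀ {v} → v ∈ K → ∀ p q → CardAt (budget p q * N) (λ u → u ∉ S × (Hit (Reg u) A p v u ⊎ Hit (Reg u) B q v u))

  -- Walks ending at a vertex of H may use everything not placed before H.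
  extend : VSet n → VSet n → (Fin n → VSet n) → Fin n → VSet n
  extend S H Reg u = if H u then S else Reg u

  extend-∈ : ∀ {S H Reg u} → u ∈ H → extend S H Reg u ≡ S
  extend-∈ ⟨ e ⟩ rewrite e = refl

  extend-∉ : ∀ {S H Reg u} → u ∉ H → extend S H Reg u ≡ Reg u
  extend-∉ ⟨ e ⟩ rewrite e = refl

  module Step {S K : VSet n} (ic : IsComp S K) {Reg : Fin n → VSet n} (st : State S K Reg) where
    open IsComp ic
    open State st

    ch : Choice K A B
    ch = choose seps ic (climb-conn (LPath.inj lpA) (LPath.clm lpA)) (climb-conn (LPath.inj lpB) (LPath.clm lpB))
             dAB (LPath.out lpA) (LPath.out lpB) nbr ab
    open Choice ch public

    Reg' : Fin n → VSet n
    Reg' = extend S P Reg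

    reg-in : ∀ {u} → u ∈ P → Reg' u ≡ S
    reg-in = extend-∈ {S} {P} {Reg}

    reg-out : ∀ {u} → u ∉ P → Reg' u ≡ Reg u
    reg-out = extend-∉ {S} {P} {Reg}

    inside : ∀ {v} → v ∈ K → CardAt N (λ u → u ∈ P × ∃ λ m → m ≤ r × W S v u m)
    inside {v} v∈ = card-⊆ ≤-refl near' (window r (ℓ v) inj)
      where
      near' : ∀ {u} → u ∈ P × (∃ λ m → m ≤ r × W S v u m) → u ∈ P × ℓ u ≤ ℓ v + r × ℓ v ≤ ℓ u + r
      near' {u} (u∈ , m , le , w) = u∈ , ≤-trans (lip-walk lip (wrev wK)) (+-monoʳ-≤ (ℓ v) le) , ≤-trans (lip-walk lip wK) (+-monoʳ-≤ (ℓ u) le)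
        where wK = comp-walk ic v∈ w

    -- `u` is already placed, so the walk must leave `K`, and it can only leave into a parent. The
    -- leaving edge uses one of the remaining steps, which turns `suc p` into `p`.
    leave : ∀ {v x u k l p} → x ∈ K → u ∉ S → W (Reg u) v x k → W (Reg u) x u l → k + l ≤ r → l < suc p →
            Hit (Reg u) A p v u ⊎ Hit (Reg u) B p v u
    leave {v} {x} {u} {k} {p = p} x∈ u∉ w₁ w₂ le lt with exit K w₂ x∈ (¬∈→∉ λ u∈ → ∈∉ (sub u∈) u∉)
    ... | a , b , i , j , a∈ , b∉ , ab , w₃ , w₄ , refl =
        [ (λ bA → inj₁ (hit bA front w₄ bound' short)) , (λ bB → inj₂ (hit bB front w₄ bound' short)) ]′
          (nbr a∈ ab (¬∈→∉ λ b∈ → ∈∉ (closed a∈ b∈ ab) b∉))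
      where
      front = wsnoc (wapp w₁ w₃) ab (wfst w₄)
      bound' : suc (k + i) + j ≤ r
      bound' = ≤-trans (≤-reflexive (trans (cong suc (+-assoc k i j)) (trans (sym (+-suc k (i + j))) (cong (k +_) (sym (+-suc i j)))))) le
      short : j < p
      short = ≤-trans (s≤s (m≤n+m j i)) (≤-trans (≤-reflexive (sym (+-suc i j))) (≤-pred lt))

    bound : ∀ {v} → v ∈ P → CardAt ((1 + budget r r) * N) (λ u → (u ∈ P × ∃ λ m → m ≤ r × W S v u m) ⊎ (u ∉ S × ∃ λ m → m ≤ r × W (Reg u) v u m))
    bound {v} v∈ = card-⊎ (inside (P⊆K v∈)) (card-⊆ ≤-refl
        (λ { (u∉ , m , le , w) → u∉ , leave (P⊆K v∈) u∉ (nil (wfst w)) w le (s≤s le) }) (bnd (P⊆K v∈) r r))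

    sub-comp : ∀ {L} → IsComp (K ∖ P) L → L ⊆ K
    sub-comp il p = ∖-l (IsComp.sub il p)

    split-out : ∀ {v} → v ∉ S ∖ P → v ∈ P ⊎ v ∉ S
    split-out {v} p with in? v S
    ... | inj₁ s = inj₁ (∖-∉ s p)
    ... | inj₂ s = inj₂ s

    toward : ∀ {L G F ℓG} → IsComp (K ∖ P) L → LPath S K G ℓG →
             (∀ {u v} → u ∈ L → u ~ v → v ∉ S → v ∈ G) → (Adj L G → Adj P G) →
             (∀ {v} → v ∈ K → ∀ p q → CardAt (budget p q * N) (λ u → u ∉ S × (Hit (Reg u) G p v u ⊎ Hit (Reg u) F q v u))) →
             (∀ {v x u k l p} → x ∈ K → u ∉ S → W (Reg u) v x k → W (Reg u) x u l → k + l ≤ r → l < suc p →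
                Hit (Reg u) G p v u ⊎ Hit (Reg u) F p v u) →
             State (S ∖ P) L Reg'
    toward {L} {G} {F} {ℓG} il lpG nb pg bndG lv = record { A = P ; B = G ; ℓA = ℓ ; ℓB = ℓG
        ; lpA = record { out = λ x∈ → ¬∈→∉ λ p → ∈∉ x∈ (∖-r p) ; inj = inj ; clm = clm
                       ; lip = lip-mono (λ p → [ sub-comp il , P⊆K ]′ (∪-e p)) lip }
        ; lpB = lpath-mono ∖-l (sub-comp il) lpG
        ; dAB = λ p → ¬∈→∉ λ g → ∈∉ (sub (P⊆K p)) (LPath.out lpG g)
        ; nbr = λ u∈ e v∉ → [ inj₁ , (λ v∉S → inj₂ (nb u∈ e v∉S)) ]′ (split-out v∉)
        ; ab = λ _ lg → pg lg ; bnd = λ v∈ → cnt (sub-comp il v∈) }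
      where
      Query : ℕ → ℕ → Fin n → Fin n → Set
      Query p q v u = u ∉ S ∖ P × (Hit (Reg' u) P p v u ⊎ Hit (Reg' u) G q v u)
      -- Walks to a vertex of `P` run in `S`, which contains no vertex of the earlier path `G`.
      noG : ∀ {q v u} → u ∈ P → Hit (Reg' u) G q v u → ⊥
      noG {u = u} u∈ (hit g∈ _ w₂ _ _) = ∈∉ (subst (_ ∈_) (reg-in u∈) (wfst w₂)) (LPath.out lpG g∈)
      viaG : ∀ {q v u} → u ∉ P → Hit (Reg' u) G q v u → Hit (Reg u) G q v u
      viaG u∉ h = subst (λ R → Hit R G _ _ _) (reg-out u∉) h
      viaP : ∀ {p v u} → u ∉ P → u ∉ S → Hit (Reg' u) P (suc p) v u → Hit (Reg u) G p v u ⊎ Hit (Reg u) F p v u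
      viaP {p} {v} {u} u∉P u∉ h with subst (λ R → Hit R P (suc p) v u) (reg-out u∉P) h
      ... | hit x∈ w₁ w₂ le lt = lv (P⊆K x∈) u∉ w₁ w₂ le lt
      ∉S→∉P : ∀ {u} → u ∉ S → u ∉ P
      ∉S→∉P u∉S = ¬∈→∉ λ u∈P → ∈∉ (sub (P⊆K u∈P)) u∉S
      cnt : ∀ {v} → v ∈ K → ∀ p q → CardAt (budget p q * N) (Query p q v)
      -- No walk enters `P` with fewer than zero steps left, so only hits through `G` remain.
      cnt {v} v∈ zero q = card-⊆ (≤-reflexive (cong (_* N) (budget-comm q 0))) f (bndG v∈ q 0)
        where
        Old : Fin n → Set
        Old u = u ∉ S × (Hit (Reg u) G q v u ⊎ Hit (Reg u) F 0 v u)
        go : ∀ {u} → u ∈ P ⊎ u ∉ S → Hit (Reg' u) P 0 v u ⊎ Hit (Reg' u) G q v u → Old u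
        go _          (inj₁ (hit _ _ _ _ ()))
        go (inj₁ u∈P) (inj₂ h) = ⊥-elim (noG u∈P h)
        go (inj₂ u∉S) (inj₂ h) = u∉S , inj₁ (viaG (∉S→∉P u∉S) h)
        f : ∀ {u} → Query 0 q v u → Old u
        f (u∉ , h) = go (split-out u∉) h
      -- Vertices of `P` fill one window. An earlier vertex is hit through `G` directly with `q`, or
      -- after passing `P` through `G` or `F` with `p`; the two bounds for `G` merge into `q ⊔ p`.
      cnt {v} v∈ (suc p) q = card-⊆ (*-monoˡ-≤ N (budget-step p q)) f (card-⊎ (inside v∈) (bndG v∈ (q ⊔ p) p))
        where
        Old : Fin n → Set
        Old u = (u ∈ P × ∃ λ m → m ≤ r × W S v u m) ⊎ (u ∉ S × (Hit (Reg u) G (q ⊔ p) v u ⊎ Hit (Reg u) F p v u))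
        go : ∀ {u} → u ∈ P ⊎ u ∉ S → Hit (Reg' u) P (suc p) v u ⊎ Hit (Reg' u) G q v u → Old u
        go (inj₁ u∈P) (inj₂ h) = ⊥-elim (noG u∈P h)
        go {u} (inj₁ u∈P) (inj₁ (hit x∈ w₁ w₂ le lt)) = inj₁ (u∈P , _ , le , subst (λ R → W R v u _) (reg-in u∈P) (wapp w₁ w₂))
        go (inj₂ u∉S) (inj₂ h) = inj₂ (u∉S , inj₁ (hit-mono id (m≤m⊔n q p) (viaG (∉S→∉P u∉S) h)))
        go (inj₂ u∉S) (inj₁ h) = inj₂ (u∉S , [ (λ g → inj₁ (hit-mono id (m≤n⊔m q p) g)) , inj₂ ]′ (viaP (∉S→∉P u∉S) u∉S h))
        f : ∀ {u} → Query (suc p) q v u → Old u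
        f (u∉ , h) = go (split-out u∉) h

    next : ∀ {L} → IsComp (K ∖ P) L → State (S ∖ P) L Reg'
    next {L} il = body (adj? L B)
      where
      nb : ∀ {u v} → u ∈ L → u ~ v → v ∉ S → v ∈ A ⊎ v ∈ B
      nb u∈ = nbr (sub-comp il u∈)
      adjP : ∀ {G} → Ends P ℓ G → Adj P G
      adjP e = _ , _ , Ends.lo∈ e , Ends.b∈ e , Ends.lo~ e
      body : Dec (Adj L B) → State (S ∖ P) L Reg'
      body (yes lb) = toward {F = A} il lpB (λ u∈ e v∉ → [ (λ a → ⊥-elim (sepa il (_ , _ , u∈ , a , e) lb)) , id ]′ (nb u∈ e v∉))
        (λ g → adjP (endB (adj-⊆ (sub-comp il) g)))
        (λ v∈ p q → card-⊆ (≤-reflexive (cong (_* N) (budget-comm q p))) (λ { (u∉ , h) → u∉ , Sum.swap h }) (bnd v∈ q p))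
        (λ x∈ u∉ w₁ w₂ le lt → Sum.swap (leave x∈ u∉ w₁ w₂ le lt))
      body (no ¬lb) = toward {F = B} il lpA (λ u∈ e v∉ → [ id , (λ b → ⊥-elim (¬lb (_ , _ , u∈ , b , e))) ]′ (nb u∈ e v∉))
        (λ g → adjP (endA (adj-⊆ (sub-comp il) g))) bnd leave

    -- The parents of an untouched component were placed before `P`. A walk to a vertex of `P` runs
    -- in `S` and cannot pass through them, so nothing new is hit.
    keep : ∀ {L} → L ⊆ S ∖ P → IsComp S L → State S L Reg → State (S ∖ P) L Reg'
    keep {L} L⊆ il st' = record { A = A' ; B = B' ; ℓA = s.ℓA ; ℓB = s.ℓB ; lpA = lpath-mono ∖-l id s.lpA ; lpB = lpath-mono ∖-l id s.lpB
      ; dAB = s.dAB ; ab = s.ab ; nbr = λ u∈ e v∉ → s.nbr u∈ e (¬∈→∉ λ v∈ → ∈∉ (L⊆ (IsComp.closed il u∈ v∈ e)) v∉)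
      ; bnd = λ v∈ p q → card-⊆ ≤-refl f (s.bnd v∈ p q) }
      where
      module s = State st'
      A' = s.A
      B' = s.B
      no-in : ∀ {G q v u} → (∀ {g} → g ∈ G → g ∉ S) → u ∈ P → Hit (Reg' u) G q v u → ⊥
      no-in o u∈ (hit g∈ _ w₂ _ _) = ∈∉ (subst (_ ∈_) (reg-in u∈) (wfst w₂)) (o g∈)
      f : ∀ {v p q u} → u ∉ S ∖ P × (Hit (Reg' u) A' p v u ⊎ Hit (Reg' u) B' q v u) → u ∉ S × (Hit (Reg u) A' p v u ⊎ Hit (Reg u) B' q v u)
      f {u = u} (u∉ , h) with split-out u∉ | h
      ... | inj₁ u∈ | inj₁ h' = ⊥-elim (no-in (LPath.out s.lpA) u∈ h')
      ... | inj₁ u∈ | inj₂ h' = ⊥-elim (no-in (LPath.out s.lpB) u∈ h')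
      ... | inj₂ u∉S | h' = u∉S , Sum.map (subst (λ R → Hit R _ _ _ _) eq) (subst (λ R → Hit R _ _ _ _) eq) h'
        where eq = reg-out {u} (¬∈→∉ λ u∈P → ∈∉ (sub (P⊆K u∈P)) u∉S)

  atLeast? : ∀ (S : VSet n) (pos : Fin n → ℕ) u w → Dec (w ∈ S × pos u ≤ pos w)
  atLeast? S pos u w = mem? w S ×-dec (pos u ≤? pos w)

  opaque
    atLeast : VSet n → (Fin n → ℕ) → Fin n → VSet n
    atLeast S pos u w = does (atLeast? S pos u w)

    atLeast-i : ∀ {S pos u w} → w ∈ S → pos u ≤ pos w → w ∈ atLeast S pos u
    atLeast-i {S} {pos} {u} {w} p q = ⟨ dec-true (atLeast? S pos u w) (p , q) ⟩

    atLeast-e : ∀ {S pos u w} → w ∈ atLeast S pos u → w ∈ S × pos u ≤ pos w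
    atLeast-e {S} {pos} {u} {w} ⟨ p ⟩ = does-e (atLeast? S pos u w) p

  -- The bound also counts the reachable vertices placed before `S`, through their regions;
  -- otherwise the bounds of successive stages could not be put together.
  record Ordered (S : VSet n) (Reg : Fin n → VSet n) : Set where
    field
      pos   : Fin n → ℕ
      pinj  : Inj S pos
      bound : ∀ {v} → v ∈ S → CardAt ((1 + budget r r) * N) (λ u →
        (u ∈ S × ∃ λ m → m ≤ r × W (atLeast S pos u) v u m) ⊎ (u ∉ S × ∃ λ m → m ≤ r × W (Reg u) v u m))

  prepend : ∀ {S K Reg} (ic : IsComp S K) (st : State S K Reg) → let open Step ic st in
            Ordered (S ∖ P) Reg' → Ordered S Reg
  prepend {S} {K} {Reg} ic st o = record { pos = pos ; pinj = pinj' ; bound = λ {v} → bd' v (in? v P) }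
    where
    open Step ic st
    open Ordered o renaming (pos to pos'; pinj to pinj₀; bound to bound₀)
    M = proj₁ (maxval ℓ)
    pos : Fin n → ℕ
    pos v = if P v then ℓ v else M + pos' v
    P⊆S : P ⊆ S
    P⊆S p = IsComp.sub ic (P⊆K p)
    posH : ∀ {v} → v ∈ P → pos v ≡ ℓ v
    posH ⟨ e ⟩ rewrite e = refl
    posN : ∀ {v} → v ∉ P → pos v ≡ M + pos' v
    posN ⟨ e ⟩ rewrite e = refl
    H<N : ∀ {v w} → v ∈ P → w ∉ P → pos v < pos w
    H<N {v} {w} p q = subst (_< pos w) (sym (posH p)) (<-≤-trans (proj₂ (maxval ℓ) v) (≤-trans (m≤m+n M _) (≤-reflexive (sym (posN q)))))
    pinj' : Inj S pos
    pinj' {a} {b} p q e with in? a P | in? b P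
    ... | inj₁ x | inj₁ y = inj x y (trans (sym (posH x)) (trans e (posH y)))
    ... | inj₁ x | inj₂ y = ⊥-elim (<-irrefl e (H<N x y))
    ... | inj₂ x | inj₁ y = ⊥-elim (<-irrefl (sym e) (H<N y x))
    ... | inj₂ x | inj₂ y = pinj₀ (∖-i p x) (∖-i q y) (+-cancelˡ-≡ M _ _ (trans (sym (posN x)) (trans e (posN y))))
    Near : Fin n → Fin n → Set
    Near v u = (u ∈ S × ∃ λ m → m ≤ r × W (atLeast S pos u) v u m) ⊎ (u ∉ S × ∃ λ m → m ≤ r × W (Reg u) v u m)
    bd' : ∀ v → v ∈ P ⊎ v ∉ P → v ∈ S → CardAt ((1 + budget r r) * N) (Near v)
    bd' v (inj₁ v∈) _ = card-⊆ ≤-refl f (bound v∈)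
      where
      f : ∀ {u} → Near v u → (u ∈ P × ∃ λ m → m ≤ r × W S v u m) ⊎ (u ∉ S × ∃ λ m → m ≤ r × W (Reg u) v u m)
      f (inj₂ h) = inj₂ h
      f {u} (inj₁ (u∈S , m , le , w)) with in? u P
      ... | inj₁ u∈ = inj₁ (u∈ , m , le , wmono (λ p → proj₁ (atLeast-e p)) w)
      ... | inj₂ u∉ = ⊥-elim (<-irrefl refl (<-≤-trans (H<N v∈ u∉) (proj₂ (atLeast-e (wfst w)))))
    bd' v (inj₂ v∉) v∈S = card-⊆ ≤-refl f (bound₀ (∖-i v∈S v∉))
      where
      f : ∀ {u} → Near v u → (u ∈ S ∖ P × ∃ λ m → m ≤ r × W (atLeast (S ∖ P) pos' u) v u m) ⊎ (u ∉ S ∖ P × ∃ λ m → m ≤ r × W (Reg' u) v u m)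
      f {u} (inj₂ (u∉ , m , le , w)) = inj₂ ((¬∈→∉ λ p → ∈∉ (∖-l p) u∉) , m , le
        , subst (λ R → W R v u m) (sym (reg-out (¬∈→∉ λ p → ∈∉ (P⊆S p) u∉))) w)
      f {u} (inj₁ (u∈S , m , le , w)) with in? u P
      ... | inj₁ u∈ = inj₂ ((¬∈→∉ λ p → ∈∉ u∈ (∖-r p)) , m , le , subst (λ R → W R v u m) (sym (reg-in u∈)) (wmono (λ p → proj₁ (atLeast-e p)) w))
      ... | inj₂ u∉ = inj₁ (∖-i u∈S u∉ , m , le , wmono hi w)
        where
        hi : atLeast S pos u ⊆ atLeast (S ∖ P) pos' u
        hi {x} h with atLeast-e h | in? x P
        ... | xS , l | inj₁ x∈ = ⊥-elim (<-irrefl refl (<-≤-trans (H<N x∈ u∉) l))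
        ... | xS , l | inj₂ x∉ = atLeast-i (∖-i xS x∉) (+-cancelˡ-≤ M _ _ (≤-trans (≤-reflexive (sym (posN u∉))) (≤-trans l (≤-reflexive (posN x∉)))))

  order : ∀ S Reg → (∀ {K} → IsComp S K → State S K Reg) → Ordered S Reg
  order S Reg = go S Reg (<-wellFounded _)
    where
    go : ∀ S Reg → Acc _<_ (card S) → (∀ {K} → IsComp S K → State S K Reg) → Ordered S Reg
    go S Reg (acc rs) st with inhabited? S
    ... | inj₂ none = record { pos = λ _ → 0 ; pinj = λ a _ _ → ⊥-elim (∈∉ a (none _)) ; bound = λ v → ⊥-elim (∈∉ v (none _)) }
    ... | inj₁ (v , v∈) with compOf S v v∈
    ...   | K , ic , _ = prepend ic (st ic) (go (S ∖ P) Reg' (rs (card-strict ∖-l _ (P⊆S p∈) (¬∈→∉ λ p → ∈∉ p∈ (∖-r p)))) st')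
      where
      open Step ic (st ic)
      P⊆S : P ⊆ S
      P⊆S p = IsComp.sub ic (P⊆K p)
      st' : ∀ {L} → IsComp (S ∖ P) L → State (S ∖ P) L Reg'
      st' il with comp-cases P ic P⊆K il
      ... | inj₁ il' = keep (IsComp.sub il) il' (st il')
      ... | inj₂ il' = next il'

  weakOrder : Ordered (λ _ → true) (λ _ → ∅)
  weakOrder = order _ _ λ ic → record { A = ∅ ; B = ∅ ; ℓA = λ _ → 0 ; ℓB = λ _ → 0 ; lpA = empty ; lpB = empty
    ; dAB = λ p → ⊥-elim (∈∉ p ∅-no) ; nbr = λ { _ _ ⟨ () ⟩ } ; ab = λ { (_ , _ , _ , p , _) → ⊥-elim (∈∉ p ∅-no) }
    ; bnd = λ _ p q → card-⊆ z≤n (λ { (_ , inj₁ (hit p _ _ _ _)) → ∈∉ p ∅-no ; (_ , inj₂ (hit p _ _ _ _)) → ∈∉ p ∅-no }) (card-0 id) }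
    where
    empty : ∀ {S K} → LPath S K ∅ (λ _ → 0)
    empty = record { out = λ p → ⊥-elim (∈∉ p ∅-no) ; lip = λ _ _ _ → z≤n ; inj = λ p → ⊥-elim (∈∉ p ∅-no) ; clm = λ p → ⊥-elim (∈∉ p ∅-no) }

-- Combinatorial maps and their homology

xor-monoid : CommutativeMonoid _ _
xor-monoid = CommutativeRing.+-commutativeMonoid Bool.xor-∧-commutativeRing

module ⊕ = MonoidSum xor-monoid

xor-swap : ∀ a b c d → (a xor b) xor (c xor d) ≡ (a xor c) xor (b xor d)
xor-swap a b c d = trans (Bool.xor-assoc a b (c xor d)) (trans (cong (a xor_) (trans (sym (Bool.xor-assoc b c d))
  (trans (cong (_xor d) (Bool.xor-comm b c)) (Bool.xor-assoc c b d)))) (sym (Bool.xor-assoc a c (b xor d))))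

xor-cancel : ∀ a b c → (a xor b) xor (b xor c) ≡ a xor c
xor-cancel a b c = trans (Bool.xor-assoc a b (b xor c)) (cong (a xor_) (trans (sym (Bool.xor-assoc b b c)) (cong (_xor c) (Bool.xor-same b))))

xor≡false : ∀ {a b} → a xor b ≡ false → a ≡ b
xor≡false {true}  {true}  _ = refl
xor≡false {false} {false} _ = refl

bool-ext : ∀ {a b} → (a ≡ true → b ≡ true) → (b ≡ true → a ≡ true) → a ≡ b
bool-ext {true}  {b}     f g = sym (f refl)
bool-ext {false} {true}  f g = g refl
bool-ext {false} {false} f g = refl

record Enum (D : Set) : Set where
  field
    size    : ℕ
    to      : D → Fin size
    from    : Fin size → D
    from-to : ∀ d → from (to d) ≡ d
    to-from : ∀ i → to (from i) ≡ i

module Sums {D : Set} (E : Enum D) where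
  open Enum E

  _≟D_ : (d e : D) → Dec (d ≡ e)
  d ≟D e = map′ (λ p → trans (sym (from-to d)) (trans (cong from p) (from-to e))) (cong to) (to d Fin.≟ to e)

  any-D : {P : D → Set} → (∀ d → Dec (P d)) → Dec (∃ P)
  any-D {P} P? = map′ (λ { (i , p) → from i , p }) (λ { (d , p) → to d , subst P (sym (from-to d)) p }) (Fin.any? (λ i → P? (from i)))

  opaque
    eqb : D → D → Bool
    eqb d e = does (d ≟D e)

    eqb-refl : ∀ d → eqb d d ≡ true
    eqb-refl d = dec-true (d ≟D d) refl

    eqb-≡ : ∀ {d e} → eqb d e ≡ true → d ≡ e
    eqb-≡ {d} {e} p = does-e (d ≟D e) p

    eqb-≢ : ∀ {d e} → d ≢ e → eqb d e ≡ false
    eqb-≢ {d} {e} h = dec-false (d ≟D e) h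

  opaque
    ΣD : (D → Bool) → Bool
    ΣD f = ⊕.sum (f ∘ from)

    Σ-cong : ∀ {f g} → (∀ d → f d ≡ g d) → ΣD f ≡ ΣD g
    Σ-cong h = ⊕.sum-cong-≗ (h ∘ from)

    Σ-zero : ∀ {f} → (∀ d → f d ≡ false) → ΣD f ≡ false
    Σ-zero {f} h = trans (⊕.sum-cong-≗ (h ∘ from)) (⊕.sum-replicate-zero size)

    Σ-def : ∀ f → ΣD f ≡ ⊕.sum (f ∘ from)
    Σ-def f = refl

    Σ-xor : ∀ (f g : D → Bool) → ΣD (λ d → f d xor g d) ≡ ΣD f xor ΣD g
    Σ-xor f g = ⊕.∑-distrib-+ (f ∘ from) (g ∘ from)

    Σ-bij : ∀ (f : D → Bool) (π π⁻¹ : D → D) → (∀ d → π (π⁻¹ d) ≡ d) → (∀ d → π⁻¹ (π d) ≡ d) → ΣD (f ∘ π) ≡ ΣD f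
    Σ-bij f π π⁻¹ l r = trans (⊕.sum-cong-≗ (λ i → cong f (sym (from-to (π (from i)))))) (sym (⊕.sum-permute (f ∘ from) perm))
      where
      perm : Permutation size size
      perm = permutation (to ∘ π ∘ from) (to ∘ π⁻¹ ∘ from)
               ((λ i → trans (cong to (trans (cong π (from-to _)) (l (from i)))) (to-from i)))
               ((λ i → trans (cong to (trans (cong π⁻¹ (from-to _)) (r (from i)))) (to-from i)))

    Σ-delta : ∀ (f : D → Bool) e → ΣD (λ d → eqb e d ∧ f d) ≡ f e
    Σ-delta f e = go size from to from-to to-from
      where
      go : ∀ N (from : Fin N → D) (to : D → Fin N) → (∀ d → from (to d) ≡ d) → (∀ i → to (from i) ≡ i) →
           ⊕.sum (λ i → eqb e (from i) ∧ f (from i)) ≡ f e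
      go N from to ft tf = trans (pick N from (to e) (ft e) (λ i p → trans (sym (tf i)) (cong to (sym p)))) refl
        where
        pick : ∀ N (from : Fin N → D) (j : Fin N) → from j ≡ e → (∀ i → e ≡ from i → i ≡ j) →
               ⊕.sum (λ i → eqb e (from i) ∧ f (from i)) ≡ f e
        pick (suc N) from j fj uq = trans (⊕.sum-remove {N} {j} (λ i → eqb e (from i) ∧ f (from i)))
            (trans (cong₂ _xor_ (trans (cong (λ z → eqb e z ∧ f z) fj) (cong (_∧ f e) (eqb-refl e)))
                     (trans (⊕.sum-cong-≗ (λ i → cong (_∧ f (from (punchIn j i))) (eqb-≢ (λ p → Fin.punchInᵢ≢i j i (uq _ p)))))
                            (⊕.sum-replicate-zero N)))
                   (Bool.xor-identityʳ (f e)))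

  module Involution (rev : D → D) (rr : ∀ d → rev (rev d) ≡ d) (rn : ∀ d → rev d ≢ d) where
    -- Selects one of the two darts of every edge.
    less : D → Bool
    less d = does (toℕ (to d) <? toℕ (to (rev d)))

    less-rev : ∀ d → less (rev d) ≡ not (less d)
    less-rev d = trans (cong (λ z → does (toℕ (to (rev d)) <? toℕ (to z))) (rr d)) (body (toℕ (to (rev d)) <? toℕ (to d)) (toℕ (to d) <? toℕ (to (rev d))))
      where
      a b : ℕ
      a = toℕ (to (rev d))
      b = toℕ (to d)
      body : Dec (a < b) → Dec (b < a) → does (a <? b) ≡ not (does (b <? a))
      body (yes p) (yes q) = ⊥-elim (<-asym p q)
      body (yes p) (no  q) = trans (dec-true (a <? b) p) (cong not (sym (dec-false (b <? a) q)))
      body (no  p) (yes q) = trans (dec-false (a <? b) p) (cong not (sym (dec-true (b <? a) q)))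
      body (no  p) (no  q) = ⊥-elim (rn d (trans (sym (from-to _)) (trans (cong from (Fin.toℕ-injective (≤-antisym (≮⇒≥ q) (≮⇒≥ p)))) (from-to d))))

  -- Split D into the elements preceding and following their partner.
  Σ-pairs : ∀ (f : D → Bool) (rev : D → D) → (∀ d → rev (rev d) ≡ d) → (∀ d → rev d ≢ d) → (∀ d → f (rev d) ≡ f d) → ΣD f ≡ false
  Σ-pairs f rev rr rn fr = trans (Σ-cong split) (trans (Σ-xor _ _)
      (trans (cong (ΣD (λ d → less d ∧ f d) xor_) swap) (Bool.xor-same (ΣD (λ d → less d ∧ f d)))))
    where
    open Involution rev rr rn
    split : ∀ d → f d ≡ (less d ∧ f d) xor (less (rev d) ∧ f (rev d))
    split d rewrite less-rev d | fr d with less d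
    ... | true  = sym (Bool.xor-identityʳ (f d))
    ... | false = refl
    swap : ΣD (λ d → less (rev d) ∧ f (rev d)) ≡ ΣD (λ d → less d ∧ f d)
    swap = Σ-bij (λ d → less d ∧ f d) rev rev rr rr

record Map (n : ℕ) : Set₁ where
  field
    D       : Set
    enum    : Enum D
    tail    : D → Fin n
    rev     : D → D
    rev-rev : ∀ d → rev (rev d) ≡ d
    rev≢    : ∀ d → rev d ≢ d
    ρ ρ⁻¹   : D → D
    ρρ⁻¹    : ∀ d → ρ (ρ⁻¹ d) ≡ d
    ρ⁻¹ρ    : ∀ d → ρ⁻¹ (ρ d) ≡ d
    tail-ρ  : ∀ d → tail (ρ d) ≡ tail d
    cyclic  : ∀ d d' → tail d ≡ tail d' → ∃ λ k → iter k ρ d ≡ d'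

  open Sums enum public

  head : D → Fin n
  head d = tail (rev d)

  φ φ⁻¹ : D → D
  φ d = ρ (rev d)
  φ⁻¹ d = rev (ρ⁻¹ d)

  φφ⁻¹ : ∀ d → φ (φ⁻¹ d) ≡ d
  φφ⁻¹ d = trans (cong ρ (rev-rev (ρ⁻¹ d))) (ρρ⁻¹ d)

  φ⁻¹φ : ∀ d → φ⁻¹ (φ d) ≡ d
  φ⁻¹φ d = trans (cong rev (ρ⁻¹ρ (rev d))) (rev-rev d)

  tail-φ : ∀ d → tail (φ d) ≡ head d
  tail-φ d = tail-ρ (rev d)

  head-rev : ∀ d → head (rev d) ≡ tail d
  head-rev d = cong tail (rev-rev d)

  open Involution rev rev-rev rev≢ public

  data DWalk : Fin n → Fin n → List D → Set where
    []  : ∀ {u} → DWalk u u []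
    _∷_ : ∀ {u v d ds} → tail d ≡ u → DWalk (head d) v ds → DWalk u v (d ∷ ds)

  edge : D → D → Bool
  edge e d = eqb e d xor eqb (rev e) d

  cnt : List D → D → Bool
  cnt []       d = false
  cnt (e ∷ es) d = edge e d xor cnt es d

  -- Homology with two-element coefficients: the `φ`-invariant function `S` is a set of faces, and
  -- `C` consists of the edges with exactly one side in it.
  record Bounds (C : D → Bool) : Set where
    field
      S   : D → Bool
      S-φ : ∀ d → S (φ d) ≡ S d
      ∂S  : ∀ d → S d xor S (rev d) ≡ C d

  -- All cycles bound, in the form: for every edge e, the cycle consisting of e and the
  -- reference walks to its two ends bounds a set of faces.
  record Spherical : Set where
    field
      ref : Fin n → D → Bool
      bd  : ∀ e → Bounds (λ d → (ref (tail e) d xor ref (head e) d) xor edge e d)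

  Bounds-xor : ∀ {C C'} → Bounds C → Bounds C' → Bounds (λ d → C d xor C' d)
  Bounds-xor {C} {C'} b b' = record { S = λ d → S b d xor S b' d ; S-φ = λ d → cong₂ _xor_ (S-φ b d) (S-φ b' d)
    ; ∂S = λ d → trans (xor-swap (S b d) (S b' d) (S b (rev d)) (S b' (rev d))) (cong₂ _xor_ (∂S b d) (∂S b' d)) }
    where open Bounds

  Bounds-cong : ∀ {C C'} → (∀ d → C d ≡ C' d) → Bounds C → Bounds C'
  Bounds-cong h b = record { S = Bounds.S b ; S-φ = Bounds.S-φ b ; ∂S = λ d → trans (Bounds.∂S b d) (h d) }

  Bounds-0 : Bounds (λ _ → false)
  Bounds-0 = record { S = λ _ → false ; S-φ = λ _ → refl ; ∂S = λ _ → refl }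

  Bounds-not : ∀ {C} → Bounds C → Bounds C
  Bounds-not b = record { S = not ∘ S ; S-φ = λ d → cong not (S-φ d) ; ∂S = λ d → trans (Bool.xor-annihilates-not (S d) (S (rev d))) (∂S d) }
    where open Bounds b

  module _ (sph : Spherical) where
    open Spherical sph

    walk-bounds : ∀ {u v ds} → DWalk u v ds → Bounds (λ d → (ref u d xor ref v d) xor cnt ds d)
    walk-bounds {u} [] = Bounds-cong (λ d → sym (trans (Bool.xor-identityʳ _) (Bool.xor-same (ref u d)))) Bounds-0
    walk-bounds {v = v} (_∷_ {d = e} {ds} refl w) = Bounds-cong (λ d → tele (ref (tail e) d) (ref (head e) d) (ref v d) (edge e d) (cnt ds d)) (Bounds-xor (bd e) (walk-bounds w))
      where
      tele : ∀ a b c e f → ((a xor b) xor e) xor ((b xor c) xor f) ≡ (a xor c) xor (e xor f)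
      tele a b c e f = trans (xor-swap (a xor b) e (b xor c) f) (cong (_xor (e xor f)) (xor-cancel a b c))

    closed-bounds : ∀ {u ds} → DWalk u u ds → Bounds (cnt ds)
    closed-bounds {u} w = Bounds-cong (λ d → cong (_xor _) (Bool.xor-same (ref u d))) (walk-bounds w)

  DW-++ : ∀ {u v x ds es} → DWalk u v ds → DWalk v x es → DWalk u x (ds ++ es)
  DW-++ []      w' = w'
  DW-++ (p ∷ w) w' = p ∷ DW-++ w w'

  cnt-++ : ∀ ds es d → cnt (ds ++ es) d ≡ cnt ds d xor cnt es d
  cnt-++ []       es d = refl
  cnt-++ (e ∷ ds) es d = trans (cong (edge e d xor_) (cnt-++ ds es d)) (sym (Bool.xor-assoc (edge e d) (cnt ds d) (cnt es d)))

  eqb-rev : ∀ e d → eqb e (rev d) ≡ eqb (rev e) d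
  eqb-rev e d = bool-ext
    (λ p → trans (cong (λ z → eqb (rev z) d) (eqb-≡ p)) (trans (cong (λ z → eqb z d) (rev-rev d)) (eqb-refl d)))
    (λ p → trans (cong (λ z → eqb e (rev z)) (sym (eqb-≡ p))) (trans (cong (eqb e) (rev-rev e)) (eqb-refl e)))

  edge-rev : ∀ e d → edge e (rev d) ≡ edge e d
  edge-rev e d = trans (cong₂ _xor_ (eqb-rev e d) (trans (eqb-rev (rev e) d) (cong (λ z → eqb z d) (rev-rev e)))) (Bool.xor-comm (eqb (rev e) d) (eqb e d))

  edge-revˡ : ∀ e d → edge (rev e) d ≡ edge e d
  edge-revˡ e d = trans (cong (λ z → eqb (rev e) d xor eqb z d) (rev-rev e)) (Bool.xor-comm (eqb (rev e) d) (eqb e d))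

  cnt-rev : ∀ ds d → cnt ds (rev d) ≡ cnt ds d
  cnt-rev []       d = refl
  cnt-rev (e ∷ ds) d = cong₂ _xor_ (edge-rev e d) (cnt-rev ds d)

  Σw : (D → Bool) → List D → Bool
  Σw c []       = false
  Σw c (e ∷ es) = c e xor Σw c es

  Σw-++ : ∀ c ds es → Σw c (ds ++ es) ≡ Σw c ds xor Σw c es
  Σw-++ c []       es = refl
  Σw-++ c (e ∷ ds) es = trans (cong (c e xor_) (Σw-++ c ds es)) (sym (Bool.xor-assoc (c e) (Σw c ds) (Σw c es)))

  Σw-0 : ∀ c {ds} → All (λ d → c d ≡ false) ds → Σw c ds ≡ false
  Σw-0 c []       = refl
  Σw-0 c (p ∷ ps) = cong₂ _xor_ p (Σw-0 c ps)

  occ : List D → D → Bool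
  occ []       d = false
  occ (e ∷ es) d = eqb e d xor occ es d

  occ-cnt : ∀ ds d → occ ds d xor occ ds (rev d) ≡ cnt ds d
  occ-cnt [] d = refl
  occ-cnt (e ∷ ds) d = trans (xor-swap (eqb e d) (occ ds d) (eqb e (rev d)) (occ ds (rev d)))
      (cong₂ _xor_ (cong (eqb e d xor_) (eqb-rev e d)) (occ-cnt ds d))

  Σ-occ : ∀ c ds → Σw c ds ≡ ΣD (λ d → occ ds d ∧ c d)
  Σ-occ c [] = sym (Σ-zero (λ _ → refl))
  Σ-occ c (e ∷ ds) = sym (trans (Σ-cong (λ d → Bool.∧-distribʳ-xor (c d) (eqb e d) (occ ds d)))
      (trans (Σ-xor (λ d → eqb e d ∧ c d) (λ d → occ ds d ∧ c d)) (cong₂ _xor_ (Σ-delta c e) (sym (Σ-occ c ds)))))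

  -- Both `occ ds` and `S` differ between `d` and `rev d` by `cnt ds d`. Their sum is therefore
  -- invariant under `rev`, and multiplied by the symmetric `c` it cancels in pairs.
  stokes : ∀ {ds} (b : Bounds (cnt ds)) (c : D → Bool) → (∀ d → c (rev d) ≡ c d) →
           Σw c ds ≡ ΣD (λ d → Bounds.S b d ∧ c d)
  stokes {ds} b c cs = trans (Σ-occ c ds) (xor≡false (trans (sym (Σ-xor _ _)) (trans (Σ-cong (λ d → sym (Bool.∧-distribʳ-xor (c d) (occ ds d) (S d))))
        (Σ-pairs _ rev rev-rev rev≢ (λ d → cong₂ _∧_ (inv d) (cs d))))))
    where
    open Bounds b
    inv : ∀ d → occ ds (rev d) xor S (rev d) ≡ occ ds d xor S d
    inv d = lem (occ ds (rev d)) (S (rev d)) (occ ds d) (S d) (trans (occ-cnt ds d) (sym (∂S d)))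
      where
      lem : ∀ a b c e → c xor a ≡ e xor b → a xor b ≡ c xor e
      lem true  true  true  true  _ = refl
      lem true  true  false false _ = refl
      lem true  false true  false _ = refl
      lem true  false false true  _ = refl
      lem false true  true  false _ = refl
      lem false true  false true  _ = refl
      lem false false true  true  _ = refl
      lem false false false false _ = refl

uniq-inj : {A B : Set} {f : A → B} {xs : List A} → Unique (map f xs) → ∀ {x y} → x ∈ˡ xs → y ∈ˡ xs → f x ≡ f y → x ≡ y
uniq-inj (p ∷ ps) (here refl) (here refl) e = refl
uniq-inj {f = f} (p ∷ ps) (here refl) (there j) e = ⊥-elim (All.lookup p (∈-map⁺ f j) e)
uniq-inj {f = f} (p ∷ ps) (there i) (here refl) e = ⊥-elim (All.lookup p (∈-map⁺ f i) (sym e))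
uniq-inj (p ∷ ps) (there i) (there j) e = uniq-inj ps i j e

iter-suc : {A : Set} (f : A → A) (k : ℕ) (x : A) → iter k f (f x) ≡ f (iter k f x)
iter-suc f zero    x = refl
iter-suc f (suc k) x = cong f (iter-suc f k x)

opaque
  ⟦_⟧ : {n : ℕ} {P : Fin n → Set} → (∀ v → Dec (P v)) → VSet n
  ⟦ P? ⟧ v = does (P? v)

  ⟦⟧-i : {n : ℕ} {P : Fin n → Set} (P? : ∀ v → Dec (P v)) {v : Fin n} → P v → v ∈ ⟦ P? ⟧
  ⟦⟧-i P? {v} p = ⟨ dec-true (P? v) p ⟩

  ⟦⟧-e : {n : ℕ} {P : Fin n → Set} (P? : ∀ v → Dec (P v)) {v : Fin n} → v ∈ ⟦ P? ⟧ → P v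
  ⟦⟧-e P? {v} ⟨ p ⟩ = does-e (P? v) p

-- Simple closed walks and the sides of a bounding cycle

module Cycles {n : ℕ} (M : Map n) where
  open Map M

  cnt-∈ : ∀ ds {f} → cnt ds f ≡ true → ∃ λ g → g ∈ˡ ds × (g ≡ f ⊎ rev g ≡ f)
  cnt-∈ (e ∷ ds) {f} p with eqb e f in e₁ | eqb (rev e) f in e₂
  ... | true  | _     = e , here refl , inj₁ (eqb-≡ e₁)
  ... | false | true  = e , here refl , inj₂ (eqb-≡ e₂)
  ... | false | false with cnt-∈ ds p
  ...   | g , g∈ , h = g , there g∈ , h

  tails-heads : ∀ {u v ds} → DWalk u v ds → map tail ds ++ v ∷ [] ≡ u ∷ map head ds
  tails-heads [] = refl
  tails-heads (refl ∷ w) = cong (_ ∷_) (tails-heads w)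

  heads-unique : ∀ {u ds} → DWalk u u ds → Unique (map tail ds) → Unique (map head ds)
  heads-unique [] un = []
  heads-unique {u} {d ∷ ds} (refl ∷ w) (p ∷ un) = subst Unique (tails-heads w)
      (AllPairs.++⁺ un ([] ∷ []) (All.map (λ q → (λ e → q (sym e)) ∷ []) p))

  -- By simplicity no edge of the walk is met while rotating from one of its darts to the next.
  module _ {u : Fin n} {ds : List D} (w : DWalk u u ds) (un : Unique (map tail ds))
           (X : D → Bool) (X-ρ : ∀ d → X (ρ d) ≡ X d xor cnt ds d) where

    turn : ∀ {e e'} → e ∈ˡ ds → e' ∈ˡ ds → head e ≡ tail e' → X (ρ (rev e)) ≡ X e'
    turn {e} {e'} e∈ e'∈ he = go (proj₁ orbit) (ρ (rev e)) refl (trans (tail-ρ (rev e)) he) (proj₂ orbit)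
      where
      orbit = cyclic (ρ (rev e)) e' (trans (tail-ρ (rev e)) he)
      only : ∀ {f} → tail f ≡ tail e' → f ≢ e' → f ≢ rev e → cnt ds f ≡ false
      only {f} tf n₁ n₂ = ¬t→f λ p → case cnt-∈ ds p of λ where
        (g , g∈ , inj₁ refl) → n₁ (uniq-inj un g∈ e'∈ tf)
        (g , g∈ , inj₂ refl) → n₂ (cong rev (uniq-inj (heads-unique w un) g∈ e∈ (trans tf (sym he))))
      go : ∀ k f → X (ρ (rev e)) ≡ X f → tail f ≡ tail e' → iter k ρ f ≡ e' → X (ρ (rev e)) ≡ X e'
      go zero    f xf tf refl = xf
      go (suc k) f xf tf it with f ≟D e' | f ≟D rev e
      ... | yes refl | _        = xf
      ... | no _     | yes refl = go k (ρ f) refl (trans (tail-ρ f) tf) (trans (iter-suc ρ k f) it)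
      ... | no n₁    | no n₂    = go k (ρ f) (trans xf (sym (trans (X-ρ f) (trans (cong (X f xor_) (only tf n₁ n₂)) (Bool.xor-identityʳ (X f))))))
                                     (trans (tail-ρ f) tf) (trans (iter-suc ρ k f) it)

module Sides {n : ℕ} (M : Map n) where
  open Map M
  open Cycles M

  infix 4 _~_
  _~_ : Fin n → Fin n → Set
  u ~ v = ∃ λ d → tail d ≡ u × head d ≡ v

  ~sym : ∀ {u v} → u ~ v → v ~ u
  ~sym (d , p , q) = rev d , q , trans (head-rev d) p

  _~?_ : ∀ u v → Dec (u ~ v)
  u ~? v = any-D (λ d → (tail d Fin.≟ u) ×-dec (head d Fin.≟ v))

  open Paths _~_ ~sym _~?_

  Inside : VSet n → D → Set
  Inside X d = tail d ∈ X × head d ∈ X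

  toDarts : ∀ {X u v m} → W X u v m → ∃ λ ds → DWalk u v ds × All (Inside X) ds
  toDarts (nil p) = [] , [] , []
  toDarts (cons p (d , refl , refl) w) with toDarts w
  ... | ds , dw , a = d ∷ ds , refl ∷ dw , (p , wfst w) ∷ a

  module _ {C : D → Bool} (b : Bounds C) where
    open Bounds b

    S-rev : ∀ d → S (rev d) ≡ S d xor C d
    S-rev d = trans (sym (trans (sym (Bool.xor-assoc (S d) (S d) (S (rev d)))) (cong (_xor S (rev d)) (Bool.xor-same (S d)))))
                    (cong (S d xor_) (∂S d))

    -- Turning from `d` to `ρ d` around a vertex passes the edge of `d`, so the side changes exactly
    -- when that edge belongs to `C`.
    S-ρ : ∀ d → S (ρ d) ≡ S d xor C d
    S-ρ d = trans (cong S (cong ρ (sym (rev-rev d)))) (trans (S-φ (rev d)) (S-rev d))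

    module _ {X : VSet n} (off : ∀ d → tail d ∈ X → C d ≡ false) where
      private
        step0 : ∀ d → tail d ∈ X → S (ρ d) ≡ S d
        step0 d t = trans (S-ρ d) (trans (cong (S d xor_) (off d t)) (Bool.xor-identityʳ (S d)))

      vertex-const : ∀ d d' → tail d ∈ X → tail d ≡ tail d' → S d ≡ S d'
      vertex-const d d' t e = go (proj₁ orbit) d t (proj₂ orbit)
        where
        orbit = cyclic d d' e
        go : ∀ k d → tail d ∈ X → iter k ρ d ≡ d' → S d ≡ S d'
        go zero    d t refl = refl
        go (suc k) d t it = trans (sym (step0 d t)) (go k (ρ d) (subst (_∈ X) (sym (tail-ρ d)) t) (trans (iter-suc ρ k d) it))

      conn-const : ∀ {u v m} → W X u v m → ∀ d d' → tail d ≡ u → tail d' ≡ v → S d ≡ S d'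
      conn-const (nil p) d d' refl e' = vertex-const d d' p (sym e')
      conn-const (cons p (f , tf , hf) w) d d' refl e' =
        trans (vertex-const d f p (sym tf)) (trans (sym (trans (S-rev f) (trans (cong (S f xor_) (off f (subst (_∈ X) (sym tf) p))) (Bool.xor-identityʳ (S f)))))
          (conn-const w (rev f) d' hf e'))

      opaque
        -- Away from `C` the side is constant on a connected set, and a set of faces has the same
        -- boundary as its complement; one of the two vanishes on `X`.
        normalise : Conn X → ∃ λ (b' : Bounds C) → ∀ d → tail d ∈ X → Bounds.S b' d ≡ false
        normalise cX with any-D (λ d → mem? (tail d) X)
        ... | no none = b , λ d t → ⊥-elim (none (d , t))
        ... | yes (d₀ , t₀) with S d₀ in eq
        ...   | false = b , λ d t → trans (conn-const (proj₂ (cX _ _ t t₀)) d d₀ refl refl) eq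
        ...   | true  = Bounds-not b , λ d t → cong not (trans (conn-const (proj₂ (cX _ _ t t₀)) d d₀ refl refl) eq)

  Avoids : VSet n → D → Set
  Avoids X d = tail d ∉ X × head d ∉ X

  edge-off : ∀ {X e d} → Avoids X e → tail d ∈ X → edge e d ≡ false
  edge-off {X} {e} {d} (t , h) td = cong₂ _xor_ (eqb-≢ λ p → ∈∉ (subst (λ z → tail z ∈ X) (sym p) td) t)
                                                (eqb-≢ λ p → ∈∉ (subst (λ z → tail z ∈ X) (sym p) td) h)

  cnt-off : ∀ {X ds} → All (Avoids X) ds → ∀ d → tail d ∈ X → cnt ds d ≡ false
  cnt-off [] d t = refl
  cnt-off (a ∷ as) d t = cong₂ _xor_ (edge-off a t) (cnt-off as d t)

  inside-avoid : ∀ {X Y} → Disj X Y → ∀ {ds} → All (Inside X) ds → All (Avoids Y) ds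
  inside-avoid dis = All.map (λ { (t , h) → dis t , dis h })

-- Separation in spherical triangulated maps

module Planar {n : ℕ} (M : Map n) (tri : ∀ d → Map.φ M (Map.φ M (Map.φ M d)) ≡ d) (sph : Map.Spherical M) where
  open Map M
  open Cycles M
  open Sides M
  open Paths _~_ ~sym _~?_

  apex : D → Fin n
  apex d = tail (φ (φ d))

  head-φ : ∀ d → head (φ d) ≡ apex d
  head-φ d = sym (tail-φ (φ d))

  head-φφ : ∀ d → head (φ (φ d)) ≡ tail d
  head-φφ d = trans (sym (tail-φ (φ (φ d)))) (cong tail (tri d))

  apex-φ : ∀ d → apex (φ d) ≡ tail d
  apex-φ d = cong tail (tri d)

  apex-φφ : ∀ d → apex (φ (φ d)) ≡ head d
  apex-φφ d = trans (cong (λ z → tail (φ z)) (tri d)) (tail-φ d)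

  opaque
    cross : VSet n → VSet n → D → Bool
    cross K X d = (K (tail d) ∧ X (head d)) xor (X (tail d) ∧ K (head d))

    cross-rev : ∀ K X d → cross K X (rev d) ≡ cross K X d
    cross-rev K X d rewrite rev-rev d = trans (cong₂ _xor_ (Bool.∧-comm (K (head d)) (X (tail d))) (Bool.∧-comm (X (head d)) (K (tail d))))
      (Bool.xor-comm (X (tail d) ∧ K (head d)) (K (tail d) ∧ X (head d)))

    cross-0ˡ : ∀ {K X d} → tail d ∉ K → head d ∉ K → cross K X d ≡ false
    cross-0ˡ {K} {X} {d} ⟨ p ⟩ ⟨ q ⟩ rewrite p | q = Bool.∧-zeroʳ (X (tail d))

    cross-0ʳ : ∀ {K X d} → tail d ∉ X → head d ∉ X → cross K X d ≡ false
    cross-0ʳ {K} {X} {d} ⟨ p ⟩ ⟨ q ⟩ rewrite p | q = cong (_xor false) (Bool.∧-zeroʳ (K (tail d)))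

    cross-1 : ∀ {K X d} → Disj K X → tail d ∈ K → head d ∈ X → cross K X d ≡ true
    cross-1 {K} {X} {d} dis t h = lem {e = K (head d)} (un t) (un h) (un∉ (dis t))
      where
      lem : ∀ {a b c e} → a ≡ true → b ≡ true → c ≡ false → (a ∧ b) xor (c ∧ e) ≡ true
      lem refl refl refl = refl

    cross-1' : ∀ {K X d} → Disj K X → tail d ∈ X → head d ∈ K → cross K X d ≡ true
    cross-1' {K} {X} {d} dis t h = lem {e = K (tail d)} (un t) (un h) (un∉ (dis h))
      where
      lem : ∀ {a b c e} → a ≡ true → b ≡ true → c ≡ false → (e ∧ c) xor (a ∧ b) ≡ true
      lem {e = e} refl refl refl = cong (_xor true) (Bool.∧-zeroʳ e)
  
    cross-val : ∀ {K X d a b a' b'} → K (tail d) ≡ a → X (head d) ≡ b → X (tail d) ≡ a' → K (head d) ≡ b' →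
                cross K X d ≡ (a ∧ b) xor (a' ∧ b')
    cross-val refl refl refl refl = refl

  private
    data Label : Set where
      κ χ ω : Label
    ink inx : Label → Bool
    ink κ = true
    ink _ = false
    inx χ = true
    inx _ = false
    kx : Label → Label → Bool
    kx a b = (ink a ∧ inx b) xor (inx a ∧ ink b)

    mixed : Label → Label → Label → Bool
    mixed κ χ ω = true
    mixed κ ω χ = true
    mixed χ κ ω = true
    mixed χ ω κ = true
    mixed ω κ χ = true
    mixed ω χ κ = true
    mixed _ _ _ = false

    mixed-kx : ∀ a b e → kx a b xor (kx b e xor kx e a) ≡ mixed a b e
    mixed-kx κ κ κ = refl
    mixed-kx κ κ χ = refl
    mixed-kx κ κ ω = refl
    mixed-kx κ χ κ = refl
    mixed-kx κ χ χ = refl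
    mixed-kx κ χ ω = refl
    mixed-kx κ ω κ = refl
    mixed-kx κ ω χ = refl
    mixed-kx κ ω ω = refl
    mixed-kx χ κ κ = refl
    mixed-kx χ κ χ = refl
    mixed-kx χ κ ω = refl
    mixed-kx χ χ κ = refl
    mixed-kx χ χ χ = refl
    mixed-kx χ χ ω = refl
    mixed-kx χ ω κ = refl
    mixed-kx χ ω χ = refl
    mixed-kx χ ω ω = refl
    mixed-kx ω κ κ = refl
    mixed-kx ω κ χ = refl
    mixed-kx ω κ ω = refl
    mixed-kx ω χ κ = refl
    mixed-kx ω χ χ = refl
    mixed-kx ω χ ω = refl
    mixed-kx ω ω κ = refl
    mixed-kx ω ω χ = refl
    mixed-kx ω ω ω = refl

  -- A face contributes an even number of K–X edges unless it has one vertex in K, one in X and the third in neither.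
  even : ∀ {K X ds} (b : Bounds (cnt ds)) → Disj K X →
         (∀ d → Bounds.S b d ≡ true → tail d ∈ K → head d ∈ X → apex d ∉ K → apex d ∉ X → ⊥) →
         (∀ d → Bounds.S b d ≡ true → tail d ∈ X → head d ∈ K → apex d ∉ K → apex d ∉ X → ⊥) →
         Σw (cross K X) ds ≡ false
  -- By `stokes` the number of crossings is a sum over the darts of `S`. Modulo two it equals three
  -- times itself, and shifting two of the copies along `φ` turns it into a sum over whole
  -- triangles.
  even {K} {X} {ds} b dis h₁ h₂ = trans (stokes {ds} b c (cross-rev K X)) (trans (sym (Bool.xor-identityʳ _))
      (trans (cong (ΣD Sc xor_) (sym (Bool.xor-same (ΣD Sc)))) (trans (cong₂ (λ p q → ΣD Sc xor (p xor q)) (sym (shift 1)) (sym (shift 2)))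
      (trans (cong (ΣD Sc xor_) (sym (Σ-xor _ _))) (trans (sym (Σ-xor _ _)) (Σ-zero zero'))))))
    where
    open Bounds b
    c = cross K X
    Sc : D → Bool
    Sc d = S d ∧ c d
    φ^ : ℕ → D → D
    φ^ 0 d = d
    φ^ (suc i) d = φ^ i (φ d)
    shift : ∀ i → ΣD (λ d → Sc (φ^ i d)) ≡ ΣD Sc
    shift zero = refl
    shift (suc i) = trans (Σ-bij (λ d → Sc (φ^ i d)) φ φ⁻¹ φφ⁻¹ φ⁻¹φ) (shift i)
    data Lab (v : Fin n) : Label → Set where
      lk : v ∈ K → Lab v κ
      lx : v ∈ X → Lab v χ
      lo : v ∉ K → v ∉ X → Lab v ω
    lab : ∀ v → ∃ (Lab v)
    lab v with in? v K | in? v X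
    ... | inj₁ p | _      = κ , lk p
    ... | inj₂ _ | inj₁ q = χ , lx q
    ... | inj₂ p | inj₂ q = ω , lo p q
    lab-k : ∀ {v l} → Lab v l → K v ≡ ink l
    lab-k (lk p)   = un p
    lab-k (lx p)   = un∉ (disj-sym dis p)
    lab-k (lo p _) = un∉ p
    lab-x : ∀ {v l} → Lab v l → X v ≡ inx l
    lab-x (lk p)   = un∉ (dis p)
    lab-x (lx p)   = un p
    lab-x (lo _ q) = un∉ q
    val : ∀ {d u v l l'} → tail d ≡ u → head d ≡ v → Lab u l → Lab v l' → c d ≡ kx l l'
    val {d} refl refl a a' = cross-val {K} {X} {d} (lab-k a) (lab-x a') (lab-x a) (lab-k a')
    sφ : ∀ {d} → S d ≡ true → S (φ d) ≡ true
    sφ {d} p = trans (S-φ d) p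
    unmixed : ∀ d {p q r} → S d ≡ true → Lab (tail d) p → Lab (head d) q → Lab (apex d) r → mixed p q r ≡ false
    unmixed d s (lk a) (lx b) (lo e e') = ⊥-elim (h₁ d s a b e e')
    unmixed d s (lx a) (lk b) (lo e e') = ⊥-elim (h₂ d s a b e e')
    unmixed d s (lo a a') (lk b) (lx e) = ⊥-elim (h₁ (φ d) (sφ s) (subst (_∈ K) (sym (tail-φ d)) b) (subst (_∈ X) (sym (head-φ d)) e)
                                            (subst (_∉ K) (sym (apex-φ d)) a) (subst (_∉ X) (sym (apex-φ d)) a'))
    unmixed d s (lo a a') (lx b) (lk e) = ⊥-elim (h₂ (φ d) (sφ s) (subst (_∈ X) (sym (tail-φ d)) b) (subst (_∈ K) (sym (head-φ d)) e)
                                            (subst (_∉ K) (sym (apex-φ d)) a) (subst (_∉ X) (sym (apex-φ d)) a'))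
    unmixed d s (lx a) (lo b b') (lk e) = ⊥-elim (h₁ (φ (φ d)) (sφ (sφ s)) e (subst (_∈ X) (sym (head-φφ d)) a)
                                            (subst (_∉ K) (sym (apex-φφ d)) b) (subst (_∉ X) (sym (apex-φφ d)) b'))
    unmixed d s (lk a) (lo b b') (lx e) = ⊥-elim (h₂ (φ (φ d)) (sφ (sφ s)) e (subst (_∈ K) (sym (head-φφ d)) a)
                                            (subst (_∉ K) (sym (apex-φφ d)) b) (subst (_∉ X) (sym (apex-φφ d)) b'))
    unmixed d s (lk _) (lk _) (lk _) = refl
    unmixed d s (lk _) (lk _) (lx _) = refl
    unmixed d s (lk _) (lk _) (lo _ _) = refl
    unmixed d s (lk _) (lx _) (lk _) = refl
    unmixed d s (lk _) (lx _) (lx _) = refl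
    unmixed d s (lk _) (lo _ _) (lk _) = refl
    unmixed d s (lk _) (lo _ _) (lo _ _) = refl
    unmixed d s (lx _) (lk _) (lk _) = refl
    unmixed d s (lx _) (lk _) (lx _) = refl
    unmixed d s (lx _) (lx _) (lk _) = refl
    unmixed d s (lx _) (lx _) (lx _) = refl
    unmixed d s (lx _) (lx _) (lo _ _) = refl
    unmixed d s (lx _) (lo _ _) (lx _) = refl
    unmixed d s (lx _) (lo _ _) (lo _ _) = refl
    unmixed d s (lo _ _) (lk _) (lk _) = refl
    unmixed d s (lo _ _) (lk _) (lo _ _) = refl
    unmixed d s (lo _ _) (lx _) (lx _) = refl
    unmixed d s (lo _ _) (lx _) (lo _ _) = refl
    unmixed d s (lo _ _) (lo _ _) (lk _) = refl
    unmixed d s (lo _ _) (lo _ _) (lx _) = refl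
    unmixed d s (lo _ _) (lo _ _) (lo _ _) = refl
    zero' : ∀ d → Sc d xor (Sc (φ d) xor Sc (φ (φ d))) ≡ false
    zero' d with S d in sd
    ... | false rewrite S-φ (φ d) | S-φ d | sd = refl
    ... | true rewrite S-φ (φ d) | S-φ d | sd =
          let (p , lp) = lab (tail d) ; (q , lq) = lab (head d) ; (r , lr) = lab (apex d) in
          trans (cong₂ _xor_ (val {d} refl refl lp lq) (cong₂ _xor_ (val {φ d} (tail-φ d) (head-φ d) lq lr) (val {φ (φ d)} refl (head-φφ d) lr lp)))
                (trans (mixed-kx p q r) (unmixed d sd lp lq lr))

  opaque
    closed : ∀ {u ds} → DWalk u u ds → Bounds (cnt ds)
    closed = closed-bounds sph

  module _ {Y : VSet n} (c : D → Bool) (c0 : ∀ d → Inside Y d → c d ≡ false) where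
    Σw-inside : ∀ {ds} → All (Inside Y) ds → Σw c ds ≡ false
    Σw-inside a = Σw-0 c (All.map (λ {d} → c0 d) a)

  -- Two such faces would lie on different sides of a simple cycle through X and Y that avoids Z.
  same-face : ∀ {X Y Z d₁ d₂} → Conn X → Conn Y → Conn Z → Disj X Y → Disj X Z → Disj Y Z →
              tail d₁ ∈ X → head d₁ ∈ Y → apex d₁ ∈ Z → tail d₂ ∈ X → head d₂ ∈ Y → apex d₂ ∈ Z → d₁ ≢ d₂ → ⊥
  same-face {X} {Y} {Z} {d₁} {d₂} cX cY cZ xy xz yz tx₁ hy₁ az₁ tx₂ hy₂ az₂ ne =
      -- The side is constant along the simple cycle, so it agrees at `d₁` and `rev d₂` and hence
      -- differs at `d₁` and `d₂`. But the two apexes lie in the connected set `Z` off the cycle,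
      -- which makes the sides of `d₁` and `d₂` equal.
      not≢ (trans (cong not S₁₂) (trans (sym S-back) (sym (along (∈-++⁺ʳ' (here refl))))))
    where
    simple : ∀ {A u v m} → W A u v m → ∃ λ ds → DWalk u v ds × All (Inside A) ds × Unique (map tail ds) × All (λ d → v ≢ tail d) ds
    simple w with toDarts w
    ... | ds , dw , ins = go dw ins
      where
      go : ∀ {A u v ds} → DWalk u v ds → All (Inside A) ds → ∃ λ ds → DWalk u v ds × All (Inside A) ds × Unique (map tail ds) × All (λ d → v ≢ tail d) ds
      go [] [] = [] , [] , [] , [] , []
      go {A} {u} {v} (_∷_ {d = d} refl w) (i ∷ is) with go w is
      ... | es , dw , ins , un , av with v Fin.≟ tail d | Any.any? (λ e → tail e Fin.≟ tail d) es
      ...   | yes refl | _ = [] , [] , [] , [] , []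
      ...   | no v≢ | no none = d ∷ es , refl ∷ dw , i ∷ ins , All-map⁺ (All.map (λ q e → q (sym e)) (¬Any⇒All¬ es none)) ∷ un , v≢ ∷ av
      ...   | no v≢ | yes some = drop dw ins un av some
        where
        drop : ∀ {u' es} → DWalk u' v es → All (Inside A) es → Unique (map tail es) → All (λ d → v ≢ tail d) es → Any (λ e → tail e ≡ tail d) es →
               ∃ λ ds → DWalk (tail d) v ds × All (Inside A) ds × Unique (map tail ds) × All (λ d → v ≢ tail d) ds
        drop (p ∷ w) (i ∷ is) un (a ∷ as) (here q) = _ , q ∷ w , i ∷ is , un , a ∷ as
        drop (p ∷ w) (i ∷ is) (_ ∷ un) (a ∷ as) (there q) = drop w is un as q
    yp = simple (proj₂ (cY (head d₁) (head d₂) hy₁ hy₂))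
    xp = simple (proj₂ (cX (tail d₂) (tail d₁) tx₂ tx₁))
    ys = proj₁ yp
    xs = proj₁ xp
    yI = proj₁ (proj₂ (proj₂ yp))
    xI = proj₁ (proj₂ (proj₂ xp))
    ds = d₁ ∷ (ys ++ rev d₂ ∷ xs)
    ∈-++⁺ʳ' : ∀ {e} → e ∈ˡ rev d₂ ∷ xs → e ∈ˡ ds
    ∈-++⁺ʳ' p = there (∈-++⁺ʳ ys p)
    d₁∈ : d₁ ∈ˡ ds
    d₁∈ = here refl
    w₁ : DWalk (head d₁) (tail d₁) (ys ++ rev d₂ ∷ xs)
    w : DWalk (tail d₁) (tail d₁) ds
    w = refl ∷ w₁
    w₁ = DW-++ (proj₁ (proj₂ yp)) (refl ∷ subst (λ z → DWalk z (tail d₁) xs) (sym (head-rev d₂)) (proj₁ (proj₂ xp)))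
    b = closed w
    open Bounds b
    X≢Y : ∀ {u v} → u ∈ X → v ∈ Y → u ≢ v
    X≢Y p q refl = ∈∉ q (xy p)
    map-++ : ∀ as bs → map tail (as ++ bs) ≡ map tail as ++ map tail bs
    map-++ [] bs = refl
    map-++ (a ∷ as) bs = cong (tail a ∷_) (map-++ as bs)
    uds : Unique (map tail ds)
    uds = subst (λ z → All (tail d₁ ≢_) z) (sym (map-++ ys (rev d₂ ∷ xs)))
           (All-++⁺ (All-map⁺ (All.map (λ i → X≢Y tx₁ (proj₁ i)) yI)) (X≢Y tx₁ hy₂ ∷ All-map⁺ (proj₂ (proj₂ (proj₂ (proj₂ xp))))))
         ∷ subst Unique (sym (map-++ ys (rev d₂ ∷ xs)))
           (AllPairs.++⁺ (proj₁ (proj₂ (proj₂ (proj₂ yp)))) (All-map⁺ (All.map (λ i e → X≢Y (proj₁ i) hy₂ (sym e)) xI) ∷ proj₁ (proj₂ (proj₂ (proj₂ xp))))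
             (All-map⁺ (All.zipWith (λ { (i , q) → (λ e → q (sym e)) ∷ All-map⁺ (All.map (λ j e → X≢Y (proj₁ j) (proj₁ i) (sym e)) xI) }) (yI , proj₂ (proj₂ (proj₂ (proj₂ yp)))))))
    step : ∀ {e e'} → e ∈ˡ ds → e' ∈ˡ ds → head e ≡ tail e' → S e ≡ S e'
    step {e} p q h = trans (sym (S-φ e)) (turn w uds S (S-ρ b) p q h)
    chain : ∀ {v e es} → DWalk (head e) v es → e ∈ˡ ds → (∀ {e} → e ∈ˡ es → e ∈ˡ ds) → S d₁ ≡ S e → All (λ e → S d₁ ≡ S e) es
    chain [] e∈ sub eq = []
    chain (p ∷ w) e∈ sub eq = let eq' = trans eq (step e∈ (sub (here refl)) (sym p)) in eq' ∷ chain w (sub (here refl)) (λ q → sub (there q)) eq'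
    along : ∀ {e} → e ∈ˡ ds → S d₁ ≡ S e
    along = All.lookup (refl ∷ chain w₁ d₁∈ there refl)
    C₂ : cnt ds d₂ ≡ true
    C₂ = trans (cong₂ _xor_ e₁ (trans (cnt-++ ys (rev d₂ ∷ xs) d₂) (cong₂ _xor_ (cnt-off {X} (inside-avoid (disj-sym xy) yI) d₂ tx₂)
           (cong₂ _xor_ e₂ (trans (sym (cnt-rev xs d₂)) (cnt-off {Y} (inside-avoid xy xI) (rev d₂) hy₂)))))) refl
      where
      e₁ : edge d₁ d₂ ≡ false
      e₁ = cong₂ _xor_ (eqb-≢ ne) (eqb-≢ λ p → X≢Y tx₂ hy₁ (cong tail (sym p)))
      e₂ : edge (rev d₂) d₂ ≡ true
      e₂ = cong₂ _xor_ (eqb-≢ (rev≢ d₂)) (trans (cong (λ z → eqb z d₂) (rev-rev d₂)) (eqb-refl d₂))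
    S-back : S (rev d₂) ≡ not (S d₂)
    S-back = trans (S-rev b d₂) (trans (cong (S d₂ xor_) C₂) (Bool.xor-comm (S d₂) true))
    offZ : ∀ d → tail d ∈ Z → cnt ds d ≡ false
    offZ = cnt-off ((xz tx₁ , yz hy₁) ∷ All-++⁺ (inside-avoid yz yI) ((yz hy₂ , subst (_∉ Z) (sym (head-rev d₂)) (xz tx₂)) ∷ inside-avoid xz xI))
    S₁₂ : S d₁ ≡ S d₂
    S₁₂ = trans (sym (trans (S-φ (φ d₁)) (S-φ d₁))) (trans (conn-const b offZ (proj₂ (cZ _ _ az₁ az₂)) (φ (φ d₁)) (φ (φ d₂)) refl refl) (trans (S-φ (φ d₂)) (S-φ d₂)))
    not≢ : ∀ {s} → not s ≢ s
    not≢ {true} ()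
    not≢ {false} ()

  Crossing : VSet n → VSet n → Set
  Crossing X Y = ∃ λ d → tail d ∈ X × head d ∈ Y

  crossing : ∀ {X Y} → Adj X Y → Crossing X Y
  crossing (_ , _ , p , q , d , refl , refl) = d , p , q

  -- One edge is used for each passage between two of the sets, so a cochain that vanishes inside
  -- all three is evaluated by three terms.
  record Loop (L A B : VSet n) : Set where
    field
      {u}   : Fin n
      ds    : List D
      w     : DWalk u u ds
      la    : Crossing L A
      ab    : Crossing A B
      bl    : Crossing B L
      total : ∀ (c : D → Bool) → (∀ d → Inside L d → c d ≡ false) → (∀ d → Inside A d → c d ≡ false) →
              (∀ d → Inside B d → c d ≡ false) → Σw c ds ≡ c (proj₁ la) xor (c (proj₁ ab) xor c (proj₁ bl))
      avoid : ∀ {P} → Disj L P → Disj A P → Disj B P → All (Avoids P) ds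

  opaque
    loop : ∀ {L A B} → Conn L → Conn A → Conn B → Adj L A → Adj L B → Adj A B → Loop L A B
    loop {L} {A} {B} cL cA cB la' lb' ab' = make (crossing la') (crossing ab') (crossing (adj-sym lb'))
      where
      make : Crossing L A → Crossing A B → Crossing B L → Loop L A B
      make (d₁ , t₁ , h₁) (d₂ , t₂ , h₂) (d₃ , t₃ , h₃) =
          build (toDarts (proj₂ (cA _ _ h₁ t₂))) (toDarts (proj₂ (cB _ _ h₂ t₃))) (toDarts (proj₂ (cL _ _ h₃ t₁)))
        where
        build : (∃ λ ds → DWalk (head d₁) (tail d₂) ds × All (Inside A) ds) → (∃ λ ds → DWalk (head d₂) (tail d₃) ds × All (Inside B) ds) →
                (∃ λ ds → DWalk (head d₃) (tail d₁) ds × All (Inside L) ds) → Loop L A B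
        build (as , wa , ia) (bs , wb , ib) (ls , wl , il) = record
          { ds = d₁ ∷ (as ++ d₂ ∷ (bs ++ d₃ ∷ ls)) ; w = refl ∷ DW-++ wa (refl ∷ DW-++ wb (refl ∷ wl))
          ; la = d₁ , t₁ , h₁ ; ab = d₂ , t₂ , h₂ ; bl = d₃ , t₃ , h₃
          ; total = λ c cl ca cb → cong (c d₁ xor_) (trans (Σw-++ c as _) (cong₂ _xor_ (Σw-inside c ca ia)
              (cong (c d₂ xor_) (trans (Σw-++ c bs _) (cong₂ _xor_ (Σw-inside c cb ib)
                (trans (cong (c d₃ xor_) (Σw-inside c cl il)) (Bool.xor-identityʳ (c d₃))))))))
          ; avoid = λ lp ap bp → (lp t₁ , ap h₁) ∷ All-++⁺ (inside-avoid ap ia) ((ap t₂ , bp h₂) ∷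
              All-++⁺ (inside-avoid bp ib) ((bp t₃ , lp h₃) ∷ inside-avoid lp il)) }

  module TwoApex (K A B : VSet n) (cK : Conn K) (cA : Conn A) (cB : Conn B) (kA : Disj K A) (kB : Disj K B) (aB : Disj A B)
         (nbr : ∀ {u v} → u ∈ K → u ~ v → v ∈ K ⊎ v ∈ A ⊎ v ∈ B) (ka : Adj K A) (kb : Adj K B) (ab : Adj A B) where

    -- Triangles over an edge between `A` and `B` with apex in `K`, distinguished by orientation
    -- because `same-face` leaves at most one of each kind.
    Pos Neg : D → Set
    Pos d = tail d ∈ A × head d ∈ B × apex d ∈ K
    Neg d = tail d ∈ B × head d ∈ A × apex d ∈ K

    pos? : Dec (∃ Pos)
    pos? = any-D (λ d → mem? (tail d) A ×-dec mem? (head d) B ×-dec mem? (apex d) K)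

    neg? : Dec (∃ Neg)
    neg? = any-D (λ d → mem? (tail d) B ×-dec mem? (head d) A ×-dec mem? (apex d) K)

    third : ∀ {k z} → k ∈ K → k ~ z → z ∉ K → z ∉ A → z ∈ B
    third k∈ e z∉K z∉A = [ (λ p → ⊥-elim (∈∉ p z∉K)) , [ (λ p → ⊥-elim (∈∉ p z∉A)) , id ]′ ]′ (nbr k∈ e)

    -- A loop through `K`, `A` and `B` has exactly one edge between `K` and `A`, whereas without a
    -- triangle meeting all three sets `even` makes their number even.
    someFace : ¬ ∃ Pos → ¬ ∃ Neg → ⊥
    someFace np nn = t≢f (trans (total (cross K A) (λ d i → cross-0ʳ {K} {A} (kA (proj₁ i)) (kA (proj₂ i)))
          (λ d i → cross-0ˡ {K} {A} (disj-sym kA (proj₁ i)) (disj-sym kA (proj₂ i))) (λ d i → cross-0ˡ {K} {A} (disj-sym kB (proj₁ i)) (disj-sym kB (proj₂ i))))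
        (cong₂ _xor_ (cross-1 {K} {A} kA t₁ h₁) (cong₂ _xor_ (cross-0ˡ {K} {A} (disj-sym kA t₂) (disj-sym kB h₂)) (cross-0ʳ {K} {A} (disj-sym aB t₃) (kA h₃)))))
        (even {K} {A} {ds} (closed w) kA
          (λ d _ t h z∉K z∉A → np (φ d , subst (_∈ A) (sym (tail-φ d)) h , subst (_∈ B) (sym (head-φ d)) (third t (rev (φ (φ d)) , head-φφ d , head-rev (φ (φ d))) z∉K z∉A) , subst (_∈ K) (sym (apex-φ d)) t))
          (λ d _ t h z∉K z∉A → nn (φ (φ d) , third h (φ d , tail-φ d , head-φ d) z∉K z∉A , subst (_∈ A) (sym (head-φφ d)) t , subst (_∈ K) (sym (apex-φφ d)) h)))
      where
      open Loop (loop cK cA cB ka kb ab) using (ds; w; total; la; bl) renaming (ab to ab′)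
      t₁ = proj₁ (proj₂ la)
      h₁ = proj₂ (proj₂ la)
      t₂ = proj₁ (proj₂ ab′)
      h₂ = proj₂ (proj₂ ab′)
      t₃ = proj₁ (proj₂ bl)
      h₃ = proj₂ (proj₂ bl)

    -- Otherwise a loop runs through `L`, `A` and `B`, and its faces `S` can be taken to avoid `P`.
    -- Let `Λ` be the vertices outside `A`, `B` and `L` that meet `S`. The loop has one edge between
    -- `B ∪ Λ` and `A`, so by `even` some triangle of `S` has such an edge and its third vertex
    -- outside both sets, necessarily in `L`. The end in `B ∪ Λ` is not in `B`, as triangles over an
    -- edge between `A` and `B` with apex in `K` have it in `P`; nor is it in `Λ`, as a neighbour of
    -- `L` lies in `L`, `A`, `B` or in `P`, which `S` avoids.
    blocks : ∀ P L → P ⊆ K → Conn P → (∀ {d} → Pos d → apex d ∈ P) → (∀ {d} → Neg d → apex d ∈ P) →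
             IsComp (K ∖ P) L → Adj L A → Adj L B → ⊥
    blocks P L P⊆K cP posP negP il la lb = t≢f
        (trans (total (cross BΛ A) (λ d i → cross-0ʳ {BΛ} {A} (kA (L⊆K (proj₁ i))) (kA (L⊆K (proj₂ i))))
              (λ d i → cross-0ˡ {BΛ} {A} (A∉ (proj₁ i)) (A∉ (proj₂ i))) (λ d i → cross-0ʳ {BΛ} {A} (disj-sym aB (proj₁ i)) (disj-sym aB (proj₂ i))))
          (cong₂ _xor_ (cross-0ˡ {BΛ} {A} (L∉ t₁) (A∉ h₁)) (cong₂ _xor_ (cross-1' {BΛ} {A} BΛA t₂ (∪-l h₂)) (cross-0ʳ {BΛ} {A} (disj-sym aB t₃) (kA (L⊆K h₃))))))
        (even {BΛ} {A} {ds} b BΛA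
          (λ d s t h z∉ z∉A → core t z∉ z∉A (φ (φ d)) refl (trans (S-φ (φ d)) (trans (S-φ d) s)) (φ (φ d) , refl , head-φφ d)
              (λ tB zK → negP (tB , h , zK)))
          (λ d s t h z∉ z∉A → core h z∉ z∉A (φ (φ d)) refl (trans (S-φ (φ d)) (trans (S-φ d) s)) (rev (φ d) , head-φ d , trans (head-rev (φ d)) (tail-φ d))
              (λ hB zK → posP (t , hB , zK))))
      where
      open Loop (loop (IsComp.conn il) cA cB la lb ab) using (ds; w; total; avoid; bl) renaming (ab to ab′; la to la′)
      t₁ = proj₁ (proj₂ la′)
      h₁ = proj₂ (proj₂ la′)
      t₂ = proj₁ (proj₂ ab′)
      h₂ = proj₂ (proj₂ ab′)
      t₃ = proj₁ (proj₂ bl)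
      h₃ = proj₂ (proj₂ bl)
      L⊆K : L ⊆ K
      L⊆K p = ∖-l (IsComp.sub il p)
      L#P : Disj L P
      L#P p = ∖-r (IsComp.sub il p)
      off : ∀ d → tail d ∈ P → cnt ds d ≡ false
      off = cnt-off (avoid L#P (λ p → ¬∈→∉ λ q → ∈∉ p (kA (P⊆K q))) (λ p → ¬∈→∉ λ q → ∈∉ p (kB (P⊆K q))))
      nb = normalise (closed w) off cP
      b = proj₁ nb
      open Bounds b
      lit? : ∀ v → Dec (v ∉ A × v ∉ B × v ∉ L × ∃ λ d → tail d ≡ v × S d ≡ true)
      lit? v = map′ ⟨_⟩ un∉ (A v Bool.≟ false) ×-dec map′ ⟨_⟩ un∉ (B v Bool.≟ false) ×-dec map′ ⟨_⟩ un∉ (L v Bool.≟ false)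
               ×-dec any-D (λ d → (tail d Fin.≟ v) ×-dec (S d Bool.≟ true))
      Λ : VSet n
      Λ = ⟦ lit? ⟧
      Λ-e : ∀ {v} → v ∈ Λ → v ∉ A × v ∉ B × v ∉ L × ∃ λ d → tail d ≡ v × S d ≡ true
      Λ-e = ⟦⟧-e lit?
      BΛ = B ∪ Λ
      BΛA : Disj BΛ A
      BΛA p = [ disj-sym aB , (λ q → proj₁ (Λ-e q)) ]′ (∪-e p)
      A∉ : ∀ {v} → v ∈ A → v ∉ BΛ
      A∉ = disj-sym BΛA
      L∉ : ∀ {v} → v ∈ L → v ∉ BΛ
      L∉ p = ∪-∉ (kB (L⊆K p)) (¬∈→∉ λ q → ∈∉ p (proj₁ (proj₂ (proj₂ (Λ-e q)))))
      core : ∀ {v z} → v ∈ BΛ → z ∉ BΛ → z ∉ A → ∀ e → tail e ≡ z → S e ≡ true → z ~ v → (v ∈ B → z ∈ K → z ∈ P) → ⊥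
      core {v} {z} v∈ z∉ z∉A e te se zv noface = [ inL , outL ]′ (in? z L)
        where
        outL : z ∉ L → ⊥
        outL z∉L = ∈∉ (⟦⟧-i lit? (z∉A , ∪-∉l z∉ , z∉L , e , te , se)) (∪-∉r z∉)
        inL : z ∈ L → ⊥
        inL z∈L = [ (λ vB → ∈∉ (noface vB (L⊆K z∈L)) (L#P z∈L)) , (λ vΛ → inΛ (Λ-e vΛ)) ]′ (∪-e v∈)
          where
          inΛ : v ∉ A × v ∉ B × v ∉ L × (∃ λ d → tail d ≡ v × S d ≡ true) → ⊥
          inΛ (v∉A , v∉B , v∉L , d' , td' , sd') = [ inK , [ (λ a → ∈∉ a v∉A) , (λ b → ∈∉ b v∉B) ]′ ]′ (nbr (L⊆K z∈L) zv)
            where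
            inK : v ∈ K → ⊥
            inK vK = [ (λ vP → t≢f sd' (proj₂ nb d' (subst (_∈ P) (sym td') vP))) , (λ v∉P → ∈∉ (IsComp.closed il z∈L (∖-i vK v∉P) zv) v∉L) ]′ (in? v P)

    Result : Set
    Result = ∃ λ x → ∃ λ y → x ∈ K × y ∈ K
        × (∃ λ a → a ∈ A × x ~ a) × (∃ λ b → b ∈ B × x ~ b)
        × (∃ λ a → a ∈ A × y ~ a) × (∃ λ b → b ∈ B × y ~ b)
        × (∀ P L → P ⊆ K → x ∈ P → y ∈ P → Conn P → IsComp (K ∖ P) L → Adj L A → Adj L B → ⊥)

    result : Result
    result = body pos? neg?
      where
      posA : ∀ {d} → Pos d → ∃ λ a → a ∈ A × apex d ~ a
      posA {d} (t , h , z) = tail d , t , φ (φ d) , refl , head-φφ d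
      posB : ∀ {d} → Pos d → ∃ λ a → a ∈ B × apex d ~ a
      posB {d} (t , h , z) = head d , h , rev (φ d) , head-φ d , trans (head-rev (φ d)) (tail-φ d)
      negA : ∀ {d} → Neg d → ∃ λ a → a ∈ A × apex d ~ a
      negA {d} (t , h , z) = head d , h , rev (φ d) , head-φ d , trans (head-rev (φ d)) (tail-φ d)
      negB : ∀ {d} → Neg d → ∃ λ a → a ∈ B × apex d ~ a
      negB {d} (t , h , z) = tail d , t , φ (φ d) , refl , head-φφ d
      uniqP : ∀ {d e} → Pos d → Pos e → apex d ≡ apex e
      uniqP {d} {e} (t , h , z) (t' , h' , z') with d ≟D e
      ... | yes refl = refl
      ... | no ne = ⊥-elim (same-face cA cB cK aB (disj-sym kA) (disj-sym kB) t h z t' h' z' ne)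
      uniqN : ∀ {d e} → Neg d → Neg e → apex d ≡ apex e
      uniqN {d} {e} (t , h , z) (t' , h' , z') with d ≟D e
      ... | yes refl = refl
      ... | no ne = ⊥-elim (same-face cB cA cK (disj-sym aB) (disj-sym kB) (disj-sym kA) t h z t' h' z' ne)
      body : Dec (∃ Pos) → Dec (∃ Neg) → Result
      body (no np) (no nn) = ⊥-elim (someFace np nn)
      body (yes (d , p)) (no nn) = apex d , apex d , proj₂ (proj₂ p) , proj₂ (proj₂ p) , posA p , posB p , posA p , posB p ,
        λ P L s x∈ y∈ cP → blocks P L s cP (λ q → subst (_∈ P) (uniqP p q) x∈) (λ q → ⊥-elim (nn (_ , q)))
      body (no np) (yes (d , p)) = apex d , apex d , proj₂ (proj₂ p) , proj₂ (proj₂ p) , negA p , negB p , negA p , negB p ,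
        λ P L s x∈ y∈ cP → blocks P L s cP (λ q → ⊥-elim (np (_ , q))) (λ q → subst (_∈ P) (uniqN p q) x∈)
      body (yes (d , p)) (yes (e , p')) = apex d , apex e , proj₂ (proj₂ p) , proj₂ (proj₂ p') , posA p , posB p , negA p' , negB p' ,
        λ P L s x∈ y∈ cP → blocks P L s cP (λ q → subst (_∈ P) (uniqP p q) x∈) (λ q → subst (_∈ P) (uniqN p' q) y∈)

  -- The closed walk misses `y`, so its faces can be chosen to avoid `y`. All remaining triangles
  -- satisfy the condition of `even`, against the single edge between `X` and `K`.
  evenCut′ : ∀ K X Z y p v k₁ k₂ → Disj K X → Disj K Z → y ∉ Z → y ∉ K → p ∈ X → v ∉ X →
        p ~ k₁ → (∃ λ m → W K k₁ k₂ m) → k₂ ~ v → (∃ λ m → W Z v p m) →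
        (∀ {z k x} → k ∈ K → x ∈ X → z ~ k → z ~ x → z ∈ K ⊎ z ∈ X ⊎ z ≡ y) → ⊥
  evenCut′ K X Z y p v k₁ k₂ kx kz y∉Z y∉K p∈X v∉X (d₁ , refl , refl) (_ , wK) (d₂ , refl , refl) (_ , wZ) apexes =
      go (toDarts wK) (toDarts wZ)
    where
    p∈Z = wlst wZ
    v∈Z = wfst wZ
    k₁∈ = wfst wK
    k₂∈ = wlst wK
    go : (∃ λ ds → DWalk (head d₁) (tail d₂) ds × All (Inside K) ds) → (∃ λ ds → DWalk (head d₂) (tail d₁) ds × All (Inside Z) ds) → ⊥
    go (ks , wk , ik) (zs , wz , iz) = finish (normalise (closed w) off (conn-⟪⟫ y))
      where
      ds = d₁ ∷ (ks ++ d₂ ∷ zs)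
      w : DWalk (tail d₁) (tail d₁) ds
      w = refl ∷ DW-++ wk (refl ∷ wz)
      not-y : ∀ {Y} → y ∉ Y → Disj Y ⟪ y ⟫
      not-y y∉ p = ¬∈→∉ λ q → ∈∉ (subst (_∈ _) (⟪⟫-e q) p) y∉
      off : ∀ d → tail d ∈ ⟪ y ⟫ → cnt ds d ≡ false
      off = cnt-off ((not-y y∉Z p∈Z , not-y y∉K k₁∈) ∷ All-++⁺ (inside-avoid (not-y y∉K) ik) ((not-y y∉K k₂∈ , not-y y∉Z v∈Z) ∷ inside-avoid (not-y y∉Z) iz))
      total : Σw (cross K X) ds ≡ true
      total = cong₂ _xor_ (cross-1' {K} {X} kx p∈X k₁∈) (trans (Σw-++ (cross K X) ks _) (cong₂ _xor_
        (Σw-inside (cross K X) (λ d i → cross-0ʳ {K} {X} (kx (proj₁ i)) (kx (proj₂ i))) ik)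
        (cong₂ _xor_ (cross-0ʳ {K} {X} (kx k₂∈) v∉X) (Σw-inside (cross K X) (λ d i → cross-0ˡ {K} {X} (disj-sym kz (proj₁ i)) (disj-sym kz (proj₂ i))) iz))))
      finish : (∃ λ (b : Bounds (cnt ds)) → ∀ d → tail d ∈ ⟪ y ⟫ → Bounds.S b d ≡ false) → ⊥
      finish (b , zero-y) = t≢f total (even {K} {X} {ds} b kx
          (λ d s t h z∉K z∉X → atApex d s (apexes t h (φ (φ d) , refl , head-φφ d) (rev (φ d) , head-φ d , trans (head-rev (φ d)) (tail-φ d))) z∉K z∉X)
          (λ d s t h z∉K z∉X → atApex d s (apexes h t (rev (φ d) , head-φ d , trans (head-rev (φ d)) (tail-φ d)) (φ (φ d) , refl , head-φφ d)) z∉K z∉X))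
        where
        open Bounds b
        atApex : ∀ d → S d ≡ true → apex d ∈ K ⊎ apex d ∈ X ⊎ apex d ≡ y → apex d ∉ K → apex d ∉ X → ⊥
        atApex d s (inj₁ k) k∉ _ = ∈∉ k k∉
        atApex d s (inj₂ (inj₁ x)) _ x∉ = ∈∉ x x∉
        atApex d s (inj₂ (inj₂ refl)) _ _ = t≢f (trans (S-φ (φ d)) (trans (S-φ d) s)) (zero-y (φ (φ d)) (⟪⟫-i y))

  -- The boundary of the intersection of two sets of faces is even at every vertex.
  even-at : ∀ {C C'} (b : Bounds C) (b' : Bounds C') q → let F = λ d → Bounds.S b d ∧ Bounds.S b' d in
            ΣD (λ d → does (tail d Fin.≟ q) ∧ (F d xor F (rev d))) ≡ false
  even-at b b' q = trans (Σ-cong (λ d → Bool.∧-distribˡ-xor (at d) (F d) (F (rev d)))) (trans (Σ-xor (λ d → at d ∧ F d) (λ d → at d ∧ F (rev d)))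
      (trans (cong (ΣD (λ d → at d ∧ F d) xor_) (trans (Σ-cong turn') (Σ-bij (λ d → at d ∧ F d) ρ ρ⁻¹ ρρ⁻¹ ρ⁻¹ρ))) (Bool.xor-same (ΣD (λ d → at d ∧ F d)))))
    where
    F at : D → Bool
    F d = Bounds.S b d ∧ Bounds.S b' d
    at d = does (tail d Fin.≟ q)
    F-ρ : ∀ d → F (rev d) ≡ F (ρ d)
    F-ρ d = sym (trans (cong F (cong ρ (sym (rev-rev d)))) (cong₂ _∧_ (Bounds.S-φ b (rev d)) (Bounds.S-φ b' (rev d))))
    turn' : ∀ d → at d ∧ F (rev d) ≡ at (ρ d) ∧ F (ρ d)
    turn' d = cong₂ _∧_ (cong (λ z → does (z Fin.≟ q)) (sym (tail-ρ d))) (F-ρ d)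

  -- Two closed walks leave `q` through `W'` and `Y` and return through `X₁` and `X₂` respectively.
  -- Their face sets are normalised to vanish on `X₂ ∪ B` and on `X₁ ∪ B`. At the edge from `q` to
  -- `X₁` the second set is absent on both sides, at the edge to `X₂` the first one; at `dw` both
  -- change together. So the boundary of the intersection has exactly one edge at `q`, against
  -- `even-at`.
  noK33′ : ∀ q X₁ X₂ W' Y B → Conn X₁ → Conn X₂ → Conn W' → Conn Y → Conn B →
        q ∉ X₁ → q ∉ X₂ → q ∉ W' → q ∉ Y → q ∉ B →
        Disj X₁ X₂ → Disj X₁ W' → Disj X₁ Y → Disj X₁ B → Disj X₂ W' → Disj X₂ Y → Disj X₂ B →
        Disj W' Y → Disj W' B → Disj Y B →
        Adj ⟪ q ⟫ X₁ → Adj ⟪ q ⟫ X₂ → Adj ⟪ q ⟫ W' → Adj Y X₁ → Adj Y X₂ → Adj Y W' →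
        Adj B X₁ → Adj B X₂ → Adj B W' → ⊥
  noK33′ q X₁ X₂ W' Y B c₁ c₂ cW cY cB q∉X₁ q∉X₂ q∉W q∉Y q∉B d₁₂ d₁W d₁Y d₁B d₂W d₂Y d₂B dWY dWB dYB qX₁ qX₂ qW yX₁ yX₂ yW bX₁ bX₂ bW =
      build (crossing qW) (crossing (adj-sym yW))
    where
    -- A closed walk from q through W', Y and X back to q; its first part is the same for X₁ and X₂.
    record Third (X : VSet n) (dw : D) (y₀ : Fin n) : Set where
      field
        dx    : D
        tq    : tail dx ≡ q
        hX    : head dx ∈ X
        rest  : List D
        walk  : DWalk y₀ q rest
        count : ∀ d → tail d ≡ q → cnt rest d ≡ eqb dx d
        avoid : ∀ {U} → Disj Y U → Disj X U → q ∉ U → All (Avoids U) rest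
    opaque
      third : ∀ {X dw y₀} → Conn X → q ∉ X → Adj ⟪ q ⟫ X → Adj Y X → y₀ ∈ Y → Third X dw y₀
      third {X} {dw} {y₀} cX q∉X qX yX y₀∈ = mk (crossing qX) (crossing yX)
        where
        mk : Crossing ⟪ q ⟫ X → Crossing Y X → Third X dw y₀
        mk (dx , tq' , hx) (dy , ty , hy) = mk' (toDarts (proj₂ (cY _ _ y₀∈ ty))) (toDarts (proj₂ (cX _ _ hy hx)))
          where
          tq : tail dx ≡ q
          tq = ⟪⟫-e tq'
          not-q : ∀ {U} → q ∉ U → Disj U ⟪ q ⟫
          not-q q∉ p = ¬∈→∉ λ r → ∈∉ (subst (_∈ _) (⟪⟫-e r) p) q∉
          mk' : (∃ λ ds → DWalk y₀ (tail dy) ds × All (Inside Y) ds) → (∃ λ ds → DWalk (head dy) (head dx) ds × All (Inside X) ds) → Third X dw y₀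
          mk' (ys , wy , iy) (xs , wx , ix) = record { dx = dx ; tq = tq ; hX = hx ; rest = ys ++ dy ∷ (xs ++ rev dx ∷ [])
            ; walk = DW-++ wy (refl ∷ DW-++ wx (refl ∷ subst (λ z → DWalk z q []) (sym (trans (head-rev dx) tq)) []))
            ; count = cq
            ; avoid = λ yu xu qu → All-++⁺ (inside-avoid yu iy) ((yu ty , xu hy) ∷ All-++⁺ (inside-avoid xu ix)
                         ((xu hx , subst (_∉ _) (sym (trans (head-rev dx) tq)) qu) ∷ [])) }
            where
            cq : ∀ d → tail d ≡ q → cnt (ys ++ dy ∷ (xs ++ rev dx ∷ [])) d ≡ eqb dx d
            cq d td = trans (cnt-++ ys _ d) (cong₂ _xor_ (cnt-off (inside-avoid (not-q q∉Y) iy) d atq)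
                (cong₂ _xor_ (edge-off (not-q q∉Y ty , not-q q∉X hy) atq)
                  (trans (cnt-++ xs _ d) (trans (cong₂ _xor_ (cnt-off (inside-avoid (not-q q∉X) ix) d atq) refl) last))))
              where
              atq : tail d ∈ ⟪ q ⟫
              atq = subst (_∈ ⟪ q ⟫) (sym td) (⟪⟫-i q)
              last : edge (rev dx) d xor false ≡ eqb dx d
              last = trans (Bool.xor-identityʳ _) (cong₂ _xor_ (eqb-≢ (λ e → ∈∉ (subst (_∈ X) (trans (cong tail e) td) hx) q∉X)) (cong (λ z → eqb z d) (rev-rev dx)))
    build : Crossing ⟪ q ⟫ W' → Crossing W' Y → ⊥
    build (dw , tw' , hw) (dy , twy , hy) = common (toDarts (proj₂ (cW _ _ hw twy))) (third {dw = dw} c₁ q∉X₁ qX₁ yX₁ hy) (third {dw = dw} c₂ q∉X₂ qX₂ yX₂ hy)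
      where
      tw : tail dw ≡ q
      tw = ⟪⟫-e tw'
      common : (∃ λ ds → DWalk (head dw) (tail dy) ds × All (Inside W') ds) → Third X₁ dw (head dy) → Third X₂ dw (head dy) → ⊥
      common (ws , ww , iw) t₁ t₂ = finish (normalise (closed (whole t₁)) (off t₁ c₂X (disj-sym dYX₂B) d₁X c₁q) cX₂B)
                                           (normalise (closed (whole t₂)) (off t₂ c₁X (disj-sym dYX₁B) d₂X c₂q) cX₁B)
        where
        pre : List D
        pre = dw ∷ (ws ++ dy ∷ [])
        whole : ∀ {X} (t : Third X dw (head dy)) → DWalk q q (pre ++ Third.rest t)
        whole t = tw ∷ subst (λ z → DWalk (head dw) q z) (sym (assoc ws)) (DW-++ ww (refl ∷ Third.walk t))
          where
          assoc : ∀ ws → (ws ++ dy ∷ []) ++ Third.rest t ≡ ws ++ dy ∷ Third.rest t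
          assoc [] = refl
          assoc (w ∷ ws) = cong (w ∷_) (assoc ws)
        cX₁B : Conn (X₁ ∪ B)
        cX₁B = conn-∪ c₁ cB (adj-sym bX₁)
        cX₂B : Conn (X₂ ∪ B)
        cX₂B = conn-∪ c₂ cB (adj-sym bX₂)
        split : ∀ {X U} → Disj U X → Disj U B → Disj U (X ∪ B)
        split ux ub p = ∪-∉ (ux p) (ub p)
        c₂X : Disj W' (X₂ ∪ B)
        c₂X = split (disj-sym d₂W) dWB
        c₁X : Disj W' (X₁ ∪ B)
        c₁X = split (disj-sym d₁W) dWB
        dYX₂B : Disj (X₂ ∪ B) Y
        dYX₂B = disj-sym (split (disj-sym d₂Y) dYB)
        dYX₁B : Disj (X₁ ∪ B) Y
        dYX₁B = disj-sym (split (disj-sym d₁Y) dYB)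
        d₁X : Disj X₁ (X₂ ∪ B)
        d₁X = split d₁₂ d₁B
        d₂X : Disj X₂ (X₁ ∪ B)
        d₂X = split (disj-sym d₁₂) d₂B
        c₁q : q ∉ X₂ ∪ B
        c₁q = ∪-∉ q∉X₂ q∉B
        c₂q : q ∉ X₁ ∪ B
        c₂q = ∪-∉ q∉X₁ q∉B
        pre-avoid : ∀ {U} → Disj W' U → Disj Y U → q ∉ U → All (Avoids U) pre
        pre-avoid wu yu qu = (subst (_∉ _) (sym tw) qu , wu hw) ∷ All-++⁺ (inside-avoid wu iw) ((wu twy , yu hy) ∷ [])
        off : ∀ {X U} (t : Third X dw (head dy)) → Disj W' U → Disj Y U → Disj X U → q ∉ U → ∀ d → tail d ∈ U → cnt (pre ++ Third.rest t) d ≡ false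
        off t wu yu xu qu = cnt-off (All-++⁺ (pre-avoid wu yu qu) (Third.avoid t yu xu qu))
        not-q : ∀ {U} → q ∉ U → Disj U ⟪ q ⟫
        not-q q∉ p = ¬∈→∉ λ r → ∈∉ (subst (_∈ _) (⟪⟫-e r) p) q∉
        pre-count : ∀ d → tail d ≡ q → cnt pre d ≡ eqb dw d
        pre-count d td = trans (cong₂ _xor_ e₁ (trans (cnt-++ ws _ d) (cong₂ _xor_ (cnt-off (inside-avoid (not-q q∉W) iw) d atq)
              (trans (Bool.xor-identityʳ _) (edge-off (not-q q∉W twy , not-q q∉Y hy) atq))))) (Bool.xor-identityʳ _)
          where
          atq : tail d ∈ ⟪ q ⟫
          atq = subst (_∈ ⟪ q ⟫) (sym td) (⟪⟫-i q)
          e₁ : edge dw d ≡ eqb dw d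
          e₁ = trans (cong (eqb dw d xor_) (eqb-≢ λ e → ∈∉ (subst (_∈ W') (trans (cong tail e) td) hw) q∉W)) (Bool.xor-identityʳ _)
        full : ∀ {X} (t : Third X dw (head dy)) d → tail d ≡ q → cnt (pre ++ Third.rest t) d ≡ eqb dw d xor eqb (Third.dx t) d
        full t d td = trans (cnt-++ pre _ d) (cong₂ _xor_ (pre-count d td) (Third.count t d td))
        module t₁ = Third t₁
        module t₂ = Third t₂
        finish : (∃ λ (b : Bounds (cnt (pre ++ t₁.rest))) → ∀ d → tail d ∈ X₂ ∪ B → Bounds.S b d ≡ false) →
                 (∃ λ (b : Bounds (cnt (pre ++ t₂.rest))) → ∀ d → tail d ∈ X₁ ∪ B → Bounds.S b d ≡ false) → ⊥
        finish (b₁ , z₁) (b₂ , z₂) = t≢f (trans (Σ-cong local) (trans (Σ-cong (λ d → sym (Bool.∧-identityʳ (eqb dw d)))) (Σ-delta (λ _ → true) dw))) (even-at b₁ b₂ q)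
          where
          open Bounds b₁ renaming (S to S₁) using ()
          open Bounds b₂ renaming (S to S₂) using ()
          b₁₂ = Bounds-xor b₁ b₂
          cancel : ∀ d → tail d ∈ W' ∪ B → cnt (pre ++ t₁.rest) d xor cnt (pre ++ t₂.rest) d ≡ false
          cancel d td = trans (cong₂ _xor_ (trans (cnt-++ pre t₁.rest d) (trans (cong (cnt pre d xor_) r₁) (Bool.xor-identityʳ (cnt pre d))))
                                           (trans (cnt-++ pre t₂.rest d) (trans (cong (cnt pre d xor_) r₂) (Bool.xor-identityʳ (cnt pre d))))) (Bool.xor-same (cnt pre d))
            where
            r₁ : cnt t₁.rest d ≡ false
            r₁ = cnt-off (t₁.avoid (λ p → ∪-∉ (disj-sym dWY p) (dYB p)) (λ p → ∪-∉ (d₁W p) (d₁B p)) (∪-∉ q∉W q∉B)) d td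
            r₂ : cnt t₂.rest d ≡ false
            r₂ = cnt-off (t₂.avoid (λ p → ∪-∉ (disj-sym dWY p) (dYB p)) (λ p → ∪-∉ (d₂W p) (d₂B p)) (∪-∉ q∉W q∉B)) d td
          -- The two walks coincide near `W'`, so the sum of the two sides is constant on the
          -- connected set `W' ∪ B`, and it is zero on `B`.
          sameW : S₁ dw ≡ S₂ dw
          sameW = xor≡false (trans (sym (xor-rev)) (onB (crossing bW)))
            where
            onB : Crossing B W' → S₁ (rev dw) xor S₂ (rev dw) ≡ false
            onB (d , td , hd) = trans (conn-const b₁₂ cancel (proj₂ (conn-∪ cW cB (adj-sym bW) _ _ (∪-l hw) (∪-r td))) (rev dw) d refl refl)
                                      (cong₂ _xor_ (z₁ d (∪-r td)) (z₂ d (∪-r td)))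
            xor-rev : S₁ (rev dw) xor S₂ (rev dw) ≡ S₁ dw xor S₂ dw
            xor-rev = trans (S-rev b₁₂ dw) (trans (cong ((S₁ dw xor S₂ dw) xor_) (trans (cong₂ _xor_ (full t₁ dw tw) (full t₂ dw tw))
                       (cong₂ _xor_ (one dw≢₁) (one dw≢₂)))) (Bool.xor-identityʳ _))
              where
              dw≢₁ : eqb t₁.dx dw ≡ false
              dw≢₁ = eqb-≢ λ e → ∈∉ (subst (λ z → head z ∈ X₁) e t₁.hX) (disj-sym d₁W hw)
              dw≢₂ : eqb t₂.dx dw ≡ false
              dw≢₂ = eqb-≢ λ e → ∈∉ (subst (λ z → head z ∈ X₂) e t₂.hX) (disj-sym d₂W hw)
              one : ∀ {c} → c ≡ false → eqb dw dw xor c ≡ true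
              one refl = cong (_xor false) (eqb-refl dw)
          local : ∀ d → does (tail d Fin.≟ q) ∧ ((S₁ d ∧ S₂ d) xor (S₁ (rev d) ∧ S₂ (rev d))) ≡ eqb dw d
          local d = body (tail d Fin.≟ q) (dw ≟D d) (t₁.dx ≟D d) (t₂.dx ≟D d)
            where
            E : Bool
            E = (S₁ d ∧ S₂ d) xor (S₁ (rev d) ∧ S₂ (rev d))
            same : ∀ {a b c d} → a ≡ c → b ≡ d → (a ∧ b) xor (c ∧ d) ≡ false
            same {a} {b} refl refl = Bool.xor-same (a ∧ b)
            low : ∀ {a b c d} → b ≡ false → d ≡ false → (a ∧ b) xor (c ∧ d) ≡ false
            low {a} {c = c} refl refl = cong₂ _xor_ (Bool.∧-zeroʳ a) (Bool.∧-zeroʳ c)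
            diag : ∀ a → (a ∧ a) xor ((a xor true) ∧ (a xor true)) ≡ true
            diag true = refl
            diag false = refl
            rev₁ : tail d ≡ q → S₁ (rev d) ≡ S₁ d xor (eqb dw d xor eqb t₁.dx d)
            rev₁ td = trans (S-rev b₁ d) (cong (S₁ d xor_) (full t₁ d td))
            rev₂ : tail d ≡ q → S₂ (rev d) ≡ S₂ d xor (eqb dw d xor eqb t₂.dx d)
            rev₂ td = trans (S-rev b₂ d) (cong (S₂ d xor_) (full t₂ d td))
            keep : ∀ {s t e f} → t ≡ s xor (e xor f) → e ≡ false → f ≡ false → s ≡ t
            keep {s} refl refl refl = sym (Bool.xor-identityʳ s)
            flip : ∀ {s t e f} → t ≡ s xor (e xor f) → e ≡ true → f ≡ false → t ≡ s xor true
            flip refl refl refl = refl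
            x₁≢x₂ : t₁.dx ≢ t₂.dx
            x₁≢x₂ e = ∈∉ t₁.hX (disj-sym d₁₂ (subst (λ z → head z ∈ X₂) (sym e) t₂.hX))
            body : Dec (tail d ≡ q) → Dec (dw ≡ d) → Dec (t₁.dx ≡ d) → Dec (t₂.dx ≡ d) → does (tail d Fin.≟ q) ∧ E ≡ eqb dw d
            body (no td) _ _ _ = trans (cong (_∧ E) (dec-false (tail d Fin.≟ q) td)) (sym (eqb-≢ λ e → td (trans (cong tail (sym e)) tw)))
            body (yes td) wd x₁ x₂ = trans (cong (_∧ E) (dec-true (tail d Fin.≟ q) td)) (inner wd x₁ x₂)
              where
              inner : Dec (dw ≡ d) → Dec (t₁.dx ≡ d) → Dec (t₂.dx ≡ d) → E ≡ eqb dw d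
              inner (yes refl) _ _ = trans (cong₂ _xor_ (cong (S₁ dw ∧_) (sym sameW)) (cong₂ _∧_ (flip {S₁ dw} (rev₁ td) (eqb-refl dw) ne₁)
                    (trans (flip {S₂ dw} (rev₂ td) (eqb-refl dw) ne₂) (cong (_xor true) (sym sameW))))) (trans (diag (S₁ dw)) (sym (eqb-refl dw)))
                where
                ne₁ : eqb t₁.dx dw ≡ false
                ne₁ = eqb-≢ λ e → ∈∉ (subst (λ z → head z ∈ X₁) e t₁.hX) (disj-sym d₁W hw)
                ne₂ : eqb t₂.dx dw ≡ false
                ne₂ = eqb-≢ λ e → ∈∉ (subst (λ z → head z ∈ X₂) e t₂.hX) (disj-sym d₂W hw)
              inner (no nw) (yes refl) _ = trans (low {S₁ d} {S₂ d} {S₁ (rev d)} {S₂ (rev d)} (trans (keep {S₂ d} (rev₂ td) (eqb-≢ nw) (eqb-≢ (λ e → x₁≢x₂ (sym e)))) zr) zr) (sym (eqb-≢ nw))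
                where
                zr : S₂ (rev t₁.dx) ≡ false
                zr = z₂ (rev t₁.dx) (∪-l t₁.hX)
              inner (no nw) (no n₁) (yes refl) = trans (cong₂ _xor_ (Bool.∧-comm (S₁ t₂.dx) _) (Bool.∧-comm (S₁ (rev t₂.dx)) _))
                  (trans (low {S₂ d} {S₁ d} {S₂ (rev d)} {S₁ (rev d)} (trans (keep {S₁ d} (rev₁ td) (eqb-≢ nw) (eqb-≢ n₁)) zr) zr) (sym (eqb-≢ nw)))
                where
                zr : S₁ (rev t₂.dx) ≡ false
                zr = z₁ (rev t₂.dx) (∪-l t₂.hX)
              inner (no nw) (no n₁) (no n₂) = trans (same (keep {S₁ d} (rev₁ td) (eqb-≢ nw) (eqb-≢ n₁)) (keep {S₂ d} (rev₂ td) (eqb-≢ nw) (eqb-≢ n₂))) (sym (eqb-≢ nw))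

  separators : Separators
  separators = record { twoApex = TwoApex.result ; noK33 = noK33′ ; evenCut = evenCut′ }

iter-+ : {A : Set} (f : A → A) (k l : ℕ) (x : A) → iter (k + l) f x ≡ iter k f (iter l f x)
iter-+ f zero    l x = refl
iter-+ f (suc k) l x = cong f (iter-+ f k l x)

-- Subdividing faces and splitting vertices

module _ {D : Set} (E : Enum D) (f f⁻¹ : D → D) (l : ∀ d → f⁻¹ (f d) ≡ d) where
  open Enum E

  iter-inv : ∀ k d → iter k f⁻¹ (iter k f d) ≡ d
  iter-inv zero    d = refl
  iter-inv (suc k) d = trans (sym (iter-suc f⁻¹ k (f (iter k f d)))) (trans (cong (iter k f⁻¹) (l (iter k f d))) (iter-inv k d))

  -- Two iterates agree by the pigeonhole principle, and applying the inverse carries the agreement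
  -- back to `d`.
  period : ∀ d → ∃ λ p → iter (suc p) f d ≡ d
  period d with Fin.pigeonhole (≤-refl {suc size}) (λ i → to (iter (toℕ i) f d))
  ... | i , j , i<j , e = p , trans (sym (iter-inv (toℕ i) (iter (suc p) f d))) (trans (cong (iter (toℕ i) f⁻¹)
        (trans (sym (iter-+ f (toℕ i) (suc p) d)) (trans (cong (λ m → iter m f d) (trans (+-suc (toℕ i) p) (m+[n∸m]≡n i<j))) (sym same)))) (iter-inv (toℕ i) d))
    where
    p = toℕ j ∸ suc (toℕ i)
    same : iter (toℕ i) f d ≡ iter (toℕ j) f d
    same = trans (sym (from-to _)) (trans (cong from e) (from-to _))

  orbit-sym : ∀ {d e} k → iter k f d ≡ e → ∃ λ j → iter j f e ≡ d
  orbit-sym {d} k refl with period d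
  ... | p , fp = k * suc p ∸ k , trans (sym (iter-+ f (k * suc p ∸ k) k d)) (trans (cong (λ m → iter m f d) (m∸n+n≡m (m≤m*n k (suc p)))) (many k))
    where
    many : ∀ k → iter (k * suc p) f d ≡ d
    many zero    = refl
    many (suc k) = trans (iter-+ f (suc p) (k * suc p) d) (trans (cong (iter (suc p) f) (many k)) fp)

module Representatives {n : ℕ} (_~_ : Fin n → Fin n → Set)
             (~sym : ∀ {u v} → u ~ v → v ~ u) (_~?_ : ∀ u v → Dec (u ~ v)) where
  open Graphs _~_ ~sym _~?_

  record Reps (S : VSet n) : Set where
    field
      rep   : Fin n → Fin n
      reach : ∀ {u} → u ∈ S → ∃ λ m → W S u (rep u) m
      same  : ∀ {u v} → u ∈ S → v ∈ S → u ~ v → rep u ≡ rep v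

  opaque
    reps : ∀ S → Reps S
    reps S = go S (<-wellFounded (card S))
      where
      go : ∀ S → Acc _<_ (card S) → Reps S
      go S (acc rs) = body (inhabited? S)
        where
        body : (∃ λ v → v ∈ S) ⊎ (∀ v → v ∉ S) → Reps S
        body (inj₂ none) = record { rep = id ; reach = λ p → ⊥-elim (∈∉ p (none _)) ; same = λ p → ⊥-elim (∈∉ p (none _)) }
        body (inj₁ (v , v∈)) = glue (compOf S v v∈)
          where
          glue : (∃ λ K → IsComp S K × v ∈ K) → Reps S
          glue (K , ic , v∈K) = record { rep = rep' ; reach = λ {u} → reach' u (in? u K) ; same = λ {u} {w} → same' u w (in? u K) (in? w K) }
            where
            open Reps (go (S ∖ K) (rs (card-strict ∖-l v v∈ (¬∈→∉ λ p → ∈∉ v∈K (∖-r p)))))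
            open IsComp ic using (sub; conn; closed)
            rep' : Fin n → Fin n
            rep' u = if K u then v else rep u
            on : ∀ {u} → u ∈ K → rep' u ≡ v
            on ⟨ e ⟩ rewrite e = refl
            off : ∀ {u} → u ∉ K → rep' u ≡ rep u
            off ⟨ e ⟩ rewrite e = refl
            reach' : ∀ u → u ∈ K ⊎ u ∉ K → u ∈ S → ∃ λ m → W S u (rep' u) m
            reach' u (inj₁ p) _ = subst (λ z → ∃ λ m → W S u z m) (sym (on p)) (_ , wmono sub (proj₂ (conn u v p v∈K)))
            reach' u (inj₂ p) q = subst (λ z → ∃ λ m → W S u z m) (sym (off p)) (_ , wmono ∖-l (proj₂ (reach (∖-i q p))))
            same' : ∀ u w → u ∈ K ⊎ u ∉ K → w ∈ K ⊎ w ∉ K → u ∈ S → w ∈ S → u ~ w → rep' u ≡ rep' w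
            same' u w (inj₁ p) (inj₁ q) _ _ _ = trans (on p) (sym (on q))
            same' u w (inj₂ p) (inj₂ q) x y e = trans (off p) (trans (same (∖-i x p) (∖-i y q) e) (sym (off q)))
            same' u w (inj₁ p) (inj₂ q) x y e = ⊥-elim (∈∉ (closed p y e) q)
            same' u w (inj₂ p) (inj₁ q) x y e = ⊥-elim (∈∉ (closed q x (~sym e)) p)

-- Faces are the components of the graph on darts that joins `d` to `φ d`, so `reps` also selects
-- one dart in each of them.
module FaceReps {n : ℕ} (M : Map n) where
  open Map M
  open Enum enum

  private
    _~_ : Fin size → Fin size → Set
    i ~ j = φ (from i) ≡ from j ⊎ φ (from j) ≡ from i

    ~sym : ∀ {i j} → i ~ j → j ~ i
    ~sym = Sum.swap

    _~?_ : ∀ i j → Dec (i ~ j)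
    i ~? j = (φ (from i) ≟D from j) ⊎-dec (φ (from j) ≟D from i)

    open Representatives _~_ ~sym _~?_
    open Graphs _~_ ~sym _~?_ using (W; nil; cons)

    full : VSet size
    full _ = true

    R : Reps full
    R = reps full

    walk-iter : ∀ {i j m} → W full i j m → ∃ λ k → iter k φ (from i) ≡ from j
    walk-iter (nil _) = 0 , refl
    walk-iter (cons _ (inj₁ e) w) with walk-iter w
    ... | k , p = suc k , trans (sym (iter-suc φ k _)) (trans (cong (iter k φ) e) p)
    walk-iter {i} (cons {w = j} _ (inj₂ e) w) with walk-iter w | orbit-sym enum φ φ⁻¹ φ⁻¹φ {from j} {from i} 1 e
    ... | k , p | l , q = k + l , trans (iter-+ φ k l (from i)) (trans (cong (iter k φ) q) p)

  face : D → D
  face d = from (Reps.rep R (to d))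

  face-φ : ∀ d → face (φ d) ≡ face d
  face-φ d = cong from (Reps.same R ⟨ refl ⟩ ⟨ refl ⟩ (inj₂ (trans (cong φ (from-to d)) (sym (from-to (φ d))))))

  to-face : ∀ d → ∃ λ k → iter k φ d ≡ face d
  to-face d with walk-iter (proj₂ (Reps.reach R {to d} ⟨ refl ⟩))
  ... | k , p = k , trans (cong (iter k φ) (sym (from-to d))) p

  from-face : ∀ d → ∃ λ k → iter k φ (face d) ≡ d
  from-face d with to-face d
  ... | k , p = orbit-sym enum φ φ⁻¹ φ⁻¹φ k p

  same-orbit : ∀ d e → face d ≡ face e → ∃ λ k → iter k φ d ≡ e
  same-orbit d e eq with to-face d | from-face e
  ... | k , p | l , q = l + k , trans (iter-+ φ l k d) (trans (cong (iter l φ) (trans p eq)) q)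

enum-×3 : {D : Set} → Enum D → Enum (D × Fin 3)
enum-×3 {D} E = record { size = size * 3
  ; to = λ { (d , t) → Data.Fin.combine (to d) t }
  ; from = λ i → from (proj₁ (Data.Fin.remQuot {size} 3 i)) , proj₂ (Data.Fin.remQuot {size} 3 i)
  ; from-to = λ { (d , t) → cong₂ _,_ (trans (cong (λ z → from (proj₁ z)) (Fin.remQuot-combine (to d) t)) (from-to d)) (cong proj₂ (Fin.remQuot-combine {size} (to d) t)) }
  ; to-from = λ i → trans (cong (λ z → Data.Fin.combine z (proj₂ (Data.Fin.remQuot {size} 3 i))) (to-from _)) (Fin.combine-remQuot {size} 3 i) }
  where open Enum E

-- Every face is subdivided by a new vertex joined to all its corners: (e , 0) is the dart e, (e , 1) the
-- spoke leaving the corner just before e, (e , 2) its reverse. Face vertices are indexed by darts, of which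
-- only the chosen representatives of faces are used.
module Stellation {n : ℕ} (M : Map n) (sph : Map.Spherical M) where
  open Map M
  open Enum enum
  open FaceReps M

  private
    D₂ : Set
    D₂ = D × Fin 3

    tail₂ : D₂ → Fin (n + size)
    tail₂ (e , 0F) = tail e ↑ˡ size
    tail₂ (e , 1F) = tail e ↑ˡ size
    tail₂ (e , 2F) = n ↑ʳ to (face e)

    rev₂ ρ₂ ρ₂⁻¹ : D₂ → D₂
    rev₂ (e , 0F) = rev e , 0F
    rev₂ (e , 1F) = e , 2F
    rev₂ (e , 2F) = e , 1F
    ρ₂ (e , 0F) = ρ e , 1F
    ρ₂ (e , 1F) = e , 0F
    ρ₂ (e , 2F) = φ⁻¹ e , 2F
    ρ₂⁻¹ (e , 0F) = e , 1F
    ρ₂⁻¹ (e , 1F) = ρ⁻¹ e , 0F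
    ρ₂⁻¹ (e , 2F) = φ e , 2F

    Orb : D₂ → D₂ → Set
    Orb x y = ∃ λ k → iter k ρ₂ x ≡ y

    orb-trans : ∀ {x y z} → Orb x y → Orb y z → Orb x z
    orb-trans {x} (k , refl) (l , refl) = l + k , iter-+ ρ₂ l k x

    around : ∀ k e → Orb (e , 0F) (iter k ρ e , 0F)
    around zero    e = 0 , refl
    around (suc k) e = orb-trans (around k e) (2 , refl)

    darts : ∀ e e' → tail e ≡ tail e' → Orb (e , 0F) (e' , 0F)
    darts e e' p with cyclic e e' p
    ... | k , refl = around k e

    to-spoke : ∀ e → Orb (ρ⁻¹ e , 0F) (e , 1F)
    to-spoke e = 1 , cong (_, 1F) (ρρ⁻¹ e)

    tail-ρ⁻¹ : ∀ e → tail (ρ⁻¹ e) ≡ tail e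
    tail-ρ⁻¹ e = trans (sym (tail-ρ (ρ⁻¹ e))) (cong tail (ρρ⁻¹ e))

    spokes : ∀ k e → iter k φ⁻¹ e ≡ iter k φ⁻¹ e → Orb (e , 2F) (iter k φ⁻¹ e , 2F)
    spokes zero    e _ = 0 , refl
    spokes (suc k) e _ = orb-trans (spokes k e refl) (1 , refl)

    l≢r : ∀ {i : Fin n} {j : Fin size} → i ↑ˡ size ≡ n ↑ʳ j → ⊥
    l≢r {i} {j} p = case trans (sym (Fin.splitAt-↑ˡ n i size)) (trans (cong (splitAt n) p) (Fin.splitAt-↑ʳ n size j)) of λ ()

    cyclic₂ : ∀ x y → tail₂ x ≡ tail₂ y → Orb x y
    cyclic₂ (e , 0F) (e' , 0F) p = darts e e' (Fin.↑ˡ-injective size _ _ p)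
    cyclic₂ (e , 0F) (e' , 1F) p = orb-trans (darts e (ρ⁻¹ e') (trans (Fin.↑ˡ-injective size _ _ p) (sym (tail-ρ⁻¹ e')))) (to-spoke e')
    cyclic₂ (e , 1F) (e' , 0F) p = orb-trans (1 , refl) (darts e e' (Fin.↑ˡ-injective size _ _ p))
    cyclic₂ (e , 1F) (e' , 1F) p = orb-trans (1 , refl) (orb-trans (darts e (ρ⁻¹ e') (trans (Fin.↑ˡ-injective size _ _ p) (sym (tail-ρ⁻¹ e')))) (to-spoke e'))
    cyclic₂ (e , 2F) (e' , 2F) p with same-orbit e' e (trans (sym (from-to _)) (trans (cong from (sym (Fin.↑ʳ-injective n _ _ p))) (from-to _)))
    ... | k , q = subst (λ z → Orb (e , 2F) (z , 2F)) (trans (cong (iter k φ⁻¹) (sym q)) (iter-inv enum φ φ⁻¹ φ⁻¹φ k e')) (spokes k e refl)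
    cyclic₂ (e , 0F) (e' , 2F) p = ⊥-elim (l≢r p)
    cyclic₂ (e , 1F) (e' , 2F) p = ⊥-elim (l≢r p)
    cyclic₂ (e , 2F) (e' , 0F) p = ⊥-elim (l≢r (sym p))
    cyclic₂ (e , 2F) (e' , 1F) p = ⊥-elim (l≢r (sym p))

  stellation : Map (n + size)
  stellation = record
    { D = D₂ ; enum = enum-×3 enum ; tail = tail₂ ; rev = rev₂
    ; rev-rev = λ { (e , 0F) → cong (_, 0F) (rev-rev e) ; (e , 1F) → refl ; (e , 2F) → refl }
    ; rev≢ = λ { (e , 0F) p → rev≢ e (cong proj₁ p) ; (e , 1F) () ; (e , 2F) () }
    ; ρ = ρ₂ ; ρ⁻¹ = ρ₂⁻¹
    ; ρρ⁻¹ = λ { (e , 0F) → refl ; (e , 1F) → cong (_, 1F) (ρρ⁻¹ e) ; (e , 2F) → cong (_, 2F) (φ⁻¹φ e) }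
    ; ρ⁻¹ρ = λ { (e , 0F) → cong (_, 0F) (ρ⁻¹ρ e) ; (e , 1F) → refl ; (e , 2F) → cong (_, 2F) (φφ⁻¹ e) }
    ; tail-ρ = λ { (e , 0F) → cong (_↑ˡ size) (tail-ρ e) ; (e , 1F) → refl
                 ; (e , 2F) → cong (λ z → n ↑ʳ to z) (trans (sym (face-φ (φ⁻¹ e))) (cong face (φφ⁻¹ e))) }
    ; cyclic = cyclic₂ }

  private
    module M₂ = Map stellation

  triangular : ∀ x → M₂.φ (M₂.φ (M₂.φ x)) ≡ x
  triangular (e , 0F) = cong (_, 0F) (φ⁻¹φ e)
  triangular (e , 1F) = cong (_, 1F) (φφ⁻¹ e)
  triangular (e , 2F) = cong (_, 2F) (φ⁻¹φ e)

  private
    -- The triangle at the dart d is {(d , 0) , (φ d , 1) , (d , 2)}, so sets of faces are functions on D.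
    fromTriangles : ∀ {C} (t : D → Bool) → (∀ d → t d xor t (rev d) ≡ C (d , 0F)) → (∀ d → t (φ⁻¹ d) xor t d ≡ C (d , 1F)) →
                    (∀ d → t d xor t (φ⁻¹ d) ≡ C (d , 2F)) → M₂.Bounds C
    fromTriangles t h₀ h₁ h₂ = record
      { S = λ { (d , 0F) → t d ; (d , 1F) → t (φ⁻¹ d) ; (d , 2F) → t d }
      ; S-φ = λ { (d , 0F) → cong t (φ⁻¹φ d) ; (d , 1F) → refl ; (d , 2F) → refl }
      ; ∂S = λ { (d , 0F) → h₀ d ; (d , 1F) → h₁ d ; (d , 2F) → h₂ d } }

    open Spherical sph

    eqb₂ : ∀ d e t → M₂.eqb (d , t) (e , t) ≡ eqb d e
    eqb₂ d e t = bool-ext (λ p → trans (cong (eqb d) (sym (cong proj₁ (M₂.eqb-≡ p)))) (eqb-refl d))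
                          (λ p → trans (cong (λ z → M₂.eqb (d , t) (z , t)) (sym (eqb-≡ p))) (M₂.eqb-refl (d , t)))

    eqb-tag : ∀ d e {t t'} → t ≢ t' → M₂.eqb (d , t) (e , t') ≡ false
    eqb-tag d e ne = M₂.eqb-≢ (λ p → ne (cong proj₂ p))

    edge₂ : D₂ → D₂ → Bool
    edge₂ (e , 0F) (d , 0F) = edge e d
    edge₂ (e , 0F) (d , _)  = false
    edge₂ (e , _)  (d , 0F) = false
    edge₂ (e , _)  (d , _)  = eqb e d

    edge₂-≡ : ∀ x y → M₂.edge x y ≡ edge₂ x y
    edge₂-≡ (e , 0F) (d , 0F) = cong₂ _xor_ (eqb₂ e d 0F) (eqb₂ (rev e) d 0F)
    edge₂-≡ (e , 0F) (d , 1F) = cong₂ _xor_ (eqb-tag e d λ ()) (eqb-tag (rev e) d λ ())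
    edge₂-≡ (e , 0F) (d , 2F) = cong₂ _xor_ (eqb-tag e d λ ()) (eqb-tag (rev e) d λ ())
    edge₂-≡ (e , 1F) (d , 0F) = cong₂ _xor_ (eqb-tag e d λ ()) (eqb-tag e d λ ())
    edge₂-≡ (e , 1F) (d , 1F) = trans (cong₂ _xor_ (eqb₂ e d 1F) (eqb-tag e d λ ())) (Bool.xor-identityʳ _)
    edge₂-≡ (e , 1F) (d , 2F) = cong₂ _xor_ (eqb-tag e d λ ()) (eqb₂ e d 2F)
    edge₂-≡ (e , 2F) (d , 0F) = cong₂ _xor_ (eqb-tag e d λ ()) (eqb-tag e d λ ())
    edge₂-≡ (e , 2F) (d , 1F) = cong₂ _xor_ (eqb-tag e d λ ()) (eqb₂ e d 1F)
    edge₂-≡ (e , 2F) (d , 2F) = trans (cong₂ _xor_ (eqb₂ e d 2F) (eqb-tag e d λ ())) (Bool.xor-identityʳ _)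

    -- The reference walk to the centre of the face of `f`: the one to `tail f`, followed by the
    -- spoke at `f`.
    pick : D → D₂ → Bool
    pick f (d , 0F) = ref (tail f) d
    pick f (d , _)  = eqb f d

    refV : Fin n → D₂ → Bool
    refV v (d , 0F) = ref v d
    refV v (d , _)  = false

    ref₂ : Fin (n + size) → D₂ → Bool
    ref₂ v = [ refV , (λ j → pick (from j)) ]′ (splitAt n v)

    ref-l : ∀ v x → ref₂ (v ↑ˡ size) x ≡ refV v x
    ref-l v x = cong (λ z → [ refV , (λ j → pick (from j)) ]′ z x) (Fin.splitAt-↑ˡ n v size)

    ref-r : ∀ f x → ref₂ (n ↑ʳ to f) x ≡ pick f x
    ref-r f x = trans (cong (λ z → [ refV , (λ j → pick (from j)) ]′ z x) (Fin.splitAt-↑ʳ n size (to f))) (cong (λ z → pick z x) (from-to f))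

    Spoke : D → D → D₂ → Bool
    Spoke f e (d , 0F) = ref (tail e) d xor ref (tail f) d
    Spoke f e (d , _)  = eqb f d xor eqb e d

    -- Moving from the spoke at e to the spoke at φ e adds the triangle between them and the faces bounded by
    -- the reference cycle of e.
    spoke-bounds : ∀ k f e → iter k φ f ≡ e → M₂.Bounds (Spoke f e)
    spoke-bounds zero f .f refl = M₂.Bounds-cong (λ { (d , 0F) → sym (Bool.xor-same (ref (tail f) d)) ; (d , 1F) → sym (Bool.xor-same (eqb f d)) ; (d , 2F) → sym (Bool.xor-same (eqb f d)) }) M₂.Bounds-0
    spoke-bounds (suc k) f .(φ (iter k φ f)) refl = M₂.Bounds-cong total
        (M₂.Bounds-xor (spoke-bounds k f e refl) (M₂.Bounds-xor (fromTriangles {C = A} S (λ d → ∂S d) (λ d → flat (S-φ⁻¹ d)) (λ d → flat (sym (S-φ⁻¹ d))))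
                                                                (fromTriangles {C = B} (eqb e) (λ d → cong (eqb e d xor_) (eqb-rev e d)) (λ d → cong (_xor eqb e d) (eqb-φ d)) (λ d → trans (cong (eqb e d xor_) (eqb-φ d)) (Bool.xor-comm (eqb e d) (eqb (φ e) d))))))
      where
      e = iter k φ f
      open Bounds (bd e)
      S-φ⁻¹ : ∀ d → S (φ⁻¹ d) ≡ S d
      S-φ⁻¹ d = trans (sym (S-φ (φ⁻¹ d))) (cong S (φφ⁻¹ d))
      flat : ∀ {a b} → a ≡ b → a xor b ≡ false
      flat {a} refl = Bool.xor-same a
      A B : D₂ → Bool
      A (d , 0F) = (ref (tail e) d xor ref (head e) d) xor edge e d
      A (d , _)  = false
      B (d , 0F) = edge e d
      B (d , _)  = eqb (φ e) d xor eqb e d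
      eqb-φ : ∀ d → eqb e (φ⁻¹ d) ≡ eqb (φ e) d
      eqb-φ d = bool-ext (λ p → trans (cong (λ z → eqb (φ z) d) (eqb-≡ p)) (trans (cong (λ z → eqb z d) (φφ⁻¹ d)) (eqb-refl d)))
                         (λ p → trans (cong (λ z → eqb e (φ⁻¹ z)) (sym (eqb-≡ p))) (trans (cong (eqb e) (φ⁻¹φ e)) (eqb-refl e)))
      tl : ∀ d → ref (tail (φ e)) d ≡ ref (head e) d
      tl d = cong (λ z → ref z d) (tail-φ e)
      lem₀ : ∀ a b c x → (a xor b) xor (((a xor c) xor x) xor x) ≡ c xor b
      lem₀ a b c x = trans (cong ((a xor b) xor_) (trans (Bool.xor-assoc (a xor c) x x) (trans (cong ((a xor c) xor_) (Bool.xor-same x)) (Bool.xor-identityʳ (a xor c)))))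
        (trans (cong (_xor (a xor c)) (Bool.xor-comm a b)) (trans (xor-cancel b a c) (Bool.xor-comm b c)))
      lem₁ : ∀ a b c → (a xor b) xor (c xor b) ≡ a xor c
      lem₁ a b c = trans (cong ((a xor b) xor_) (Bool.xor-comm c b)) (xor-cancel a b c)
      total : ∀ x → Spoke f e x xor (A x xor B x) ≡ Spoke f (φ e) x
      total (d , 0F) = trans (lem₀ (ref (tail e) d) (ref (tail f) d) (ref (head e) d) (edge e d)) (cong (_xor ref (tail f) d) (sym (tl d)))
      total (d , 1F) = lem₁ (eqb f d) (eqb e d) (eqb (φ e) d)
      total (d , 2F) = lem₁ (eqb f d) (eqb e d) (eqb (φ e) d)

    bd₂ : ∀ x → M₂.Bounds (λ y → (ref₂ (tail₂ x) y xor ref₂ (tail₂ (rev₂ x)) y) xor M₂.edge x y)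
    bd₂ (e , 0F) = M₂.Bounds-cong (λ y → sym (cong₂ _xor_ (cong₂ _xor_ (ref-l (tail e) y) (ref-l (head e) y)) (edge₂-≡ (e , 0F) y)))
        (fromTriangles S (λ d → ∂S d) (λ d → flat (S-φ⁻¹ d)) (λ d → flat (sym (S-φ⁻¹ d))))
      where
      open Bounds (bd e)
      S-φ⁻¹ : ∀ d → S (φ⁻¹ d) ≡ S d
      S-φ⁻¹ d = trans (sym (S-φ (φ⁻¹ d))) (cong S (φφ⁻¹ d))
      flat : ∀ {a b} → a ≡ b → a xor b ≡ false
      flat {a} refl = Bool.xor-same a
    bd₂ (e , 1F) = M₂.Bounds-cong (λ y → trans (val y) (sym (cong₂ _xor_ (cong₂ _xor_ (ref-l (tail e) y) (ref-r (face e) y)) (edge₂-≡ (e , 1F) y))))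
        (spoke-bounds (proj₁ (from-face e)) (face e) e (proj₂ (from-face e)))
      where
      val : ∀ y → Spoke (face e) e y ≡ (refV (tail e) y xor pick (face e) y) xor edge₂ (e , 1F) y
      val (d , 0F) = sym (Bool.xor-identityʳ _)
      val (d , 1F) = refl
      val (d , 2F) = refl
    bd₂ (e , 2F) = M₂.Bounds-cong (λ y → trans (val y) (sym (cong₂ _xor_ (cong₂ _xor_ (ref-r (face e) y) (ref-l (tail e) y)) (edge₂-≡ (e , 2F) y))))
        (spoke-bounds (proj₁ (from-face e)) (face e) e (proj₂ (from-face e)))
      where
      val : ∀ y → Spoke (face e) e y ≡ (pick (face e) y xor refV (tail e) y) xor edge₂ (e , 2F) y
      val (d , 0F) = trans (Bool.xor-comm (ref (tail e) d) _) (sym (Bool.xor-identityʳ _))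
      val (d , 1F) = cong (_xor eqb e d) (sym (Bool.xor-identityʳ (eqb (face e) d)))
      val (d , 2F) = cong (_xor eqb e d) (sym (Bool.xor-identityʳ (eqb (face e) d)))

  spherical : M₂.Spherical
  spherical = record { ref = ref₂ ; bd = bd₂ }

-- Every dart leaving R gets a tail of its own, which removes the vertices of R from the map without
-- renumbering the darts.
module Split {n : ℕ} (M : Map n) (R : VSet n) where
  open Map M
  open Enum enum

  -- Sphericity up to edges inside `R`. The cycles chosen before use only such edges, so a relation
  -- that holds modulo these cycles is exact on all other darts.
  record RelSpherical : Set where
    field
      ref : Fin n → D → Bool
      off : ∀ {v} d → v ∉ R → tail d ∈ R ⊎ head d ∈ R → ref v d ≡ false
      bd  : ∀ e → tail e ∉ R → head e ∉ R → ∃ λ (S : D → Bool) → (∀ d → S (φ d) ≡ S d) ×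
            (∀ d → tail d ∉ R ⊎ head d ∉ R → S d xor S (rev d) ≡ (ref (tail e) d xor ref (head e) d) xor edge e d)

  private
    Side : D → Set
    Side d = tail d ∈ R ⊎ tail d ∉ R

    choose₁ : {A : Set} {d : D} → Side d → A → A → A
    choose₁ (inj₁ _) a b = a
    choose₁ (inj₂ _) a b = b

    side : ∀ d → Side d
    side d = in? (tail d) R

  opaque
    tail₁ : D → Fin (n + size)
    tail₁ d = choose₁ (side d) (n ↑ʳ to d) (tail d ↑ˡ size)

    tail₁-∈ : ∀ {d} → tail d ∈ R → tail₁ d ≡ n ↑ʳ to d
    tail₁-∈ {d} p = go (side d)
      where
      go : (s : Side d) → choose₁ s (n ↑ʳ to d) (tail d ↑ˡ size) ≡ n ↑ʳ to d
      go (inj₁ _) = refl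
      go (inj₂ q) = ⊥-elim (∈∉ p q)

    tail₁-∉ : ∀ {d} → tail d ∉ R → tail₁ d ≡ tail d ↑ˡ size
    tail₁-∉ {d} p = go (side d)
      where
      go : (s : Side d) → choose₁ s (n ↑ʳ to d) (tail d ↑ˡ size) ≡ tail d ↑ˡ size
      go (inj₁ q) = ⊥-elim (∈∉ q p)
      go (inj₂ _) = refl

    ρ₁ : D → D
    ρ₁ d = choose₁ (side d) d (ρ d)

    ρ₁-∈ : ∀ {d} → tail d ∈ R → ρ₁ d ≡ d
    ρ₁-∈ {d} p = go (side d)
      where
      go : (s : Side d) → choose₁ s d (ρ d) ≡ d
      go (inj₁ _) = refl
      go (inj₂ q) = ⊥-elim (∈∉ p q)

    ρ₁-∉ : ∀ {d} → tail d ∉ R → ρ₁ d ≡ ρ d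
    ρ₁-∉ {d} p = go (side d)
      where
      go : (s : Side d) → choose₁ s d (ρ d) ≡ ρ d
      go (inj₁ q) = ⊥-elim (∈∉ q p)
      go (inj₂ _) = refl

    ρ₁⁻¹ : D → D
    ρ₁⁻¹ d = choose₁ (side d) d (ρ⁻¹ d)

    ρ₁⁻¹-∈ : ∀ {d} → tail d ∈ R → ρ₁⁻¹ d ≡ d
    ρ₁⁻¹-∈ {d} p = go (side d)
      where
      go : (s : Side d) → choose₁ s d (ρ⁻¹ d) ≡ d
      go (inj₁ _) = refl
      go (inj₂ q) = ⊥-elim (∈∉ p q)

    ρ₁⁻¹-∉ : ∀ {d} → tail d ∉ R → ρ₁⁻¹ d ≡ ρ⁻¹ d
    ρ₁⁻¹-∉ {d} p = go (side d)
      where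
      go : (s : Side d) → choose₁ s d (ρ⁻¹ d) ≡ ρ⁻¹ d
      go (inj₁ q) = ⊥-elim (∈∉ q p)
      go (inj₂ _) = refl

  private
    tail-ρ⁻¹ : ∀ e → tail (ρ⁻¹ e) ≡ tail e
    tail-ρ⁻¹ e = trans (sym (tail-ρ (ρ⁻¹ e))) (cong tail (ρρ⁻¹ e))

    stays : ∀ {d} → tail d ∉ R → tail (ρ d) ∉ R
    stays p = subst (_∉ R) (sym (tail-ρ _)) p

    stays⁻¹ : ∀ {d} → tail d ∉ R → tail (ρ⁻¹ d) ∉ R
    stays⁻¹ p = subst (_∉ R) (sym (tail-ρ⁻¹ _)) p

    iter-∉ : ∀ k d → tail d ∉ R → iter k ρ₁ d ≡ iter k ρ d × tail (iter k ρ d) ∉ R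
    iter-∉ zero    d p = refl , p
    iter-∉ (suc k) d p with iter-∉ k d p
    ... | e , q = trans (cong ρ₁ e) (ρ₁-∉ q) , stays q

    l≢r : ∀ {i : Fin n} {j : Fin size} → i ↑ˡ size ≡ n ↑ʳ j → ⊥
    l≢r {i} {j} p = case trans (sym (Fin.splitAt-↑ˡ n i size)) (trans (cong (splitAt n) p) (Fin.splitAt-↑ʳ n size j)) of λ ()

    by : {A : D → Set} → (∀ d → tail d ∈ R → A d) → (∀ d → tail d ∉ R → A d) → ∀ d → A d
    by f g d = [ f d , g d ]′ (side d)

    cyclic₁ : ∀ d d' → tail₁ d ≡ tail₁ d' → ∃ λ k → iter k ρ₁ d ≡ d'
    cyclic₁ d d' p = go (side d) (side d')
      where
      go : Side d → Side d' → ∃ λ k → iter k ρ₁ d ≡ d'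
      go (inj₁ a) (inj₁ b) = 0 , trans (sym (from-to d)) (trans (cong from (Fin.↑ʳ-injective n _ _ (trans (sym (tail₁-∈ a)) (trans p (tail₁-∈ b))))) (from-to d'))
      go (inj₁ a) (inj₂ b) = ⊥-elim (l≢r (trans (sym (tail₁-∉ b)) (trans (sym p) (tail₁-∈ a))))
      go (inj₂ a) (inj₁ b) = ⊥-elim (l≢r (trans (sym (tail₁-∉ a)) (trans p (tail₁-∈ b))))
      go (inj₂ a) (inj₂ b) with cyclic d d' (Fin.↑ˡ-injective size _ _ (trans (sym (tail₁-∉ a)) (trans p (tail₁-∉ b))))
      ... | k , q = k , trans (proj₁ (iter-∉ k d a)) q

  split : Map (n + size)
  split = record
    { D = D ; enum = enum ; tail = tail₁ ; rev = rev ; rev-rev = rev-rev ; rev≢ = rev≢ ; ρ = ρ₁ ; ρ⁻¹ = ρ₁⁻¹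
    ; ρρ⁻¹ = by (λ d p → trans (cong ρ₁ (ρ₁⁻¹-∈ p)) (ρ₁-∈ p)) (λ d p → trans (cong ρ₁ (ρ₁⁻¹-∉ p)) (trans (ρ₁-∉ (stays⁻¹ p)) (ρρ⁻¹ d)))
    ; ρ⁻¹ρ = by (λ d p → trans (cong ρ₁⁻¹ (ρ₁-∈ p)) (ρ₁⁻¹-∈ p)) (λ d p → trans (cong ρ₁⁻¹ (ρ₁-∉ p)) (trans (ρ₁⁻¹-∉ (stays p)) (ρ⁻¹ρ d)))
    ; tail-ρ = by (λ d p → cong tail₁ (ρ₁-∈ p)) (λ d p → trans (cong tail₁ (ρ₁-∉ p)) (trans (tail₁-∉ (stays p)) (trans (cong (_↑ˡ size) (tail-ρ d)) (sym (tail₁-∉ p)))))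
    ; cyclic = cyclic₁ }

  private
    module M₁ = Map split

  module _ (rel : RelSpherical) where
    open RelSpherical rel

    private
      less-xor : ∀ d → less d xor less (rev d) ≡ true
      less-xor d = trans (cong (less d xor_) (less-rev d)) (xor-not (less d))
        where
        xor-not : ∀ a → a xor not a ≡ true
        xor-not true  = refl
        xor-not false = refl

      -- The reference walk to a private tail of d passes through d itself; an edge inside R is assigned to one of its two ends.
      leaf : D → D → Bool
      leaf d x = choose₁ (side (rev d)) (less d ∧ edge d x) (ref (head d) x xor edge d x)

      leaf-∈ : ∀ {d} x → head d ∈ R → leaf d x ≡ less d ∧ edge d x
      leaf-∈ {d} x p = go (side (rev d))
        where
        go : (s : Side (rev d)) → choose₁ s (less d ∧ edge d x) (ref (head d) x xor edge d x) ≡ less d ∧ edge d x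
        go (inj₁ _) = refl
        go (inj₂ q) = ⊥-elim (∈∉ p q)

      leaf-∉ : ∀ {d} x → head d ∉ R → leaf d x ≡ ref (head d) x xor edge d x
      leaf-∉ {d} x p = go (side (rev d))
        where
        go : (s : Side (rev d)) → choose₁ s (less d ∧ edge d x) (ref (head d) x xor edge d x) ≡ ref (head d) x xor edge d x
        go (inj₁ q) = ⊥-elim (∈∉ q p)
        go (inj₂ _) = refl

      ref₁ : Fin (n + size) → D → Bool
      ref₁ v = [ ref , (λ j → leaf (from j)) ]′ (splitAt n v)

      ref-∉ : ∀ {d} x → tail d ∉ R → ref₁ (tail₁ d) x ≡ ref (tail d) x
      ref-∉ {d} x p = trans (cong (λ z → ref₁ z x) (tail₁-∉ p)) (cong (λ z → [ ref , (λ j → leaf (from j)) ]′ z x) (Fin.splitAt-↑ˡ n (tail d) size))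

      ref-∈ : ∀ {d} x → tail d ∈ R → ref₁ (tail₁ d) x ≡ leaf d x
      ref-∈ {d} x p = trans (cong (λ z → ref₁ z x) (tail₁-∈ p)) (trans (cong (λ z → [ ref , (λ j → leaf (from j)) ]′ z x) (Fin.splitAt-↑ʳ n size (to d))) (cong (λ z → leaf z x) (from-to d)))

      Goal : D → Set
      Goal e = M₁.Bounds (λ d → (ref₁ (tail₁ e) d xor ref₁ (tail₁ (rev e)) d) xor edge e d)

      trivial : ∀ {e} → (∀ d → (ref₁ (tail₁ e) d xor ref₁ (tail₁ (rev e)) d) xor edge e d ≡ false) → Goal e
      trivial h = M₁.Bounds-cong (λ d → sym (h d)) M₁.Bounds-0

      cancel₁ : ∀ a x → ((a xor x) xor a) xor x ≡ false
      cancel₁ a x = trans (cong (_xor x) (trans (cong (_xor a) (Bool.xor-comm a x)) (trans (Bool.xor-assoc x a a) (trans (cong (x xor_) (Bool.xor-same a)) (Bool.xor-identityʳ x))))) (Bool.xor-same x)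

      cancel₂ : ∀ a x → (a xor (a xor x)) xor x ≡ false
      cancel₂ a x = trans (cong (_xor x) (trans (sym (Bool.xor-assoc a a x)) (cong (_xor x) (Bool.xor-same a)))) (Bool.xor-same x)

      module Proper (e : D) (te : tail e ∉ R) (he : head e ∉ R) where
        S₀ = proj₁ (bd e te he)
        S₀-φ = proj₁ (proj₂ (bd e te he))
        ∂S₀ = proj₂ (proj₂ (bd e te he))
        C : D → Bool
        C d = (ref (tail e) d xor ref (head e) d) xor edge e d
        -- After the splitting an edge inside `R` is a component of its own with a single face, on
        -- which `S₀` need not be constant; there it is reset to zero.
        S₁ : D → Bool
        S₁ d = choose₁ (side d) (choose₁ (side (rev d)) false (S₀ d)) (S₀ d)
        S₁-both : ∀ {d} → tail d ∈ R → head d ∈ R → S₁ d ≡ false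
        S₁-both {d} p q = go (side d) (side (rev d))
          where
          go : (s : Side d) (s' : Side (rev d)) → choose₁ s (choose₁ s' false (S₀ d)) (S₀ d) ≡ false
          go (inj₁ _) (inj₁ _) = refl
          go (inj₂ r) _ = ⊥-elim (∈∉ p r)
          go (inj₁ _) (inj₂ r) = ⊥-elim (∈∉ q r)
        S₁-t : ∀ {d} → tail d ∉ R → S₁ d ≡ S₀ d
        S₁-t {d} p = go (side d) (side (rev d))
          where
          go : (s : Side d) (s' : Side (rev d)) → choose₁ s (choose₁ s' false (S₀ d)) (S₀ d) ≡ S₀ d
          go (inj₂ _) _ = refl
          go (inj₁ r) _ = ⊥-elim (∈∉ r p)
        S₁-h : ∀ {d} → head d ∉ R → S₁ d ≡ S₀ d
        S₁-h {d} p = go (side d) (side (rev d))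
          where
          go : (s : Side d) (s' : Side (rev d)) → choose₁ s (choose₁ s' false (S₀ d)) (S₀ d) ≡ S₀ d
          go (inj₂ _) _ = refl
          go (inj₁ _) (inj₂ _) = refl
          go (inj₁ _) (inj₁ r) = ⊥-elim (∈∉ r p)
        C-off : ∀ d → tail d ∈ R ⊎ head d ∈ R → C d ≡ false
        C-off d r = cong₂ _xor_ (cong₂ _xor_ (off d te r) (off d he r)) (cong₂ _xor_ (eqb-≢ λ p → no₁ p r) (eqb-≢ λ p → no₂ p r))
          where
          no₁ : e ≡ d → tail d ∈ R ⊎ head d ∈ R → ⊥
          no₁ refl = [ (λ p → ∈∉ p te) , (λ p → ∈∉ p he) ]′
          no₂ : rev e ≡ d → tail d ∈ R ⊎ head d ∈ R → ⊥
          no₂ refl = [ (λ p → ∈∉ p he) , (λ p → ∈∉ p (subst (_∉ R) (sym (head-rev e)) te)) ]′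
        head-rev∈ : ∀ {d} → tail d ∈ R → head (rev d) ∈ R
        head-rev∈ {d} p = subst (_∈ R) (sym (head-rev d)) p
        head-rev∉ : ∀ {d} → tail d ∉ R → head (rev d) ∉ R
        head-rev∉ {d} p = subst (_∉ R) (sym (head-rev d)) p
        S₁-φ : ∀ d → S₁ (ρ₁ (rev d)) ≡ S₁ d
        S₁-φ d = go (side d) (side (rev d))
          where
          go : Side d → Side (rev d) → S₁ (ρ₁ (rev d)) ≡ S₁ d
          go _        (inj₂ h) = trans (cong S₁ (ρ₁-∉ h)) (trans (S₁-t (stays h)) (trans (S₀-φ d) (sym (S₁-h h))))
          go (inj₁ t) (inj₁ h) = trans (cong S₁ (ρ₁-∈ h)) (trans (S₁-both h (head-rev∈ t)) (sym (S₁-both t h)))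
          -- At a leaf the face turns back from `d` to `rev d`, and `S₀` agrees on the two because
          -- `C` vanishes on edges that touch `R`.
          go (inj₂ t) (inj₁ h) = trans (cong S₁ (ρ₁-∈ h)) (trans (S₁-h (head-rev∉ t)) (trans (sym (xor≡false (trans (∂S₀ d (inj₁ t)) (C-off d (inj₂ h))))) (sym (S₁-t t))))
        ∂S₁ : ∀ d → S₁ d xor S₁ (rev d) ≡ C d
        ∂S₁ d = go (side d) (side (rev d))
          where
          go : Side d → Side (rev d) → S₁ d xor S₁ (rev d) ≡ C d
          go (inj₁ t) (inj₁ h) = trans (cong₂ _xor_ (S₁-both t h) (S₁-both h (head-rev∈ t))) (sym (C-off d (inj₁ t)))
          go (inj₂ t) _        = trans (cong₂ _xor_ (S₁-t t) (S₁-h (head-rev∉ t))) (∂S₀ d (inj₁ t))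
          go (inj₁ _) (inj₂ h) = trans (cong₂ _xor_ (S₁-h h) (S₁-t h)) (∂S₀ d (inj₂ h))
        goal : Goal e
        goal = M₁.Bounds-cong (λ d → sym (cong (_xor edge e d) (cong₂ _xor_ (ref-∉ d te) (ref-∉ d he))))
                 (record { S = S₁ ; S-φ = S₁-φ ; ∂S = ∂S₁ })

      bd₁ : ∀ e → Goal e
      bd₁ e = go (side e) (side (rev e))
        where
        go : Side e → Side (rev e) → Goal e
        go (inj₂ t) (inj₂ h) = Proper.goal e t h
        go (inj₁ t) (inj₂ h) = trivial λ d → trans (cong (_xor edge e d) (cong₂ _xor_ (trans (ref-∈ d t) (leaf-∉ d h)) (ref-∉ d h))) (cancel₁ (ref (head e) d) (edge e d))
        go (inj₂ t) (inj₁ h) = trivial λ d → trans (cong (_xor edge e d) (cong₂ _xor_ (ref-∉ d t) (trans (ref-∈ d h)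
              (trans (leaf-∉ d (subst (_∉ R) (sym (head-rev e)) t)) (cong₂ _xor_ (cong (λ z → ref z d) (head-rev e)) (edge-revˡ e d)))))) (cancel₂ (ref (tail e) d) (edge e d))
        go (inj₁ t) (inj₁ h) = trivial λ d → trans (cong (_xor edge e d) (trans (cong₂ _xor_ (trans (ref-∈ d t) (leaf-∈ d h))
              (trans (ref-∈ d h) (trans (leaf-∈ d (subst (_∈ R) (sym (head-rev e)) t)) (cong (less (rev e) ∧_) (edge-revˡ e d)))))
              (trans (sym (Bool.∧-distribʳ-xor (edge e d) (less e) (less (rev e)))) (cong (_∧ edge e d) (less-xor e))))) (Bool.xor-same (edge e d))

    split-spherical : M₁.Spherical
    split-spherical = record { ref = ref₁ ; bd = bd₁ }

  split-edge : ∀ d → tail d ∉ R → head d ∉ R → M₁.tail d ≡ tail d ↑ˡ size × M₁.head d ≡ head d ↑ˡ size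
  split-edge d p q = tail₁-∉ p , tail₁-∉ q

-- The genus bounds the number of independent disjoint cycles

module _ {X : Set} where
  comb : {p : ℕ} → (Fin p → Bool) → (Fin p → X → Bool) → X → Bool
  comb x a e = ⊕.sum (λ i → x i ∧ a i e)

  dot : List X → (X → Bool) → (X → Bool) → Bool
  dot []       a b = false
  dot (e ∷ es) a b = (a e ∧ b e) xor dot es a b

  Indep : List X → {p : ℕ} → (Fin p → X → Bool) → Set
  Indep es {p} a = ∀ x → (∀ {e} → e ∈ˡ es → comb x a e ≡ false) → ∀ i → x i ≡ false

  private
    sum-0 : ∀ {p} {t : Fin p → Bool} → (∀ i → t i ≡ false) → ⊕.sum t ≡ false
    sum-0 {p} h = trans (⊕.sum-cong-≗ h) (⊕.sum-replicate-zero p)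

    sum-∧ : ∀ {p} b (t : Fin p → Bool) → ⊕.sum (λ i → t i ∧ b) ≡ ⊕.sum t ∧ b
    sum-∧ {zero}  b t = refl
    sum-∧ {suc p} b t = trans (cong ((t zero ∧ b) xor_) (sum-∧ b (t ∘ suc))) (sym (Bool.∧-distribʳ-xor b (t zero) (⊕.sum (t ∘ suc))))

  dot-comm : ∀ es a b → dot es a b ≡ dot es b a
  dot-comm []       a b = refl
  dot-comm (e ∷ es) a b = cong₂ _xor_ (Bool.∧-comm (a e) (b e)) (dot-comm es a b)

  private
    dot-comb : ∀ es {p} (x : Fin p → Bool) a b → dot es (comb x a) b ≡ ⊕.sum (λ i → x i ∧ dot es (a i) b)
    dot-comb [] x a b = sym (sum-0 (λ i → Bool.∧-zeroʳ (x i)))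
    dot-comb (e ∷ es) x a b = trans (cong₂ _xor_ (sym (sum-∧ (b e) (λ i → x i ∧ a i e))) (dot-comb es x a b))
      (trans (sym (⊕.∑-distrib-+ (λ i → (x i ∧ a i e) ∧ b e) (λ i → x i ∧ dot es (a i) b)))
             (⊕.sum-cong-≗ (λ i → trans (cong (_xor (x i ∧ dot es (a i) b)) (Bool.∧-assoc (x i) (a i e) (b e))) (sym (Bool.∧-distribˡ-xor (x i) (a i e ∧ b e) (dot es (a i) b))))))

    dot-xor : ∀ es a b c → dot es a (λ e → b e xor c e) ≡ dot es a b xor dot es a c
    dot-xor []       a b c = refl
    dot-xor (e ∷ es) a b c = trans (cong₂ _xor_ (Bool.∧-distribˡ-xor (a e) (b e) (c e)) (dot-xor es a b c)) (xor-swap (a e ∧ b e) (a e ∧ c e) (dot es a b) (dot es a c))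

    dot-∧ : ∀ es a s b → dot es a (λ e → s ∧ b e) ≡ s ∧ dot es a b
    dot-∧ es a true  b = refl
    dot-∧ [] a false b = refl
    dot-∧ (e ∷ es) a false b = cong₂ _xor_ (Bool.∧-zeroʳ (a e)) (dot-∧ es a false b)

  -- Gaussian elimination at the coordinate e with pivot b j.
  module Pivot (e : X) (es : List X) {p q : ℕ} (a : Fin p → X → Bool) (b : Fin (suc q) → X → Bool) (ia : Indep (e ∷ es) a) (ib : Indep (e ∷ es) b)
               (ab : ∀ i j → dot (e ∷ es) (a i) (b j) ≡ false) (j : Fin (suc q)) (bj : b j e ≡ true) where
    b' : Fin q → X → Bool
    b' i x = b (punchIn j i) x xor (b (punchIn j i) e ∧ b j x)

    b'e : ∀ i → b' i e ≡ false
    b'e i = trans (cong (λ z → b (punchIn j i) e xor (b (punchIn j i) e ∧ z)) bj) (trans (cong (b (punchIn j i) e xor_) (Bool.∧-identityʳ _)) (Bool.xor-same (b (punchIn j i) e)))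

    -- Orthogonality to `b j`, whose coordinate at `e` is one, determines the coordinate at `e` of a
    -- combination of the `a i` from the others. A combination that vanishes on `es` thus vanishes
    -- at `e` too.
    ia' : Indep es a
    ia' x h = ia x λ { (here refl) → at-e ; (there m) → h m }
      where
      rest : ∀ es → (∀ {f} → f ∈ˡ es → comb x a f ≡ false) → dot es (comb x a) (b j) ≡ false
      rest [] h = refl
      rest (f ∷ fs) h = cong₂ _xor_ (cong (_∧ b j f) (h (here refl))) (rest fs (h ∘ there))
      at-e : comb x a e ≡ false
      at-e = trans (sym (trans (cong₂ _xor_ (trans (cong (comb x a e ∧_) bj) (Bool.∧-identityʳ _)) (rest es h)) (Bool.xor-identityʳ _)))
                   (trans (dot-comb (e ∷ es) x a (b j)) (sum-0 (λ i → trans (cong (x i ∧_) (ab i j)) (Bool.∧-zeroʳ (x i)))))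

    ib' : Indep es b'
    ib' x h i = trans (sym (Vector.insertAt-punchIn x j s i)) (ib y (λ m → trans (eq _) (all m)) (punchIn j i))
      where
      s = ⊕.sum (λ i → x i ∧ b (punchIn j i) e)
      y = Vector.insertAt x j s
      all : ∀ {f} → f ∈ˡ e ∷ es → comb x b' f ≡ false
      all (here refl) = sum-0 (λ i → trans (cong (x i ∧_) (b'e i)) (Bool.∧-zeroʳ (x i)))
      all (there m) = h m
      eq : ∀ f → comb y b f ≡ comb x b' f
      eq f = trans (⊕.sum-remove {q} {j} (λ i → y i ∧ b i f)) (trans (cong₂ _xor_
              (trans (cong (_∧ b j f) (Vector.insertAt-lookup x j s)) (sym (sum-∧ (b j f) (λ i → x i ∧ b (punchIn j i) e))))
              (⊕.sum-cong-≗ (λ i → cong (_∧ b (punchIn j i) f) (Vector.insertAt-punchIn x j s i))))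
            (trans (sym (⊕.∑-distrib-+ (λ i → (x i ∧ b (punchIn j i) e) ∧ b j f) (λ i → x i ∧ b (punchIn j i) f)))
              (⊕.sum-cong-≗ (λ i → trans (Bool.xor-comm _ (x i ∧ b (punchIn j i) f)) (trans (cong ((x i ∧ b (punchIn j i) f) xor_) (Bool.∧-assoc (x i) (b (punchIn j i) e) (b j f)))
                 (sym (Bool.∧-distribˡ-xor (x i) (b (punchIn j i) f) (b (punchIn j i) e ∧ b j f))))))))

    ab' : ∀ i l → dot es (a i) (b' l) ≡ false
    ab' i l = trans (sym (trans (cong (λ z → (a i e ∧ z) xor dot es (a i) (b' l)) (b'e l)) (cong (_xor dot es (a i) (b' l)) (Bool.∧-zeroʳ (a i e)))))
      (trans (dot-xor (e ∷ es) (a i) (b (punchIn j l)) (λ f → b (punchIn j l) e ∧ b j f))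
        (cong₂ _xor_ (ab i (punchIn j l)) (trans (dot-∧ (e ∷ es) (a i) (b (punchIn j l) e) (b j)) (trans (cong (b (punchIn j l) e ∧_) (ab i j)) (Bool.∧-zeroʳ _)))))

  -- The dimensions of a subspace and of its orthogonal complement add up to the number of
  -- coordinates. Each pivot removes one coordinate and one vector of one family, and a coordinate
  -- without pivot is dropped.
  orthogonal-bound : ∀ es {p q} (a : Fin p → X → Bool) (b : Fin q → X → Bool) → Indep es a → Indep es b →
                     (∀ i j → dot es (a i) (b j) ≡ false) → p + q ≤ length es
  orthogonal-bound [] {zero}  {zero}  a b ia ib ab = z≤n
  orthogonal-bound [] {suc p} {q}     a b ia ib ab = case ia (λ _ → true) (λ ()) zero of λ ()
  orthogonal-bound [] {zero}  {suc q} a b ia ib ab = case ib (λ _ → true) (λ ()) zero of λ ()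
  orthogonal-bound (e ∷ es) {p} {q} a b ia ib ab with Fin.any? (λ j → b j e Bool.≟ true) | Fin.any? (λ i → a i e Bool.≟ true)
  orthogonal-bound (e ∷ es) {p} {suc q} a b ia ib ab | yes (j , bj) | _ =
      ≤-trans (≤-reflexive (+-suc p q)) (s≤s (orthogonal-bound es a b' ia' ib' ab'))
    where open Pivot e es a b ia ib ab j bj
  orthogonal-bound (e ∷ es) {suc p} {q} a b ia ib ab | no _ | yes (i , ai) =
      s≤s (≤-trans (≤-reflexive (+-comm p q)) (orthogonal-bound es b b' ia' ib' ab'))
    where open Pivot e es b a ib ia (λ j i → trans (dot-comm (e ∷ es) (b j) (a i)) (ab i j)) i ai
  orthogonal-bound (e ∷ es) a b ia ib ab | no nb | no na =
      m≤n⇒m≤1+n (orthogonal-bound es a b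
        (λ x h → ia x λ { (here refl) → sum-0 (λ i → trans (cong (x i ∧_) (a0 i)) (Bool.∧-zeroʳ (x i))) ; (there m) → h m })
        (λ x h → ib x λ { (here refl) → sum-0 (λ i → trans (cong (x i ∧_) (b0 i)) (Bool.∧-zeroʳ (x i))) ; (there m) → h m })
        (λ i j → trans (cong (λ z → (z ∧ b j e) xor dot es (a i) (b j)) (sym (a0 i))) (ab i j)))
    where
    a0 : ∀ i → a i e ≡ false
    a0 i = ¬t→f (λ p → na (i , p))
    b0 : ∀ i → b i e ≡ false
    b0 i = ¬t→f (λ p → nb (i , p))

sum-↑ : ∀ m {k} (t : Fin (m + k) → Bool) → ⊕.sum t ≡ ⊕.sum (λ i → t (i ↑ˡ k)) xor ⊕.sum (λ i → t (m ↑ʳ i))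
sum-↑ zero    t = refl
sum-↑ (suc m) t = trans (cong (t zero xor_) (sum-↑ m (t ∘ suc))) (sym (Bool.xor-assoc (t zero) _ _))

⊕-zero : ∀ {p} {t : Fin p → Bool} → (∀ i → t i ≡ false) → ⊕.sum t ≡ false
⊕-zero {p} h = trans (⊕.sum-cong-≗ h) (⊕.sum-replicate-zero p)

≟-refl : ∀ {p} (j : Fin p) → does (j Fin.≟ j) ≡ true
≟-refl j = dec-true (j Fin.≟ j) refl

⊕-pick : ∀ {p} (x : Fin p → Bool) j (c : Fin p → Bool) → c j ≡ true → (∀ i → i ≢ j → c i ≡ false) → ⊕.sum (λ i → x i ∧ c i) ≡ x j
⊕-pick {suc p} x j c cj co = trans (⊕.sum-remove {p} {j} (λ i → x i ∧ c i))
    (trans (cong₂ _xor_ (trans (cong (x j ∧_) cj) (Bool.∧-identityʳ (x j))) (⊕-zero (λ i → trans (cong (x (punchIn j i) ∧_) (co _ (Fin.punchInᵢ≢i j i))) (Bool.∧-zeroʳ _))))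
      (Bool.xor-identityʳ (x j)))

⊕-delta : ∀ {p} (x : Fin p → Bool) j → ⊕.sum (λ i → x i ∧ does (j Fin.≟ i)) ≡ x j
⊕-delta x j = ⊕-pick x j (λ i → does (j Fin.≟ i)) (≟-refl j) (λ i ne → dec-false (j Fin.≟ i) (λ e → ne (sym e)))

module _ {n : ℕ} {M : Map n} where
  open Map M
  open Cycles M

  after : ∀ {ds u e} → DWalk u u ds → e ∈ˡ ds → ∃ λ a → a ∈ˡ ds × tail a ≡ head e
  after {d ∷ ds} {u} {e} (refl ∷ w) m with ∈-map⁻ tail (unshift (subst (head e ∈ˡ_) (sym (tails-heads w)) (∈-map⁺ head m)))
    where
    unshift : ∀ {x} → x ∈ˡ map tail ds ++ tail d ∷ [] → x ∈ˡ tail d ∷ map tail ds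
    unshift {x} m = go (map tail ds) m
      where
      go : ∀ xs → x ∈ˡ xs ++ tail d ∷ [] → x ∈ˡ tail d ∷ xs
      go [] (here p) = here p
      go (y ∷ ys) (here p) = there (here p)
      go (y ∷ ys) (there m) with go ys m
      ... | here p = here p
      ... | there m' = there (there m')
  ... | a , a∈ , eq = a , a∈ , sym eq

record SimpleCycle {n : ℕ} (M : Map n) : Set where
  open Map M
  field
    {u} : Fin n
    ds  : List D
    w   : DWalk u u ds
    uq  : Unique (map tail ds)

-- The left side of a simple closed walk: a function on corners that changes across exactly its edges
-- and vanishes at the other vertices.
module Left {n : ℕ} (M : Map n) (c : SimpleCycle M) where
  open Map M
  open Cycles M
  open SimpleCycle c

  private
    occ-∉ : ∀ {ds f} → ¬ (f ∈ˡ ds) → occ ds f ≡ false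
    occ-∉ {[]}     h = refl
    occ-∉ {e ∷ ds} h = cong₂ _xor_ (eqb-≢ (λ p → h (here (sym p)))) (occ-∉ (h ∘ there))

    occ-∈ : ∀ {ds f} → Unique (map tail ds) → f ∈ˡ ds → occ ds f ≡ true
    occ-∈ {e ∷ ds} (p ∷ ps) (here refl) = cong₂ _xor_ (eqb-refl e) (occ-∉ (λ m → All.lookup p (∈-map⁺ tail m) refl))
    occ-∈ {e ∷ ds} (p ∷ ps) (there m) = cong₂ _xor_ (eqb-≢ (λ { refl → All.lookup p (∈-map⁺ tail m) refl })) (occ-∈ ps m)

    hq : Unique (map head ds)
    hq = heads-unique w uq

    before : ∀ {ds u e} → DWalk u u ds → e ∈ˡ ds → ∃ λ p → p ∈ˡ ds × head p ≡ tail e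
    before {d ∷ ds} {u} {e} (refl ∷ w) m with ∈-map⁻ head (subst (tail e ∈ˡ_) (tails-heads w) (shift (∈-map⁺ tail m)))
      where
      shift : ∀ {x} → x ∈ˡ tail d ∷ map tail ds → x ∈ˡ map tail ds ++ tail d ∷ []
      shift (here p)  = ∈-++⁺ʳ (map tail ds) (here p)
      shift (there m) = ∈-++⁺ˡ m
    ... | p , p∈ , eq = p , p∈ , sym eq

    -- Rotating from a dart, the outgoing dart a of the cycle is met before the incoming one b, or conversely.
    data First (a b : D) : D → Bool → Set where
      out  : First a b a true
      into : b ≢ a → First a b b false
      pass : ∀ {d s} → d ≢ a → d ≢ b → First a b (ρ d) s → First a b d s

    first-unique : ∀ {a b d s t} → First a b d s → First a b d t → s ≡ t
    first-unique out           out           = refl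
    first-unique out           (into ne)     = ⊥-elim (ne refl)
    first-unique out           (pass n₁ _ _) = ⊥-elim (n₁ refl)
    first-unique (into ne)     out           = ⊥-elim (ne refl)
    first-unique (into _)      (into _)      = refl
    first-unique (into _)      (pass _ n₂ _) = ⊥-elim (n₂ refl)
    first-unique (pass n₁ _ _) out           = ⊥-elim (n₁ refl)
    first-unique (pass _ n₂ _) (into _)      = ⊥-elim (n₂ refl)
    first-unique (pass _ _ p)  (pass _ _ q)  = first-unique p q

    first : ∀ a b k d → iter k ρ d ≡ a → ∃ (First a b d)
    first a b zero    d refl = true , out
    first a b (suc k) d it with d ≟D a | d ≟D b
    ... | yes refl | _ = true , out
    ... | no n₁ | yes refl = false , into n₁
    ... | no n₁ | no n₂ with first a b k (ρ d) (trans (iter-suc ρ k d) it)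
    ...   | s , p = s , pass n₁ n₂ p

    -- If the answer from ρ a were "out first", it would be so at every dart of the vertex, including b.
    constant : ∀ {a b s} → (∀ {d} → First a b d s → First a b (ρ d) s) → ∀ k {d} → First a b d s → First a b (iter k ρ d) s
    constant h zero    p = p
    constant h (suc k) p = h (constant h k p)

    -- A relation with unique values instead of the search itself, so that the behaviour of `L`
    -- under `ρ` follows by exhibiting a derivation at `ρ d`.
    data At (d : D) (s : Bool) : Set where
      away : (∀ {e} → e ∈ˡ ds → tail e ≢ tail d) → s ≡ false → At d s
      on   : ∀ {a p} → a ∈ˡ ds → p ∈ˡ ds → tail a ≡ tail d → head p ≡ tail a → First a (rev p) d s → At d s

    at-unique : ∀ {d s t} → At d s → At d t → s ≡ t
    at-unique (away _ refl) (away _ refl) = refl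
    at-unique (away h _) (on a∈ _ ta _ _) = ⊥-elim (h a∈ ta)
    at-unique (on a∈ _ ta _ _) (away h _) = ⊥-elim (h a∈ ta)
    at-unique (on a∈ p∈ ta hp f) (on a'∈ p'∈ ta' hp' f') with uniq-inj uq a∈ a'∈ (trans ta (sym ta'))
    ... | refl with uniq-inj hq p∈ p'∈ (trans hp (sym hp'))
    ...   | refl = first-unique f f'

    at : ∀ d → ∃ (At d)
    at d with Any.any? (λ e → tail e Fin.≟ tail d) ds
    ... | no none = false , away (λ m e → All.lookup (¬Any⇒All¬ ds none) m e) refl
    ... | yes some with find some
    ...   | a , a∈ , ta with before w a∈ | cyclic d a (sym ta)
    ...     | p , p∈ , hp | k , it = _ , on a∈ p∈ ta hp (proj₂ (first a (rev p) k d it))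

  L : D → Bool
  L d = proj₁ (at d)

  L-off : ∀ {d} → (∀ {e} → e ∈ˡ ds → tail e ≢ tail d) → L d ≡ false
  L-off {d} h = at-unique (proj₂ (at d)) (away h refl)

  -- Passing the outgoing or the incoming dart of the cycle exchanges which of them is met next. If
  -- the cycle returns along the same edge, the two darts coincide and the two changes cancel, as do
  -- the two contributions to `cnt`.
  L-ρ : ∀ d → L (ρ d) ≡ L d xor cnt ds d
  L-ρ d = at-unique (proj₂ (at (ρ d))) (step (proj₂ (at d)))
    where
    cnt-occ : ∀ {s t} → occ ds d ≡ s → occ ds (rev d) ≡ t → cnt ds d ≡ s xor t
    cnt-occ refl refl = sym (occ-cnt ds d)
    step : ∀ {s} → At d s → At (ρ d) (s xor cnt ds d)
    step (away h refl) = away (λ m e → h m (trans e (tail-ρ d))) (¬t→f λ p → case cnt-∈ ds p of λ where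
      (g , g∈ , inj₁ refl) → h g∈ refl
      (g , g∈ , inj₂ refl) → let (a , a∈ , ta) = after {M = M} w g∈ in h a∈ ta)
    step (on {a} {p} a∈ p∈ ta hp f) = on a∈ p∈ (trans ta (sym (tail-ρ d))) hp (move f)
      where
      b = rev p
      tb : tail b ≡ tail a
      tb = hp
      orbit : ∀ e → tail e ≡ tail a → ∃ λ k → iter k ρ (ρ d) ≡ e
      orbit e te = cyclic (ρ d) e (trans (tail-ρ d) (trans (sym ta) (sym te)))
      total : ∃ (First a b (ρ d))
      total = first a b (proj₁ (orbit a refl)) (ρ d) (proj₂ (orbit a refl))
      rev-∈ : ∀ {e} → e ∈ˡ ds → rev e ∈ˡ ds → tail e ≡ tail a → a ≡ b
      rev-∈ {e} e∈ r∈ te = trans (uniq-inj uq a∈ e∈ (sym te)) (trans (sym (rev-rev e)) (cong rev (uniq-inj hq r∈ p∈ (trans (head-rev e) (trans te (sym hp))))))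
      move : ∀ {s} → First a b d s → First a b (ρ d) (s xor cnt ds d)
      move out with a ≟D b
      ... | yes refl = subst (First b b (ρ b)) (sym (cong not (cnt-occ (occ-∈ uq a∈) (occ-∈ uq (subst (_∈ˡ ds) (sym (rev-rev p)) p∈))))) (go total)
        where
        go : ∃ (First b b (ρ b)) → First b b (ρ b) true
        go (true , f) = f
        go (false , f) = ⊥-elim (no-in f)
          where
          no-in : ∀ {d} → First b b d false → ⊥
          no-in (into ne) = ne refl
          no-in (pass _ _ f) = no-in f
      ... | no a≢b = subst (First a b (ρ a)) (sym (cong not (cnt-occ (occ-∈ uq a∈) (occ-∉ λ r∈ → a≢b (rev-∈ a∈ r∈ refl))))) (go total)
        where
        go : ∃ (First a b (ρ a)) → First a b (ρ a) false
        go (false , f) = f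
        go (true , f) = ⊥-elim (absurd (subst (λ z → First a b z true) (proj₂ (orbit b tb)) (constant closed (proj₁ (orbit b tb)) f)))
          where
          closed : ∀ {e} → First a b e true → First a b (ρ e) true
          closed out = f
          closed (pass _ _ g) = g
          absurd : First a b b true → ⊥
          absurd g = case first-unique g (into (λ e → a≢b (sym e))) of λ ()
      move (into b≢a) = subst (First a b (ρ b)) (sym (cnt-occ (occ-∉ λ b∈ → b≢a (sym (uniq-inj uq a∈ b∈ (sym tb)))) (trans (cong (occ ds) (rev-rev p)) (occ-∈ uq p∈)))) (go total)
        where
        go : ∃ (First a b (ρ b)) → First a b (ρ b) true
        go (true , f) = f
        go (false , f) = ⊥-elim (absurd (subst (λ z → First a b z false) (proj₂ (orbit a refl)) (constant closed (proj₁ (orbit a refl)) f)))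
          where
          closed : ∀ {e} → First a b e false → First a b (ρ e) false
          closed (into _) = f
          closed (pass _ _ g) = g
          absurd : First a b a false → ⊥
          absurd g = case first-unique g out of λ ()
      move {s} (pass n₁ n₂ g) = subst (First a b (ρ d)) (sym (trans (cong (s xor_) none) (Bool.xor-identityʳ s))) g
        where
        none : cnt ds d ≡ false
        none = ¬t→f λ q → case cnt-∈ ds q of λ where
          (e , e∈ , inj₁ refl) → n₁ (uniq-inj uq e∈ a∈ (sym ta))
          (e , e∈ , inj₂ refl) → n₂ (cong rev (uniq-inj hq e∈ p∈ (trans (sym ta) (sym hp))))

  -- A cycle does not cross its own left push-off.
  self : Σw (λ d → L d xor L (φ d)) ds ≡ false
  self = go w id
    where
    next : ∀ {e e'} → e ∈ˡ ds → e' ∈ˡ ds → head e ≡ tail e' → L (φ e) ≡ L e'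
    next = turn w uq L L-ρ
    tele : ∀ {u v es} e₀ e₁ → e₀ ∈ˡ ds → e₁ ∈ˡ ds → head e₀ ≡ u → tail e₁ ≡ v → DWalk u v es → (∀ {e} → e ∈ˡ es → e ∈ˡ ds) → Σw (λ d → L d xor L (φ d)) es ≡ L (φ e₀) xor L e₁
    tele e₀ e₁ m₀ m₁ hu tv [] sub = sym (trans (cong (_xor L e₁) (next m₀ m₁ (trans hu (sym tv)))) (Bool.xor-same (L e₁)))
    tele e₀ e₁ m₀ m₁ hu tv (_∷_ {d = e} p w) sub = trans (cong₂ _xor_ (cong (_xor L (φ e)) (sym (next m₀ (sub (here refl)) (trans hu (sym p))))) (tele e e₁ (sub (here refl)) m₁ refl tv w (sub ∘ there))) (xor-cancel (L (φ e₀)) (L (φ e)) (L e₁))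
    go : ∀ {es u} → DWalk u u es → (∀ {e} → e ∈ˡ es → e ∈ˡ ds) → Σw (λ d → L d xor L (φ d)) es ≡ false
    go [] sub = refl
    go (_∷_ {d = e} refl w) sub = trans (cong ((L e xor L (φ e)) xor_) (tele e e (sub (here refl)) (sub (here refl)) refl refl w (sub ∘ there))) (trans (xor-cancel (L e) (L (φ e)) (L e)) (Bool.xor-same (L e)))

module ⊞ = MonoidSum +-0-commutativeMonoid

record Cellular {n : ℕ} (M : Map n) : Set where
  open Map M
  open Sides M
  open Paths _~_ ~sym _~?_ using (W)
  field
    faces    : ℕ
    face     : D → Fin faces
    face-sur : ∀ i → ∃ λ d → face d ≡ i
    face-φ   : ∀ d → face (φ d) ≡ face d
    comps    : ℕ
    comp     : Fin n → Fin comps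
    base     : Fin comps → Fin n
    comp-base : ∀ j → comp (base j) ≡ j
    joined   : ∀ {u v} → comp u ≡ comp v → ∃ λ m → W (λ _ → true) u v m
    isolated : ℕ
    lone     : Fin isolated → Fin n
    lone-inj : ∀ {i j} → lone i ≡ lone j → i ≡ j
    lone-no  : ∀ i d → tail d ≢ lone i

module Genus {n : ℕ} (M : Map n) (cell : Cellular M) where
  open Map M
  open Cycles M
  open Sides M
  open Enum enum
  open Cellular cell
  open Paths _~_ ~sym _~?_ using (W; nil; cons)

  Independent : {k : ℕ} → (Fin k → SimpleCycle M) → Set
  Independent {k} C = ∀ y → Bounds (comb y (λ i → cnt (SimpleCycle.ds (C i)))) → ∀ i → y i ≡ false

  Disjoint : {k : ℕ} → (Fin k → SimpleCycle M) → Set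
  Disjoint C = ∀ i j → i ≢ j → ∀ {d e} → d ∈ˡ SimpleCycle.ds (C i) → e ∈ˡ SimpleCycle.ds (C j) → tail d ≢ tail e

  private
    halfOf : ∀ {N} → (Fin N → D) → List D
    halfOf {zero}  g = []
    halfOf {suc N} g = if less (g zero) then g zero ∷ halfOf (g ∘ suc) else halfOf (g ∘ suc)

    half : List D
    half = halfOf from

    half-∈ : ∀ {N} (g : Fin N → D) i → less (g i) ≡ true → g i ∈ˡ halfOf g
    half-∈ g zero p rewrite p = here refl
    half-∈ g (suc i) p with less (g zero)
    ... | true  = there (half-∈ (g ∘ suc) i p)
    ... | false = half-∈ (g ∘ suc) i p

    b2n : Bool → ℕ
    b2n b = if b then 1 else 0

    half-length : ∀ {N} (g : Fin N → D) → length (halfOf g) ≡ ⊞.sum (λ i → b2n (less (g i)))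
    half-length {zero}  g = refl
    half-length {suc N} g with less (g zero)
    ... | true  = cong suc (half-length (g ∘ suc))
    ... | false = half-length (g ∘ suc)

    half-count : length half + length half ≡ size
    half-count = trans (cong₂ _+_ (half-length from) (trans (half-length from) swap)) (trans (sym (⊞.∑-distrib-+ (λ i → b2n (less (from i))) (λ i → b2n (less (rev (from i))))))
        (trans (⊞.sum-cong-≗ (λ i → trans (cong (λ z → b2n (less (from i)) + b2n z) (less-rev (from i))) (one (less (from i))))) (ones size)))
      where
      ones : ∀ m → ⊞.sum {m} (λ _ → 1) ≡ m
      ones zero = refl
      ones (suc m) = cong suc (ones m)
      one : ∀ b → b2n b + b2n (not b) ≡ 1
      one true  = refl
      one false = refl
      perm : Permutation size size
      perm = permutation (to ∘ rev ∘ from) (to ∘ rev ∘ from) (λ i → trans (cong (to ∘ rev) (from-to _)) (trans (cong to (rev-rev _)) (to-from i)))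
               (λ i → trans (cong (to ∘ rev) (from-to _)) (trans (cong to (rev-rev _)) (to-from i)))
      swap : ⊞.sum (λ i → b2n (less (from i))) ≡ ⊞.sum (λ i → b2n (less (rev (from i))))
      swap = trans (⊞.sum-permute (λ i → b2n (less (from i))) perm) (⊞.sum-cong-≗ {size} (λ i → cong (b2n ∘ less) (from-to (rev (from i)))))

    half-dot : ∀ a b → dot half a b ≡ ΣD (λ d → less d ∧ (a d ∧ b d))
    half-dot a b = trans (go from) (sym (Σ-def _))
      where
      go : ∀ {N} (g : Fin N → D) → dot (halfOf g) a b ≡ ⊕.sum (λ i → less (g i) ∧ (a (g i) ∧ b (g i)))
      go {zero} g = refl
      go {suc N} g with less (g zero)
      ... | true  = cong ((a (g zero) ∧ b (g zero)) xor_) (go (g ∘ suc))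
      ... | false = go (g ∘ suc)

    on-half : ∀ {f : D → Bool} → (∀ d → f (rev d) ≡ f d) → (∀ {d} → d ∈ˡ half → f d ≡ false) → ∀ d → f d ≡ false
    on-half {f} fr h d with less d in eq
    ... | true  = h (subst (_∈ˡ half) (from-to d) (half-∈ from (to d) (trans (cong less (from-to d)) eq)))
    ... | false = trans (sym (fr d)) (h (subst (_∈ˡ half) (from-to (rev d)) (half-∈ from (to (rev d)) (trans (cong less (from-to (rev d))) (trans (less-rev d) (cong not eq))))))

    Sym : (D → Bool) → Set
    Sym c = ∀ d → c (rev d) ≡ c d

    -- The pairing uses one dart per edge; since `c` is symmetric, the term at `rev d` can be
    -- charged to the other dart, which gives a sum over all darts.
    pair-boundary : ∀ (S c : D → Bool) → Sym c → dot half (λ d → S d xor S (rev d)) c ≡ ΣD (λ d → S d ∧ c d)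
    pair-boundary S c sc = trans (half-dot _ c) (trans (Σ-cong (λ d → expand (less d) (S d) (S (rev d)) (c d)))
        (trans (Σ-xor (λ d → less d ∧ (S d ∧ c d)) (λ d → less d ∧ (S (rev d) ∧ c d)))
        (trans (cong (ΣD (λ d → less d ∧ (S d ∧ c d)) xor_) swap)
        (trans (sym (Σ-xor (λ d → less d ∧ (S d ∧ c d)) (λ d → not (less d) ∧ (S d ∧ c d)))) (Σ-cong (λ d → whole (less d) (S d ∧ c d)))))))
      where
      expand : ∀ l a b c → l ∧ ((a xor b) ∧ c) ≡ (l ∧ (a ∧ c)) xor (l ∧ (b ∧ c))
      expand l a b c = trans (cong (l ∧_) (Bool.∧-distribʳ-xor c a b)) (Bool.∧-distribˡ-xor l (a ∧ c) (b ∧ c))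
      whole : ∀ l x → (l ∧ x) xor (not l ∧ x) ≡ x
      whole true  x = Bool.xor-identityʳ x
      whole false x = refl
      swap : ΣD (λ d → less d ∧ (S (rev d) ∧ c d)) ≡ ΣD (λ d → not (less d) ∧ (S d ∧ c d))
      swap = trans (Σ-cong (λ d → cong₂ _∧_ (sym (trans (cong not (less-rev d)) (Bool.not-involutive (less d)))) (cong (S (rev d) ∧_) (sym (sc d)))))
                   (Σ-bij (λ d → not (less d) ∧ (S d ∧ c d)) rev rev rev-rev rev-rev)

    pair-walk : ∀ ds c → Sym c → dot half (cnt ds) c ≡ Σw c ds
    pair-walk ds c sc = trans (dot-cong {half} {cnt ds} {λ d → occ ds d xor occ ds (rev d)} (λ d → sym (occ-cnt ds d))) (trans (pair-boundary (occ ds) c sc) (sym (Σ-occ c ds)))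
      where
      dot-cong : ∀ {es a a'} → (∀ d → a d ≡ a' d) → dot es a c ≡ dot es a' c
      dot-cong {[]}     h = refl
      dot-cong {e ∷ es} h = cong₂ _xor_ (cong (_∧ c e) (h e)) (dot-cong {es} h)

    -- Cochains of the form g + g∘φ vanish on all face boundaries.
    δ : (D → Bool) → D → Bool
    δ g d = g d xor g (φ d)

    closed-δ : ∀ (S g : D → Bool) → (∀ d → S (φ d) ≡ S d) → ΣD (λ d → S d ∧ δ g d) ≡ false
    closed-δ S g sφ = trans (Σ-cong (λ d → Bool.∧-distribˡ-xor (S d) (g d) (g (φ d)))) (trans (Σ-xor (λ d → S d ∧ g d) (λ d → S d ∧ g (φ d)))
      (trans (cong (ΣD (λ d → S d ∧ g d) xor_) (trans (Σ-cong (λ d → cong (_∧ g (φ d)) (sym (sφ d)))) (Σ-bij (λ d → S d ∧ g d) φ φ⁻¹ φφ⁻¹ φ⁻¹φ))) (Bool.xor-same (ΣD (λ d → S d ∧ g d)))))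

    full : VSet n
    full _ = true

    isF : Fin faces → D → Bool
    isF i d = does (face d Fin.≟ i)

    isV : Fin n → D → Bool
    isV v d = does (tail d Fin.≟ v)

    isF-φ : ∀ i d → isF i (φ d) ≡ isF i d
    isF-φ i d = cong (λ z → does (z Fin.≟ i)) (face-φ d)

    isV-φ : ∀ v d → isV v (φ d) ≡ isV v (rev d)
    isV-φ v d = cong (λ z → does (z Fin.≟ v)) (tail-φ d)

    sym-δV : ∀ v → Sym (δ (isV v))
    sym-δV v d = trans (cong (isV v (rev d) xor_) (trans (isV-φ v (rev d)) (cong (isV v) (rev-rev d))))
                   (trans (Bool.xor-comm (isV v (rev d)) (isV v d)) (cong (isV v d xor_) (sym (isV-φ v d))))

  module _ {k : ℕ} (C : Fin k → SimpleCycle M) (ind : Independent C) (dis : Disjoint C) where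
    private
      module C i = SimpleCycle (C i)
      module L i = Left M (C i)

      ci : Fin k → D → Bool
      ci i = cnt (C.ds i)

      L-φ : ∀ i d → L.L i (φ d) ≡ L.L i (rev d) xor ci i d
      L-φ i d = trans (L.L-ρ i (rev d)) (cong (L.L i (rev d) xor_) (cnt-rev (C.ds i) d))

      sym-δL : ∀ i → Sym (δ (L.L i))
      sym-δL i d = trans (cong (L.L i (rev d) xor_) (trans (L-φ i (rev d)) (cong₂ _xor_ (cong (L.L i) (rev-rev d)) (cnt-rev (C.ds i) d))))
        (trans (sym (Bool.xor-assoc (L.L i (rev d)) (L.L i d) (ci i d))) (trans (cong (_xor ci i d) (Bool.xor-comm (L.L i (rev d)) (L.L i d)))
          (trans (Bool.xor-assoc (L.L i d) (L.L i (rev d)) (ci i d)) (cong (L.L i d xor_) (sym (L-φ i d))))))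

      -- Coordinates: half of the darts, and two copies of the set of components.
      X : Set
      X = D ⊎ (Fin comps ⊎ Fin comps)

      coords : List X
      coords = map inj₁ half ++ (map (inj₂ ∘ inj₁) (tabulate id) ++ map (inj₂ ∘ inj₂) (tabulate id))

      baseDart : ∀ j → Dec (∃ λ d → tail d ≡ base j)
      baseDart j = any-D (λ d → tail d Fin.≟ base j)

      rooted : ∀ {j} → Dec (∃ λ d → tail d ≡ base j) → Fin faces → Bool
      rooted (yes (d , _)) i = isF i d
      rooted (no _)        i = false

      -- The face boundaries of a component sum to zero. The extra coordinate, which records the
      -- face at a dart of the base vertex, removes this dependence. A component that is an isolated
      -- vertex has no such dart, and `aI` uses its coordinate for the extra face.
      aF : Fin faces → X → Bool
      aF i (inj₁ d)        = isF i d xor isF i (rev d)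
      aF i (inj₂ (inj₁ j)) = rooted (baseDart j) i
      aF i (inj₂ (inj₂ j)) = false

      aI : Fin isolated → X → Bool
      aI i (inj₁ d)        = false
      aI i (inj₂ (inj₁ j)) = does (comp (lone i) Fin.≟ j)
      aI i (inj₂ (inj₂ j)) = false

      aC : Fin k → X → Bool
      aC i (inj₁ d) = ci i d
      aC i (inj₂ _) = false

      -- The coboundaries of the vertices of a component sum to zero as well. A separate copy of the
      -- components marks the base vertices, so that the correction terms of the two families stay
      -- orthogonal.
      bV : Fin n → X → Bool
      bV v (inj₁ d)        = δ (isV v) d
      bV v (inj₂ (inj₁ j)) = false
      bV v (inj₂ (inj₂ j)) = does (base j Fin.≟ v)

      bC : Fin k → X → Bool
      bC i (inj₁ d) = δ (L.L i) d
      bC i (inj₂ _) = false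

      a₂ : Fin isolated ⊎ Fin k → X → Bool
      a₂ = [ aI , aC ]′

      a : Fin (faces + (isolated + k)) → X → Bool
      a i = [ aF , (λ j → a₂ (splitAt isolated j)) ]′ (splitAt faces i)

      b : Fin (n + k) → X → Bool
      b i = [ bV , bC ]′ (splitAt n i)

      comb-a : ∀ (x : Fin (faces + (isolated + k)) → Bool) e → comb x a e ≡
               comb (λ i → x (i ↑ˡ (isolated + k))) aF e xor (comb (λ i → x (faces ↑ʳ (i ↑ˡ k))) aI e xor comb (λ i → x (faces ↑ʳ (isolated ↑ʳ i))) aC e)
      comb-a x e = trans (sum-↑ faces _) (cong₂ _xor_ (⊕.sum-cong-≗ (λ i → cong (λ z → x (i ↑ˡ _) ∧ [ aF , (λ j → a₂ (splitAt isolated j)) ]′ z e) (Fin.splitAt-↑ˡ faces i (isolated + k))))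
        (trans (⊕.sum-cong-≗ (λ i → cong (λ z → x (faces ↑ʳ i) ∧ [ aF , (λ j → a₂ (splitAt isolated j)) ]′ z e) (Fin.splitAt-↑ʳ faces (isolated + k) i)))
          (trans (sum-↑ isolated _) (cong₂ _xor_ (⊕.sum-cong-≗ (λ i → cong (λ z → x (faces ↑ʳ (i ↑ˡ k)) ∧ a₂ z e) (Fin.splitAt-↑ˡ isolated i k)))
                                                 (⊕.sum-cong-≗ (λ i → cong (λ z → x (faces ↑ʳ (isolated ↑ʳ i)) ∧ a₂ z e) (Fin.splitAt-↑ʳ isolated k i)))))))

      comb-b : ∀ (y : Fin (n + k) → Bool) e → comb y b e ≡ comb (λ i → y (i ↑ˡ k)) bV e xor comb (λ i → y (n ↑ʳ i)) bC e
      comb-b y e = trans (sum-↑ n _) (cong₂ _xor_ (⊕.sum-cong-≗ (λ i → cong (λ z → y (i ↑ˡ k) ∧ [ bV , bC ]′ z e) (Fin.splitAt-↑ˡ n i k)))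
                                                  (⊕.sum-cong-≗ (λ i → cong (λ z → y (n ↑ʳ i) ∧ [ bV , bC ]′ z e) (Fin.splitAt-↑ʳ n k i))))

      ∈-dart : ∀ {d} → d ∈ˡ half → inj₁ d ∈ˡ coords
      ∈-dart m = ∈-++⁺ˡ (∈-map⁺ inj₁ m)

      ∈-left : ∀ j → inj₂ (inj₁ j) ∈ˡ coords
      ∈-left j = ∈-++⁺ʳ (map inj₁ half) (∈-++⁺ˡ (∈-map⁺ (inj₂ ∘ inj₁) (∈-tabulate⁺ j)))

      ∈-right : ∀ j → inj₂ (inj₂ j) ∈ˡ coords
      ∈-right j = ∈-++⁺ʳ (map inj₁ half) (∈-++⁺ʳ (map (inj₂ ∘ inj₁) (tabulate id)) (∈-map⁺ (inj₂ ∘ inj₂) (∈-tabulate⁺ j)))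

      length-coords : length coords ≡ length half + (comps + comps)
      length-coords = trans (length-++ (map inj₁ half) {copy inj₁ ++ copy inj₂}) (cong₂ _+_ (length-map inj₁ half)
          (trans (length-++ (copy inj₁) {copy inj₂}) (cong₂ _+_ (copies inj₁) (copies inj₂))))
        where
        copy : (Fin comps → Fin comps ⊎ Fin comps) → List X
        copy f = map (inj₂ ∘ f) (tabulate id)
        copies : ∀ f → length (copy f) ≡ comps
        copies f = trans (length-map (inj₂ ∘ f) (tabulate id)) (length-tabulate id)

      comb-0 : ∀ {p} (x : Fin p → Bool) {c : Fin p → X → Bool} {e} → (∀ i → c i e ≡ false) → comb x c e ≡ false
      comb-0 x h = ⊕-zero (λ i → trans (cong (x i ∧_) (h i)) (Bool.∧-zeroʳ (x i)))

      ↑-cases : ∀ p {q} {P : Fin (p + q) → Set} → (∀ i → P (i ↑ˡ q)) → (∀ i → P (p ↑ʳ i)) → ∀ i → P i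
      ↑-cases zero    l r i       = r i
      ↑-cases (suc p) l r zero    = l zero
      ↑-cases (suc p) {P = P} l r (suc i) = ↑-cases p {P = P ∘ suc} (l ∘ suc) r i

      const-walk : ∀ {u v m} (g : Fin n → Bool) → (∀ d → g (tail d) ≡ g (head d)) → W full u v m → g u ≡ g v
      const-walk g h (nil _) = refl
      const-walk g h (cons _ (d , refl , refl) w) = trans (h d) (const-walk g h w)

      -- A dependence makes the combination of the cycles the boundary of the face set `F`, so by
      -- independence no cycle occurs in it. Then `F` has no boundary and is constant on components,
      -- and the extra coordinates make it zero.
      indep-a : Indep coords a
      indep-a x h = ↑-cases faces {P = λ i → x i ≡ false} xF0 (↑-cases isolated {P = λ i → x (faces ↑ʳ i) ≡ false} xI0 xC0)
        where
        xF : Fin faces → Bool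
        xF i = x (i ↑ˡ (isolated + k))
        xI : Fin isolated → Bool
        xI i = x (faces ↑ʳ (i ↑ˡ k))
        xC : Fin k → Bool
        xC i = x (faces ↑ʳ (isolated ↑ʳ i))
        F : D → Bool
        F d = xF (face d)
        F-sum : ∀ d → comb xF isF d ≡ F d
        F-sum d = ⊕-delta xF (face d)
        at-dart : ∀ d → comb xF aF (inj₁ d) ≡ F d xor F (rev d)
        at-dart d = trans (⊕.sum-cong-≗ (λ i → Bool.∧-distribˡ-xor (xF i) (isF i d) (isF i (rev d))))
                     (trans (⊕.∑-distrib-+ (λ i → xF i ∧ isF i d) (λ i → xF i ∧ isF i (rev d))) (cong₂ _xor_ (F-sum d) (F-sum (rev d))))
        eq : ∀ d → (F d xor F (rev d)) xor comb xC ci d ≡ false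
        eq = on-half (λ d → cong₂ _xor_ (trans (cong (F (rev d) xor_) (cong F (rev-rev d))) (Bool.xor-comm (F (rev d)) (F d)))
                                        (⊕.sum-cong-≗ (λ i → cong (xC i ∧_) (cnt-rev (C.ds i) d))))
               (λ {d} m → trans (cong₂ _xor_ (sym (at-dart d)) (sym (cong (_xor comb xC ci d) (comb-0 xI {aI} {inj₁ d} (λ _ → refl))))) (trans (sym (comb-a x (inj₁ d))) (h (∈-dart m))))
        bounds : Bounds (comb xC ci)
        bounds = record { S = F ; S-φ = λ d → cong xF (face-φ d) ; ∂S = λ d → xor≡false (eq d) }
        xC0 : ∀ i → xC i ≡ false
        xC0 = ind xC bounds
        flat : Bounds (λ _ → false)
        flat = Bounds-cong (λ d → ⊕-zero (λ i → cong (_∧ ci i d) (xC0 i))) bounds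
        same : ∀ {d d'} → comp (tail d) ≡ comp (tail d') → F d ≡ F d'
        same {d} {d'} e = conn-const flat {full} (λ _ _ → refl) (proj₂ (joined e)) d d' refl refl
        at-left : ∀ j → comb xF aF (inj₂ (inj₁ j)) xor comb xI aI (inj₂ (inj₁ j)) ≡ false
        at-left j = trans (sym (trans (comb-a x (inj₂ (inj₁ j))) (cong (comb xF aF (inj₂ (inj₁ j)) xor_) (trans (cong (comb xI aI (inj₂ (inj₁ j)) xor_) (comb-0 xC {aC} {inj₂ (inj₁ j)} (λ _ → refl))) (Bool.xor-identityʳ _))))) (h (∈-left j))
        noDart : ∀ i {v m} → W full (lone i) v m → v ≡ lone i
        noDart i (nil _) = refl
        noDart i (cons _ (d , td , _) _) = ⊥-elim (lone-no i d td)
        F0 : ∀ d → F d ≡ false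
        F0 d = go (baseDart (comp (tail d))) refl
          where
          j = comp (tail d)
          go : (z : Dec (∃ λ e → tail e ≡ base j)) → baseDart j ≡ z → F d ≡ false
          go (yes (e , te)) eqz = trans (same (trans (sym (comp-base j)) (cong comp (sym te)))) (trans (sym (F-sum e)) (trans (⊕.sum-cong-≗ (λ i → cong (xF i ∧_) (cong (λ z → rooted z i) (sym eqz))))
               (trans (sym (Bool.xor-identityʳ _)) (trans (cong (comb xF aF (inj₂ (inj₁ j)) xor_) (sym (comb-0 xI {aI} {inj₂ (inj₁ j)} noLone))) (at-left j)))))
            where
            noLone : ∀ i → does (comp (lone i) Fin.≟ j) ≡ false
            noLone i = dec-false (comp (lone i) Fin.≟ j) (λ q → lone-no i e (trans te (noDart i (proj₂ (joined (trans q (sym (comp-base j))))))))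
          go (no none) _ with joined {base j} {tail d} (comp-base j)
          ... | _ , w = ⊥-elim (none (end w))
            where
            end : ∀ {u m} → W full u (tail d) m → ∃ λ e → tail e ≡ u
            end (nil _) = d , refl
            end (cons _ (e , te , _) _) = e , te
        xF0 : ∀ i → xF i ≡ false
        xF0 i with face-sur i
        ... | d , refl = F0 d
        xI0 : ∀ i → xI i ≡ false
        xI0 i = trans (sym (⊕-pick xI i (λ i' → does (comp (lone i') Fin.≟ j)) (dec-true (comp (lone i) Fin.≟ j) refl)
                  (λ i' ne → dec-false (comp (lone i') Fin.≟ j) (λ q → ne (sym (lone-inj (noDart i' (proj₂ (joined q)))))))))
                (trans (cong (_xor comb xI aI (inj₂ (inj₁ j))) (sym (⊕-zero {t = λ i' → xF i' ∧ aF i' (inj₂ (inj₁ j))} (λ i' → cong (_∧ aF i' (inj₂ (inj₁ j))) (xF0 i'))))) (at-left j))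
          where
          j = comp (lone i)

      -- A dependence says that `s`, the vertex part plus the left sides, is invariant under `φ`. As
      -- a set of faces it bounds the combination of the cycles, so by independence no left side
      -- occurs; the vertex part is then constant on components and zero at the base vertices.
      indep-b : Indep coords b
      indep-b y h = ↑-cases n {P = λ i → y i ≡ false} yV0 yC0
        where
        yV : Fin n → Bool
        yV v = y (v ↑ˡ k)
        yC : Fin k → Bool
        yC i = y (n ↑ʳ i)
        LC : D → Bool
        LC d = ⊕.sum (λ i → yC i ∧ L.L i d)
        V-sum : ∀ d → ⊕.sum (λ v → yV v ∧ isV v d) ≡ yV (tail d)
        V-sum d = ⊕-delta yV (tail d)
        s : D → Bool
        s d = yV (tail d) xor LC d
        δ-sum : ∀ {p} (x : Fin p → Bool) (g : Fin p → D → Bool) d → ⊕.sum (λ i → x i ∧ δ (g i) d) ≡ ⊕.sum (λ i → x i ∧ g i d) xor ⊕.sum (λ i → x i ∧ g i (φ d))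
        δ-sum x g d = trans (⊕.sum-cong-≗ (λ i → Bool.∧-distribˡ-xor (x i) (g i d) (g i (φ d)))) (⊕.∑-distrib-+ (λ i → x i ∧ g i d) (λ i → x i ∧ g i (φ d)))
        total : ∀ d → comb y b (inj₁ d) ≡ s d xor s (φ d)
        total d = trans (comb-b y (inj₁ d)) (trans (cong₂ _xor_ (trans (δ-sum yV isV d) (cong₂ _xor_ (V-sum d) (V-sum (φ d)))) (δ-sum yC (λ i → L.L i) d))
                    (xor-swap (yV (tail d)) (yV (tail (φ d))) (LC d) (LC (φ d))))
        sym-total : ∀ d → comb y b (inj₁ (rev d)) ≡ comb y b (inj₁ d)
        sym-total d = trans (comb-b y (inj₁ (rev d))) (trans (cong₂ _xor_ (⊕.sum-cong-≗ (λ v → cong (yV v ∧_) (sym-δV v d))) (⊕.sum-cong-≗ (λ i → cong (yC i ∧_) (sym-δL i d)))) (sym (comb-b y (inj₁ d))))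
        s-φ : ∀ d → s (φ d) ≡ s d
        s-φ d = sym (xor≡false (trans (sym (total d)) (on-half {λ d → comb y b (inj₁ d)} sym-total (λ m → h (∈-dart m)) d)))
        LC-φ : ∀ d → LC (φ d) ≡ LC (rev d) xor comb yC ci d
        LC-φ d = trans (⊕.sum-cong-≗ (λ i → trans (cong (yC i ∧_) (L-φ i d)) (Bool.∧-distribˡ-xor (yC i) (L.L i (rev d)) (ci i d)))) (⊕.∑-distrib-+ (λ i → yC i ∧ L.L i (rev d)) (λ i → yC i ∧ ci i d))
        -- s d = s (φ d), and s (φ d) differs from s (rev d) by the cycles through d.
        bounds : Bounds (comb yC ci)
        bounds = record { S = s ; S-φ = s-φ ; ∂S = λ d → trans (cong (_xor s (rev d)) (trans (sym (s-φ d)) (cong₂ _xor_ (cong yV (tail-φ d)) (LC-φ d))))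
            (fin (yV (tail (rev d))) (LC (rev d)) (comb yC ci d)) }
          where
          fin : ∀ a b c → (a xor (b xor c)) xor (a xor b) ≡ c
          fin a b c = trans (cong (_xor (a xor b)) (sym (Bool.xor-assoc a b c))) (trans (cong (_xor (a xor b)) (Bool.xor-comm (a xor b) c))
                        (trans (Bool.xor-assoc c (a xor b) (a xor b)) (trans (cong (c xor_) (Bool.xor-same (a xor b))) (Bool.xor-identityʳ c))))
        yC0 : ∀ i → yC i ≡ false
        yC0 = ind yC bounds
        LC0 : ∀ d → LC d ≡ false
        LC0 d = ⊕-zero (λ i → cong (_∧ L.L i d) (yC0 i))
        across : ∀ d → yV (tail d) ≡ yV (head d)
        across d = trans (trans (sym (Bool.xor-identityʳ _)) (cong (yV (tail d) xor_) (sym (LC0 d)))) (trans (sym (s-φ d))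
                     (trans (trans (cong (yV (tail (φ d)) xor_) (LC0 (φ d))) (Bool.xor-identityʳ _)) (cong yV (tail-φ d))))
        at-base : ∀ j → yV (base j) ≡ false
        at-base j = trans (sym (⊕-delta yV (base j))) (trans (sym (trans (comb-b y (inj₂ (inj₂ j))) (trans (cong (comb yV bV (inj₂ (inj₂ j)) xor_) (comb-0 yC {bC} {inj₂ (inj₂ j)} (λ _ → refl))) (Bool.xor-identityʳ _)))) (h (∈-right j)))
        yV0 : ∀ v → yV v ≡ false
        yV0 v = trans (const-walk yV across (proj₂ (joined (sym (comp-base (comp v)))))) (at-base (comp v))

      dot-++ : ∀ es fs (g g' : X → Bool) → dot (es ++ fs) g g' ≡ dot es g g' xor dot fs g g'
      dot-++ []       fs g g' = refl
      dot-++ (e ∷ es) fs g g' = trans (cong ((g e ∧ g' e) xor_) (dot-++ es fs g g')) (sym (Bool.xor-assoc (g e ∧ g' e) _ _))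

      dot-map : ∀ {Y : Set} (f : Y → X) es (g g' : X → Bool) → dot (map f es) g g' ≡ dot es (g ∘ f) (g' ∘ f)
      dot-map f []       g g' = refl
      dot-map f (e ∷ es) g g' = cong ((g (f e) ∧ g' (f e)) xor_) (dot-map f es g g')

      dot-0 : ∀ {Y : Set} (es : List Y) {g g' : Y → Bool} → (∀ e → g e ∧ g' e ≡ false) → dot es g g' ≡ false
      dot-0 []       h = refl
      dot-0 (e ∷ es) h = cong₂ _xor_ (h e) (dot-0 es h)

      dots : ∀ (g g' : X → Bool) → (∀ j → g' (inj₂ (inj₁ j)) ≡ false) → (∀ j → g (inj₂ (inj₂ j)) ≡ false) →
             dot half (g ∘ inj₁) (g' ∘ inj₁) ≡ false → dot coords g g' ≡ false
      dots g g' l r h = trans (dot-++ (map inj₁ half) _ g g') (cong₂ _xor_ (trans (dot-map inj₁ half g g') h)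
        (trans (dot-++ (map (inj₂ ∘ inj₁) (tabulate id)) _ g g') (cong₂ _xor_
          (trans (dot-map (inj₂ ∘ inj₁) (tabulate id) g g') (dot-0 (tabulate id) (λ j → trans (cong (g (inj₂ (inj₁ j)) ∧_) (l j)) (Bool.∧-zeroʳ _))))
          (trans (dot-map (inj₂ ∘ inj₂) (tabulate id) g g') (dot-0 (tabulate id) (λ j → cong (_∧ g' (inj₂ (inj₂ j))) (r j)))))))

      FV : ∀ i (g : D → Bool) → Sym (δ g) → dot half (λ d → isF i d xor isF i (rev d)) (δ g) ≡ false
      FV i g sg = trans (pair-boundary (isF i) (δ g) sg) (closed-δ (isF i) g (isF-φ i))

      CV : ∀ i v → dot half (ci i) (δ (isV v)) ≡ false
      CV i v = trans (pair-walk (C.ds i) (δ (isV v)) (sym-δV v)) (trans (tele (C.w i)) (Bool.xor-same (does (C.u i Fin.≟ v))))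
        where
        tele : ∀ {u u' ds} → DWalk u u' ds → Σw (δ (isV v)) ds ≡ does (u Fin.≟ v) xor does (u' Fin.≟ v)
        tele {u} [] = sym (Bool.xor-same (does (u Fin.≟ v)))
        tele {u} {u'} (_∷_ {d = d} refl w) = trans (cong₂ _xor_ (cong (isV v d xor_) (isV-φ v d)) (tele w)) (xor-cancel (isV v d) (isV v (rev d)) (does (u' Fin.≟ v)))

      -- The left side of a cycle vanishes at vertices off that cycle, hence along every disjoint
      -- one; for a cycle and its own push-off this is `L.self`.
      CC : ∀ i j → dot half (ci i) (δ (L.L j)) ≡ false
      CC i j = trans (pair-walk (C.ds i) (δ (L.L j)) (sym-δL j)) (go (i Fin.≟ j))
        where
        go : Dec (i ≡ j) → Σw (δ (L.L j)) (C.ds i) ≡ false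
        go (yes refl) = L.self i
        go (no i≢j) = Σw-0 (δ (L.L j)) (All.tabulate λ {d} d∈ → cong₂ _xor_ (L.L-off j (λ e∈ q → dis i j i≢j d∈ e∈ (sym q)))
            (L.L-off j (λ e∈ q → let (a , a∈ , ta) = after {M = M} (C.w i) d∈ in dis i j i≢j a∈ e∈ (sym (trans q (trans (tail-φ d) (sym ta)))))))

      lr : ∀ (i : Fin faces ⊎ Fin (isolated + k)) (j : Fin n ⊎ Fin k) → dot coords ([ aF , (λ j → a₂ (splitAt isolated j)) ]′ i) ([ bV , bC ]′ j) ≡ false
      lr (inj₁ i) (inj₁ v) = dots (aF i) (bV v) (λ _ → refl) (λ _ → refl) (FV i (isV v) (sym-δV v))
      lr (inj₁ i) (inj₂ c) = dots (aF i) (bC c) (λ _ → refl) (λ _ → refl) (FV i (L.L c) (sym-δL c))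
      lr (inj₂ i) j = go (splitAt isolated i) j
        where
        go : ∀ (i : Fin isolated ⊎ Fin k) (j : Fin n ⊎ Fin k) → dot coords (a₂ i) ([ bV , bC ]′ j) ≡ false
        go (inj₁ i) (inj₁ v) = dots (aI i) (bV v) (λ _ → refl) (λ _ → refl) (dot-0 half (λ _ → refl))
        go (inj₁ i) (inj₂ c) = dots (aI i) (bC c) (λ _ → refl) (λ _ → refl) (dot-0 half (λ _ → refl))
        go (inj₂ i) (inj₁ v) = dots (aC i) (bV v) (λ _ → refl) (λ _ → refl) (CV i v)
        go (inj₂ i) (inj₂ c) = dots (aC i) (bC c) (λ _ → refl) (λ _ → refl) (CC i c)

    -- There are `faces + isolated + k` chains orthogonal to `n + k` cochains in a space whose
    -- dimension is the number of edges plus `2 * comps`. The inequality is doubled because `size`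
    -- counts darts.
    cycle-bound : 2 * (faces + isolated) + 2 * n + 4 * k ≤ size + 4 * comps
    cycle-bound = ≤-trans (≤-reflexive (lhs faces isolated n k)) (≤-trans (+-mono-≤ half-bound half-bound)
        (≤-reflexive (trans (rhs (length half) comps) (cong (_+ 4 * comps) half-count))))
      where
      half-bound : (faces + (isolated + k)) + (n + k) ≤ length half + (comps + comps)
      half-bound = ≤-trans (orthogonal-bound coords a b indep-a indep-b (λ i j → lr (splitAt faces i) (splitAt n j))) (≤-reflexive length-coords)
      open +-*-Solver
      lhs : ∀ f i n k → 2 * (f + i) + 2 * n + 4 * k ≡ ((f + (i + k)) + (n + k)) + ((f + (i + k)) + (n + k))
      lhs = solve 4 (λ f i n k → con 2 :* (f :+ i) :+ con 2 :* n :+ con 4 :* k := ((f :+ (i :+ k)) :+ (n :+ k)) :+ ((f :+ (i :+ k)) :+ (n :+ k))) refl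
      rhs : ∀ h c → (h + (c + c)) + (h + (c + c)) ≡ (h + h) + 4 * c
      rhs = solve 2 (λ h c → (h :+ (c :+ c)) :+ (h :+ (c :+ c)) := (h :+ h) :+ con 4 :* c) refl

-- Exhaustive search, by which bounding and membership in a span become decidable. `P` respects
-- pointwise equality because a function is recovered from its values only pointwise.
any-fun : ∀ N {P : (Fin N → Bool) → Set} → (∀ {f g} → (∀ i → f i ≡ g i) → P f → P g) → (∀ f → Dec (P f)) → Dec (∃ P)
any-fun zero {P} resp P? = map′ (λ p → _ , p) (λ { (f , p) → resp (λ ()) p }) (P? (λ ()))
any-fun (suc N) {P} resp P? = map′ to′ from′ (half true ⊎-dec half false)
  where
  _▸_ : Bool → (Fin N → Bool) → Fin (suc N) → Bool
  (b ▸ f) zero    = b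
  (b ▸ f) (suc i) = f i
  half : ∀ b → Dec (∃ λ f → P (b ▸ f))
  half b = any-fun N (λ h → resp (λ { zero → refl ; (suc i) → h i })) (λ f → P? (b ▸ f))
  to′ : (∃ λ f → P (true ▸ f)) ⊎ (∃ λ f → P (false ▸ f)) → ∃ P
  to′ (inj₁ (f , p)) = _ , p
  to′ (inj₂ (f , p)) = _ , p
  from′ : ∃ P → (∃ λ f → P (true ▸ f)) ⊎ (∃ λ f → P (false ▸ f))
  from′ (f , p) with f zero in eq
  ... | true  = inj₁ (f ∘ suc , resp (λ { zero → eq ; (suc i) → refl }) p)
  ... | false = inj₂ (f ∘ suc , resp (λ { zero → eq ; (suc i) → refl }) p)

-- Tiers

module Peeling {n : ℕ} (M : Map n) (cell : Cellular M) (r : ℕ) where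
  open Map M
  open Cycles M
  open Sides M
  open Enum enum
  open Genus M cell
  open Paths _~_ ~sym _~?_
  open Representatives _~_ ~sym _~?_

  private
    all-D : {P : D → Set} → (∀ d → Dec (P d)) → Dec (∀ d → P d)
    all-D {P} P? = map′ (λ h d → subst P (from-to d) (h (to d))) (λ h i → h (from i)) (Fin.all? (λ i → P? (from i)))

    cyc : {k : ℕ} → (Fin k → SimpleCycle M) → Fin k → D → Bool
    cyc C i = cnt (SimpleCycle.ds (C i))

    InSpan : {k : ℕ} → (Fin k → SimpleCycle M) → (D → Bool) → Set
    InSpan C c = ∃ λ y → Bounds (λ d → c d xor comb y (cyc C) d)

    bounds? : ∀ C → Dec (Bounds C)
    bounds? C = map′ (λ { (s , p , q) → record { S = s ∘ to ; S-φ = p ; ∂S = q } })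
                     (λ b → let open Bounds b in S ∘ from , (λ d → trans (cong S (from-to (φ d))) (trans (S-φ d) (cong S (sym (from-to d)))))
                                               , (λ d → trans (cong₂ _xor_ (cong S (from-to d)) (cong S (from-to (rev d)))) (∂S d)))
      (any-fun size {λ s → (∀ d → s (to (φ d)) ≡ s (to d)) × (∀ d → s (to d) xor s (to (rev d)) ≡ C d)}
         (λ h (p , q) → (λ d → trans (sym (h _)) (trans (p d) (h _))) , (λ d → trans (sym (cong₂ _xor_ (h _) (h _))) (q d)))
         (λ s → all-D (λ d → s (to (φ d)) Bool.≟ s (to d)) ×-dec all-D (λ d → (s (to d) xor s (to (rev d))) Bool.≟ C d)))

    opaque
      inSpan? : ∀ {k} (C : Fin k → SimpleCycle M) c → Dec (InSpan C c)
      inSpan? {k} C c = any-fun k (λ h → Bounds-cong (λ d → cong (c d xor_) (⊕.sum-cong-≗ (λ i → cong (_∧ cyc C i d) (h i)))))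
                          (λ y → bounds? (λ d → c d xor comb y (cyc C) d))

    span-cong : ∀ {k} {C : Fin k → SimpleCycle M} {c c'} → (∀ d → c d ≡ c' d) → InSpan C c → InSpan C c'
    span-cong {C = C} h (y , b) = y , Bounds-cong (λ d → cong (_xor comb y (cyc C) d) (h d)) b

    span-xor : ∀ {k} {C : Fin k → SimpleCycle M} {c c'} → InSpan C c → InSpan C c' → InSpan C (λ d → c d xor c' d)
    span-xor {C = C} {c} {c'} (y , b) (y' , b') = (λ i → y i xor y' i) , Bounds-cong
        (λ d → trans (xor-swap (c d) (comb y (cyc C) d) (c' d) (comb y' (cyc C) d))
           (cong ((c d xor c' d) xor_) (sym (trans (⊕.sum-cong-≗ (λ i → Bool.∧-distribʳ-xor (cyc C i d) (y i) (y' i))) (⊕.∑-distrib-+ (λ i → y i ∧ cyc C i d) (λ i → y' i ∧ cyc C i d))))))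
        (Bounds-xor b b')

    record Pinch (u v : Fin n) (ds : List D) : Set where
      field
        p c s : List D
        {x}   : Fin n
        eq    : ds ≡ p ++ (c ++ s)
        loop  : DWalk x x c
        rest  : DWalk u v (p ++ s)
        c≥1   : 1 ≤ length c
        s≥1   : 1 ≤ length s

    pinch : ∀ {u v ds} → DWalk u v ds → Unique (map tail ds) ⊎ Pinch u v ds
    pinch [] = inj₁ []
    pinch (_∷_ {d = d} {ds} refl w) with pinch w
    ... | inj₂ q = inj₂ (record { p = d ∷ Pinch.p q ; c = Pinch.c q ; s = Pinch.s q ; eq = cong (d ∷_) (Pinch.eq q) ; loop = Pinch.loop q
                                ; rest = refl ∷ Pinch.rest q ; c≥1 = Pinch.c≥1 q ; s≥1 = Pinch.s≥1 q })
    ... | inj₁ uq with Any.any? (λ e → tail e Fin.≟ tail d) ds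
    ...   | no none = inj₁ (All-map⁺ (All.map (λ q e → q (sym e)) (¬Any⇒All¬ ds none)) ∷ uq)
    ...   | yes some with cut w some
      where
      cut : ∀ {u v ds} → DWalk u v ds → Any (λ e → tail e ≡ tail d) ds →
            ∃ λ c → ∃ λ s → ds ≡ c ++ s × DWalk u (tail d) c × DWalk (tail d) v s × 1 ≤ length s
      cut (_∷_ {d = e} refl w) (here te) = [] , _ , refl , subst (λ z → DWalk (tail e) z []) te [] , te ∷ w , s≤s z≤n
      cut (_∷_ {d = e} p w) (there m) with cut w m
      ... | c , s , refl , wc , ws , l = e ∷ c , s , refl , p ∷ wc , ws , l
    ...     | c , s , refl , wc , ws , l = inj₂ (record { p = [] ; c = d ∷ c ; s = s ; eq = refl ; loop = refl ∷ wc ; rest = ws ; c≥1 = s≤s z≤n ; s≥1 = l })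

    cnt-pinch : ∀ p c s d → cnt (p ++ (c ++ s)) d ≡ cnt (p ++ s) d xor cnt c d
    cnt-pinch p c s d = trans (cnt-++ p (c ++ s) d) (trans (cong (cnt p d xor_) (trans (cnt-++ c s d) (Bool.xor-comm (cnt c d) (cnt s d))))
        (trans (sym (Bool.xor-assoc (cnt p d) (cnt s d) (cnt c d))) (cong (_xor cnt c d) (sym (cnt-++ p s d)))))

    -- At a repeated vertex the walk is the sum of two shorter closed walks, and if both were in the
    -- span, so would be the whole. Continuing with one that is not ends in a simple cycle.
    simplify : ∀ {k} (C : Fin k → SimpleCycle M) {u ds} → Acc _<_ (length ds) → DWalk u u ds → ¬ InSpan C (cnt ds) →
               ∃ λ (c : SimpleCycle M) → (∀ {e} → e ∈ˡ SimpleCycle.ds c → e ∈ˡ ds) × ¬ InSpan C (cnt (SimpleCycle.ds c))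
    simplify C {u} {ds} (acc rs) w ns with pinch w
    ... | inj₁ uq = record { ds = ds ; w = w ; uq = uq } , id , ns
    ... | inj₂ record { p = p ; c = c ; s = s ; eq = refl ; loop = loop ; rest = rest ; c≥1 = c≥1 ; s≥1 = s≥1 } with inSpan? C (cnt c)
    ...   | no nc with simplify C (rs len) loop nc
      where
      len : length c < length (p ++ (c ++ s))
      len = ≤-trans (≤-trans (≤-reflexive (sym (+-comm (length c) 1))) (≤-trans (+-monoʳ-≤ (length c) s≥1) (≤-reflexive (sym (length-++ c)))))
              (≤-trans (m≤n+m _ (length p)) (≤-reflexive (sym (length-++ p))))
    ...     | cy , sub , nb = cy , (λ m → ∈-++⁺ʳ p (∈-++⁺ˡ (sub m))) , nb
    simplify C {u} {ds} (acc rs) w ns | inj₂ record { p = p ; c = c ; s = s ; eq = refl ; loop = loop ; rest = rest ; c≥1 = c≥1 ; s≥1 = s≥1 } | yes yc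
      with simplify C (rs len) rest (λ q → ns (span-cong {C = C} (λ d → sym (cnt-pinch p c s d)) (span-xor {C = C} {cnt (p ++ s)} {cnt c} q yc)))
      where
      len : length (p ++ s) < length (p ++ (c ++ s))
      len = ≤-trans (s≤s (≤-reflexive (length-++ p))) (≤-trans (≤-reflexive (sym (+-suc (length p) (length s))))
              (≤-trans (+-monoʳ-≤ (length p) (≤-trans (+-monoˡ-≤ (length s) c≥1) (≤-reflexive (sym (length-++ c))))) (≤-reflexive (sym (length-++ p)))))
    ...   | cy , sub , nb = cy , (λ m → insert (∈-++⁻ p (sub m))) , nb
      where
      insert : ∀ {e} → e ∈ˡ p ⊎ e ∈ˡ s → e ∈ˡ p ++ (c ++ s)
      insert (inj₁ m) = ∈-++⁺ˡ m
      insert (inj₂ m) = ∈-++⁺ʳ p (∈-++⁺ʳ c m)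

    back : List D → List D
    back []       = []
    back (d ∷ ds) = back ds ++ rev d ∷ []

    back-walk : ∀ {u v ds} → DWalk u v ds → DWalk v u (back ds)
    back-walk [] = []
    back-walk (_∷_ {d = d} refl w) = DW-++ (back-walk w) (refl ∷ subst (λ z → DWalk z (tail d) []) (sym (head-rev d)) [])

    back-cnt : ∀ ds d → cnt (back ds) d ≡ cnt ds d
    back-cnt []       d = refl
    back-cnt (e ∷ ds) d = trans (cnt-++ (back ds) _ d) (trans (cong₂ _xor_ (back-cnt ds d) (trans (Bool.xor-identityʳ _) (edge-revˡ e d))) (Bool.xor-comm (cnt ds d) (edge e d)))

    back-tails : ∀ {X ds} → All (Inside X) ds → All (λ e → tail e ∈ X) (back ds)
    back-tails [] = []
    back-tails ((t , h) ∷ is) = All-++⁺ (back-tails is) (h ∷ [])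

  -- Tiers are placed one after another before everything else, so a walk whose vertices do not
  -- precede `u` stays in tiers from that of `u` on. The order inside a tier is irrelevant to the
  -- count.
  above : (Fin n → ℕ) → Fin n → VSet n
  above tier u = ⟦ (λ w → tier u ≤? tier w) ⟧

  Seen : (Fin n → ℕ) → Fin n → Fin n → Set
  Seen tier v u = ∃ λ m → m ≤ r × W (above tier u) v u m

  record Peeled (k : ℕ) : Set where
    field
      R      : VSet n
      C      : Fin k → SimpleCycle M
      C⊆R    : ∀ i {e} → e ∈ˡ SimpleCycle.ds (C i) → tail e ∈ R
      ind    : Independent C
      dis    : Disjoint C
      tier   : Fin n → ℕ
      tier-∈ : ∀ {v} → v ∈ R → tier v < k
      tier-∉ : ∀ {v} → v ∉ R → tier v ≡ k
      near   : ∀ v → CardAt (k * (2 * (2 * r + 1))) (λ u → u ∈ R × Seen tier v u)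

  private
    module Peel {k : ℕ} (st : Peeled k) where
      open Peeled st

      everywhere : VSet n
      everywhere _ = true

      S : VSet n
      S = everywhere ∖ R

      S-i : ∀ {v} → v ∉ R → v ∈ S
      S-i p = ∖-i ⟨ refl ⟩ p

      reps-S : Reps S
      reps-S = reps S
      open Reps reps-S

      Lv : Levels S rep
      Lv = levels S rep same reach
      open Levels Lv using (ℓ; ℓ-lip)

      record Geo (v : Fin n) : Set where
        field
          P    : VSet n
          P⊆S  : P ⊆ S
          inj  : Inj P ℓ
          v∈P  : v ∈ P
          ds   : List D
          walk : DWalk (rep v) v ds
          inP  : All (Inside P) ds

      geo : ∀ {v} → v ∈ S → Geo v
      geo {v} v∈ = mk (geodesic Lv refl v∈)
        where
        mk : Up S ℓ (rep v) v (ℓ v) → Geo v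
        mk up = mk' (toDarts (uwalk (proj₂ (vs-self up))))
          where
          mk' : (∃ λ ds → DWalk (rep v) v ds × All (Inside (vs up)) ds) → Geo v
          mk' (ds , w , i) = record { P = vs up ; P⊆S = vs-⊆ up ; inj = vs-inj up ; v∈P = vs-lst up ; ds = ds ; walk = w ; inP = i }

      opaque
        ref : Fin n → D → Bool
        ref v = [ (λ v∈ → cnt (Geo.ds (geo v∈))) , (λ _ _ → false) ]′ (in? v S)

        ref-geo : ∀ {v} → v ∈ S → ∃ λ (g : Geo v) → ∀ d → ref v d ≡ cnt (Geo.ds g) d
        ref-geo {v} v∈ = go (in? v S)
          where
          go : (s : v ∈ S ⊎ v ∉ S) → ∃ λ (g : Geo v) → ∀ d → [ (λ v∈ → cnt (Geo.ds (geo v∈))) , (λ _ _ → false) ]′ s d ≡ cnt (Geo.ds g) d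
          go (inj₁ p) = geo p , λ d → refl
          go (inj₂ p) = ⊥-elim (∈∉ v∈ p)

      -- The fundamental cycle of `e`: the edge together with the geodesics from the representative
      -- of the component to its two ends.
      f : D → D → Bool
      f e d = (ref (tail e) d xor ref (head e) d) xor edge e d

      Bad : D → Set
      Bad e = tail e ∈ S × head e ∈ S × ¬ InSpan C (f e)

      bad? : Dec (∃ Bad)
      bad? = any-D (λ e → mem? (tail e) S ×-dec mem? (head e) S ×-dec ¬? (inSpan? C (f e)))

      head∈R : ∀ i {e} → e ∈ˡ SimpleCycle.ds (C i) → head e ∈ R
      head∈R i m with after {M = M} (SimpleCycle.w (C i)) m
      ... | a , a∈ , ta = subst (_∈ R) ta (C⊆R i a∈)

      cyc-off : ∀ i d → tail d ∉ R ⊎ head d ∉ R → cyc C i d ≡ false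
      cyc-off i d h = [ (λ p → off d (S-i p)) , (λ p → trans (sym (cnt-rev (SimpleCycle.ds (C i)) d)) (off (rev d) (S-i p))) ]′ h
        where
        off : ∀ d → tail d ∈ S → cyc C i d ≡ false
        off = cnt-off (All.tabulate (λ m → ¬∈→∉ (λ p → ∈∉ (C⊆R i m) (∖-r p)) , ¬∈→∉ (λ p → ∈∉ (head∈R i m) (∖-r p))))

      -- Every fundamental cycle outside `R` now bounds modulo the chosen cycles, and these vanish
      -- on darts with an end outside `R`.
      finished : ¬ ∃ Bad → Split.RelSpherical M R
      finished none = record { ref = ref ; off = off ; bd = bd }
        where
        off : ∀ {v} d → v ∉ R → tail d ∈ R ⊎ head d ∈ R → ref v d ≡ false
        off {v} d v∉ h with ref-geo (S-i v∉)
        ... | g , eq = trans (eq d) ([ z d , (λ p → trans (sym (cnt-rev (Geo.ds g) d)) (z (rev d) p)) ]′ h)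
          where
          z : ∀ d → tail d ∈ R → cnt (Geo.ds g) d ≡ false
          z = cnt-off (All.map (λ { (t , h) → ∖-r (Geo.P⊆S g t) , ∖-r (Geo.P⊆S g h) }) (Geo.inP g))
        bd : ∀ e → tail e ∉ R → head e ∉ R → ∃ λ (S : D → Bool) → (∀ d → S (φ d) ≡ S d) ×
            (∀ d → tail d ∉ R ⊎ head d ∉ R → S d xor S (rev d) ≡ (ref (tail e) d xor ref (head e) d) xor edge e d)
        bd e t h = go (inSpan? C (f e))
          where
          go : Dec (InSpan C (f e)) → _
          go (no ns) = ⊥-elim (none (e , S-i t , S-i h , ns))
          go (yes (y , b)) = Bounds.S b , Bounds.S-φ b , λ d p → trans (Bounds.∂S b d) (trans (cong (f e d xor_)
              (⊕-zero (λ i → trans (cong (y i ∧_) (cyc-off i d p)) (Bool.∧-zeroʳ (y i))))) (Bool.xor-identityʳ _))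

      module Next (e : D) (te : tail e ∈ S) (he : head e ∈ S) (ns : ¬ InSpan C (f e)) where
        gt = ref-geo te
        gh = ref-geo he
        module T = Geo (proj₁ gt)
        module H = Geo (proj₁ gh)

        ds₀ : List D
        ds₀ = T.ds ++ e ∷ back H.ds

        w₀ : DWalk (rep (tail e)) (rep (tail e)) ds₀
        w₀ = subst (λ z → DWalk (rep (tail e)) z ds₀) (sym (same te he (e , refl , refl))) (DW-++ T.walk (refl ∷ back-walk H.walk))

        ns₀ : ¬ InSpan C (cnt ds₀)
        ns₀ q = ns (span-cong {C = C} (λ d → trans (cnt-++ T.ds _ d) (trans (cong (cnt T.ds d xor_) (cong (edge e d xor_) (back-cnt H.ds d)))
            (trans (cong (cnt T.ds d xor_) (Bool.xor-comm (edge e d) (cnt H.ds d))) (trans (sym (Bool.xor-assoc (cnt T.ds d) (cnt H.ds d) (edge e d)))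
              (cong (_xor edge e d) (sym (cong₂ _xor_ (proj₂ gt d) (proj₂ gh d)))))))) q)

        PQ : VSet n
        PQ = T.P ∪ H.P

        tails₀ : All (λ d → tail d ∈ PQ) ds₀
        tails₀ = All-++⁺ (All.map (λ i → ∪-l (proj₁ i)) T.inP) (∪-l T.v∈P ∷ All.map ∪-r (back-tails H.inP))

        PQ⊆S : PQ ⊆ S
        PQ⊆S p = [ T.P⊆S , H.P⊆S ]′ (∪-e p)

        opaque
          new : ∃ λ (c : SimpleCycle M) → (∀ {e} → e ∈ˡ SimpleCycle.ds c → e ∈ˡ ds₀) × ¬ InSpan C (cnt (SimpleCycle.ds c))
          new = simplify C (<-wellFounded _) w₀ ns₀

        c₀ = proj₁ new

        c₀-tails : ∀ {d} → d ∈ˡ SimpleCycle.ds c₀ → tail d ∈ PQ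
        c₀-tails m = All.lookup tails₀ (proj₁ (proj₂ new) m)

        -- Both geodesics are removed entirely, even where `c₀` uses only a part of them. The count
        -- of two windows covers them, and as they lie in `S` the new cycle is disjoint from the
        -- earlier ones.
        R' : VSet n
        R' = R ∪ PQ

        C' : Fin (suc k) → SimpleCycle M
        C' zero    = c₀
        C' (suc i) = C i

        C'⊆ : ∀ i {d} → d ∈ˡ SimpleCycle.ds (C' i) → tail d ∈ R'
        C'⊆ zero    m = ∪-r (c₀-tails m)
        C'⊆ (suc i) m = ∪-l (C⊆R i m)

        dis' : Disjoint C'
        dis' zero    zero    ne _ _ = ⊥-elim (ne refl)
        dis' zero    (suc j) ne m m' q = ∈∉ (C⊆R j m') (∖-r (PQ⊆S (subst (_∈ PQ) q (c₀-tails m))))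
        dis' (suc i) zero    ne m m' q = ∈∉ (C⊆R i m) (∖-r (PQ⊆S (subst (_∈ PQ) (sym q) (c₀-tails m'))))
        dis' (suc i) (suc j) ne m m' = dis i j (λ p → ne (cong suc p)) m m'

        ind' : Independent C'
        ind' y b = body (y zero) refl
          where
          change : ∀ {s} → y zero ≡ s → Bounds (λ d → (s ∧ cyc C' zero d) xor comb (y ∘ suc) (cyc C) d)
          change eq = Bounds-cong (λ d → cong (λ z → (z ∧ cyc C' zero d) xor comb (y ∘ suc) (cyc C) d) eq) b
          body : ∀ s → y zero ≡ s → ∀ i → y i ≡ false
          body true  eq i       = ⊥-elim (proj₂ (proj₂ new) (y ∘ suc , change eq))
          body false eq zero    = eq
          body false eq (suc i) = ind (y ∘ suc) (change eq) i

        tier' : Fin n → ℕ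
        tier' v = if R' v then tier v else suc k

        on : ∀ {v} → v ∈ R' → tier' v ≡ tier v
        on ⟨ p ⟩ rewrite p = refl

        off : ∀ {v} → v ∉ R' → tier' v ≡ suc k
        off ⟨ p ⟩ rewrite p = refl

        tier≤ : ∀ {v} → v ∈ R' → tier v ≤ k
        tier≤ p = [ (λ q → <⇒≤ (tier-∈ q)) , (λ q → ≤-reflexive (tier-∉ (∖-r (PQ⊆S q)))) ]′ (∪-e p)

        old : ∀ v {u} → u ∈ R → Seen tier' v u → Seen tier v u
        old v {u} u∈ (m , le , w) = m , le , wmono (λ {x} p → ⟦⟧-i (λ w → tier u ≤? tier w) (lower (⟦⟧-e (λ w → tier' u ≤? tier' w) p))) w
          where
          lower : ∀ {x} → tier' u ≤ tier' x → tier u ≤ tier x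
          lower {x} h with in? x R'
          ... | inj₁ x∈ = ≤-trans (≤-reflexive (sym (on (∪-l u∈)))) (≤-trans h (≤-reflexive (on x∈)))
          ... | inj₂ x∉ = ≤-trans (<⇒≤ (tier-∈ u∈)) (≤-reflexive (sym (tier-∉ (∪-∉l x∉))))

        -- A vertex of `PQ` gets tier `k`, so the witnessing walk avoids `R` and stays in `S`, where
        -- the distance `ℓ` is 1-Lipschitz.
        young : ∀ v {u} → u ∈ PQ → Seen tier' v u → ℓ u ≤ ℓ v + r × ℓ v ≤ ℓ u + r
        young v {u} u∈ (m , le , w) = ≤-trans (lip-walk ℓ-lip (wrev wS)) (+-monoʳ-≤ (ℓ v) le) , ≤-trans (lip-walk ℓ-lip wS) (+-monoʳ-≤ (ℓ u) le)
          where
          u-tier : tier' u ≡ k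
          u-tier = trans (on (∪-r u∈)) (tier-∉ (∖-r (PQ⊆S u∈)))
          inS : ∀ {x} → tier' u ≤ tier' x → x ∈ S
          inS {x} h = S-i (¬∈→∉ λ x∈ → <-irrefl refl (<-≤-trans (tier-∈ x∈) (≤-trans (≤-reflexive (sym u-tier)) (≤-trans h (≤-reflexive (on (∪-l x∈)))))))
          wS : W S v u m
          wS = wmono (λ p → inS (⟦⟧-e (λ w → tier' u ≤? tier' w) p)) w

        near' : ∀ v → CardAt (suc k * (2 * (2 * r + 1))) (λ u → u ∈ R' × Seen tier' v u)
        near' v = card-⊆ (≤-reflexive (cong (_+ k * (2 * (2 * r + 1))) (cong ((2 * r + 1) +_) (sym (+-identityʳ (2 * r + 1)))))) classify
            (card-⊎ (card-⊎ (window r (ℓ v) T.inj) (window r (ℓ v) H.inj)) (near v))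
          where
          classify : ∀ {u} → u ∈ R' × Seen tier' v u → ((u ∈ T.P × ℓ u ≤ ℓ v + r × ℓ v ≤ ℓ u + r) ⊎ (u ∈ H.P × ℓ u ≤ ℓ v + r × ℓ v ≤ ℓ u + r)) ⊎ (u ∈ R × Seen tier v u)
          classify (p , s) = [ (λ q → inj₂ (q , old v q s)) , (λ q → inj₁ ([ (λ t → inj₁ (t , young v q s)) , (λ h → inj₂ (h , young v q s)) ]′ (∪-e q))) ]′ (∪-e p)

        next : Peeled (suc k)
        next = record { R = R' ; C = C' ; C⊆R = C'⊆ ; ind = ind' ; dis = dis' ; tier = tier'
          ; tier-∈ = λ p → s≤s (≤-trans (≤-reflexive (on p)) (tier≤ p)) ; tier-∉ = off ; near = near' }

        smaller : card (everywhere ∖ R') < card S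
        smaller = card-strict (λ p → ∖-i ⟨ refl ⟩ (∪-∉l (∖-r p))) (tail e) te (¬∈→∉ λ p → ∈∉ (∪-r (∪-l T.v∈P)) (∖-r p))

    start : Peeled 0
    start = record { R = ∅ ; C = λ () ; C⊆R = λ () ; ind = λ _ _ () ; dis = λ () ; tier = λ _ → 0 ; tier-∈ = λ p → ⊥-elim (∈∉ p ∅-no) ; tier-∉ = λ _ → refl
                   ; near = λ v → card-0 (λ { (p , _) → ∈∉ p ∅-no }) }

  opaque
    peel : ∃ λ k → ∃ λ (st : Peeled k) → Split.RelSpherical M (Peeled.R st)
    peel = go start (<-wellFounded _)
      where
      go : ∀ {k} (st : Peeled k) → Acc _<_ (card (Peel.S st)) → ∃ λ k → ∃ λ (st : Peeled k) → Split.RelSpherical M (Peeled.R st)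
      go st (acc rs) = body (Peel.bad? st)
        where
        body : Dec (∃ (Peel.Bad st)) → ∃ λ k → ∃ λ (st : Peeled k) → Split.RelSpherical M (Peeled.R st)
        body (no none) = _ , st , Peel.finished st none
        body (yes (e , te , he , ns)) = go (Peel.Next.next st e te he ns) (rs (Peel.Next.smaller st e te he ns))

-- From embedded graphs to maps

open Defs using (Graph; Walk; Dart; numDarts; degree; numIsolated; sumFin; Connected; here; step; inner; dropLast; RotationSystem; EmbedsInGenus; HasGenus; Planar; ColAtMost; WcolAtMost; SReach; WReach; LinearOrder)

size-Σ : {n : ℕ} → (Fin n → ℕ) → ℕ
size-Σ {zero}  f = 0
size-Σ {suc n} f = f zero + size-Σ (f ∘ suc)

sumFin-Σ : {n : ℕ} (f : Fin n → ℕ) → sumFin f ≡ size-Σ f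
sumFin-Σ {n} f = trans (cong sum (map-tabulate id f)) (go f)
  where
  go : ∀ {n} (f : Fin n → ℕ) → sum (tabulate f) ≡ size-Σ f
  go {zero}  f = refl
  go {suc n} f = cong (f zero +_) (go (f ∘ suc))

size-Σ-cong : {n : ℕ} {f g : Fin n → ℕ} → (∀ i → f i ≡ g i) → size-Σ f ≡ size-Σ g
size-Σ-cong {zero}  h = refl
size-Σ-cong {suc n} h = cong₂ _+_ (h zero) (size-Σ-cong (h ∘ suc))

size-Σ-0 : {n : ℕ} (f : Fin n → ℕ) → size-Σ f ≡ 0 → ∀ i → f i ≡ 0
size-Σ-0 f e zero    = m+n≡0⇒m≡0 (f zero) e
size-Σ-0 f e (suc i) = size-Σ-0 (f ∘ suc) (m+n≡0⇒n≡0 (f zero) e) i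

enum-Σ : {n : ℕ} {P : Fin n → Set} (E : ∀ i → Enum (P i)) → Enum (Σ (Fin n) P)
enum-Σ {zero} E = record { size = 0 ; to = λ () ; from = λ () ; from-to = λ () ; to-from = λ () }
enum-Σ {suc n} {P} E = record { size = a + E′.size ; to = to′ ; from = from′ ∘ splitAt a ; from-to = ft ; to-from = tf }
  where
  module E₀ = Enum (E zero)
  module E′ = Enum (enum-Σ (E ∘ suc))
  a = E₀.size
  to′ : Σ (Fin (suc n)) P → Fin (a + E′.size)
  to′ (zero , p)  = E₀.to p ↑ˡ E′.size
  to′ (suc i , p) = a ↑ʳ E′.to (i , p)
  up : Σ (Fin n) (P ∘ suc) → Σ (Fin (suc n)) P
  up (i , p) = suc i , p
  from′ : Fin a ⊎ Fin E′.size → Σ (Fin (suc n)) P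
  from′ (inj₁ i) = zero , E₀.from i
  from′ (inj₂ i) = up (E′.from i)
  ft : ∀ d → from′ (splitAt a (to′ d)) ≡ d
  ft (zero , p)  = trans (cong from′ (Fin.splitAt-↑ˡ a (E₀.to p) E′.size)) (cong (zero ,_) (E₀.from-to p))
  ft (suc i , p) = trans (cong from′ (Fin.splitAt-↑ʳ a E′.size (E′.to (i , p)))) (cong up (E′.from-to (i , p)))
  tf : ∀ i → to′ (from′ (splitAt a i)) ≡ i
  tf i = trans (go (splitAt a i)) (Fin.join-splitAt a E′.size i)
    where
    go : ∀ s → to′ (from′ s) ≡ Data.Fin.join a E′.size s
    go (inj₁ j) = cong (_↑ˡ E′.size) (E₀.to-from j)
    go (inj₂ j) = cong (a ↑ʳ_) (E′.to-from j)

enum-Σ-size : {n : ℕ} {P : Fin n → Set} (E : ∀ i → Enum (P i)) → Enum.size (enum-Σ E) ≡ size-Σ (λ i → Enum.size (E i))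
enum-Σ-size {zero}  E = refl
enum-Σ-size {suc n} E = cong (Enum.size (E zero) +_) (enum-Σ-size (E ∘ suc))

enum-T : (b : Bool) → Enum (T b)
enum-T true  = record { size = 1 ; to = λ _ → zero ; from = λ _ → tt ; from-to = λ _ → refl ; to-from = λ { zero → refl } }
enum-T false = record { size = 0 ; to = λ () ; from = λ () ; from-to = λ () ; to-from = λ () }

enum-T-size : ∀ b → Enum.size (enum-T b) ≡ Defs.b2n b
enum-T-size true  = refl
enum-T-size false = refl

module Embedded (G : Graph) (rot : RotationSystem G) where
  open Graph G renaming (sym to adj-sym′)
  private
    module Rot = RotationSystem rot

  darts : Enum (Dart G)
  darts = enum-Σ (λ u → enum-Σ (λ v → enum-T (adj u v)))

  darts-size : Enum.size darts ≡ numDarts G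
  darts-size = trans (enum-Σ-size (λ u → enum-Σ (λ v → enum-T (adj u v))))
    (trans (size-Σ-cong (λ u → trans (enum-Σ-size (λ v → enum-T (adj u v))) (trans (size-Σ-cong (λ v → enum-T-size (adj u v))) (sym (sumFin-Σ (λ v → Defs.b2n (adj u v)))))))
           (sym (sumFin-Σ (λ u → sumFin (λ v → Defs.b2n (adj u v))))))

  private
    dart-≡ : ∀ {u v} {p q : T (adj u v)} → _≡_ {A = Dart G} (u , v , p) (u , v , q)
    dart-≡ {u} {v} {p} {q} = cong (λ z → u , v , z) (Bool.T-irrelevant p q)

  graphMap : Map n
  graphMap = record
    { D = Dart G ; enum = darts ; tail = Defs.tail G ; rev = Defs.rev G
    ; rev-rev = λ { (u , v , p) → dart-≡ }
    ; rev≢ = λ { (u , v , p) e → loopless u v p (cong proj₁ e) }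
    ; ρ = Rot.ρ ; ρ⁻¹ = Rot.ρ⁻¹ ; ρρ⁻¹ = Rot.inv₁ ; ρ⁻¹ρ = Rot.inv₂ ; tail-ρ = Rot.ρ-tail ; cyclic = Rot.cyclic }
    where
    loopless : ∀ u v → T (adj u v) → v ≡ u → ⊥
    loopless u .u p refl = subst T (irrefl u) p

  open Sides graphMap public
  open Paths _~_ ~sym _~?_ using (W; nil; cons)

  adjacent : ∀ {a b} → T (adj a b) → a ~ b
  adjacent {a} {b} p = (a , b , p) , refl , refl

  walk-W : ∀ {a b xs} → Walk G a b xs → ∃ λ m → W (λ _ → true) a b m
  walk-W here       = 0 , nil ⟨ refl ⟩
  walk-W (step e w) = _ , cons ⟨ refl ⟩ (adjacent e) (proj₂ (walk-W w))

  lonely : Enum (Σ (Fin n) (λ v → T (degree G v Data.Nat.≡ᵇ 0)))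
  lonely = enum-Σ (λ v → enum-T (degree G v Data.Nat.≡ᵇ 0))

  lonely-size : Enum.size lonely ≡ numIsolated G
  lonely-size = trans (enum-Σ-size (λ v → enum-T (degree G v Data.Nat.≡ᵇ 0)))
    (trans (size-Σ-cong (λ v → one (degree G v Data.Nat.≡ᵇ 0))) (sym (sumFin-Σ (λ v → if degree G v Data.Nat.≡ᵇ 0 then 1 else 0))))
    where
    one : ∀ b → Enum.size (enum-T b) ≡ (if b then 1 else 0)
    one true  = refl
    one false = refl

  private
    no-dart : ∀ v → T (degree G v Data.Nat.≡ᵇ 0) → (d : Dart G) → Defs.tail G d ≢ v
    no-dart v z (.v , w , p) refl = t≢f (Equivalence.to Bool.T-≡ p) (b2n-0 (size-Σ-0 _ (trans (sym (sumFin-Σ (λ u → Defs.b2n (adj v u)))) (≡ᵇ⇒≡ _ 0 z)) w))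
      where
      b2n-0 : ∀ {b} → Defs.b2n b ≡ 0 → b ≡ false
      b2n-0 {false} _ = refl

  module _ {g : ℕ} (f : ℕ) (face : Dart G → Fin f) (sur : ∀ i → ∃ λ d → face d ≡ i)
           (orb : ∀ d d' → (face d ≡ face d' → ∃ λ k → iter k Rot.φ d ≡ d') × ((∃ λ k → iter k Rot.φ d ≡ d') → face d ≡ face d'))
           (c : ℕ) (comp : Fin n → Fin c) (csur : ∀ i → ∃ λ v → comp v ≡ i)
           (con : ∀ u v → (comp u ≡ comp v → Connected G u v) × (Connected G u v → comp u ≡ comp v))
           (euler : 4 * c + numDarts G ≤ 4 * g + 2 * n + 2 * (f + numIsolated G)) where

    cellular : Cellular graphMap
    cellular = record { faces = f ; face = face ; face-sur = sur ; face-φ = λ d → sym (proj₂ (orb d (Rot.φ d)) (1 , refl))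
      ; comps = c ; comp = comp ; base = λ j → proj₁ (csur j) ; comp-base = λ j → proj₂ (csur j)
      ; joined = λ {u} {v} e → walk-W (proj₂ (proj₁ (con u v) e))
      ; isolated = Enum.size lonely ; lone = λ i → proj₁ (Enum.from lonely i)
      ; lone-inj = λ {i} {j} e → trans (sym (Enum.to-from lonely i)) (trans (cong (Enum.to lonely) (pair-≡ e)) (Enum.to-from lonely j))
      ; lone-no = λ i d → no-dart _ (proj₂ (Enum.from lonely i)) d }
      where
      pair-≡ : ∀ {x y : Σ (Fin n) (λ v → T (degree G v Data.Nat.≡ᵇ 0))} → proj₁ x ≡ proj₁ y → x ≡ y
      pair-≡ {v , p} {.v , q} refl = cong (v ,_) (Bool.T-irrelevant p q)

    -- Subtracting the inequality of the embedding from `cycle-bound` cancels everything but `4 * k`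
    -- and `4 * g`.
    few : ∀ {k} (cs : Fin k → SimpleCycle graphMap) → Genus.Independent graphMap cellular cs → Genus.Disjoint graphMap cellular cs → k ≤ g
    few {k} cs ind dis = *-cancelˡ-≤ 4 (+-cancelʳ-≤ (2 * (f + numIsolated G) + 2 * n) _ _ (begin
        4 * k + (2 * (f + numIsolated G) + 2 * n)          ≡⟨ +-comm (4 * k) _ ⟩
        2 * (f + numIsolated G) + 2 * n + 4 * k            ≡⟨ cong (λ z → 2 * (f + z) + 2 * n + 4 * k) (sym lonely-size) ⟩
        2 * (f + Enum.size lonely) + 2 * n + 4 * k         ≤⟨ Genus.cycle-bound graphMap cellular cs ind dis ⟩
        Enum.size darts + 4 * c                            ≡⟨ trans (cong (_+ 4 * c) darts-size) (+-comm (numDarts G) (4 * c)) ⟩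
        4 * c + numDarts G                                 ≤⟨ euler ⟩
        4 * g + 2 * n + 2 * (f + numIsolated G)            ≡⟨ trans (+-assoc (4 * g) _ _) (cong (4 * g +_) (+-comm (2 * n) _)) ⟩
        4 * g + (2 * (f + numIsolated G) + 2 * n)          ∎))
      where open ≤-Reasoning

-- Joining the tiers and the order of the spherical remainder

card-map : {A B : Set} {k : ℕ} {P : B → Set} (f : A → B) → (∀ {x y} → f x ≡ f y → x ≡ y) → CardAt k P → CardAt k (P ∘ f)
card-map f inj c xs ux ps = ≤-trans (≤-reflexive (sym (length-map f xs))) (c (map f xs) (Unique.map⁺ inj ux) (All-map⁺ ps))

module _ {G : Graph} where
  open Graph G using (n; adj)

  all-vertices : ∀ {P : Fin n → Set} {a b xs} → Walk G a b xs → P a → P b → All P (inner xs) → All P xs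
  all-vertices here pa pb _ = pa ∷ []
  all-vertices {P} (step e w) pa pb ps = pa ∷ go w pb ps
    where
    go : ∀ {a b xs} → Walk G a b xs → P b → All P (dropLast xs) → All P xs
    go here pb _ = pb ∷ []
    go (step e here) pb (p ∷ []) = p ∷ pb ∷ []
    go (step e w@(step _ _)) pb (p ∷ ps) = p ∷ go w pb ps

  module _ {N : ℕ} (_≈_ : Fin N → Fin N → Set) (f : Fin n → Fin N) (P : Fin n → Set) (Y : VSet N)
           (edge : ∀ {a b} → P a → P b → T (adj a b) → f a ≈ f b) where
    open Walks _≈_

    map-walk : (∀ {a} → P a → f a ∈ Y) → ∀ {a b xs} → Walk G a b xs → All P xs → ∃ λ m → W Y (f a) (f b) m × suc m ≡ length xs
    map-walk h here (p ∷ []) = 0 , nil (h p) , refl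
    map-walk h (step e w) (p ∷ ps) with map-walk h w ps
    ... | m , r , eq = suc m , cons (h p) (edge p (first w ps) e) r , cong suc eq
      where
      first : ∀ {a b xs} → Walk G a b xs → All P xs → P a
      first here (p ∷ _)       = p
      first (step _ _) (p ∷ _) = p

    private
      to-last : ∀ {a c b zs} → T (adj a c) → Walk G c b zs → All P (a ∷ zs) → All (λ w → f w ∈ Y) (dropLast (a ∷ zs)) →
                ∃ λ y → ∃ λ k → W Y (f a) y k × y ≈ f b × 2 + k ≡ suc (length zs)
      to-last e here (p ∷ q ∷ []) (y ∷ []) = _ , 0 , nil y , edge p q e , refl
      to-last e (step e' w') (p ∷ ps@(q ∷ _)) (y ∷ ys) with to-last e' w' ps ys
      ... | z , k , r , zb , eq = z , suc k , cons y (edge p q e) r , zb , cong suc eq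

    -- The three cases match those of `Reach`: a walk with `3 + k` vertices has `2 + k` edges, of
    -- which the first and the last are split off.
    map-inner : ∀ {a b xs} → Walk G a b xs → All P xs → All (λ w → f w ∈ Y) (inner xs) →
                a ≡ b ⊎ (f a ≈ f b × 2 ≤ length xs) ⊎ (∃ λ w → ∃ λ w' → ∃ λ k → f a ≈ w × W Y w w' k × w' ≈ f b × 3 + k ≡ length xs)
    map-inner here _ _ = inj₁ refl
    map-inner (step e here) (p ∷ q ∷ []) _ = inj₂ (inj₁ (edge p q e , s≤s (s≤s z≤n)))
    map-inner (step e (step e' w')) (p ∷ ps@(q ∷ _)) ys with to-last e' w' ps ys
    ... | y , k , r , yb , eq = inj₂ (inj₂ (_ , y , k , edge p q e , r , yb , cong suc eq))

module Combine (G : Graph) (rot : RotationSystem G) (r : ℕ) (1≤r : 1 ≤ r) (cell : Cellular (Embedded.graphMap G rot))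
               (k : ℕ) (st : Peeling.Peeled (Embedded.graphMap G rot) cell r k) (N₂ : ℕ) (_≈_ : Fin N₂ → Fin N₂ → Set)
               (≈sym : ∀ {u v} → u ≈ v → v ≈ u) (_≈?_ : ∀ u v → Dec (u ≈ v)) (seps : Paths.Separators _≈_ ≈sym _≈?_)
               (emb : Fin (Graph.n G) → Fin N₂) (emb-inj : ∀ {u v} → emb u ≡ emb v → u ≡ v)
               (emb-edge : ∀ {a b} → a ∉ Peeling.Peeled.R st → b ∉ Peeling.Peeled.R st → T (Graph.adj G a b) → emb a ≈ emb b) where
  open Graph G using (n; adj)
  open Embedded G rot
  open Peeling graphMap cell r using (above; Seen)
  open Peeling.Peeled st
  open Walks _~_ using (W)

  private
    -- The vertices of R come first, by tiers.
    rank : (Fin N₂ → ℕ) → Fin n → ℕ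
    rank pos v = if R v then tier v * n + toℕ v else k * n + pos (emb v)

    module Rank (pos : Fin N₂ → ℕ) (pinj : ∀ {a b} → pos a ≡ pos b → a ≡ b) where
      on : ∀ {v} → v ∈ R → rank pos v ≡ tier v * n + toℕ v
      on ⟨ p ⟩ rewrite p = refl

      off : ∀ {v} → v ∉ R → rank pos v ≡ k * n + pos (emb v)
      off ⟨ p ⟩ rewrite p = refl

      below : ∀ {v m} → tier v < m → tier v * n + toℕ v < m * n
      below {v} {m} lt = <-≤-trans (+-monoʳ-< (tier v * n) (Fin.toℕ<n v)) (≤-trans (≤-reflexive (+-comm (tier v * n) n)) (*-monoˡ-≤ n lt))

      R<N : ∀ {u v} → u ∈ R → v ∉ R → rank pos u < rank pos v
      R<N {u} {v} p q = <-≤-trans (≤-trans (≤-reflexive (cong suc (on p))) (below (tier-∈ p))) (≤-trans (m≤m+n (k * n) _) (≤-reflexive (sym (off q))))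

      tier-mono : ∀ {u v} → u ∈ R → rank pos u ≤ rank pos v → tier u ≤ tier v
      tier-mono {u} {v} p le with in? v R
      ... | inj₂ v∉ = ≤-trans (<⇒≤ (tier-∈ p)) (≤-reflexive (sym (tier-∉ v∉)))
      ... | inj₁ v∈ = ≮⇒≥ λ lt → <-irrefl refl (<-≤-trans (≤-trans (≤-reflexive (cong suc (on v∈))) (below lt))
                        (≤-trans (m≤m+n (tier u * n) (toℕ u)) (≤-trans (≤-reflexive (sym (on p))) le)))

      injective : ∀ {u v} → rank pos u ≡ rank pos v → u ≡ v
      injective {u} {v} e with in? u R | in? v R
      ... | inj₁ p | inj₂ q = ⊥-elim (<-irrefl e (R<N p q))
      ... | inj₂ p | inj₁ q = ⊥-elim (<-irrefl (sym e) (R<N q p))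
      ... | inj₂ p | inj₂ q = emb-inj (pinj (+-cancelˡ-≡ (k * n) _ _ (trans (sym (off p)) (trans e (off q)))))
      ... | inj₁ p | inj₁ q = Fin.toℕ-injective (+-cancelˡ-≡ (tier u * n) _ _ (trans (sym (on p)) (trans e (trans (on q) (cong (λ z → z * n + toℕ v)
                                (≤-antisym (tier-mono q (≤-reflexive (sym e))) (tier-mono p (≤-reflexive e))))))))

      order : LinearOrder G
      order = rank pos , injective

      outside : ∀ {u v} → u ∉ R → rank pos u ≤ rank pos v → v ∉ R
      outside u∉ le = ¬∈→∉ λ v∈ → <-irrefl refl (<-≤-trans (R<N v∈ u∉) le)

      rank-cancel : ∀ {u v} → u ∉ R → v ∉ R → rank pos u ≤ rank pos v → pos (emb u) ≤ pos (emb v)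
      rank-cancel p q le = +-cancelˡ-≤ (k * n) _ _ (≤-trans (≤-reflexive (sym (off p))) (≤-trans le (≤-reflexive (off q))))

      seen : ∀ {u v xs} → u ∈ R → Walk G v u xs → length xs ≤ suc r → All (λ w → rank pos u ≤ rank pos w) xs → Seen tier v u
      seen {u} {v} {xs} u∈ w le ps with map-walk _~_ id (λ w → rank pos u ≤ rank pos w) (above tier u) (λ _ _ → adjacent)
            (λ p → ⟦⟧-i (λ w → tier u ≤? tier w) (tier-mono u∈ p)) w ps
      ... | m , ww , eq = m , ≤-pred (≤-trans (≤-reflexive eq) le) , ww

    module Col where
      open StrongOrder _≈_ ≈sym _≈?_ r 1≤r seps using (strongOrder; module Ordered; higher; higher-i; Lower; everything)
      open Strong _≈_ ≈sym _≈?_ r using (Reach; self; edge; thru)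
      open Ordered strongOrder
      open Rank pos (λ e → pinj ⟨ refl ⟩ ⟨ refl ⟩ e) public

      bound′ : ∀ v → CardAt (k * (2 * (2 * r + 1)) + (5 * r + 1)) (SReach G r order v)
      bound′ v = card-⊆ ≤-refl classify (card-⊎ (near v) (card-map emb emb-inj (bound {emb v} ⟨ refl ⟩)))
        where
        classify : ∀ {u} → SReach G r order v u →
                   (u ∈ R × Seen tier v u) ⊎ (Reach (higher everything pos (emb v)) (emb v) (emb u) × Lower everything pos (emb v) (emb u))
        classify {u} (xs , (w , _) , len , u≤v , inn) with in? u R
        ... | inj₁ u∈ = inj₁ (u∈ , seen u∈ w len (all-vertices w u≤v ≤-refl (All.map (λ lt → ≤-trans u≤v (<⇒≤ lt)) inn)))
        ... | inj₂ u∉ = inj₂ (reach , inj₂ (rank-cancel u∉ v∉ u≤v))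
          where
          v∉ = outside u∉ u≤v
          outs : All (_∉ R) xs
          outs = all-vertices w v∉ u∉ (All.map (λ lt → outside v∉ (<⇒≤ lt)) inn)
          highs : All (λ x → emb x ∈ higher everything pos (emb v)) (inner xs)
          highs = All.map (λ {x} lt → higher-i ⟨ refl ⟩ (+-cancelˡ-< (k * n) _ _ (≤-trans (≤-reflexive (cong suc (sym (off v∉)))) (≤-trans lt (≤-reflexive (off (outside v∉ (<⇒≤ lt)))))))) inn
          reach : Reach (higher everything pos (emb v)) (emb v) (emb u)
          reach with map-inner _≈_ emb (_∉ R) (higher everything pos (emb v)) emb-edge w outs highs
          ... | inj₁ refl = self
          ... | inj₂ (inj₁ (e , l)) = edge e (≤-pred (≤-trans l len))
          ... | inj₂ (inj₂ (_ , _ , j , e , ww , e' , eq)) = thru e ww e' (≤-pred (≤-trans (≤-reflexive eq) len))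

    module Wcol where
      open WeakOrder _≈_ ≈sym _≈?_ r seps using (weakOrder; module Ordered; atLeast; atLeast-i)
      open Ordered weakOrder
      open Rank pos (λ e → pinj ⟨ refl ⟩ ⟨ refl ⟩ e) public

      all₂ : VSet N₂
      all₂ _ = true

      bound′ : ∀ v → CardAt (k * (2 * (2 * r + 1)) + (1 + budget r r) * (2 * r + 1)) (WReach G r order v)
      bound′ v = card-⊆ ≤-refl classify (card-⊎ (near v) (card-map emb emb-inj (bound {emb v} ⟨ refl ⟩)))
        where
        open Walks _≈_ using () renaming (W to W₂)
        classify : ∀ {u} → WReach G r order v u → (u ∈ R × Seen tier v u) ⊎
                   ((emb u ∈ all₂ × ∃ λ m → m ≤ r × W₂ (atLeast all₂ pos (emb u)) (emb v) (emb u) m) ⊎ (emb u ∉ all₂ × ∃ λ m → m ≤ r × W₂ ∅ (emb v) (emb u) m))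
        classify {u} (xs , (w , _) , len , ps) with in? u R
        ... | inj₁ u∈ = inj₁ (u∈ , seen u∈ w len ps)
        ... | inj₂ u∉ with map-walk _≈_ emb (λ w → rank pos u ≤ rank pos w) (atLeast all₂ pos (emb u)) (λ p q → emb-edge (outside u∉ p) (outside u∉ q))
                (λ p → atLeast-i ⟨ refl ⟩ (rank-cancel u∉ (outside u∉ p) p)) w ps
        ...   | m , ww , eq = inj₂ (inj₁ (⟨ refl ⟩ , m , ≤-pred (≤-trans (≤-reflexive eq) len) , ww))

  col : ∀ {K} → k * (2 * (2 * r + 1)) + (5 * r + 1) ≤ K → ColAtMost G r K
  col le = Col.order , λ v xs ux ps → ≤-trans (Col.bound′ v xs ux ps) le

  wcol : ∀ {K} → k * (2 * (2 * r + 1)) + (1 + budget r r) * (2 * r + 1) ≤ K → WcolAtMost G r K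
  wcol le = Wcol.order , λ v xs ux ps → ≤-trans (Wcol.bound′ v xs ux ps) le

bounds-from-cycles : (G : Graph) (rot : RotationSystem G) (r : ℕ) → 1 ≤ r → (cell : Cellular (Embedded.graphMap G rot)) (k : ℕ)
  (st : Peeling.Peeled (Embedded.graphMap G rot) cell r k) → Split.RelSpherical (Embedded.graphMap G rot) (Peeling.Peeled.R st) →
  (∀ {K} → k * (2 * (2 * r + 1)) + (5 * r + 1) ≤ K → ColAtMost G r K) ×
  (∀ {K} → k * (2 * (2 * r + 1)) + (1 + budget r r) * (2 * r + 1) ≤ K → WcolAtMost G r K)
bounds-from-cycles G rot r 1≤r cell k st rel = C.col , C.wcol
  where
  open Graph G using (n; adj)
  open Embedded G rot using (graphMap; darts)
  module Sp = Split graphMap (Peeling.Peeled.R st)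
  N = Enum.size darts
  sph₁ = Sp.split-spherical rel
  module St = Stellation Sp.split sph₁
  module Pl = Sides St.stellation
  emb : Fin n → Fin ((n + N) + N)
  emb v = (v ↑ˡ N) ↑ˡ N
  emb-edge : ∀ {a b} → a ∉ Peeling.Peeled.R st → b ∉ Peeling.Peeled.R st → T (adj a b) → emb a Pl.~ emb b
  emb-edge {a} {b} p q e = let d = (a , b , e) ; (t , h) = Sp.split-edge d p q in (d , zero) , cong (_↑ˡ N) t , cong (_↑ˡ N) h
  module C = Combine G rot r 1≤r cell k st _ Pl._~_ Pl.~sym Pl._~?_ (Planar.separators St.stellation St.triangular St.spherical)
               emb (λ e → Fin.↑ˡ-injective N _ _ (Fin.↑ˡ-injective N _ _ e)) emb-edge

-- Binomial coefficients and the final constants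

open import Data.Nat.Combinatorics using (_C_; nCk+nC[k+1]≡[n+1]C[k+1]; nC1≡n)

tri≡C2 : ∀ m → suc m C 2 ≡ tri m
tri≡C2 zero    = refl
tri≡C2 (suc m) = trans (sym (nCk+nC[k+1]≡[n+1]C[k+1] (suc m) 1)) (cong₂ _+_ (nC1≡n (suc m)) (tri≡C2 m))

-- The `1` is the path that contains the vertex, and `budget r r`, equal to `r + tri r`, counts the
-- earlier paths.
choose-2 : ∀ r → (r + 2) C 2 ≡ 1 + budget r r
choose-2 r = trans (cong (_C 2) (+-comm r 2)) (trans (tri≡C2 (suc r)) (cong₂ (λ a b → suc (a + tri b)) (sym (⊓-idem r)) (sym (⊔-idem r))))

bounds-from-embedding : ∀ r → 1 ≤ r → (G : Graph) (g : ℕ) → EmbedsInGenus G g →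
  ColAtMost G r ((4 * g + 5) * r + 2 * g + 1) × WcolAtMost G r ((2 * g + (r + 2) C 2) * (2 * r + 1))
bounds-from-embedding r 1≤r G g (rot , f , face , sur , orb , c , comp , csur , cnct , euler) = go (Peeling.peel graphMap cell r)
  where
  open Embedded G rot using (graphMap; cellular; few)
  cell : Cellular graphMap
  cell = cellular {g} f face sur orb c comp csur cnct euler
  open +-*-Solver
  eq₁ : ∀ g r → g * (2 * (2 * r + 1)) + (5 * r + 1) ≡ (4 * g + 5) * r + 2 * g + 1
  eq₁ = solve 2 (λ g r → g :* (con 2 :* (con 2 :* r :+ con 1)) :+ (con 5 :* r :+ con 1) := (con 4 :* g :+ con 5) :* r :+ con 2 :* g :+ con 1) refl
  eq₂ : ∀ g b m → g * (2 * m) + b * m ≡ (2 * g + b) * m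
  eq₂ = solve 3 (λ g b m → g :* (con 2 :* m) :+ b :* m := (con 2 :* g :+ b) :* m) refl
  go : (∃ λ k → ∃ λ (st : Peeling.Peeled graphMap cell r k) → Split.RelSpherical graphMap (Peeling.Peeled.R st)) →
       ColAtMost G r ((4 * g + 5) * r + 2 * g + 1) × WcolAtMost G r ((2 * g + (r + 2) C 2) * (2 * r + 1))
  go (k , st , rel) = proj₁ bounds (≤-trans (+-monoˡ-≤ (5 * r + 1) many) (≤-reflexive (eq₁ g r)))
    , proj₂ bounds (≤-trans (+-monoˡ-≤ _ many) (≤-reflexive (trans (eq₂ g (1 + budget r r) (2 * r + 1)) (cong (λ z → (2 * g + z) * (2 * r + 1)) (sym (choose-2 r))))))
    where
    open Peeling.Peeled st using (ind; dis) renaming (C to cycles)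
    bounds = bounds-from-cycles G rot r 1≤r cell k st rel
    many : k * (2 * (2 * r + 1)) ≤ g * (2 * (2 * r + 1))
    many = *-monoˡ-≤ _ (few {g} f face sur orb c comp csur cnct euler cycles ind dis)

theorem1p5 : ∀ (r : ℕ) → 1 ≤ r →
    (∀ (G : Graph) (g : ℕ) → HasGenus G g →
    ColAtMost G r ((4 * g + 5) * r + 2 * g + 1)
    × WcolAtMost G r ((2 * g + (r + 2) C 2) * (2 * r + 1)))
    × (∀ (G : Graph) → Planar G →
    ColAtMost G r (5 * r + 1)
    × WcolAtMost G r (((r + 2) C 2) * (2 * r + 1)))
theorem1p5 r 1≤r = (λ G g h → bounds-from-embedding r 1≤r G g (proj₁ h))
  , λ G p → let (c , w) = bounds-from-embedding r 1≤r G 0 p in subst (λ z → ColAtMost G r (z + 1)) (+-identityʳ (5 * r)) c , w
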